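{- Let $\mathbb{F}$ be a field, let $\Delta$ be a finite simplicial complex with $\operatorname{depth}_{\mathbb{F}}\Delta=d-1$, and let $r$ be an integer with $2\le r\le d/2$. Let $\mathcal{A}$ be an intersecting family consisting of $r$-element faces of $\Delta$. Suppose $\Delta$ is shifted with respect to the ordered vertex set $\{v_1<\cdots<v_{r+1}\}$ and $\mathcal{A}$ has no common intersection (i.e. $\bigcap_{A\in\mathcal{A}}A=\emptyset$). Then \[ |\mathcal{A}|\le f_{r-1}(\operatorname{link}_\Delta v_1)-\beta+1,\] where $\beta$ is the number of $r$-element faces of $\Delta$ containing $v_1$ but no element of $\{v_2,\dots,v_{r+1}\}$.
   Context: A simplicial complex is a finite nonempty family of sets closed under taking subsets. $f_k(\Gamma)$ denotes the number of $k$-element faces of $\Gamma$. The link of a face $A$ is $\operatorname{link}_\Delta A=\{B\in\Delta: A\cap B=\emptyset,\ A\cup B\in\Delta\}$. A family is intersecting if any two of its members intersect. $\Delta$ is Cohen-Macaulay over $\mathbb{F}$ if $\tilde H_i(\operatorname{link}_\Delta A;\mathbb{F})=0$ for all $A\in\Delta$ and all $i<\dim\operatorname{link}_\Delta A$ (where $\dim A=|A|-1$); $\operatorname{depth}_{\mathbb{F}}\Delta$ is the largest $k$ such that the subcomplex of faces of dimension at most $k$ is Cohen-Macaulay over $\mathbb{F}$. For vertices $v,w$, $\Delta$ is invariant under the shift from $w$ to $v$ if whenever $B\in\Delta$ with $w\in B$, $v\notin B$, also $(B\setminus\{w\})\cup\{v\}\in\Delta$. $\Delta$ is shifted with respect to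 $\{v_1<\cdots<v_t\}$ if it is invariant under the shift from $w$ to $v_i$ for every $i$ and every vertex $w\notin\{v_1,\dots,v_i\}$. -}

module Defs where

open import Level using (Level; _⊔_) renaming (suc to lsuc)
open import Data.Bool using (Bool; true; false; _∧_; not; if_then_else_)
open import Data.Nat using (ℕ; zero; suc; _≤_; _<_; _≡ᵇ_; _≤ᵇ_; _<ᵇ_)
open import Data.Fin using (Fin; toℕ) renaming (zero to fzero; suc to fsuc)
open import Data.Fin.Subset using (Subset; _∪_; _∩_; ⁅_⁆; ∣_∣; _-_; _∈_; _∉_; Nonempty)
open import Data.Vec using (Vec; []; _∷_; lookup; tabulate)
open import Data.List using (List; []; _∷_; _++_; map; length; filterᵇ)
open import Data.Product using (Σ; ∃; _×_; _,_)
open import Relation.Nullary using (¬_)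
open import Relation.Binary.PropositionalEquality using (_≡_; _≢_)
open import Function.Definitions using (Injective)
open import Algebra.Bundles using (CommutativeRing)

record Field (c ℓ : Level) : Set (lsuc (c ⊔ ℓ)) where
  field
    commutativeRing : CommutativeRing c ℓ
  open CommutativeRing commutativeRing public
  field
    0≉1     : ¬ (0# ≈ 1#)
    inverse : ∀ x → ¬ (x ≈ 0#) → ∃ λ y → (x * y) ≈ 1#

allSubsets : (n : ℕ) → List (Subset n)
allSubsets zero    = [] ∷ []
allSubsets (suc n) = map (true ∷_) (allSubsets n) ++ map (false ∷_) (allSubsets n)

countSubsets : {n : ℕ} → (Subset n → Bool) → ℕ
countSubsets {n} P = length (filterᵇ P (allSubsets n))

allFinᵇ : {m : ℕ} → (Fin m → Bool) → Bool
allFinᵇ {zero}  f = true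
allFinᵇ {suc m} f = f fzero ∧ allFinᵇ (λ i → f (fsuc i))

Family : ℕ → Set
Family n = Subset n → Bool

_∈ᶠ_ : {n : ℕ} → Subset n → Family n → Set
σ ∈ᶠ K = K σ ≡ true

-- nonempty and closed under taking subsets (nonempty ⇔ contains ∅)
IsSimplicialComplex : {n : ℕ} → Family n → Set
IsSimplicialComplex {n} K =
  (∃ λ σ → σ ∈ᶠ K) × (∀ (σ τ : Subset n) → τ Data.Fin.Subset.⊆ σ → σ ∈ᶠ K → τ ∈ᶠ K)

f : {n : ℕ} → ℕ → Family n → ℕ
f k K = countSubsets (λ σ → K σ ∧ (∣ σ ∣ ≡ᵇ k))

link : {n : ℕ} → Family n → Subset n → Family n
link K A B = K B ∧ (∣ A ∩ B ∣ ≡ᵇ 0) ∧ K (A ∪ B)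

-- faces of size at most m (i.e. dimension at most m - 1)
skeleton : {n : ℕ} → ℕ → Family n → Family n
skeleton m K σ = K σ ∧ (∣ σ ∣ ≤ᵇ m)

module Homology {c ℓ : Level} (F : Field c ℓ) where
  open Field F

  Chain : {n : ℕ} → Set c
  Chain {n} = Subset n → Carrier

  sumFin : {m : ℕ} → (Fin m → Carrier) → Carrier
  sumFin {zero}  g = 0#
  sumFin {suc m} g = g fzero + sumFin (λ i → g (fsuc i))

  signPow : ℕ → Carrier
  signPow zero    = 1#
  signPow (suc k) = - signPow k

  below : {n : ℕ} → Subset n → Fin n → ℕ
  below σ v = ∣ σ ∩ tabulate (λ u → toℕ u <ᵇ toℕ v) ∣

  -- boundary map: ∂[σ] = Σ_{v ∈ σ} (-1)^{#{u ∈ σ : u < v}} [σ ∖ v],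
  -- so (∂ c)(τ) = Σ_{v ∉ τ} (-1)^{#{u ∈ τ : u < v}} c(τ ∪ {v}).
  ∂ : {n : ℕ} → Chain {n} → Chain {n}
  ∂ c τ = sumFin (λ v → if lookup τ v then 0#
                         else (signPow (below τ v) * c (τ ∪ ⁅ v ⁆)))

  -- c is a chain of K supported on the k-element faces (i.e. a (k-1)-chain)
  IsChain : {n : ℕ} → Family n → ℕ → Chain {n} → Set ℓ
  IsChain K k ch = ∀ σ → ¬ (σ ∈ᶠ K × ∣ σ ∣ ≡ k) → ch σ ≈ 0#

  -- reduced homology of K in dimension k - 1 vanishes
  -- (every (k-1)-cycle is a boundary; k = 0 is dimension -1)
  HomologyVanishes : {n : ℕ} → Family n → ℕ → Set (c ⊔ ℓ)
  HomologyVanishes K k =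
    ∀ ch → IsChain K k ch → (∀ τ → ∂ ch τ ≈ 0#) →
      Σ Chain λ b → IsChain K (suc k) b × (∀ σ → ch σ ≈ ∂ b σ)

  -- Cohen-Macaulay over F: for every face A and every i < dim link A,
  -- H̃_i(link A) = 0.  With k = i + 1: k < (max size of a face of link A).
  CohenMacaulay : {n : ℕ} → Family n → Set (c ⊔ ℓ)
  CohenMacaulay K =
    ∀ A → A ∈ᶠ K → ∀ k → (∃ λ B → B ∈ᶠ link K A × k < ∣ B ∣) →
      HomologyVanishes (link K A) k

  -- depth_F K = d - 1: the (d-1)-skeleton (faces of size ≤ d) is CM, and d - 1
  -- is the largest such dimension among dimensions ≤ dim K.
  DepthIs : {n : ℕ} → Family n → ℕ → Set (c ⊔ ℓ)
  DepthIs K d =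
    CohenMacaulay (skeleton d K) ×
    (∃ λ σ → σ ∈ᶠ K × d ≤ ∣ σ ∣) ×
    (∀ k → (∃ λ σ → σ ∈ᶠ K × k ≤ ∣ σ ∣) → CohenMacaulay (skeleton k K) → k ≤ d)

ShiftInvariant : {n : ℕ} → Family n → (v w : Fin n) → Set
ShiftInvariant K v w =
  ∀ B → B ∈ᶠ K → w ∈ B → v ∉ B → ((B - w) ∪ ⁅ v ⁆) ∈ᶠ K

-- shifted w.r.t. the ordered vertex set vs 0 < vs 1 < ... < vs (t-1)
Shifted : {n t : ℕ} → Family n → (Fin t → Fin n) → Set
Shifted K vs =
  Injective _≡_ _≡_ vs ×
  (∀ (i : Fin _) w → (∀ j → toℕ j ≤ toℕ i → w ≢ vs j) → ShiftInvariant K (vs i) w)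

Intersecting : {n : ℕ} → Family n → Set
Intersecting 𝒜 = ∀ A B → A ∈ᶠ 𝒜 → B ∈ᶠ 𝒜 → Nonempty (A ∩ B)

NoCommonIntersection : {n : ℕ} → Family n → Set
NoCommonIntersection {n} 𝒜 = ∀ (x : Fin n) → ∃ λ A → A ∈ᶠ 𝒜 × x ∉ A

{-# OPTIONS --safe #-}

-- The inequality is decidable, so it may be proved up to double negation; this
-- replaces decidability of equality in F.
--
-- First A is compressed by the shifts to v₁,…,vᵣ₊₁.  If a shift from w to v would
-- produce a star, then every member meets {v , w}; this pair is then kept fixed
-- and all r-faces containing it are added.  In the end every member meets
-- V = {v₁,…,vᵣ₊₁} at least twice, as A then contains all r-subsets of V.
--
-- Next, over F[θ], consider the coordinate forms of v₁,…,vᵣ₊₁, followed by the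
-- Vandermonde forms Σ_v θ_vⁱ v* and by all coordinate forms.  The leading sets of
-- the exterior chains supported on a family form a family of the same size, and
-- those of an intersecting family intersect, since exterior products vanish.
-- Cohen–Macaulayness of links allows a leading set of Δ to be enlarged by the
-- strongest forms up to size 2r.  This survives combinatorial shifting, and for
-- shifted families the bound follows by induction, removing the weakest form.

module Submission where

-- Ordinary shifts of `Δ` need not preserve its depth, so depth is spent once, on the enlargement
-- property `Star` of the leading sets. The coordinate forms of V take the strongest positions
-- because the trace of a face on V can then be read off a leading set: meeting V twice and
-- containing v₁ transfer between faces and leading sets, and both sides are controlled by the count
-- of `starFaces`, the r-faces through v₁ and another vertex of V. These forms are not generic; that
-- `Δ` is shifted towards V makes up for it. The r - 1 Vandermonde forms bring the number of strong
-- forms to 2r, and powers of the variable serve as parameters θ, so that they are distinct even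
-- over a finite field. In place of the fraction field of F[θ] there are submodules saturated under
-- nonzero scalars. Finally, `starFaces` and the faces counted by β are disjoint families of r-faces
-- through v₁, and the `+ 1` stems from the single exceptional set in `star≤target`.

-- Equation solving in commutative rings with integer coefficients

module RingSolving where
  open import Level using (Level)
  open import Algebra.Bundles using (CommutativeRing; RawRing)
  import Algebra.Solver.Ring as RingSolver
  open import Algebra.Solver.Ring.AlmostCommutativeRing using (fromCommutativeRing; _-Raw-AlmostCommutative⟶_)
  import Algebra.Properties.Ring as RingProps
  import Algebra.Properties.CommutativeSemigroup as CSProps
  import Algebra.Properties.Semiring.Mult as Mult
  open import Data.Maybe using (Maybe; just; nothing)
  open import Data.Nat as ℕ using (ℕ; zero; suc)
  import Data.Nat.Properties as ℕ
  open import Data.Product using (_×_; _,_)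
  open import Relation.Nullary using (yes; no)
  open import Relation.Binary.PropositionalEquality as ≡ using (_≡_)
  import Relation.Binary.Reasoning.Setoid as SetoidReasoning

  -- Formal differences of naturals serve as coefficients, so that the solver
  -- sees cancellations such as x - x although equality of R is not decidable.
  module IntegerSolver {c ℓ : Level} (R : CommutativeRing c ℓ) where
    open CommutativeRing R
    open RingProps ring
    open Mult semiring renaming (_×_ to _·_)
    open SetoidReasoning setoid
    private
      module CS = CSProps +-commutativeSemigroup

      Diff : RawRing _ _
      Diff = record
        { Carrier = ℕ × ℕ
        ; _≈_ = _≡_
        ; _+_ = λ (a , b) (c , d) → a ℕ.+ c , b ℕ.+ d
        ; _*_ = λ (a , b) (c , d) → a ℕ.* c ℕ.+ b ℕ.* d , a ℕ.* d ℕ.+ b ℕ.* c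
        ; -_ = λ (a , b) → b , a
        ; 0# = 0 , 0
        ; 1# = 1 , 0 }

      ⟦_⟧ : ℕ × ℕ → Carrier
      ⟦ a , b ⟧ = a · 1# - b · 1#

      -- The value of the solver's constant con (0 , 0) has to be 0# on the nose.
      value : ℕ × ℕ → Carrier
      value (0 , 0) = 0#
      value p       = ⟦ p ⟧

      value≈ : ∀ p → value p ≈ ⟦ p ⟧
      value≈ (zero , zero)  = sym (-‿inverseʳ 0#)
      value≈ (zero , suc b) = refl
      value≈ (suc a , b)    = refl

      sub-+ : ∀ a b c d → (a + c) - (b + d) ≈ (a - b) + (c - d)
      sub-+ a b c d = begin
        (a + c) - (b + d)       ≈⟨ +-congˡ (sym (-‿+-comm b d)) ⟩
        (a + c) + (- b + - d)   ≈⟨ CS.interchange a c (- b) (- d) ⟩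
        (a - b) + (c - d)       ∎

      homo-+ : ∀ x y → ⟦ RawRing._+_ Diff x y ⟧ ≈ ⟦ x ⟧ + ⟦ y ⟧
      homo-+ (a , b) (c , d) = begin
        (a ℕ.+ c) · 1# - (b ℕ.+ d) · 1#
          ≈⟨ +-cong (×-homo-+ 1# a c) (-‿cong (×-homo-+ 1# b d)) ⟩
        (a · 1# + c · 1#) - (b · 1# + d · 1#)
          ≈⟨ sub-+ _ _ _ _ ⟩
        ⟦ a , b ⟧ + ⟦ c , d ⟧ ∎

      prod : ∀ a b c d → (a * c + b * d) - (a * d + b * c) ≈ (a - b) * (c - d)
      prod a b c d = sym (begin
        (a - b) * (c - d)                       ≈⟨ distribʳ _ _ _ ⟩
        a * (c - d) + - b * (c - d)
          ≈⟨ +-cong (distribˡ _ _ _) (distribˡ _ _ _) ⟩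
        (a * c + a * - d) + (- b * c + - b * - d)
          ≈⟨ +-cong (+-congˡ (sym (-‿distribʳ-* a d)))
               (trans (+-cong (sym (-‿distribˡ-* b c))
                 (trans (sym (-‿distribˡ-* b (- d)))
                   (trans (-‿cong (sym (-‿distribʳ-* b d))) (-‿involutive _)))) (+-comm _ _)) ⟩
        (a * c - a * d) + (b * d - b * c)       ≈⟨ sym (sub-+ _ _ _ _) ⟩
        (a * c + b * d) - (a * d + b * c)       ∎)

      homo-* : ∀ x y → ⟦ RawRing._*_ Diff x y ⟧ ≈ ⟦ x ⟧ * ⟦ y ⟧
      homo-* (a , b) (c , d) = begin
        (a ℕ.* c ℕ.+ b ℕ.* d) · 1# - (a ℕ.* d ℕ.+ b ℕ.* c) · 1#
          ≈⟨ +-cong (two a c b d) (-‿cong (two a d b c)) ⟩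
        (a · 1# * c · 1# + b · 1# * d · 1#) - (a · 1# * d · 1# + b · 1# * c · 1#)
          ≈⟨ prod _ _ _ _ ⟩
        ⟦ a , b ⟧ * ⟦ c , d ⟧ ∎
        where
        two : ∀ p q r s → (p ℕ.* q ℕ.+ r ℕ.* s) · 1# ≈ p · 1# * q · 1# + r · 1# * s · 1#
        two p q r s = trans (×-homo-+ 1# (p ℕ.* q) (r ℕ.* s))
                            (+-cong (×1-homo-* p q) (×1-homo-* r s))

      homo-neg : ∀ x → ⟦ RawRing.-_ Diff x ⟧ ≈ - ⟦ x ⟧
      homo-neg (a , b) = sym (begin
        - (a · 1# - b · 1#)      ≈⟨ sym (-‿+-comm _ _) ⟩
        - (a · 1#) - - (b · 1#)  ≈⟨ +-congˡ (-‿involutive _) ⟩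
        - (a · 1#) + b · 1#      ≈⟨ +-comm _ _ ⟩
        b · 1# - a · 1#          ∎)

      morphism : Diff -Raw-AlmostCommutative⟶ fromCommutativeRing R
      morphism = record
        { ⟦_⟧ = value
        ; +-homo = λ x y → trans (value≈ (RawRing._+_ Diff x y)) (trans (homo-+ x y) (+-cong (sym (value≈ x)) (sym (value≈ y))))
        ; *-homo = λ x y → trans (value≈ (RawRing._*_ Diff x y)) (trans (homo-* x y) (*-cong (sym (value≈ x)) (sym (value≈ y))))
        ; -‿homo = λ x → trans (value≈ (RawRing.-_ Diff x)) (trans (homo-neg x) (-‿cong (sym (value≈ x))))
        ; 0-homo = refl
        ; 1-homo = trans (+-cong (+-identityʳ 1#) -0#≈0#) (+-identityʳ 1#) }

      -- Formal differences denote the same integer when their cross sums agree; coincidences due to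
      -- the characteristic of `R` are not detected.
      _≟_ : ∀ x y → Maybe (value x ≈ value y)
      (a , b) ≟ (c , d) with a ℕ.+ d ℕ.≟ c ℕ.+ b
      ... | no _ = nothing
      ... | yes eq = just (begin
        value (a , b)        ≈⟨ value≈ (a , b) ⟩
        A - B                ≈⟨ sym (+-identityʳ _) ⟩
        (A - B) + 0#         ≈⟨ +-congˡ (sym (-‿inverseʳ D)) ⟩
        (A - B) + (D - D)    ≈⟨ sym (sub-+ A B D D) ⟩
        (A + D) - (B + D)    ≈⟨ +-congʳ (trans (sym (×-homo-+ 1# a d))
                                  (trans (reflexive (≡.cong (_· 1#) eq)) (×-homo-+ 1# c b))) ⟩
        (C + B) - (B + D)    ≈⟨ +-congʳ (+-comm C B) ⟩
        (B + C) - (B + D)    ≈⟨ sub-+ B B C D ⟩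
        (B - B) + (C - D)    ≈⟨ +-congʳ (-‿inverseʳ B) ⟩
        0# + (C - D)         ≈⟨ +-identityˡ _ ⟩
        C - D                ≈⟨ sym (value≈ (c , d)) ⟩
        value (c , d)        ∎)
        where
        A = a · 1#
        B = b · 1#
        C = c · 1#
        D = d · 1#

    open RingSolver Diff (fromCommutativeRing R) morphism _≟_ public
      using (solve; _:=_; _:+_; _:*_; :-_; _:-_; con)

-- Exterior algebra in coordinates: contraction, multiplication, Leibniz rule

module ExteriorAlgebra where
  open import Level using (Level; _⊔_)
  open import Algebra.Bundles using (CommutativeRing)
  import Algebra.Properties.Ring as RingProps
  open import Data.Bool using (true; false)
  open import Data.Nat as ℕ using (ℕ; zero; suc)
  open import Data.Fin using (Fin; zero; suc)
  open import Data.Fin.Subset using (Subset)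
  open import Data.Vec using ([]; _∷_; lookup; _[_]≔_)
  open import Data.Product using (_,_)
  open import Data.Empty using (⊥)
  open import Function using (_∘_)
  open import Relation.Binary.PropositionalEquality as ≡ using (_≡_)
  import Relation.Binary.Reasoning.Setoid as SetoidReasoning
  open RingSolving

  module Exterior {c ℓ : Level} (R : CommutativeRing c ℓ) where
    open CommutativeRing R hiding (zero)
    open RingProps ring
    open IntegerSolver R
    open SetoidReasoning setoid

    Ch : ℕ → Set c
    Ch n = Subset n → Carrier

    infix 4 _≋_
    _≋_ : ∀ {n} → Ch n → Ch n → Set ℓ
    x ≋ y = ∀ σ → x σ ≈ y σ

    infixl 6 _⊕_ _⊖_
    infixr 7 _⊙_
    _⊕_ _⊖_ : ∀ {n} → Ch n → Ch n → Ch n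
    (x ⊕ y) σ = x σ + y σ
    (x ⊖ y) σ = x σ - y σ

    _⊙_ : ∀ {n} → Carrier → Ch n → Ch n
    (a ⊙ x) σ = a * x σ

    𝟎 : ∀ {n} → Ch n
    𝟎 σ = 0#

    record Linear {m n : ℕ} (D : Ch m → Ch n) : Set (c ⊔ ℓ) where
      field
        cong : ∀ {x y} → x ≋ y → D x ≋ D y
        add  : ∀ x y → D (x ⊕ y) ≋ D x ⊕ D y
        scal : ∀ a x → D (a ⊙ x) ≋ a ⊙ D x

      zero! : ∀ {x} → x ≋ 𝟎 → D x ≋ 𝟎
      zero! {x} x≋0 σ = begin
        D x σ          ≈⟨ cong (λ τ → trans (x≋0 τ) (sym (zeroˡ (x τ)))) σ ⟩
        D (0# ⊙ x) σ   ≈⟨ scal 0# x σ ⟩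
        0# * D x σ     ≈⟨ zeroˡ _ ⟩
        0#             ∎

      neg : ∀ x → D (λ σ → - x σ) ≋ (λ σ → - D x σ)
      neg x σ = begin
        D (λ τ → - x τ) σ    ≈⟨ cong (λ τ → sym (-1*x≈-x (x τ))) σ ⟩
        D ((- 1#) ⊙ x) σ     ≈⟨ scal (- 1#) x σ ⟩
        - 1# * D x σ         ≈⟨ -1*x≈-x _ ⟩
        - D x σ              ∎

      sub : ∀ x y → D (x ⊖ y) ≋ D x ⊖ D y
      sub x y σ = trans (add x (λ τ → - y τ) σ) (+-congˡ (neg y σ))

      smul-sub : ∀ a b x y → D ((a ⊙ x) ⊖ (b ⊙ y)) ≋ (a ⊙ D x) ⊖ (b ⊙ D y)
      smul-sub a b x y σ = trans (sub (a ⊙ x) (b ⊙ y) σ) (+-cong (scal a x σ) (-‿cong (scal b y σ)))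

    -- Contraction by the functional φ; φ = 1 gives the simplicial boundary.
    ∂ : ∀ {n} → (Fin n → Carrier) → Ch n → Ch n
    ∂ φ x []          = 0#
    ∂ φ x (false ∷ ρ) = φ zero * x (true ∷ ρ) + ∂ (φ ∘ suc) (x ∘ (false ∷_)) ρ
    ∂ φ x (true ∷ ρ)  = - ∂ (φ ∘ suc) (x ∘ (true ∷_)) ρ

    -- Exterior multiplication by the vertex u.
    e : ∀ {n} → Fin n → Ch n → Ch n
    e zero    x (false ∷ ρ) = 0#
    e zero    x (true ∷ ρ)  = x (false ∷ ρ)
    e (suc u) x (false ∷ ρ) = e u (x ∘ (false ∷_)) ρ
    e (suc u) x (true ∷ ρ)  = - e u (x ∘ (true ∷_)) ρ

    ∂-local : ∀ {n} {φ ψ : Fin n → Carrier} {x y : Ch n} τ →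
      (∀ v → lookup τ v ≡ false → φ v * x (τ [ v ]≔ true) ≈ ψ v * y (τ [ v ]≔ true)) →
      ∂ φ x τ ≈ ∂ ψ y τ
    ∂-local []          h = refl
    ∂-local (false ∷ τ) h = +-cong (h zero ≡.refl) (∂-local τ (h ∘ suc))
    ∂-local (true ∷ τ)  h = -‿cong (∂-local τ (h ∘ suc))

    ∂-zero-local : ∀ {n} {φ : Fin n → Carrier} {x : Ch n} τ →
      (∀ v → lookup τ v ≡ false → φ v * x (τ [ v ]≔ true) ≈ 0#) → ∂ φ x τ ≈ 0#
    ∂-zero-local []          h = refl
    ∂-zero-local (false ∷ τ) h = trans (+-cong (h zero ≡.refl) (∂-zero-local τ (h ∘ suc))) (+-identityˡ 0#)
    ∂-zero-local (true ∷ τ)  h = trans (-‿cong (∂-zero-local τ (h ∘ suc))) -0#≈0#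

    e-zero-local : ∀ {n} (u : Fin n) {x : Ch n} τ →
      (lookup τ u ≡ true → x (τ [ u ]≔ false) ≈ 0#) → e u x τ ≈ 0#
    e-zero-local zero    (false ∷ τ) h = refl
    e-zero-local zero    (true ∷ τ)  h = h ≡.refl
    e-zero-local (suc u) (false ∷ τ) h = e-zero-local u τ h
    e-zero-local (suc u) (true ∷ τ)  h = trans (-‿cong (e-zero-local u τ h)) -0#≈0#

    ∂-cong : ∀ {n} {φ ψ : Fin n → Carrier} {x y : Ch n} → (∀ v → φ v ≈ ψ v) → x ≋ y → ∂ φ x ≋ ∂ ψ y
    ∂-cong φ≈ψ x≋y τ = ∂-local τ (λ v _ → *-cong (φ≈ψ v) (x≋y _))

    ∂-linear : ∀ {n} (φ : Fin n → Carrier) → Linear (∂ φ)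
    ∂-linear φ = record { cong = ∂-cong (λ _ → refl) ; add = add φ ; scal = scal φ }
      where
      add : ∀ {n} (φ : Fin n → Carrier) (x y : Ch n) → ∂ φ (x ⊕ y) ≋ ∂ φ x ⊕ ∂ φ y
      add φ x y [] = sym (+-identityˡ 0#)
      add φ x y (false ∷ ρ) = trans (+-congˡ (add (φ ∘ suc) _ _ ρ))
        (solve 5 (λ a b c d f → a :* (b :+ c) :+ (d :+ f) := (a :* b :+ d) :+ (a :* c :+ f)) refl _ _ _ _ _)
      add φ x y (true ∷ ρ) = trans (-‿cong (add (φ ∘ suc) _ _ ρ)) (sym (-‿+-comm _ _))
      scal : ∀ {n} (φ : Fin n → Carrier) a (x : Ch n) → ∂ φ (a ⊙ x) ≋ a ⊙ ∂ φ x
      scal φ a x [] = sym (zeroʳ a)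
      scal φ a x (false ∷ ρ) = trans (+-congˡ (scal (φ ∘ suc) a _ ρ))
        (solve 4 (λ a b c d → b :* (a :* c) :+ a :* d := a :* (b :* c :+ d)) refl _ _ _ _)
      scal φ a x (true ∷ ρ) = trans (-‿cong (scal (φ ∘ suc) a _ ρ)) (-‿distribʳ-* _ _)

    e-cong : ∀ {n} (u : Fin n) {x y : Ch n} → x ≋ y → e u x ≋ e u y
    e-cong zero    h (false ∷ ρ) = refl
    e-cong zero    h (true ∷ ρ)  = h _
    e-cong (suc u) h (false ∷ ρ) = e-cong u (h ∘ (false ∷_)) ρ
    e-cong (suc u) h (true ∷ ρ)  = -‿cong (e-cong u (h ∘ (true ∷_)) ρ)

    e-linear : ∀ {n} (u : Fin n) → Linear (e u)
    e-linear u = record { cong = e-cong u ; add = add u ; scal = scal u }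
      where
      add : ∀ {n} (u : Fin n) (x y : Ch n) → e u (x ⊕ y) ≋ e u x ⊕ e u y
      add zero    x y (false ∷ ρ) = sym (+-identityˡ 0#)
      add zero    x y (true ∷ ρ)  = refl
      add (suc u) x y (false ∷ ρ) = add u _ _ ρ
      add (suc u) x y (true ∷ ρ)  = trans (-‿cong (add u _ _ ρ)) (sym (-‿+-comm _ _))
      scal : ∀ {n} (u : Fin n) a (x : Ch n) → e u (a ⊙ x) ≋ a ⊙ e u x
      scal zero    a x (false ∷ ρ) = sym (zeroʳ a)
      scal zero    a x (true ∷ ρ)  = refl
      scal (suc u) a x (false ∷ ρ) = scal u a _ ρ
      scal (suc u) a x (true ∷ ρ)  = trans (-‿cong (scal u a _ ρ)) (-‿distribʳ-* _ _)

    -- Linearity in the functional is what allows a vertex to be eliminated between two forms.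
    ∂-functional : ∀ {n} (a b : Carrier) (φ ψ : Fin n → Carrier) (x : Ch n) →
      ∂ (λ v → a * φ v - b * ψ v) x ≋ (a ⊙ ∂ φ x) ⊖ (b ⊙ ∂ ψ x)
    ∂-functional a b φ ψ x [] = solve 2 (λ a b → con (0 , 0) := a :* con (0 , 0) :- b :* con (0 , 0)) refl a b
    ∂-functional a b φ ψ x (false ∷ ρ) = trans (+-congˡ (∂-functional a b _ _ _ ρ))
      (solve 7 (λ a b f g y d₁ d₂ → (a :* f :- b :* g) :* y :+ (a :* d₁ :- b :* d₂)
                   := a :* (f :* y :+ d₁) :- b :* (g :* y :+ d₂)) refl _ _ _ _ _ _ _)
    ∂-functional a b φ ψ x (true ∷ ρ) = trans (-‿cong (∂-functional a b _ _ _ ρ))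
      (solve 4 (λ a b d₁ d₂ → :- (a :* d₁ :- b :* d₂) := a :* (:- d₁) :- b :* (:- d₂)) refl _ _ _ _)

    -- Proved separately from anticommutation, which would yield only that twice the composite
    -- vanishes and so says nothing in characteristic 2.
    ∂∂ : ∀ {n} (φ : Fin n → Carrier) (x : Ch n) → ∂ φ (∂ φ x) ≋ 𝟎
    ∂∂ φ x [] = refl
    ∂∂ φ x (false ∷ ρ) = begin
      φ zero * - D x₁ ρ + D (λ τ → φ zero * x₁ τ + D x₀ τ) ρ
        ≈⟨ +-congˡ (trans (add _ _ ρ) (+-cong (scal _ _ ρ) (∂∂ (φ ∘ suc) x₀ ρ))) ⟩
      φ zero * - D x₁ ρ + (φ zero * D x₁ ρ + 0#)
        ≈⟨ solve 2 (λ a b → a :* (:- b) :+ (a :* b :+ con (0 , 0)) := con (0 , 0)) refl _ _ ⟩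
      0# ∎
      where
      D = ∂ (φ ∘ suc)
      open Linear (∂-linear (φ ∘ suc))
      x₀ = x ∘ (false ∷_)
      x₁ = x ∘ (true ∷_)
    ∂∂ φ x (true ∷ ρ) = trans (-‿cong (trans (Linear.neg (∂-linear (φ ∘ suc)) _ ρ)
      (-‿cong (∂∂ (φ ∘ suc) _ ρ)))) (trans (-‿involutive 0#) refl)

    ∂-anticomm : ∀ {n} (φ ψ : Fin n → Carrier) (x : Ch n) → ∂ φ (∂ ψ x) ≋ (λ ρ → - ∂ ψ (∂ φ x) ρ)
    ∂-anticomm φ ψ x [] = sym -0#≈0#
    ∂-anticomm φ ψ x (false ∷ ρ) = begin
      φ zero * - E x₁ ρ + D (λ τ → ψ zero * x₁ τ + E x₀ τ) ρ
        ≈⟨ +-congˡ (trans (P.add _ _ ρ) (+-cong (P.scal _ _ ρ) (∂-anticomm _ _ x₀ ρ))) ⟩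
      φ zero * - E x₁ ρ + (ψ zero * D x₁ ρ + - E (D x₀) ρ)
        ≈⟨ solve 5 (λ f g a b z → f :* (:- a) :+ (g :* b :+ (:- z)) := :- (g :* (:- b) :+ (f :* a :+ z))) refl _ _ _ _ _ ⟩
      - (ψ zero * - D x₁ ρ + (φ zero * E x₁ ρ + E (D x₀) ρ))
        ≈⟨ -‿cong (+-congˡ (sym (trans (Q.add _ _ ρ) (+-congʳ (Q.scal _ _ ρ))))) ⟩
      - (ψ zero * - D x₁ ρ + E (λ τ → φ zero * x₁ τ + D x₀ τ) ρ) ∎
      where
      D = ∂ (φ ∘ suc)
      E = ∂ (ψ ∘ suc)
      module P = Linear (∂-linear (φ ∘ suc))
      module Q = Linear (∂-linear (ψ ∘ suc))
      x₀ = x ∘ (false ∷_)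
      x₁ = x ∘ (true ∷_)
    ∂-anticomm φ ψ x (true ∷ ρ) = -‿cong (trans (Linear.neg (∂-linear (φ ∘ suc)) _ ρ)
      (trans (-‿cong (∂-anticomm _ _ _ ρ)) (-‿cong (sym (Linear.neg (∂-linear (ψ ∘ suc)) _ ρ)))))

    ∂-swap : ∀ {n} (φ ψ : Fin n → Carrier) {x : Ch n} → ∂ φ x ≋ 𝟎 → ∂ φ (∂ ψ x) ≋ 𝟎
    ∂-swap φ ψ {x} h ρ = trans (∂-anticomm φ ψ x ρ)
      (trans (-‿cong (Linear.zero! (∂-linear ψ) h ρ)) -0#≈0#)

    -- Contraction is an antiderivation. Up to the factor `φ u`, `e u` is therefore a contracting
    -- homotopy for `∂ φ`; all cone arguments below rest on this.
    ∂-e : ∀ {n} (φ : Fin n → Carrier) u (x : Ch n) → ∂ φ (e u x) ≋ (φ u ⊙ x) ⊖ e u (∂ φ x)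
    ∂-e φ zero x (false ∷ ρ) = trans (+-congˡ (Linear.zero! (∂-linear (φ ∘ suc)) (λ _ → refl) ρ))
      (solve 1 (λ a → a :+ con (0 , 0) := a :- con (0 , 0)) refl _)
    ∂-e φ zero x (true ∷ ρ) =
      solve 3 (λ a b d → :- d := a :* b :- (a :* b :+ d)) refl (φ zero) (x (true ∷ ρ)) _
    ∂-e φ (suc u) x (false ∷ ρ) = begin
      φ zero * - e u x₁ ρ + ∂ φ′ (e u x₀) ρ
        ≈⟨ +-congˡ (∂-e φ′ u x₀ ρ) ⟩
      φ zero * - e u x₁ ρ + (φ′ u * x₀ ρ - e u (∂ φ′ x₀) ρ)
        ≈⟨ solve 4 (λ f a b d → f :* (:- a) :+ (b :- d) := b :- (f :* a :+ d)) refl _ _ _ _ ⟩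
      φ′ u * x₀ ρ - (φ zero * e u x₁ ρ + e u (∂ φ′ x₀) ρ)
        ≈⟨ +-congˡ (-‿cong (sym (trans (P.add _ _ ρ) (+-congʳ (P.scal _ _ ρ))))) ⟩
      φ′ u * x₀ ρ - e u (λ τ → φ zero * x₁ τ + ∂ φ′ x₀ τ) ρ ∎
      where
      φ′ = φ ∘ suc
      module P = Linear (e-linear u)
      x₀ = x ∘ (false ∷_)
      x₁ = x ∘ (true ∷_)
    ∂-e φ (suc u) x (true ∷ ρ) = begin
      - ∂ φ′ (λ τ → - e u x₁ τ) ρ          ≈⟨ -‿cong (Linear.neg (∂-linear φ′) _ ρ) ⟩
      - - ∂ φ′ (e u x₁) ρ                  ≈⟨ -‿involutive _ ⟩
      ∂ φ′ (e u x₁) ρ                      ≈⟨ ∂-e φ′ u x₁ ρ ⟩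
      φ′ u * x₁ ρ - e u (∂ φ′ x₁) ρ        ≈⟨ +-congˡ (-‿cong (sym (trans (-‿cong (Linear.neg (e-linear u) _ ρ)) (-‿involutive _)))) ⟩
      φ′ u * x₁ ρ - - e u (λ τ → - ∂ φ′ x₁ τ) ρ ∎
      where
      φ′ = φ ∘ suc
      x₁ = x ∘ (true ∷_)

    -- The grading involution, with sign (-1)^|σ| at σ; it supplies the signs of the Leibniz rule.
    bar : ∀ {n} → Ch n → Ch n
    bar x []          = x []
    bar x (false ∷ ρ) = bar (x ∘ (false ∷_)) ρ
    bar x (true ∷ ρ)  = - bar (x ∘ (true ∷_)) ρ

    infixr 7 _⋀_
    -- The exterior product, split at the first vertex: moving that vertex of the right factor to
    -- the front past the left factor costs the sign collected in `bar`.
    _⋀_ : ∀ {n} → Ch n → Ch n → Ch n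
    (x ⋀ y) []          = x [] * y []
    (x ⋀ y) (false ∷ ρ) = (x ∘ (false ∷_) ⋀ y ∘ (false ∷_)) ρ
    (x ⋀ y) (true ∷ ρ)  = (x ∘ (true ∷_) ⋀ y ∘ (false ∷_)) ρ + (bar (x ∘ (false ∷_)) ⋀ y ∘ (true ∷_)) ρ

    bar-linear : ∀ {n} → Linear (bar {n})
    bar-linear = record { cong = cong ; add = add ; scal = scal }
      where
      cong : ∀ {n} {x y : Ch n} → x ≋ y → bar x ≋ bar y
      cong h [] = h []
      cong h (false ∷ ρ) = cong (h ∘ (false ∷_)) ρ
      cong h (true ∷ ρ) = -‿cong (cong (h ∘ (true ∷_)) ρ)
      add : ∀ {n} (x y : Ch n) → bar (x ⊕ y) ≋ bar x ⊕ bar y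
      add x y [] = refl
      add x y (false ∷ ρ) = add _ _ ρ
      add x y (true ∷ ρ) = trans (-‿cong (add _ _ ρ)) (sym (-‿+-comm _ _))
      scal : ∀ {n} a (x : Ch n) → bar (a ⊙ x) ≋ a ⊙ bar x
      scal a x [] = refl
      scal a x (false ∷ ρ) = scal a _ ρ
      scal a x (true ∷ ρ) = trans (-‿cong (scal a _ ρ)) (-‿distribʳ-* _ _)

    bar-bar : ∀ {n} (x : Ch n) → bar (bar x) ≋ x
    bar-bar x [] = refl
    bar-bar x (false ∷ ρ) = bar-bar _ ρ
    bar-bar x (true ∷ ρ) = trans (-‿cong (Linear.neg bar-linear _ ρ)) (trans (-‿involutive _) (bar-bar _ ρ))

    ⋀-cong : ∀ {n} {x x′ y y′ : Ch n} → x ≋ x′ → y ≋ y′ → x ⋀ y ≋ x′ ⋀ y′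
    ⋀-cong p q [] = *-cong (p []) (q [])
    ⋀-cong p q (false ∷ ρ) = ⋀-cong (p ∘ (false ∷_)) (q ∘ (false ∷_)) ρ
    ⋀-cong p q (true ∷ ρ) = +-cong (⋀-cong (p ∘ (true ∷_)) (q ∘ (false ∷_)) ρ)
      (⋀-cong (Linear.cong bar-linear (p ∘ (false ∷_))) (q ∘ (true ∷_)) ρ)

    ⋀-linearˡ : ∀ {n} (y : Ch n) → Linear (_⋀ y)
    ⋀-linearˡ y = record { cong = λ p → ⋀-cong p (λ _ → refl) ; add = add y ; scal = scal y }
      where
      add : ∀ {n} (y x x′ : Ch n) → (x ⊕ x′) ⋀ y ≋ (x ⋀ y) ⊕ (x′ ⋀ y)
      add y x x′ [] = distribʳ _ _ _
      add y x x′ (false ∷ ρ) = add _ _ _ ρ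
      add y x x′ (true ∷ ρ) = trans (+-cong (add _ _ _ ρ)
        (trans (⋀-cong (Linear.add bar-linear _ _) (λ _ → refl) ρ) (add _ _ _ ρ)))
        (solve 4 (λ a b d f → (a :+ b) :+ (d :+ f) := (a :+ d) :+ (b :+ f)) refl _ _ _ _)
      scal : ∀ {n} (y : Ch n) a (x : Ch n) → (a ⊙ x) ⋀ y ≋ a ⊙ (x ⋀ y)
      scal y a x [] = *-assoc _ _ _
      scal y a x (false ∷ ρ) = scal _ a _ ρ
      scal y a x (true ∷ ρ) = trans (+-cong (scal _ a _ ρ)
        (trans (⋀-cong (Linear.scal bar-linear a _) (λ _ → refl) ρ) (scal _ a _ ρ))) (sym (distribˡ _ _ _))

    ⋀-linearʳ : ∀ {n} (x : Ch n) → Linear (x ⋀_)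
    ⋀-linearʳ x = record { cong = ⋀-cong (λ _ → refl) ; add = add x ; scal = scal x }
      where
      add : ∀ {n} (x y y′ : Ch n) → x ⋀ (y ⊕ y′) ≋ (x ⋀ y) ⊕ (x ⋀ y′)
      add x y y′ [] = distribˡ _ _ _
      add x y y′ (false ∷ ρ) = add _ _ _ ρ
      add x y y′ (true ∷ ρ) = trans (+-cong (add _ _ _ ρ) (add _ _ _ ρ))
        (solve 4 (λ a b d f → (a :+ b) :+ (d :+ f) := (a :+ d) :+ (b :+ f)) refl _ _ _ _)
      scal : ∀ {n} (x : Ch n) a (y : Ch n) → x ⋀ (a ⊙ y) ≋ a ⊙ (x ⋀ y)
      scal x a y [] = solve 3 (λ x a y → x :* (a :* y) := a :* (x :* y)) refl _ _ _
      scal x a y (false ∷ ρ) = scal _ a _ ρ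
      scal x a y (true ∷ ρ) = trans (+-cong (scal _ a _ ρ) (scal _ a _ ρ)) (sym (distribˡ _ _ _))

    bar-∂ : ∀ {n} (φ : Fin n → Carrier) (x : Ch n) → ∂ φ (bar x) ≋ (λ ρ → - bar (∂ φ x) ρ)
    bar-∂ φ x [] = sym -0#≈0#
    bar-∂ φ x (false ∷ ρ) = begin
      φ zero * - bar x₁ ρ + ∂ φ′ (bar x₀) ρ     ≈⟨ +-congˡ (bar-∂ φ′ x₀ ρ) ⟩
      φ zero * - bar x₁ ρ + - bar (∂ φ′ x₀) ρ   ≈⟨ solve 3 (λ f a b → f :* (:- a) :+ (:- b) := :- (f :* a :+ b)) refl _ _ _ ⟩
      - (φ zero * bar x₁ ρ + bar (∂ φ′ x₀) ρ)   ≈⟨ -‿cong (sym (trans (B.add _ _ ρ) (+-congʳ (B.scal _ _ ρ)))) ⟩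
      - bar (λ τ → φ zero * x₁ τ + ∂ φ′ x₀ τ) ρ ∎
      where
      φ′ = φ ∘ suc
      module B = Linear bar-linear
      x₀ = x ∘ (false ∷_)
      x₁ = x ∘ (true ∷_)
    bar-∂ φ x (true ∷ ρ) = begin
      - ∂ φ′ (λ τ → - bar x₁ τ) ρ       ≈⟨ -‿cong (Linear.neg (∂-linear φ′) _ ρ) ⟩
      - - ∂ φ′ (bar x₁) ρ               ≈⟨ -‿cong (-‿cong (bar-∂ φ′ x₁ ρ)) ⟩
      - - - bar (∂ φ′ x₁) ρ             ≈⟨ -‿cong (-‿cong (sym (Linear.neg bar-linear _ ρ))) ⟩
      - - bar (λ τ → - ∂ φ′ x₁ τ) ρ     ∎
      where
      φ′ = φ ∘ suc
      x₁ = x ∘ (true ∷_)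

    ∂-⋀ : ∀ {n} (φ : Fin n → Carrier) (x y : Ch n) → ∂ φ (x ⋀ y) ≋ (∂ φ x ⋀ y) ⊕ (bar x ⋀ ∂ φ y)
    ∂-⋀ φ x y [] = solve 2 (λ a b → con (0 , 0) := con (0 , 0) :* b :+ a :* con (0 , 0)) refl (x []) (y [])
    ∂-⋀ φ x y (false ∷ ρ) = begin
      φ zero * ((x₁ ⋀ y₀) ρ + (bar x₀ ⋀ y₁) ρ) + D (x₀ ⋀ y₀) ρ
        ≈⟨ +-congˡ (∂-⋀ φ′ x₀ y₀ ρ) ⟩
      φ zero * ((x₁ ⋀ y₀) ρ + (bar x₀ ⋀ y₁) ρ) + ((D x₀ ⋀ y₀) ρ + (bar x₀ ⋀ D y₀) ρ)
        ≈⟨ solve 5 (λ f a b d g → f :* (a :+ b) :+ (d :+ g) := (f :* a :+ d) :+ (f :* b :+ g)) refl _ _ _ _ _ ⟩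
      (φ zero * (x₁ ⋀ y₀) ρ + (D x₀ ⋀ y₀) ρ) + (φ zero * (bar x₀ ⋀ y₁) ρ + (bar x₀ ⋀ D y₀) ρ)
        ≈⟨ +-cong (sym (trans (L.add _ _ ρ) (+-congʳ (L.scal _ _ ρ))))
                  (sym (trans (Rr.add _ _ ρ) (+-congʳ (Rr.scal _ _ ρ)))) ⟩
      ((λ τ → φ zero * x₁ τ + D x₀ τ) ⋀ y₀) ρ + (bar x₀ ⋀ (λ τ → φ zero * y₁ τ + D y₀ τ)) ρ ∎
      where
      φ′ = φ ∘ suc
      D = ∂ φ′
      x₀ = x ∘ (false ∷_)
      x₁ = x ∘ (true ∷_)
      y₀ = y ∘ (false ∷_)
      y₁ = y ∘ (true ∷_)
      module L = Linear (⋀-linearˡ y₀)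
      module Rr = Linear (⋀-linearʳ (bar x₀))
    ∂-⋀ φ x y (true ∷ ρ) = begin
      - D ((x₁ ⋀ y₀) ⊕ (bar x₀ ⋀ y₁)) ρ
        ≈⟨ -‿cong (trans (P.add _ _ ρ) (+-cong (∂-⋀ φ′ x₁ y₀ ρ) (∂-⋀ φ′ (bar x₀) y₁ ρ))) ⟩
      - (((D x₁ ⋀ y₀) ρ + (bar x₁ ⋀ D y₀) ρ) + ((D (bar x₀) ⋀ y₁) ρ + (bar (bar x₀) ⋀ D y₁) ρ))
        ≈⟨ -‿cong (+-congˡ (+-congʳ (trans (⋀-cong (bar-∂ φ′ x₀) (λ _ → refl) ρ) (Linear.neg (⋀-linearˡ y₁) _ ρ)))) ⟩
      - (((D x₁ ⋀ y₀) ρ + (bar x₁ ⋀ D y₀) ρ) + (- (bar (D x₀) ⋀ y₁) ρ + (bar (bar x₀) ⋀ D y₁) ρ))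
        ≈⟨ solve 5 (λ a b d f g → :- ((a :+ b) :+ ((:- d) :+ f)) := ((:- a) :+ (g :+ d)) :+ ((:- (g :+ b)) :+ (:- f))) refl _ _ _ _ _ ⟩
      (- (D x₁ ⋀ y₀) ρ + (φ zero * (bar x₁ ⋀ y₁) ρ + (bar (D x₀) ⋀ y₁) ρ))
        + (- (φ zero * (bar x₁ ⋀ y₁) ρ + (bar x₁ ⋀ D y₀) ρ) + - (bar (bar x₀) ⋀ D y₁) ρ)
        ≈⟨ +-cong (+-cong (sym (Linear.neg (⋀-linearˡ y₀) _ ρ))
                     (sym (trans (⋀-cong (λ τ → trans (B.add _ _ τ) (+-congʳ (B.scal _ _ τ))) (λ _ → refl) ρ)
                        (trans (L₁.add _ _ ρ) (+-congʳ (L₁.scal _ _ ρ))))))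
                  (+-cong (sym (trans (Linear.neg (⋀-linearˡ _) _ ρ)
                        (-‿cong (trans (Rr.add _ _ ρ) (+-congʳ (Rr.scal _ _ ρ))))))
                     (sym (Linear.neg (⋀-linearʳ (bar (bar x₀))) _ ρ))) ⟩
      (∂ φ x ⋀ y) (true ∷ ρ) + (bar x ⋀ ∂ φ y) (true ∷ ρ) ∎
      where
      φ′ = φ ∘ suc
      D = ∂ φ′
      x₀ = x ∘ (false ∷_)
      x₁ = x ∘ (true ∷_)
      y₀ = y ∘ (false ∷_)
      y₁ = y ∘ (true ∷_)
      module P = Linear (∂-linear φ′)
      module B = Linear bar-linear
      module L₁ = Linear (⋀-linearˡ y₁)
      module Rr = Linear (⋀-linearʳ (bar x₁))

    -- The coefficient of a product at ρ is a signed sum over the splittings of ρ into two disjoint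
    -- sets, so only disjoint pairs matter.
    ⋀-zero-local : ∀ {n} {x y : Ch n} →
      (∀ σ τ → (∀ v → lookup σ v ≡ true → lookup τ v ≡ true → ⊥) → x σ * y τ ≈ 0#) → x ⋀ y ≋ 𝟎
    ⋀-zero-local h [] = h [] [] λ ()
    ⋀-zero-local {x = x} {y} h (false ∷ ρ) =
      ⋀-zero-local (λ σ τ d → h (false ∷ σ) (false ∷ τ) λ { zero () ; (suc v) → d v }) ρ
    ⋀-zero-local {x = x} {y} h (true ∷ ρ) = trans (+-cong
      (⋀-zero-local (λ σ τ d → h (true ∷ σ) (false ∷ τ) λ { zero _ () ; (suc v) → d v }) ρ)
      (⋀-zero-local (λ σ τ d → bar-zero (λ σ → h (false ∷ σ) (true ∷ τ)) σ (λ { zero () ; (suc v) → d v })) ρ))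
      (+-identityˡ 0#)
      where
      bar-zero : ∀ {n} {x : Ch n} {b : Carrier} {P : Subset n → Set} → (∀ σ → P σ → x σ * b ≈ 0#) →
        ∀ σ → P σ → bar x σ * b ≈ 0#
      bar-zero h [] p = h [] p
      bar-zero {P = P} h (false ∷ σ) p = bar-zero {P = P ∘ (false ∷_)} (h ∘ (false ∷_)) σ p
      bar-zero {P = P} h (true ∷ σ) p = trans (sym (-‿distribˡ-* _ _))
        (trans (-‿cong (bar-zero {P = P ∘ (true ∷_)} (h ∘ (true ∷_)) σ p)) -0#≈0#)

    bar-local : ∀ {n} {x : Ch n} σ → x σ ≈ 0# → bar x σ ≈ 0#
    bar-local [] h = h
    bar-local (false ∷ σ) h = bar-local σ h
    bar-local (true ∷ σ) h = trans (-‿cong (bar-local σ h)) -0#≈0#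

-- Finite double negation, subsets, weights and counting by injections

module Subsets where
  open import Defs
  open import Level using (Level)
  open import Data.Bool using (Bool; true; false)
  open import Data.Bool.Properties using (T-≡)
  open import Data.Nat as ℕ using (ℕ; zero; suc; _+_; _≤_; _<_; z≤n; s≤s)
  import Data.Nat.Properties as ℕ
  open import Data.Fin using (Fin; zero; suc)
  import Data.Fin.Properties as Fin
  open import Data.Fin.Subset using (Subset; ∣_∣)
  open import Data.List as List using (List; []; _∷_; _++_; map; length; filterᵇ)
  open import Data.Nat.ListAction using (sum)
  open import Data.Nat.ListAction.Properties using (sum-++)
  import Data.List.Properties as List
  open import Data.List.Membership.Propositional using (_∈_)
  open import Data.List.Membership.Propositional.Properties using (∈-∃++; ∈-++⁺ˡ; ∈-++⁺ʳ; ∈-++⁻; ∈-map⁺; ∈-map⁻; ∈-filter⁺; ∈-filter⁻)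
  open import Data.List.Relation.Unary.All as All using (All; []; _∷_)
  open import Data.List.Relation.Unary.Any using (here; there)
  open import Data.List.Relation.Unary.AllPairs using ([]; _∷_)
  open import Data.List.Relation.Unary.Unique.Propositional using (Unique)
  import Data.List.Relation.Unary.Unique.Propositional.Properties as Unique
  open import Data.Product using (∃; _×_; _,_; proj₂)
  open import Data.Sum using (_⊎_; inj₁; inj₂)
  open import Data.Empty using (⊥; ⊥-elim)
  open import Data.Vec as Vec using ([]; _∷_; lookup; _[_]≔_)
  open import Data.Vec.Properties using (lookup∘update; lookup∘update′; ∷-injectiveʳ)
  open import Function using (_∘_; id; const)
  open import Function.Bundles using (Equivalence)
  open import Relation.Nullary using (¬_; yes; no)
  open import Relation.Nullary.Decidable using (T?)
  open import Relation.Nullary.Negation using (contradiction)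
  open import Relation.Binary.PropositionalEquality using (_≡_; _≢_; refl; sym; trans; cong; cong₂; subst; subst₂; module ≡-Reasoning)

  private variable
    ℓ ℓ′ : Level
    n k : ℕ

  infixl 1 _>>=_
  _>>=_ : {A : Set ℓ} {B : Set ℓ′} → ¬ ¬ A → (A → ¬ ¬ B) → ¬ ¬ B
  (m >>= f) k = m λ a → f a k

  return : {A : Set ℓ} → A → ¬ ¬ A
  return a k = k a

  -- Double negation passes through this quantifier because the index set is finite.
  ¬¬-∀Fin : {P : Fin n → Set ℓ} → (∀ i → ¬ ¬ P i) → ¬ ¬ (∀ i → P i)
  ¬¬-∀Fin {n = zero}  h k = k λ ()
  ¬¬-∀Fin {n = suc n} h = h zero >>= λ p → ¬¬-∀Fin (h ∘ suc) >>= λ ps →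
    return λ { zero → p ; (suc i) → ps i }

  ¬¬-∀Subset : {P : Subset n → Set ℓ} → (∀ S → ¬ ¬ P S) → ¬ ¬ (∀ S → P S)
  ¬¬-∀Subset {n = zero}  h = h [] >>= λ p → return λ { [] → p }
  ¬¬-∀Subset {n = suc n} h = ¬¬-∀Subset (h ∘ (false ∷_)) >>= λ p → ¬¬-∀Subset (h ∘ (true ∷_)) >>= λ q →
    return λ { (false ∷ S) → p S ; (true ∷ S) → q S }

  infix 4 _∋_ _∌_
  _∋_ _∌_ : Subset n → Fin n → Set
  S ∋ x = lookup S x ≡ true
  S ∌ x = lookup S x ≡ false

  ∋∌ : ∀ {b : Bool} {A : Set ℓ} → b ≡ true → b ≡ false → A
  ∋∌ p q = contradiction (trans (sym p) q) λ ()

  ∋? : ∀ (S : Subset n) x → S ∋ x ⊎ S ∌ x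
  ∋? S x with lookup S x
  ... | true  = inj₁ refl
  ... | false = inj₂ refl

  ∋∌⇒≢ : ∀ (S : Subset n) {x y} → S ∋ x → S ∌ y → x ≢ y
  ∋∌⇒≢ S p q refl = ∋∌ p q

  infix 4 _⊑_
  _⊑_ : Subset n → Subset n → Set
  S ⊑ S′ = ∀ x → S ∋ x → S′ ∋ x

  Meet : Subset n → Subset n → Set
  Meet S S′ = ∃ λ x → S ∋ x × S′ ∋ x

  subset-ext : ∀ {S S′ : Subset n} → (∀ x → lookup S x ≡ lookup S′ x) → S ≡ S′
  subset-ext {S = []} {[]} h = refl
  subset-ext {S = s ∷ S} {t ∷ S′} h = cong₂ _∷_ (h zero) (subset-ext (h ∘ suc))

  update-same : ∀ (S : Subset n) i b → lookup (S [ i ]≔ b) i ≡ b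
  update-same S i b = lookup∘update i S b

  update-other : ∀ (S : Subset n) {i x} b → x ≢ i → lookup (S [ i ]≔ b) x ≡ lookup S x
  update-other S b x≢i = lookup∘update′ x≢i S b

  update-∋ : ∀ (S : Subset n) i {x} → S ∋ x → (S [ i ]≔ true) ∋ x
  update-∋ S i {x} S∋x with x Fin.≟ i
  ... | yes refl = update-same S i true
  ... | no x≢i   = trans (update-other S true x≢i) S∋x

  update-∋⁻ : ∀ (S : Subset n) i {x} → (S [ i ]≔ true) ∋ x → x ≡ i ⊎ S ∋ x
  update-∋⁻ S i {x} h with x Fin.≟ i
  ... | yes refl = inj₁ refl
  ... | no x≢i   = inj₂ (trans (sym (update-other S true x≢i)) h)

  erase-⊑ : ∀ (S : Subset n) i → (S [ i ]≔ false) ⊑ S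
  erase-⊑ S i x h with x Fin.≟ i
  ... | yes refl = ∋∌ h (update-same S i false)
  ... | no x≢i   = trans (sym (update-other S false x≢i)) h

  update-id : ∀ (S : Subset n) i {b} → lookup S i ≡ b → S [ i ]≔ b ≡ S
  update-id S i {b} eq = subset-ext λ x → help x
    where
    help : ∀ x → lookup (S [ i ]≔ b) x ≡ lookup S x
    help x with x Fin.≟ i
    ... | yes refl = trans (update-same S i b) (sym eq)
    ... | no x≢i   = update-other S b x≢i

  update-update : ∀ (S : Subset n) i {b b′} → (S [ i ]≔ b) [ i ]≔ b′ ≡ S [ i ]≔ b′
  update-update S i {b} {b′} = subset-ext λ x → help x
    where
    help : ∀ x → lookup ((S [ i ]≔ b) [ i ]≔ b′) x ≡ lookup (S [ i ]≔ b′) x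
    help x with x Fin.≟ i
    ... | yes refl = trans (update-same (S [ i ]≔ b) i b′) (sym (update-same S i b′))
    ... | no x≢i   = trans (update-other (S [ i ]≔ b) b′ x≢i)
                       (trans (update-other S b x≢i) (sym (update-other S b′ x≢i)))

  wt : (Fin n → ℕ) → Subset n → ℕ
  wt f []          = 0
  wt f (true ∷ S)  = f zero + wt (f ∘ suc) S
  wt f (false ∷ S) = wt (f ∘ suc) S

  wt-insert : ∀ (f : Fin n → ℕ) S i → S ∌ i → wt f (S [ i ]≔ true) ≡ f i + wt f S
  wt-insert f (false ∷ S) zero    h = refl
  wt-insert f (false ∷ S) (suc i) h = wt-insert (f ∘ suc) S i h
  wt-insert f (true ∷ S)  (suc i) h = trans (cong (f zero +_) (wt-insert (f ∘ suc) S i h))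
    (trans (sym (ℕ.+-assoc (f zero) _ _)) (trans (cong (_+ wt (f ∘ suc) S) (ℕ.+-comm (f zero) _)) (ℕ.+-assoc (f (suc i)) (f zero) _)))

  wt-erase : ∀ (f : Fin n → ℕ) S i → S ∋ i → wt f S ≡ f i + wt f (S [ i ]≔ false)
  wt-erase f S i h = trans (cong (wt f) (sym eq)) (wt-insert f (S [ i ]≔ false) i (update-same S i false))
    where
    eq : (S [ i ]≔ false) [ i ]≔ true ≡ S
    eq = trans (update-update S i) (update-id S i h)

  ∣∣≡wt : ∀ (S : Subset n) → ∣ S ∣ ≡ wt (const 1) S
  ∣∣≡wt [] = refl
  ∣∣≡wt (true ∷ S) = cong suc (∣∣≡wt S)
  ∣∣≡wt (false ∷ S) = ∣∣≡wt S

  card-insert : ∀ (S : Subset n) i → S ∌ i → ∣ S [ i ]≔ true ∣ ≡ suc ∣ S ∣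
  card-insert S i h = trans (∣∣≡wt (S [ i ]≔ true)) (trans (wt-insert (const 1) S i h) (cong suc (sym (∣∣≡wt S))))

  card-erase : ∀ (S : Subset n) i → S ∋ i → ∣ S ∣ ≡ suc ∣ S [ i ]≔ false ∣
  card-erase S i h = trans (∣∣≡wt S) (trans (wt-erase (const 1) S i h) (cong suc (sym (∣∣≡wt (S [ i ]≔ false)))))

  card-⊑ : ∀ (S S′ : Subset n) → S ⊑ S′ → ∣ S ∣ ≤ ∣ S′ ∣
  card-⊑ [] [] h = z≤n
  card-⊑ (true ∷ S) (true ∷ S′) h = s≤s (card-⊑ S S′ (h ∘ suc))
  card-⊑ (true ∷ S) (false ∷ S′) h = contradiction (h zero refl) λ ()
  card-⊑ (false ∷ S) (true ∷ S′) h = ℕ.m≤n⇒m≤1+n (card-⊑ S S′ (h ∘ suc))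
  card-⊑ (false ∷ S) (false ∷ S′) h = card-⊑ S S′ (h ∘ suc)

  card-⊑-≡ : ∀ (S S′ : Subset n) → S ⊑ S′ → ∣ S′ ∣ ≤ ∣ S ∣ → S ≡ S′
  card-⊑-≡ [] [] h c = refl
  card-⊑-≡ (true ∷ S) (true ∷ S′) h (s≤s c) = cong (true ∷_) (card-⊑-≡ S S′ (h ∘ suc) c)
  card-⊑-≡ (true ∷ S) (false ∷ S′) h c = contradiction (h zero refl) λ ()
  card-⊑-≡ (false ∷ S) (true ∷ S′) h c = contradiction (ℕ.≤-trans c (card-⊑ S S′ (h ∘ suc))) (ℕ.<-irrefl refl)
  card-⊑-≡ (false ∷ S) (false ∷ S′) h c = cong (false ∷_) (card-⊑-≡ S S′ (h ∘ suc) c)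

  ∃∋ : ∀ (S : Subset n) → 0 < ∣ S ∣ → ∃ λ x → S ∋ x
  ∃∋ (true ∷ S) h = zero , refl
  ∃∋ (false ∷ S) h with ∃∋ S h
  ... | x , S∋x = suc x , S∋x

  card-0 : ∀ (S : Subset n) → (∀ x → S ∌ x) → ∣ S ∣ ≡ 0
  card-0 [] h = refl
  card-0 (true ∷ S) h = contradiction (h zero) λ ()
  card-0 (false ∷ S) h = card-0 S (h ∘ suc)

  0-card : ∀ (S : Subset n) → ∣ S ∣ ≡ 0 → ∀ x → S ∌ x
  0-card (false ∷ S) h zero = refl
  0-card (false ∷ S) h (suc x) = 0-card S h x

  move : Fin n → Fin n → Subset n → Subset n
  move w i S = (S [ w ]≔ false) [ i ]≔ true

  module _ {S : Subset n} {w i : Fin n} (S∋w : S ∋ w) (S∌i : S ∌ i) where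
    private
      w≢i : w ≢ i
      w≢i = ∋∌⇒≢ S S∋w S∌i
      S′ = S [ w ]≔ false
      S′∌i : S′ ∌ i
      S′∌i = trans (update-other S false (w≢i ∘ sym)) S∌i

    move-∋ : move w i S ∋ i
    move-∋ = update-same S′ i true

    move-∌ : move w i S ∌ w
    move-∌ = trans (update-other S′ true w≢i) (update-same S w false)

    move-other : ∀ {x} → x ≢ w → x ≢ i → lookup (move w i S) x ≡ lookup S x
    move-other x≢w x≢i = trans (update-other S′ true x≢i) (update-other S false x≢w)

    move-wt : ∀ f → wt f (move w i S) + f w ≡ wt f S + f i
    move-wt f = begin
      wt f (move w i S) + f w   ≡⟨ cong (_+ f w) (wt-insert f S′ i S′∌i) ⟩
      (f i + wt f S′) + f w     ≡⟨ ℕ.+-assoc (f i) _ _ ⟩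
      f i + (wt f S′ + f w)     ≡⟨ ℕ.+-comm (f i) _ ⟩
      (wt f S′ + f w) + f i     ≡⟨ cong (_+ f i) (ℕ.+-comm _ (f w)) ⟩
      (f w + wt f S′) + f i     ≡⟨ cong (_+ f i) (sym (wt-erase f S w S∋w)) ⟩
      wt f S + f i              ∎
      where open ≡-Reasoning

    move-card : ∣ move w i S ∣ ≡ ∣ S ∣
    move-card = trans (card-insert S′ i S′∌i) (sym (card-erase S w S∋w))

    move-∋⁻ : ∀ {x} → move w i S ∋ x → x ≡ i ⊎ (x ≢ w × S ∋ x)
    move-∋⁻ {x} h with x Fin.≟ i | x Fin.≟ w
    ... | yes p | _        = inj₁ p
    ... | no _ | yes refl  = ∋∌ h move-∌
    ... | no x≢i | no x≢w  = inj₂ (x≢w , trans (sym (move-other x≢w x≢i)) h)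

    move-∋⁺ : ∀ {x} → x ≢ w → S ∋ x → move w i S ∋ x
    move-∋⁺ x≢w S∋x = trans (move-other x≢w (∋∌⇒≢ S S∋x S∌i)) S∋x

    move-move : move i w (move w i S) ≡ S
    move-move = subset-ext help
      where
      M = move w i S
      help : ∀ x → lookup (move i w M) x ≡ lookup S x
      help x with x Fin.≟ w | x Fin.≟ i
      ... | yes refl | _ = trans (update-same (M [ i ]≔ false) w true) (sym S∋w)
      ... | no x≢w | yes refl = trans (update-other (M [ i ]≔ false) true x≢w) (trans (update-same M i false) (sym S∌i))
      ... | no x≢w | no x≢i = trans (update-other (M [ i ]≔ false) true x≢w)
              (trans (update-other M false x≢i) (move-other x≢w x≢i))

  allSubsets-unique : ∀ n → Unique (allSubsets n)
  allSubsets-unique zero = [] ∷ []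
  allSubsets-unique (suc n) = Unique.++⁺ (Unique.map⁺ ∷-injectiveʳ (allSubsets-unique n))
    (Unique.map⁺ ∷-injectiveʳ (allSubsets-unique n)) disjoint
    where
    disjoint : ∀ {S} → ¬ (S ∈ map (true ∷_) (allSubsets n) × S ∈ map (false ∷_) (allSubsets n))
    disjoint (p , q) with ∈-map⁻ _ p | ∈-map⁻ _ q
    ... | _ , _ , refl | _ , _ , ()

  ∈-allSubsets : ∀ (S : Subset n) → S ∈ allSubsets n
  ∈-allSubsets [] = here refl
  ∈-allSubsets (true ∷ S) = ∈-++⁺ˡ (∈-map⁺ _ (∈-allSubsets S))
  ∈-allSubsets {suc n} (false ∷ S) = ∈-++⁺ʳ (map (true ∷_) (allSubsets n)) (∈-map⁺ _ (∈-allSubsets S))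

  members : (Subset n → Bool) → List (Subset n)
  members {n} P = filterᵇ P (allSubsets n)

  ∈-members⁺ : ∀ {P : Subset n → Bool} {S} → P S ≡ true → S ∈ members P
  ∈-members⁺ {P = P} {S} h = ∈-filter⁺ (T? ∘ P) (∈-allSubsets S) (Equivalence.from T-≡ h)

  ∈-members⁻ : ∀ {P : Subset n → Bool} {S} → S ∈ members P → P S ≡ true
  ∈-members⁻ {P = P} h = Equivalence.to T-≡ (proj₂ (∈-filter⁻ (T? ∘ P) {xs = allSubsets _} h))

  members-unique : ∀ (P : Subset n → Bool) → Unique (members P)
  members-unique {n} P = Unique.filter⁺ (T? ∘ P) (allSubsets-unique n)

  sum-mono : {A : Set} {f g : A → ℕ} (xs : List A) → (∀ x → x ∈ xs → f x ≤ g x) → sum (map f xs) ≤ sum (map g xs)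
  sum-mono [] h = z≤n
  sum-mono (x ∷ xs) h = ℕ.+-mono-≤ (h x (here refl)) (sum-mono xs λ y → h y ∘ there)

  sum-mono-< : {A : Set} {f g : A → ℕ} {x : A} {xs : List A} → (∀ x → x ∈ xs → f x ≤ g x) →
    x ∈ xs → f x < g x → sum (map f xs) < sum (map g xs)
  sum-mono-< h (here refl) lt = ℕ.+-mono-<-≤ lt (sum-mono _ λ y → h y ∘ there)
  sum-mono-< h (there p) lt = ℕ.+-mono-≤-< (h _ (here refl)) (sum-mono-< (λ y → h y ∘ there) p lt)

  -- The image of each entry is split off from `ys`; uniqueness and injectivity keep the images of
  -- the later entries in what remains. Weight 1 gives counting, `wt` gives the potential used for
  -- shifting.
  sum-inject : {A B : Set} (h : B → ℕ) (φ : A → B) (xs : List A) (ys : List B) → Unique xs →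
    (∀ x → x ∈ xs → φ x ∈ ys) → (∀ x y → x ∈ xs → y ∈ xs → φ x ≡ φ y → x ≡ y) →
    sum (map (h ∘ φ) xs) ≤ sum (map h ys)
  sum-inject h φ [] ys u into inj = z≤n
  sum-inject h φ (x ∷ xs) ys (x∉ ∷ u) into inj with ∈-∃++ (into x (here refl))
  ... | ys₁ , ys₂ , refl = begin
    h (φ x) + sum (map (h ∘ φ) xs)            ≤⟨ ℕ.+-monoʳ-≤ (h (φ x)) (sum-inject h φ xs (ys₁ ++ ys₂) u into′ λ y z p q → inj y z (there p) (there q)) ⟩
    h (φ x) + sum (map h (ys₁ ++ ys₂))        ≡⟨ cong (h (φ x) +_) (split ys₁ ys₂) ⟩
    h (φ x) + (s₁ + s₂)                       ≡⟨ sym (ℕ.+-assoc (h (φ x)) s₁ s₂) ⟩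
    (h (φ x) + s₁) + s₂                       ≡⟨ cong (_+ s₂) (ℕ.+-comm (h (φ x)) s₁) ⟩
    (s₁ + h (φ x)) + s₂                       ≡⟨ ℕ.+-assoc s₁ (h (φ x)) s₂ ⟩
    s₁ + (h (φ x) + s₂)                       ≡⟨ sym (split ys₁ (φ x ∷ ys₂)) ⟩
    sum (map h (ys₁ ++ φ x ∷ ys₂))            ∎
    where
    open ℕ.≤-Reasoning
    s₁ = sum (map h ys₁)
    s₂ = sum (map h ys₂)
    split : ∀ us vs → sum (map h (us ++ vs)) ≡ sum (map h us) + sum (map h vs)
    split us vs = trans (cong sum (List.map-++ h us vs)) (sum-++ (map h us) (map h vs))
    into′ : ∀ y → y ∈ xs → φ y ∈ ys₁ ++ ys₂
    into′ y y∈ with ∈-++⁻ ys₁ (into y (there y∈))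
    ... | inj₁ p = ∈-++⁺ˡ p
    ... | inj₂ (here eq) = contradiction (inj x y (here refl) (there y∈) (sym eq)) (All.lookup x∉ y∈)
    ... | inj₂ (there p) = ∈-++⁺ʳ ys₁ p

  sum-ones : {A : Set} (xs : List A) → sum (map (const 1) xs) ≡ length xs
  sum-ones [] = refl
  sum-ones (x ∷ xs) = cong suc (sum-ones xs)

  count-inject : ∀ {n′} {P : Subset n → Bool} {Q : Subset n′ → Bool} (φ : Subset n → Subset n′) →
    (∀ S → P S ≡ true → Q (φ S) ≡ true) → (∀ S S′ → P S ≡ true → P S′ ≡ true → φ S ≡ φ S′ → S ≡ S′) →
    countSubsets P ≤ countSubsets Q
  count-inject {P = P} {Q} φ into inj = subst₂ _≤_ (sum-ones (members P)) (sum-ones (members Q))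
    (sum-inject (const 1) φ (members P) (members Q) (members-unique P)
      (λ S S∈ → ∈-members⁺ {P = Q} (into S (∈-members⁻ {P = P} S∈)))
      λ S S′ S∈ S′∈ → inj S S′ (∈-members⁻ {P = P} S∈) (∈-members⁻ {P = P} S′∈))

  count-mono : ∀ {P Q : Subset n → Bool} → (∀ S → P S ≡ true → Q S ≡ true) → countSubsets P ≤ countSubsets Q
  count-mono h = count-inject id h λ _ _ _ _ eq → eq

  count-suc : ∀ (P : Subset (suc n) → Bool) →
    countSubsets P ≡ countSubsets (P ∘ (true ∷_)) + countSubsets (P ∘ (false ∷_))
  count-suc {n} P = begin
    length (filterᵇ P (map (true ∷_) xs ++ map (false ∷_) xs))  ≡⟨ cong length (List.filter-++ (T? ∘ P) (map (true ∷_) xs) _) ⟩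
    length (filterᵇ P (map (true ∷_) xs) ++ filterᵇ P (map (false ∷_) xs))  ≡⟨ List.length-++ (filterᵇ P (map (true ∷_) xs)) ⟩
    length (filterᵇ P (map (true ∷_) xs)) + length (filterᵇ P (map (false ∷_) xs))
      ≡⟨ cong₂ _+_ (filter-map (true ∷_) xs) (filter-map (false ∷_) xs) ⟩
    _ ∎
    where
    open ≡-Reasoning
    xs = allSubsets n
    filter-map : ∀ (g : Subset n → Subset (suc n)) ys → length (filterᵇ P (map g ys)) ≡ length (filterᵇ (P ∘ g) ys)
    filter-map g [] = refl
    filter-map g (y ∷ ys) with P (g y)
    ... | true  = cong suc (filter-map g ys)
    ... | false = filter-map g ys

  count-zero : ∀ (P : Subset n → Bool) → (∀ S → P S ≡ true → ⊥) → countSubsets P ≡ 0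
  count-zero P h with members P in eq
  ... | []     = refl
  ... | S ∷ xs = ⊥-elim (h S (∈-members⁻ {P = P} (subst (S ∈_) (sym eq) (here refl))))

-- Combinatorial shifts and their termination

module Shifting where
  open import Defs
  open import Data.Bool using (Bool; true; false; not; _∧_; _∨_; if_then_else_)
  open import Data.Nat as ℕ using (ℕ; zero; suc; _+_; _≤_; _<_)
  import Data.Nat.Properties as ℕ
  open import Data.Nat.ListAction using (sum)
  open import Data.Fin using (Fin; zero; suc)
  import Data.Fin.Properties as Fin
  open import Data.Fin.Subset using (Subset)
  open import Data.List using (map)
  open import Data.Product using (∃; _×_; _,_)
  open import Data.Sum using (_⊎_; inj₁; inj₂)
  open import Data.Vec using (lookup)
  open import Function using (id; const)
  open import Relation.Nullary using (¬_; yes; no)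
  open import Relation.Nullary.Negation using (contradiction)
  open import Relation.Nullary.Decidable using (¬¬-excluded-middle)
  open import Relation.Binary.PropositionalEquality using (_≡_; refl; sym; trans; cong; subst)
  open Subsets

  private variable
    n : ℕ

  private
    -- Truth table for membership of S in a shifted family. The arguments say whether S contains
    -- `i`, whether it contains `w`, and whether S itself, its possible preimage and its image
    -- belong to the old family.
    pick : Bool → Bool → Bool → Bool → Bool → Bool
    pick true  false a b c = a ∨ b
    pick false true  a b c = a ∧ c
    pick _     _     a b c = a

    pick-elim : ∀ p q a b c → pick p q a b c ≡ true →
      (a ≡ true × (q ≡ true → p ≡ false → c ≡ true)) ⊎ (p ≡ true × q ≡ false × b ≡ true)
    pick-elim true  true  true  b c h = inj₁ (refl , λ _ ())
    pick-elim true  false true  b c h = inj₁ (refl , λ ())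
    pick-elim true  false false true c h = inj₂ (refl , refl , refl)
    pick-elim false true  true  b true h = inj₁ (refl , λ _ _ → refl)
    pick-elim false false true  b c h = inj₁ (refl , λ ())

    pick-intro₁ : ∀ p q a b c → a ≡ true → (q ≡ true → p ≡ false → c ≡ true) → pick p q a b c ≡ true
    pick-intro₁ true  true  true b c h g = refl
    pick-intro₁ true  false true b c h g = refl
    pick-intro₁ false true  true b c h g = g refl refl
    pick-intro₁ false false true b c h g = refl

    pick-intro₂ : ∀ p q a b c → p ≡ true → q ≡ false → b ≡ true → pick p q a b c ≡ true
    pick-intro₂ true false true  b c _ _ h = refl
    pick-intro₂ true false false b c _ _ h = h

  shift : Fin n → Fin n → Family n → Family n
  shift w i A S = pick (lookup S i) (lookup S w) (A S) (A (move i w S)) (A (move w i S))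

  module _ (w i : Fin n) (A : Family n) where

    shift-elim : ∀ {S} → S ∈ᶠ shift w i A →
      (S ∈ᶠ A × (S ∋ w → S ∌ i → move w i S ∈ᶠ A)) ⊎ (S ∋ i × S ∌ w × move i w S ∈ᶠ A)
    shift-elim = pick-elim _ _ _ _ _

    shift-stay : ∀ {S} → S ∈ᶠ A → (S ∋ w → S ∌ i → move w i S ∈ᶠ A) → S ∈ᶠ shift w i A
    shift-stay = pick-intro₁ _ _ _ _ _

    shift-back : ∀ {S} → S ∋ i → S ∌ w → move i w S ∈ᶠ A → S ∈ᶠ shift w i A
    shift-back {S} = pick-intro₂ _ _ (A S) _ (A (move w i S))

    shift-move : ∀ {S} → S ∈ᶠ A → S ∋ w → S ∌ i → move w i S ∈ᶠ shift w i A
    shift-move {S} S∈ S∋w S∌i = shift-back (move-∋ {S = S} S∋w S∌i) (move-∌ {S = S} S∋w S∌i)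
      (subst (_∈ᶠ A) (sym (move-move {S = S} S∋w S∌i)) S∈)

    shift-intersecting : (∀ S S′ → S ∈ᶠ A → S′ ∈ᶠ A → Meet S S′) →
      ∀ S S′ → S ∈ᶠ shift w i A → S′ ∈ᶠ shift w i A → Meet S S′
    shift-intersecting meet S S′ S∈ S′∈ = cases (shift-elim {S} S∈) (shift-elim {S′} S′∈)
      where
      Stayed Moved : Subset n → Set
      Stayed S = S ∈ᶠ A × (S ∋ w → S ∌ i → move w i S ∈ᶠ A)
      Moved S = S ∋ i × S ∌ w × move i w S ∈ᶠ A
      -- `S` meets the preimage of `S′`. If they meet only in `w`, which `S′` has lost, then either
      -- `S` contains `i`, as `S′` does, or its own image lies in `A` as well and meets that
      -- preimage in a vertex other than `w` and `i`.
      mixed : ∀ S S′ → Stayed S → Moved S′ → Meet S S′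
      mixed S S′ (p , g) (S′∋i , S′∌w , q) with meet S (move i w S′) p q
      ... | x , S∋x , M∋x with move-∋⁻ {S = S′} S′∋i S′∌w M∋x
      ... | inj₂ (_ , S′∋x) = x , S∋x , S′∋x
      ... | inj₁ refl with ∋? S i
      ... | inj₁ S∋i = i , S∋i , S′∋i
      ... | inj₂ S∌i with meet (move w i S) (move i w S′) (g S∋x S∌i) q
      ... | y , N∋y , M∋y with move-∋⁻ {S = S} S∋x S∌i N∋y | move-∋⁻ {S = S′} S′∋i S′∌w M∋y
      ... | inj₂ (_ , S∋y) | inj₂ (_ , S′∋y) = y , S∋y , S′∋y
      ... | inj₁ refl | inj₂ (y≢i , _) = contradiction refl y≢i
      ... | _ | inj₁ refl = ∋∌ N∋y (move-∌ {S = S} S∋x S∌i)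
      cases : Stayed S ⊎ Moved S → Stayed S′ ⊎ Moved S′ → Meet S S′
      cases (inj₁ (p , _)) (inj₁ (q , _)) = meet S S′ p q
      cases (inj₂ (p , _)) (inj₂ (q , _)) = i , p , q
      cases (inj₁ p) (inj₂ q) = mixed S S′ p q
      cases (inj₂ p) (inj₁ q) with mixed S′ S q p
      ... | x , a , b = x , b , a

    private
      -- Exactly the sets whose image is missing from `A` are moved, which makes the map injective
      -- on `A`.
      φ : Subset n → Subset n
      φ S = if lookup S w ∧ (not (lookup S i) ∧ not (A (move w i S))) then move w i S else S

      φ-spec : ∀ S → (φ S ≡ move w i S × S ∋ w × S ∌ i × A (move w i S) ≡ false) ⊎
                     (φ S ≡ S × (S ∋ w → S ∌ i → move w i S ∈ᶠ A))
      φ-spec S with lookup S w | lookup S i | A (move w i S)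
      ... | false | _     | _     = inj₂ (refl , λ ())
      ... | true  | true  | _     = inj₂ (refl , λ _ ())
      ... | true  | false | true  = inj₂ (refl , λ _ _ → refl)
      ... | true  | false | false = inj₁ (refl , refl , refl , refl)

      φ-into : ∀ S → S ∈ᶠ A → φ S ∈ᶠ shift w i A
      φ-into S S∈ with φ-spec S
      ... | inj₁ (eq , S∋w , S∌i , _) = subst (_∈ᶠ shift w i A) (sym eq) (shift-move {S} S∈ S∋w S∌i)
      ... | inj₂ (eq , g) = subst (_∈ᶠ shift w i A) (sym eq) (shift-stay {S} S∈ g)

      φ-injective : ∀ S S′ → S ∈ᶠ A → S′ ∈ᶠ A → φ S ≡ φ S′ → S ≡ S′
      φ-injective S S′ S∈ S′∈ eq with φ-spec S | φ-spec S′
      ... | inj₁ (e , S∋w , S∌i , _) | inj₁ (e′ , S′∋w , S′∌i , _) =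
        trans (sym (move-move {S = S} S∋w S∌i)) (trans (cong (move i w) (trans (sym e) (trans eq e′))) (move-move {S = S′} S′∋w S′∌i))
      ... | inj₂ (e , _) | inj₂ (e′ , _) = trans (sym e) (trans eq e′)
      ... | inj₁ (e , _ , _ , ne) | inj₂ (e′ , _) = ∋∌ (subst (_∈ᶠ A) (trans (sym e′) (trans (sym eq) e)) S′∈) ne
      ... | inj₂ (e , _) | inj₁ (e′ , _ , _ , ne) = ∋∌ (subst (_∈ᶠ A) (trans (sym e) (trans eq e′)) S∈) ne

    shift-count : countSubsets A ≤ countSubsets (shift w i A)
    shift-count = count-inject φ φ-into φ-injective

    module _ (f : Fin n → ℕ) (fw<fi : f w < f i) where
      private
        move-< : ∀ {S} → S ∋ w → S ∌ i → wt f S < wt f (move w i S)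
        move-< {S} S∋w S∌i = ℕ.+-cancelʳ-< (f w) _ _ (subst (wt f S + f w <_) (sym (move-wt {S = S} S∋w S∌i f)) (ℕ.+-monoʳ-< (wt f S) fw<fi))

        φ-≤ : ∀ S → wt f S ≤ wt f (φ S)
        φ-≤ S with φ-spec S
        ... | inj₁ (eq , S∋w , S∌i , _) = subst (λ T → wt f S ≤ wt f T) (sym eq) (ℕ.<⇒≤ (move-< {S} S∋w S∌i))
        ... | inj₂ (eq , _) = ℕ.≤-reflexive (cong (wt f) (sym eq))

        φ-< : ∀ S → S ∋ w → S ∌ i → A (move w i S) ≡ false → wt f S < wt f (φ S)
        φ-< S S∋w S∌i ne with φ-spec S
        ... | inj₁ (eq , _) = subst (λ T → wt f S < wt f T) (sym eq) (move-< {S} S∋w S∌i)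
        ... | inj₂ (_ , g) = ∋∌ (g S∋w S∌i) ne

      shift-potential : ∀ {S} → S ∈ᶠ A → S ∋ w → S ∌ i → A (move w i S) ≡ false →
        sum (map (wt f) (members A)) < sum (map (wt f) (members (shift w i A)))
      shift-potential {S} S∈ S∋w S∌i ne = ℕ.<-≤-trans
        (sum-mono-< (λ T _ → φ-≤ T) (∈-members⁺ {P = A} S∈) (φ-< S S∋w S∌i ne))
        (sum-inject (wt f) φ (members A) (members (shift w i A)) (members-unique A)
          (λ T T∈ → ∈-members⁺ {P = shift w i A} (φ-into T (∈-members⁻ {P = A} T∈)))
          (λ T T′ p q → φ-injective T T′ (∈-members⁻ {P = A} p) (∈-members⁻ {P = A} q)))

  Stable : (Fin n → Fin n → Set) → Family n → Set
  Stable Rel A = ∀ w i → Rel w i → ∀ S → S ∈ᶠ A → S ∋ w → S ∌ i → move w i S ∈ᶠ A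

  -- Shifting along Rel strictly increases the total weight of a family that is
  -- not yet stable, so it must stop; an invariant may be left on the way.
  shift-until-stable : ∀ {g ι} (f : Fin n → ℕ) (Rel : Fin n → Fin n → Set) →
    (∀ {w i} → Rel w i → f w < f i) → {G : Set g} {I : Family n → Set ι} →
    (∀ A → I A → Stable Rel A → ¬ ¬ G) →
    (∀ A w i → I A → Rel w i → (I (shift w i A) → ¬ ¬ G) → ¬ ¬ G) →
    ∀ A → I A → ¬ ¬ G
  shift-until-stable {n} f Rel Rel⇒< {G} {I} stable step A₀ = loop _ A₀ (ℕ.m≤n+m bound (Φ A₀))
    where
    Φ : Family n → ℕ
    Φ A = sum (map (wt f) (members A))
    bound = Φ (const true)
    Φ≤ : ∀ A → Φ A ≤ bound
    Φ≤ A = sum-inject (wt f) id (members A) (members (const true)) (members-unique A)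
      (λ S _ → ∈-members⁺ {P = const true} refl) λ _ _ _ _ eq → eq
    Unstable : Family n → Set
    Unstable A = ∃ λ w → ∃ λ i → ∃ λ S → Rel w i × S ∈ᶠ A × S ∋ w × S ∌ i × A (move w i S) ≡ false
    decided : ∀ A → ¬ Unstable A → Stable Rel A
    decided A no-bad w i rel S S∈ S∋w S∌i with A (move w i S) in eq
    ... | true  = refl
    ... | false = contradiction (w , i , S , rel , S∈ , S∋w , S∌i , eq) no-bad
    -- `k` bounds the weight that can still be gained, since no family weighs more than `bound`, the
    -- weight of all subsets together. Every effective shift uses up at least one unit.
    loop : ∀ k A → bound ≤ Φ A + k → I A → ¬ ¬ G
    next : ∀ k A w i → I A → Rel w i → bound ≤ Φ A + k → Φ A < Φ (shift w i A) → ¬ ¬ G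
    loop k A h IA = ¬¬-excluded-middle {A = Unstable A} >>= λ where
      (no ¬u) → stable A IA (decided A ¬u)
      (yes (w , i , S , rel , S∈ , S∋w , S∌i , ne)) → next k A w i IA rel h
        (shift-potential w i A f (Rel⇒< rel) {S} S∈ S∋w S∌i ne)
    next zero A w i IA rel h lt = contradiction
      (ℕ.<-≤-trans lt (ℕ.≤-trans (Φ≤ (shift w i A)) (ℕ.≤-trans h (ℕ.≤-reflexive (ℕ.+-identityʳ _))))) (ℕ.<-irrefl refl)
    next (suc k) A w i IA rel h lt = step A w i IA rel (loop k (shift w i A)
      (ℕ.≤-trans h (ℕ.≤-trans (ℕ.≤-reflexive (ℕ.+-suc (Φ A) k)) (ℕ.+-monoˡ-≤ k lt))))

-- Intersecting families that are stable under shifts to later vertices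

module ShiftedFamilies where
  open import Defs
  open import Data.Bool using (Bool; true; false; not; _∧_; _∨_; if_then_else_; T)
  open import Data.Bool.Properties using (T-≡; not-involutive; ∨-zeroʳ)
  open import Data.Nat as ℕ using (ℕ; zero; suc; _+_; _∸_; _≤_; _<_; z≤n; s≤s; _≡ᵇ_; _≤ᵇ_)
  import Data.Nat.Properties as ℕ
  open import Algebra.Properties.CommutativeSemigroup ℕ.+-commutativeSemigroup using () renaming (interchange to +-interchange)
  open import Data.Fin using (Fin; zero; suc; toℕ)
  import Data.Fin.Properties as Fin
  open import Data.Fin.Subset using (Subset; ∣_∣; ∁; ⊤)
  open import Data.Fin.Subset.Properties using (∣∁p∣≡n∸∣p∣; ∣p∣≤n; ∣⊤∣≡n)
  open import Data.List using ([]; _∷_)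
  open import Data.List.Membership.Propositional using (_∈_)
  open import Data.List.Relation.Unary.Any using (here)
  open import Data.Product using (∃; _×_; _,_; proj₁; proj₂)
  open import Data.Sum as Sum using (_⊎_; inj₁; inj₂)
  open import Data.Empty using (⊥; ⊥-elim)
  open import Data.Unit using (tt) renaming (⊤ to Unit)
  open import Data.Vec using ([]; _∷_; lookup; _[_]≔_)
  open import Data.Vec.Properties using (lookup-map; lookup-replicate)
  open import Function using (_∘_; id)
  open import Function.Bundles using (Equivalence)
  open import Relation.Nullary using (¬_; Dec; yes; no)
  open import Relation.Nullary.Negation using (contradiction)
  open import Relation.Binary.PropositionalEquality using (_≡_; _≢_; refl; sym; trans; cong; cong₂; subst; subst₂; module ≡-Reasoning)
  open Subsets
  open Shifting

  private variable
    n : ℕ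

  ≡ᵇ-intro : ∀ {a b} → a ≡ b → (a ≡ᵇ b) ≡ true
  ≡ᵇ-intro {a} {b} eq = Equivalence.to T-≡ (ℕ.≡⇒≡ᵇ a b eq)

  ≡ᵇ-elim : ∀ {a b} → (a ≡ᵇ b) ≡ true → a ≡ b
  ≡ᵇ-elim {a} {b} h = ℕ.≡ᵇ⇒≡ a b (Equivalence.from T-≡ h)

  ≤ᵇ-intro : ∀ {a b} → a ≤ b → (a ≤ᵇ b) ≡ true
  ≤ᵇ-intro h = Equivalence.to T-≡ (ℕ.≤⇒≤ᵇ h)

  ≤ᵇ-elim : ∀ {a b} → (a ≤ᵇ b) ≡ true → a ≤ b
  ≤ᵇ-elim {a} {b} h = ℕ.≤ᵇ⇒≤ a b (Equivalence.from T-≡ h)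

  ∧-intro : ∀ a {b} → a ≡ true → b ≡ true → a ∧ b ≡ true
  ∧-intro a refl refl = refl

  ∧-elim : ∀ a {b} → a ∧ b ≡ true → a ≡ true × b ≡ true
  ∧-elim true h = refl , h

  ∧-map : ∀ a {b b′} → (b ≡ true → b′ ≡ true) → a ∧ b ≡ true → a ∧ b′ ≡ true
  ∧-map true h = h

  Uniform : ℕ → Family n → Set
  Uniform k X = ∀ S → S ∈ᶠ X → ∣ S ∣ ≡ k

  Inter : Family n → Set
  Inter X = ∀ S S′ → S ∈ᶠ X → S′ ∈ᶠ X → Meet S S′

  Upward : Fin n → Fin n → Set
  Upward w i = toℕ w < toℕ i

  -- Stability under all shifts to a later vertex, unfolded along the first vertex.
  StableR : Family n → Set
  StableR {zero}  X = Unit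
  StableR {suc n} X = StableR (X ∘ (false ∷_)) × StableR (X ∘ (true ∷_)) ×
    (∀ S j → S ∌ j → (true ∷ S) ∈ᶠ X → (false ∷ (S [ j ]≔ true)) ∈ᶠ X)

  Stable⇒StableR : (X : Family n) → Stable Upward X → StableR X
  Stable⇒StableR {zero}  X st = tt
  Stable⇒StableR {suc n} X st =
      Stable⇒StableR _ (λ w i w<i S → st (suc w) (suc i) (s≤s w<i) (false ∷ S))
    , Stable⇒StableR _ (λ w i w<i S → st (suc w) (suc i) (s≤s w<i) (true ∷ S))
    , λ S j S∌j h → st zero (suc j) (s≤s z≤n) (true ∷ S) h refl S∌j

  ∃∌² : ∀ (S S′ : Subset n) → ∣ S ∣ + ∣ S′ ∣ < n → ∃ λ j → S ∌ j × S′ ∌ j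
  ∃∌² (false ∷ S) (false ∷ S′) h = zero , refl , refl
  ∃∌² (true ∷ S) (t ∷ S′) (s≤s h) with ∃∌² S S′ (ℕ.≤-<-trans (ℕ.+-monoʳ-≤ ∣ S ∣ (tail≤ t S′)) h)
    where
    tail≤ : ∀ t (S′ : Subset n) → ∣ S′ ∣ ≤ ∣ t ∷ S′ ∣
    tail≤ true S′ = ℕ.n≤1+n _
    tail≤ false S′ = ℕ.≤-refl
  ... | j , p , q = suc j , p , q
  ∃∌² {suc n} (false ∷ S) (true ∷ S′) h with ∃∌² S S′ (ℕ.≤-pred (subst (_< suc n) (ℕ.+-suc ∣ S ∣ ∣ S′ ∣) h))
  ... | j , p , q = suc j , p , q

  inter₀ : (X : Family (suc n)) → Inter X → Inter (X ∘ (false ∷_))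
  inter₀ X meet S S′ p q with meet (false ∷ S) (false ∷ S′) p q
  ... | suc x , a , b = x , a , b

  -- If S and S′ only met in the first vertex, that vertex could be replaced in S
  -- by one outside both.
  inter₁ : ∀ {k} (X : Family (suc n)) → StableR X → Inter X → Uniform (suc k) X → k + k < n →
    Inter (X ∘ (true ∷_))
  inter₁ {k = k} X (_ , _ , st) meet uni k+k<n S S′ p q
    with ∃∌² S S′ (subst₂ (λ a b → a + b < _) (sym (ℕ.suc-injective (uni _ p))) (sym (ℕ.suc-injective (uni _ q))) k+k<n)
  ... | j , S∌j , S′∌j with meet (false ∷ (S [ j ]≔ true)) (true ∷ S′) (st S j S∌j p) q
  ... | suc x , a , b with update-∋⁻ S j a
  ... | inj₁ refl = ∋∌ b S′∌j
  ... | inj₂ S∋x = x , S∋x , b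

  uniform₁ : ∀ {k} (X : Family (suc n)) → Uniform (suc k) X → Uniform k (X ∘ (true ∷_))
  uniform₁ X uni S p = ℕ.suc-injective (uni (true ∷ S) p)

  inter-uniform-0 : (X : Family n) → Inter X → Uniform 0 X → ∀ S → S ∈ᶠ X → ⊥
  inter-uniform-0 X meet uni S p with meet S S p p
  ... | x , S∋x , _ = ∋∌ S∋x (0-card S (uni S p) x)

  lastᵇ : Subset n → Bool
  lastᵇ []          = false
  lastᵇ (s ∷ [])    = s
  lastᵇ (_ ∷ t ∷ S) = lastᵇ (t ∷ S)

  lastᵇ-∷ : ∀ s (S : Subset n) → 0 < n → lastᵇ (s ∷ S) ≡ lastᵇ S
  lastᵇ-∷ s (t ∷ S) _ = refl

  lastᵇ-∁ : ∀ (S : Subset n) → 0 < n → lastᵇ (∁ S) ≡ not (lastᵇ S)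
  lastᵇ-∁ (s ∷ []) _ = refl
  lastᵇ-∁ (_ ∷ t ∷ S) _ = lastᵇ-∁ (t ∷ S) (s≤s z≤n)

  -- The full star of the last vertex, the strongest one under upward shifts and hence the natural
  -- extremal family.
  lastStar : ∀ n → ℕ → Family n
  lastStar n k S = (∣ S ∣ ≡ᵇ k) ∧ lastᵇ S

  count-peel : ∀ {a b} (X Y : Family (suc n)) → countSubsets (X ∘ (true ∷_)) ≤ a + countSubsets (Y ∘ (true ∷_)) →
    countSubsets (X ∘ (false ∷_)) ≤ b + countSubsets (Y ∘ (false ∷_)) → countSubsets X ≤ (a + b) + countSubsets Y
  count-peel {a = a} {b} X Y p q = begin
    countSubsets X                  ≡⟨ count-suc X ⟩
    x₁ + x₀                         ≤⟨ ℕ.+-mono-≤ p q ⟩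
    (a + y₁) + (b + y₀)             ≡⟨ +-interchange a y₁ b y₀ ⟩
    (a + b) + (y₁ + y₀)             ≡⟨ cong (a + b +_) (sym (count-suc Y)) ⟩
    (a + b) + countSubsets Y        ∎
    where
    open ℕ.≤-Reasoning
    x₁ = countSubsets (X ∘ (true ∷_))
    x₀ = countSubsets (X ∘ (false ∷_))
    y₁ = countSubsets (Y ∘ (true ∷_))
    y₀ = countSubsets (Y ∘ (false ∷_))

  -- For n = 2k a set and its complement are not both members.
  ekr-half : ∀ n k (X : Family n) → 0 < n → k + k ≡ n → Uniform k X → Inter X →
    countSubsets X ≤ countSubsets (lastStar n k)
  ekr-half n k X 0<n eq uni meet = count-inject φ into inj
    where
    φ : Subset n → Subset n
    φ S = if lastᵇ S then S else ∁ S
    φ-spec : ∀ S → (φ S ≡ S × lastᵇ S ≡ true) ⊎ (φ S ≡ ∁ S × lastᵇ S ≡ false)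
    φ-spec S with lastᵇ S
    ... | true  = inj₁ (refl , refl)
    ... | false = inj₂ (refl , refl)
    into : ∀ S → S ∈ᶠ X → φ S ∈ᶠ lastStar n k
    into S p with φ-spec S
    ... | inj₁ (e , l) = subst (_∈ᶠ lastStar n k) (sym e) (∧-intro (∣ S ∣ ≡ᵇ k) (≡ᵇ-intro (uni S p)) l)
    ... | inj₂ (e , l) = subst (_∈ᶠ lastStar n k) (sym e) (∧-intro (∣ ∁ S ∣ ≡ᵇ k) (≡ᵇ-intro size) (trans (lastᵇ-∁ S 0<n) (cong not l)))
      where
      size : ∣ ∁ S ∣ ≡ k
      size = trans (∣∁p∣≡n∸∣p∣ S) (trans (cong₂ _∸_ (sym eq) (uni S p)) (ℕ.m+n∸n≡m k k))
    lookup-∁ : ∀ (S : Subset n) x → lookup (∁ S) x ≡ not (lookup S x)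
    lookup-∁ S x = lookup-map x not S
    apart : ∀ S S′ → S ∈ᶠ X → S′ ∈ᶠ X → S ≡ ∁ S′ → ⊥
    apart S S′ p q refl with meet S S′ p q
    ... | x , a , b = ∋∌ a (trans (lookup-∁ S′ x) (cong not b))
    ∁-inj : ∀ S S′ → ∁ S ≡ ∁ S′ → S ≡ S′
    ∁-inj S S′ h = subset-ext λ x → trans (sym (not-involutive _)) (trans (cong not
      (trans (sym (lookup-∁ S x)) (trans (cong (λ R → lookup R x) h) (lookup-∁ S′ x)))) (not-involutive _))
    inj : ∀ S S′ → S ∈ᶠ X → S′ ∈ᶠ X → φ S ≡ φ S′ → S ≡ S′
    inj S S′ p q h with φ-spec S | φ-spec S′
    ... | inj₁ (a , _) | inj₁ (b , _) = trans (sym a) (trans h b)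
    ... | inj₁ (a , _) | inj₂ (b , _) = ⊥-elim (apart S S′ p q (trans (sym a) (trans h b)))
    ... | inj₂ (a , _) | inj₁ (b , _) = ⊥-elim (apart S′ S q p (trans (sym b) (trans (sym h) a)))
    ... | inj₂ (a , _) | inj₂ (b , _) = ∁-inj S S′ (trans (sym a) (trans h b))

  -- The Erdős-Ko-Rado bound, by splitting at the first vertex, the weakest one. The sets through it
  -- remain intersecting after its deletion as long as there is a spare vertex to replace it; this
  -- fails only for 2k = n, where complements are paired.
  ekr : ∀ n k (X : Family n) → k + k ≤ n → Uniform k X → StableR X → Inter X →
    countSubsets X ≤ countSubsets (lastStar n k)
  ekr n zero X h uni st meet = subst (_≤ _) (sym (count-zero X (inter-uniform-0 X meet uni))) z≤n
  ekr (suc n) (suc k) X h uni st@(st₀ , st₁ , _) meet with ℕ.m≤n⇒m<n∨m≡n h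
  ... | inj₂ eq = ekr-half (suc n) (suc k) X (s≤s z≤n) eq uni meet
  ... | inj₁ (s≤s lt) = count-peel {a = 0} {0} X (lastStar (suc n) (suc k))
    (ℕ.≤-trans (ekr n k (X ∘ (true ∷_)) (ℕ.<⇒≤ k+k<n) (uniform₁ X uni) st₁ (inter₁ X st meet uni k+k<n)) (count-mono (λ S → ∧-map (∣ S ∣ ≡ᵇ k) (trans (lastᵇ-∷ true S 0<n)))))
    (ℕ.≤-trans (ekr n (suc k) (X ∘ (false ∷_)) lt (λ S → uni (false ∷ S)) st₀ (inter₀ X meet)) (count-mono (λ S → ∧-map (∣ S ∣ ≡ᵇ suc k) (trans (lastᵇ-∷ false S 0<n)))))
    where
    0<n : 0 < n
    0<n = ℕ.≤-trans (s≤s z≤n) lt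
    k+k<n : k + k < n
    k+k<n = ℕ.≤-trans (s≤s (ℕ.+-monoʳ-≤ k (ℕ.n≤1+n k))) lt

  module _ {r : ℕ} where

    -- The last suc r vertices play the role of v₁, …, vᵣ₊₁, with v₁ at the end.
    vcard : ∀ e → Subset (e + suc r) → ℕ
    vcard zero    S       = ∣ S ∣
    vcard (suc e) (_ ∷ S) = vcard e S

    ∣∣≤vcard : ∀ e (S : Subset (e + suc r)) → ∣ S ∣ ≤ e + vcard e S
    ∣∣≤vcard zero S = ℕ.≤-refl
    ∣∣≤vcard (suc e) (true ∷ S) = s≤s (∣∣≤vcard e S)
    ∣∣≤vcard (suc e) (false ∷ S) = ℕ.m≤n⇒m≤1+n (∣∣≤vcard e S)

    -- The sets through v₁ and a further vertex of V; the 2 includes v₁ itself.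
    target : ∀ e → Family (e + suc r)
    target e S = lastᵇ S ∧ (2 ≤ᵇ vcard e S)

    0<e+ : ∀ e → 0 < e + suc r
    0<e+ e = ℕ.≤-trans (s≤s z≤n) (ℕ.m≤n+m (suc r) e)

    target-∷ : ∀ e s S → S ∈ᶠ target e → (s ∷ S) ∈ᶠ target (suc e)
    target-∷ e s S p = let (l , c) = ∧-elim (lastᵇ S) p in ∧-intro (lastᵇ (s ∷ S)) (trans (lastᵇ-∷ s S (0<e+ e)) l) c

    -- Only `e` vertices lie outside V, so at least two of the `e + 2` elements lie in V.
    large⇒target : ∀ e S → ∣ S ∣ ≡ suc (suc e) → lastᵇ S ≡ true → S ∈ᶠ target e
    large⇒target e S eq l = ∧-intro (lastᵇ S) l (≤ᵇ-intro (ℕ.+-cancelˡ-≤ e _ _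
      (subst (_≤ e + vcard e S) (trans eq (ℕ.+-comm 2 e)) (∣∣≤vcard e S))))

    large-target₀ : ∀ e S → S ∈ᶠ lastStar (e + suc r) (suc (suc e)) →
      ((∣ S ∣ ≡ᵇ suc (suc e)) ∧ target (suc e) (false ∷ S)) ≡ true
    large-target₀ e S p = let (c , l) = ∧-elim (∣ S ∣ ≡ᵇ suc (suc e)) p in
      ∧-intro (∣ S ∣ ≡ᵇ suc (suc e)) c (target-∷ e false S (large⇒target e S (≡ᵇ-elim {∣ S ∣} c) l))

    -- The full simplex on r + k vertices, where k = suc e.
    simplex-bound : ∀ e (X : Family (e + suc r)) → suc e < r → Uniform (suc e) X → StableR X → Inter X →
      (∀ S → S ∈ᶠ X → 2 ≤ vcard e S) →
      countSubsets X ≤ countSubsets (λ S → (∣ S ∣ ≡ᵇ suc e) ∧ target e S)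
    simplex-bound zero X lt uni st meet h2 =
      subst (_≤ _) (sym (count-zero X λ S p → contradiction (subst (2 ≤_) (uni S p) (h2 S p)) λ { (s≤s ()) })) z≤n
    simplex-bound (suc e) X lt uni st@(st₀ , st₁ , _) meet h2 = count-peel {a = 0} {0} X _
      (ℕ.≤-trans (simplex-bound e (X ∘ (true ∷_)) (ℕ.<-trans (ℕ.n<1+n _) lt) (uniform₁ X uni) st₁
          (inter₁ X st meet uni small) (λ S → h2 (true ∷ S)))
        (count-mono λ S → ∧-map (∣ S ∣ ≡ᵇ suc e) (target-∷ e true S)))
      -- Without the first vertex only `e` vertices outside V remain for sets of `e + 2` elements.
      -- The whole star of the last vertex is then contained in the target, and Erdős-Ko-Rado
      -- suffices.
      (ℕ.≤-trans (ekr (e + suc r) (suc (suc e)) (X ∘ (false ∷_)) fits (λ S → uni (false ∷ S)) st₀ (inter₀ X meet))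
        (count-mono (large-target₀ e)))
      where
      fits : suc (suc e) + suc (suc e) ≤ e + suc r
      fits = subst (_≤ e + suc r) (trans (ℕ.+-suc e _) (cong suc (trans (ℕ.+-suc e _) refl)))
        (ℕ.+-monoʳ-≤ e (s≤s lt))
      small : suc e + suc e < e + suc r
      small = ℕ.≤-trans (ℕ.≤-trans (ℕ.n≤1+n _) (ℕ.≤-reflexive (cong suc (cong suc (sym (ℕ.+-suc e (suc e))))))) fits

    lastStar-1 : ∀ m → countSubsets (lastStar m 1) ≤ 1
    lastStar-1 zero = z≤n
    lastStar-1 (suc zero) = s≤s z≤n
    lastStar-1 (suc (suc m)) = subst (_≤ 1) (sym (count-suc (lastStar (suc (suc m)) 1)))
      (subst (λ a → a + countSubsets (lastStar (suc (suc m)) 1 ∘ (false ∷_)) ≤ 1) (sym (count-zero _ none))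
        (ℕ.≤-trans (count-mono {n = suc m} (λ S → ∧-map (∣ S ∣ ≡ᵇ 1) (trans (sym (lastᵇ-∷ false S (s≤s z≤n)))))) (lastStar-1 (suc m))))
      where
      empty : ∀ {m} (S : Subset m) → ∣ S ∣ ≡ 0 → lastᵇ S ≡ true → ⊥
      empty (true ∷ []) () _
      empty (false ∷ t ∷ S) c l = empty (t ∷ S) c l
      none : ∀ (S : Subset (suc m)) → (true ∷ S) ∈ᶠ lastStar (suc (suc m)) 1 → ⊥
      none S p = let (c , l) = ∧-elim (∣ S ∣ ≡ᵇ 0) p in
        empty S (≡ᵇ-elim {∣ S ∣} c) (trans (sym (lastᵇ-∷ true S (s≤s z≤n))) l)

    -- A set of `suc e` elements that meets V only in v₁ must consist of v₁ and all `e` vertices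
    -- outside V. This single exception is the origin of the `+ 1` in the theorem.
    star≤target : ∀ e → countSubsets (lastStar (e + suc r) (suc e)) ≤
      1 + countSubsets (λ S → (∣ S ∣ ≡ᵇ suc e) ∧ target e S)
    star≤target zero = ℕ.≤-trans (lastStar-1 (suc r)) (ℕ.m≤m+n 1 _)
    star≤target (suc e) = count-peel {a = 1} {0} (lastStar (suc e + suc r) (suc (suc e))) _
      (ℕ.≤-trans (count-mono (λ S → ∧-map (∣ S ∣ ≡ᵇ suc e) (trans (sym (lastᵇ-∷ true S (0<e+ e))))))
        (ℕ.≤-trans (star≤target e) (s≤s (count-mono λ S → ∧-map (∣ S ∣ ≡ᵇ suc e) (target-∷ e true S)))))
      (count-mono λ S → large-target₀ e S ∘ ∧-map (∣ S ∣ ≡ᵇ suc (suc e)) (trans (sym (lastᵇ-∷ false S (0<e+ e)))))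

  -- Any face may be enlarged by the j last vertices, as long as the result has
  -- at most M elements; with j = 0 this contains closure under subsets.
  Star : ℕ → Family n → Set
  Star {n} M D = ∀ j S S′ → j ≤ n → S ∈ᶠ D → (∀ x → S′ ∋ x → S ∋ x ⊎ n ≤ toℕ x + j) →
    (∀ x → n ≤ toℕ x + j → S′ ∋ x) → ∣ S′ ∣ ≤ M → S′ ∈ᶠ D

  Star-subset : ∀ {M} (D : Family n) → Star M D → ∀ S S′ → S ∈ᶠ D → S′ ⊑ S → ∣ S′ ∣ ≤ M → S′ ∈ᶠ D
  Star-subset D star S S′ p sub = star 0 S S′ z≤n p (λ x q → inj₁ (sub x q))
    (λ x h → contradiction (ℕ.≤-trans h (ℕ.≤-reflexive (ℕ.+-identityʳ _))) (ℕ.<⇒≱ (Fin.toℕ<n x)))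

  -- Enlarging any member by all `n` vertices gives the full vertex set, and every set lies below
  -- it.
  Star-full : ∀ {M} (D : Family n) → Star M D → n ≤ M → ∀ S → S ∈ᶠ D → ∀ S′ → S′ ∈ᶠ D
  Star-full {n} D star n≤M S p S′ = Star-subset D star ⊤ S′
    (star n S ⊤ ℕ.≤-refl p (λ x _ → inj₂ (ℕ.m≤n+m n (toℕ x))) (λ x _ → all x) (subst (_≤ _) (sym (∣⊤∣≡n n)) n≤M))
    (λ x _ → all x) (ℕ.≤-trans (∣p∣≤n S′) n≤M)
    where
    all : ∀ {n} (x : Fin n) → ⊤ ∋ x
    all x = lookup-replicate x true

  Star₀ : ∀ {M} (D : Family (suc n)) → Star M D → Star M (D ∘ (false ∷_))
  Star₀ D star j S S′ j≤n p q t c = star j (false ∷ S) (false ∷ S′) (ℕ.m≤n⇒m≤1+n j≤n) p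
    (λ { (suc x) h → Sum.map₂ s≤s (q x h) }) (λ { zero h → contradiction h (ℕ.<⇒≱ (s≤s j≤n)) ; (suc x) h → t x (ℕ.≤-pred h) }) c

  Star₁ : ∀ {M} (D : Family (suc n)) → Star (suc M) D → Star M (D ∘ (true ∷_))
  Star₁ D star j S S′ j≤n p q t c = star j (true ∷ S) (true ∷ S′) (ℕ.m≤n⇒m≤1+n j≤n) p
    (λ { zero h → inj₁ refl ; (suc x) h → Sum.map₂ s≤s (q x h) }) (λ { zero h → refl ; (suc x) h → t x (ℕ.≤-pred h) }) (s≤s c)

  empty-or-member : (X : Family n) → countSubsets X ≡ 0 ⊎ ∃ (_∈ᶠ X)
  empty-or-member X with members X in eq
  ... | []    = inj₁ refl
  ... | S ∷ _ = inj₂ (S , ∈-members⁻ {P = X} (subst (S ∈_) (sym eq) (here refl)))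

  module _ {r : ℕ} where

    targetFaces : ∀ e → ℕ → Family (e + suc r) → Family (e + suc r)
    targetFaces e k Γ S = Γ S ∧ ((∣ S ∣ ≡ᵇ k) ∧ target e S)

    targetFaces-∷₁ : ∀ e k Γ S → S ∈ᶠ targetFaces e k (Γ ∘ (true ∷_)) → (true ∷ S) ∈ᶠ targetFaces (suc e) (suc k) Γ
    targetFaces-∷₁ e k Γ S = ∧-map (Γ (true ∷ S)) (∧-map (∣ S ∣ ≡ᵇ k) (target-∷ e true S))

    targetFaces-∷₀ : ∀ e k Γ S → S ∈ᶠ targetFaces e k (Γ ∘ (false ∷_)) → (false ∷ S) ∈ᶠ targetFaces (suc e) k Γ
    targetFaces-∷₀ e k Γ S = ∧-map (Γ (false ∷ S)) (∧-map (∣ S ∣ ≡ᵇ k) (target-∷ e false S))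

    record Shifted-in (e k M : ℕ) (X Γ : Family (e + suc r)) : Set where
      field
        star     : Star M Γ
        sub      : ∀ S → S ∈ᶠ X → S ∈ᶠ Γ
        uni      : Uniform k X
        stable   : StableR X
        meet     : Inter X
        h2       : ∀ S → S ∈ᶠ X → 2 ≤ vcard e S

    peel₀ : ∀ {e k M} {X Γ : Family (suc e + suc r)} → Shifted-in (suc e) k M X Γ →
      Shifted-in e k M (X ∘ (false ∷_)) (Γ ∘ (false ∷_))
    peel₀ {X = X} {Γ} H = record
      { star = Star₀ Γ star ; sub = λ S → sub (false ∷ S) ; uni = λ S → uni (false ∷ S)
      ; stable = proj₁ stable ; meet = inter₀ X meet ; h2 = λ S → h2 (false ∷ S) }
      where open Shifted-in H

    peel₁ : ∀ {e k M} {X Γ : Family (suc e + suc r)} → k + k < e + suc r → Shifted-in (suc e) (suc k) (suc M) X Γ →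
      Shifted-in e k M (X ∘ (true ∷_)) (Γ ∘ (true ∷_))
    peel₁ {X = X} {Γ} lt H = record
      { star = Star₁ Γ star ; sub = λ S → sub (true ∷ S) ; uni = uniform₁ X uni
      ; stable = proj₁ (proj₂ stable) ; meet = inter₁ X stable meet uni lt ; h2 = λ S → h2 (true ∷ S) }
      where open Shifted-in H

    -- Splitting at the first vertex lowers `e`, and on the sets containing it lowers `k` and the
    -- size limit `r + k` together. When `k` reaches `suc e`, the limit `r + k` equals the number of
    -- vertices, so `Star-full` makes `Γ` a full simplex and `simplex-bound` applies, with no
    -- exception because `k < r`.
    bound-< : ∀ e k (X Γ : Family (e + suc r)) → k < r → k ≤ suc e → Shifted-in e k (r + k) X Γ →
      countSubsets X ≤ countSubsets (targetFaces e k Γ)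
    bound-< e zero X Γ k<r k≤e H = subst (_≤ _) (sym (count-zero X (inter-uniform-0 X meet uni))) z≤n
      where open Shifted-in H
    bound-< e (suc k) X Γ k<r k≤e H with ℕ.m≤n⇒m<n∨m≡n k≤e
    bound-< e (suc .e) X Γ k<r k≤e H | inj₂ refl with empty-or-member X
    ... | inj₁ none = subst (_≤ _) (sym none) z≤n
    ... | inj₂ (S₀ , S₀∈) = ℕ.≤-trans (simplex-bound e X k<r uni stable meet h2)
      (count-mono λ S p → ∧-intro (Γ S) (Star-full Γ star (ℕ.≤-reflexive (trans (ℕ.+-suc e r) (trans (cong suc (ℕ.+-comm e r)) (sym (ℕ.+-suc r e))))) S₀ (sub S₀ S₀∈) S) p)
      where open Shifted-in H
    bound-< zero (suc k) X Γ k<r k≤e H | inj₁ (s≤s ())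
    bound-< (suc e) (suc k) X Γ k<r k≤e H | inj₁ (s≤s k≤e′) = count-peel {a = 0} {0} X (targetFaces (suc e) (suc k) Γ)
      (ℕ.≤-trans (bound-< e k _ _ (ℕ.<-trans (ℕ.n<1+n k) k<r) (ℕ.≤-trans (ℕ.n≤1+n k) k≤e′)
          (peel₁ (ℕ.+-mono-≤-< (ℕ.≤-pred k≤e′) (ℕ.<-trans (ℕ.<-trans (ℕ.n<1+n k) k<r) (ℕ.n<1+n r)))
            (subst (λ M → Shifted-in (suc e) (suc k) M X Γ) (ℕ.+-suc r k) H)))
        (count-mono (targetFaces-∷₁ e k Γ)))
      (ℕ.≤-trans (bound-< e (suc k) _ _ k<r k≤e′ (peel₀ H)) (count-mono (targetFaces-∷₀ e (suc k) Γ)))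

  -- Among the sets through the first vertex the size drops below the critical one and `bound-<` is
  -- exact. Only the sets avoiding it keep the critical size, so the exceptional 1 is met a single
  -- time, in the full simplex where the recursion ends.
  bound-≡ : ∀ {r} e (X Γ : Family (e + suc (suc r))) → suc r ≤ suc e → Shifted-in e (suc r) (suc r + suc r) X Γ →
    countSubsets X ≤ 1 + countSubsets (targetFaces e (suc r) Γ)
  bound-≡ e X Γ r≤e H with ℕ.m≤n⇒m<n∨m≡n r≤e
  bound-≡ e X Γ r≤e H | inj₂ refl with empty-or-member X
  ... | inj₁ none = subst (_≤ _) (sym none) z≤n
  ... | inj₂ (S₀ , S₀∈) = ℕ.≤-trans (ekr (e + suc (suc e)) (suc e) X (ℕ.≤-reflexive (sym (ℕ.+-suc e (suc e)))) uni stable meet)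
    (ℕ.≤-trans (star≤target e) (s≤s (count-mono λ S p →
      ∧-intro (Γ S) (Star-full Γ star (ℕ.≤-reflexive (ℕ.+-suc e (suc e))) S₀ (sub S₀ S₀∈) S) p)))
    where open Shifted-in H
  bound-≡ zero X Γ r≤e H | inj₁ (s≤s ())
  bound-≡ {r} (suc e) X Γ r≤e H | inj₁ (s≤s r≤e′) = count-peel {a = 0} {1} X (targetFaces (suc e) (suc r) Γ)
    (ℕ.≤-trans (bound-< e r _ _ (ℕ.n<1+n r) (ℕ.≤-trans (ℕ.n≤1+n r) r≤e′)
        (peel₁ (ℕ.+-mono-≤-< (ℕ.≤-pred r≤e′) (ℕ.m≤n⇒m≤1+n (ℕ.n<1+n r)))
          (subst (λ M → Shifted-in (suc e) (suc r) M X Γ) (ℕ.+-suc (suc r) r) H)))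
      (count-mono (targetFaces-∷₁ e r Γ)))
    (ℕ.≤-trans (bound-≡ e _ _ r≤e′ (peel₀ H)) (s≤s (count-mono (targetFaces-∷₀ e (suc r) Γ))))

  module _ (w i : Fin n) (w<i : toℕ w < toℕ i) where

    -- As `w` precedes `i`, the last `j` vertices include `i` whenever they include `w`, so they are
    -- never lost by the shift. If `S` arose by moving `w` to `i` and `i` is among them, or is
    -- absent from `S′`, then `S′` is already an enlargement from the unmoved set; otherwise the
    -- enlargement is moved as well.
    shift-Star : ∀ {M} (D : Family n) → Star M D → Star M (shift w i D)
    shift-Star {M} D star j S S′ j≤n S∈ sub top size with shift-elim w i D {S} S∈
    ... | inj₁ (p , g) = shift-stay w i D {S′} (star j S S′ j≤n p sub top size) stay
      where
      stay : S′ ∋ w → S′ ∌ i → move w i S′ ∈ᶠ D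
      stay S′∋w S′∌i = helper (∋? S i)
        where
        ¬top-i : ¬ (n ≤ toℕ i + j)
        ¬top-i t = ∋∌ (top i t) S′∌i
        ¬top-w : ¬ (n ≤ toℕ w + j)
        ¬top-w t = ¬top-i (ℕ.≤-trans t (ℕ.+-monoˡ-≤ j (ℕ.<⇒≤ w<i)))
        S∋w : S ∋ w
        S∋w with sub w S′∋w
        ... | inj₁ h = h
        ... | inj₂ t = contradiction t ¬top-w
        top′ : ∀ x → n ≤ toℕ x + j → move w i S′ ∋ x
        top′ x t = move-∋⁺ {S = S′} S′∋w S′∌i (λ { refl → ¬top-w t }) (top x t)
        size′ : ∣ move w i S′ ∣ ≤ M
        size′ = subst (_≤ M) (sym (move-card {S = S′} S′∋w S′∌i)) size
        helper : S ∋ i ⊎ S ∌ i → move w i S′ ∈ᶠ D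
        helper (inj₁ S∋i) = star j S _ j≤n p sub′ top′ size′
          where
          sub′ : ∀ x → move w i S′ ∋ x → S ∋ x ⊎ n ≤ toℕ x + j
          sub′ x h with move-∋⁻ {S = S′} S′∋w S′∌i h
          ... | inj₁ refl = inj₁ S∋i
          ... | inj₂ (_ , S′∋x) = sub x S′∋x
        helper (inj₂ S∌i) = star j (move w i S) _ j≤n (g S∋w S∌i) sub′ top′ size′
          where
          sub′ : ∀ x → move w i S′ ∋ x → move w i S ∋ x ⊎ n ≤ toℕ x + j
          sub′ x h with move-∋⁻ {S = S′} S′∋w S′∌i h
          ... | inj₁ refl = inj₁ (move-∋ {S = S} S∋w S∌i)
          ... | inj₂ (x≢w , S′∋x) with sub x S′∋x
          ... | inj₁ S∋x = inj₁ (move-∋⁺ {S = S} S∋w S∌i x≢w S∋x)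
          ... | inj₂ t = inj₂ t
    ... | inj₂ (S∋i , S∌w , p) = helper (n ℕ.≤? toℕ i + j) (∋? S′ i)
      where
      S₀ = move i w S
      sub₀ : ∀ x → x ≢ i → S′ ∋ x → S₀ ∋ x ⊎ n ≤ toℕ x + j
      sub₀ x x≢i S′∋x with sub x S′∋x
      ... | inj₁ S∋x = inj₁ (move-∋⁺ {S = S} S∋i S∌w x≢i S∋x)
      ... | inj₂ t = inj₂ t
      helper : Dec (n ≤ toℕ i + j) → S′ ∋ i ⊎ S′ ∌ i → S′ ∈ᶠ shift w i D
      helper (yes t) _ = shift-stay w i D {S′} (star j S₀ S′ j≤n p sub′ top size) (λ _ S′∌i → ∋∌ (top i t) S′∌i)
        where
        sub′ : ∀ x → S′ ∋ x → S₀ ∋ x ⊎ n ≤ toℕ x + j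
        sub′ x S′∋x with x Fin.≟ i
        ... | yes refl = inj₂ t
        ... | no x≢i = sub₀ x x≢i S′∋x
      helper (no ¬t) (inj₂ S′∌i) = shift-stay w i D {S′} (star j S₀ S′ j≤n p
          (λ x S′∋x → sub₀ x (∋∌⇒≢ S′ S′∋x S′∌i) S′∋x) top size)
        (λ S′∋w _ → contradiction S′∋w ¬S′∋w)
        where
        ¬S′∋w : ¬ (S′ ∋ w)
        ¬S′∋w h with sub w h
        ... | inj₁ S∋w = ∋∌ S∋w S∌w
        ... | inj₂ t = ¬t (ℕ.≤-trans t (ℕ.+-monoˡ-≤ j (ℕ.<⇒≤ w<i)))
      helper (no ¬t) (inj₁ S′∋i) = shift-back w i D {S′} S′∋i S′∌w (star j S₀ (move i w S′) j≤n p sub′ top′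
          (subst (_≤ M) (sym (move-card {S = S′} S′∋i S′∌w)) size))
        where
        S′∌w : S′ ∌ w
        S′∌w with ∋? S′ w
        ... | inj₂ h = h
        ... | inj₁ h with sub w h
        ... | inj₁ S∋w = ∋∌ S∋w S∌w
        ... | inj₂ t = contradiction (ℕ.≤-trans t (ℕ.+-monoˡ-≤ j (ℕ.<⇒≤ w<i))) ¬t
        sub′ : ∀ x → move i w S′ ∋ x → S₀ ∋ x ⊎ n ≤ toℕ x + j
        sub′ x h with move-∋⁻ {S = S′} S′∋i S′∌w h
        ... | inj₁ refl = inj₁ (move-∋ {S = S} S∋i S∌w)
        ... | inj₂ (x≢i , S′∋x) = sub₀ x x≢i S′∋x
        top′ : ∀ x → n ≤ toℕ x + j → move i w S′ ∋ x
        top′ x t = move-∋⁺ {S = S′} S′∋i S′∌w (λ { refl → ¬t t }) (top x t)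

    shift-⊆ : (X D : Family n) → (∀ S → S ∈ᶠ X → S ∈ᶠ D) → ∀ S → S ∈ᶠ shift w i X → S ∈ᶠ shift w i D
    shift-⊆ X D h S S∈ with shift-elim w i X {S} S∈
    ... | inj₁ (p , g) = shift-stay w i D {S} (h S p) (λ a b → h _ (g a b))
    ... | inj₂ (a , b , p) = shift-back w i D {S} a b (h _ p)

  shift-uniform : ∀ {k} (w i : Fin n) (X : Family n) → Uniform k X → Uniform k (shift w i X)
  shift-uniform w i X uni S S∈ with shift-elim w i X {S} S∈
  ... | inj₁ (p , _) = uni S p
  ... | inj₂ (a , b , p) = trans (sym (move-card {S = S} a b)) (uni _ p)

  -- Adds the last `j` vertices: the head of a vector of length `suc n` is one of them exactly when
  -- `suc n ≤ j`.
  fill : ℕ → Subset n → Subset n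
  fill j []                = []
  fill {suc n} j (s ∷ S)   = (s ∨ (suc n ≤ᵇ j)) ∷ fill j S

  fill-∋ : ∀ j (S : Subset n) x → fill j S ∋ x → S ∋ x ⊎ n ≤ toℕ x + j
  fill-∋ j (true ∷ S) zero h = inj₁ refl
  fill-∋ j (false ∷ S) zero h = inj₂ (≤ᵇ-elim h)
  fill-∋ j (s ∷ S) (suc x) h with fill-∋ j S x h
  ... | inj₁ p = inj₁ p
  ... | inj₂ t = inj₂ (s≤s t)

  fill-⊒ : ∀ j (S : Subset n) → S ⊑ fill j S
  fill-⊒ j (true ∷ S) zero h = refl
  fill-⊒ j (s ∷ S) (suc x) h = fill-⊒ j S x h

  fill-top : ∀ j (S : Subset n) x → n ≤ toℕ x + j → fill j S ∋ x
  fill-top {suc n} j (s ∷ S) zero h = trans (cong (s ∨_) (≤ᵇ-intro h)) (∨-zeroʳ s)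
  fill-top j (s ∷ S) (suc x) h = fill-top j S x (ℕ.≤-pred h)

  fill-card : ∀ j (S : Subset n) → ∣ fill j S ∣ ≤ ∣ S ∣ + j
  fill-card j [] = z≤n
  fill-card {suc n} j (s ∷ S) with suc n ℕ.≤? j
  ... | yes h = ℕ.≤-trans (∣p∣≤n (fill j (s ∷ S))) (ℕ.≤-trans h (ℕ.m≤n+m j _))
  ... | no h = go s (suc n ≤ᵇ j) refl
    where
    go : ∀ s b → (suc n ≤ᵇ j) ≡ b → ∣ (s ∨ b) ∷ fill j S ∣ ≤ ∣ s ∷ S ∣ + j
    go true b _ = s≤s (fill-card j S)
    go false false _ = fill-card j S
    go false true eq = contradiction (≤ᵇ-elim eq) h

  module _ {r : ℕ} where

    vcard-update : ∀ e (S : Subset (e + suc r)) x b → toℕ x < e → vcard e (S [ x ]≔ b) ≡ vcard e S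
    vcard-update (suc e) (s ∷ S) zero    b h = refl
    vcard-update (suc e) (s ∷ S) (suc x) b h = vcard-update e S x b (ℕ.≤-pred h)

    lastᵇ-update : ∀ e (S : Subset (e + suc r)) x b → toℕ x < e → lastᵇ (S [ x ]≔ b) ≡ lastᵇ S
    lastᵇ-update (suc e) (s ∷ S) zero    b h = trans (lastᵇ-∷ b S (0<e+ e)) (sym (lastᵇ-∷ s S (0<e+ e)))
    lastᵇ-update (suc e) (s ∷ S) (suc x) b h = trans (lastᵇ-∷ s (S [ x ]≔ b) (0<e+ e))
      (trans (lastᵇ-update e S x b (ℕ.≤-pred h)) (sym (lastᵇ-∷ s S (0<e+ e))))

    target-move : ∀ e (S : Subset (e + suc r)) w i → toℕ w < e → toℕ i < e → target e (move w i S) ≡ target e S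
    target-move e S w i w<e i<e = cong₂ (λ l c → l ∧ (2 ≤ᵇ c))
      (trans (lastᵇ-update e (S [ w ]≔ false) i true i<e) (lastᵇ-update e S w false w<e))
      (trans (vcard-update e (S [ w ]≔ false) i true i<e) (vcard-update e S w false w<e))

    vcard-⊑ : ∀ e (S S′ : Subset (e + suc r)) → S ⊑ S′ → vcard e S ≤ vcard e S′
    vcard-⊑ zero    S S′ h = card-⊑ S S′ h
    vcard-⊑ (suc e) (s ∷ S) (s′ ∷ S′) h = vcard-⊑ e S S′ (h ∘ suc)

    -- V sits at the end of the vertex order, so an upward move can enter V but not leave it.
    vcard-move : ∀ e (S : Subset (e + suc r)) w i → toℕ w < toℕ i → S ∋ w → S ∌ i →
      vcard e S ≤ vcard e (move w i S)
    vcard-move zero S w i w<i S∋w S∌i = ℕ.≤-reflexive (sym (move-card {S = S} S∋w S∌i))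
    vcard-move (suc e) (s ∷ S) zero (suc i) w<i S∋w S∌i = vcard-⊑ e S (S [ i ]≔ true) (λ x → update-∋ S i)
    vcard-move (suc e) (s ∷ S) (suc w) (suc i) w<i S∋w S∌i = vcard-move e S w i (ℕ.≤-pred w<i) S∋w S∌i

    module _ (e : ℕ) (w i : Fin (e + suc r)) (w<i : toℕ w < toℕ i) where

      shift-vcard : (X : Family (e + suc r)) → (∀ S → S ∈ᶠ X → 2 ≤ vcard e S) →
        ∀ S → S ∈ᶠ shift w i X → 2 ≤ vcard e S
      shift-vcard X h2 S S∈ with shift-elim w i X {S} S∈
      ... | inj₁ (p , _) = h2 S p
      ... | inj₂ (S∋i , S∌w , p) = ℕ.≤-trans (h2 _ p) (subst (λ T → vcard e (move i w S) ≤ vcard e T)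
        (move-move {S = S} S∋i S∌w) (vcard-move e (move i w S) w i w<i
          (move-∋ {S = S} S∋i S∌w) (move-∌ {S = S} S∋i S∌w)))

      -- Both vertices lie before V, so moving between them does not change the trace on V. Undoing
      -- the move on exactly those faces that are new is injective.
      shift-targetFaces-weak : toℕ i < e → (D : Family (e + suc r)) → ∀ k →
        countSubsets (targetFaces e k (shift w i D)) ≤ countSubsets (targetFaces e k D)
      shift-targetFaces-weak i<e D k = count-inject ψ into inj
        where
        w<e : toℕ w < e
        w<e = ℕ.<-trans w<i i<e
        ψ : Subset (e + suc r) → Subset (e + suc r)
        ψ S = if D S then S else move i w S
        ψ-spec : ∀ S → S ∈ᶠ shift w i D →
          (ψ S ≡ S × S ∈ᶠ D) ⊎ (ψ S ≡ move i w S × D S ≡ false × S ∋ i × S ∌ w × move i w S ∈ᶠ D)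
        ψ-spec S S∈ = go (D S) refl (shift-elim w i D {S} S∈)
          where
          go : ∀ b → D S ≡ b → (S ∈ᶠ D × (S ∋ w → S ∌ i → move w i S ∈ᶠ D)) ⊎ (S ∋ i × S ∌ w × move i w S ∈ᶠ D) →
            (ψ S ≡ S × S ∈ᶠ D) ⊎ (ψ S ≡ move i w S × D S ≡ false × S ∋ i × S ∌ w × move i w S ∈ᶠ D)
          go true eq _ = inj₁ (cong (λ b → if b then S else move i w S) eq , eq)
          go false eq (inj₁ (p , _)) = ∋∌ p eq
          go false eq (inj₂ q) = inj₂ (cong (λ b → if b then S else move i w S) eq , eq , q)
        part : ∀ S → S ∈ᶠ targetFaces e k (shift w i D) → S ∈ᶠ shift w i D
        part S p = proj₁ (∧-elim (shift w i D S) p)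
        rest : ∀ S → S ∈ᶠ targetFaces e k (shift w i D) → ((∣ S ∣ ≡ᵇ k) ∧ target e S) ≡ true
        rest S p = proj₂ (∧-elim (shift w i D S) p)
        into : ∀ S → S ∈ᶠ targetFaces e k (shift w i D) → ψ S ∈ᶠ targetFaces e k D
        into S p with ψ-spec S (part S p)
        ... | inj₁ (eq , q) = subst (_∈ᶠ targetFaces e k D) (sym eq) (∧-intro (D S) q (rest S p))
        ... | inj₂ (eq , _ , a , b , q) = subst (_∈ᶠ targetFaces e k D) (sym eq) (∧-intro (D (move i w S)) q
          (trans (cong₂ (λ c t → (c ≡ᵇ k) ∧ t) (move-card {S = S} a b) (target-move e S i w i<e w<e)) (rest S p)))
        clash : ∀ S S′ → S ∈ᶠ shift w i D → D S′ ≡ false → S′ ∋ i → S′ ∌ w → S ≡ move i w S′ → ⊥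
        clash S S′ S∈ ne a b refl with shift-elim w i D {S} S∈
        ... | inj₁ (_ , g) = ∋∌ (subst (_∈ᶠ D) (move-move {S = S′} a b) (g (move-∋ {S = S′} a b) (move-∌ {S = S′} a b))) ne
        ... | inj₂ (c , _) = ∋∌ c (move-∌ {S = S′} a b)
        inj : ∀ S S′ → S ∈ᶠ targetFaces e k (shift w i D) → S′ ∈ᶠ targetFaces e k (shift w i D) → ψ S ≡ ψ S′ → S ≡ S′
        inj S S′ p q h with ψ-spec S (part S p) | ψ-spec S′ (part S′ q)
        ... | inj₁ (x , _) | inj₁ (y , _) = trans (sym x) (trans h y)
        ... | inj₁ (x , _) | inj₂ (y , ne , a , b , _) = ⊥-elim (clash S S′ (part S p) ne a b (trans (sym x) (trans h y)))
        ... | inj₂ (x , ne , a , b , _) | inj₁ (y , _) = ⊥-elim (clash S′ S (part S′ q) ne a b (trans (sym y) (trans (sym h) x)))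
        ... | inj₂ (x , _ , a , b , _) | inj₂ (y , _ , a′ , b′ , _) = trans (sym (move-move {S = S} a b))
          (trans (cong (move w i) (trans (sym x) (trans h y))) (move-move {S = S′} a′ b′))

      -- A face of size r can already be shifted to each of the last suc r vertices.
      shift-targetFaces-strong : e ≤ toℕ i → (D : Family (e + suc r)) → Star (r + r) D →
        countSubsets (targetFaces e r (shift w i D)) ≤ countSubsets (targetFaces e r D)
      shift-targetFaces-strong e≤i D star = count-mono λ S p →
        let (q , t) = ∧-elim (shift w i D S) p in
        ∧-intro (D S) (stays S q (≡ᵇ-elim {∣ S ∣} (proj₁ (∧-elim (∣ S ∣ ≡ᵇ r) t)))) t
        where
        N = e + suc r
        j = N ∸ toℕ i
        i+j : toℕ i + j ≡ N
        i+j = ℕ.m+[n∸m]≡n (ℕ.<⇒≤ (Fin.toℕ<n i))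
        j≤ : j ≤ suc r
        j≤ = ℕ.≤-trans (ℕ.∸-monoʳ-≤ N e≤i) (ℕ.≤-reflexive (ℕ.m+n∸m≡n e (suc r)))
        stays : ∀ S → S ∈ᶠ shift w i D → ∣ S ∣ ≡ r → S ∈ᶠ D
        stays S S∈ size with shift-elim w i D {S} S∈
        ... | inj₁ (p , _) = p
        ... | inj₂ (S∋i , S∌w , p) = Star-subset D star (fill j S⁻) S
          (star j (move i w S) (fill j S⁻) (ℕ.m∸n≤m N (toℕ i)) p sub (fill-top j S⁻) big)
          inside (subst (_≤ r + r) (sym size) (ℕ.m≤m+n r r))
          where
          S⁻ = S [ i ]≔ false
          sub : ∀ x → fill j S⁻ ∋ x → move i w S ∋ x ⊎ N ≤ toℕ x + j
          sub x h with fill-∋ j S⁻ x h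
          ... | inj₂ t = inj₂ t
          ... | inj₁ S⁻∋x = inj₁ (move-∋⁺ {S = S} S∋i S∌w
            (λ { refl → ∋∌ S⁻∋x (update-same S i false) }) (erase-⊑ S i x S⁻∋x))
          -- Deleting `i` leaves r - 1 vertices and at most r + 1 are added: the size limit 2r is
          -- just enough.
          big : ∣ fill j S⁻ ∣ ≤ r + r
          big = ℕ.≤-trans (fill-card j S⁻) (ℕ.≤-trans (ℕ.+-monoʳ-≤ ∣ S⁻ ∣ j≤)
            (ℕ.≤-reflexive (trans (ℕ.+-suc ∣ S⁻ ∣ r) (cong (_+ r) (trans (sym (card-erase S i S∋i)) size)))))
          inside : S ⊑ fill j S⁻
          inside x S∋x with x Fin.≟ i
          ... | yes refl = fill-top j S⁻ i (ℕ.≤-reflexive (sym i+j))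
          ... | no x≢i = fill-⊒ j S⁻ x (trans (update-other S false x≢i) S∋x)

  -- A shift of `A` alone need not stay inside `D`. Both are therefore shifted together until `D` is
  -- stable; after that `A` can be shifted within the fixed family `D` until it is stable too.
  hilton-milner-star : ∀ {r} e → suc r ≤ suc e → (D A : Family (e + suc (suc r))) → Star (suc r + suc r) D →
    (∀ S → S ∈ᶠ A → S ∈ᶠ D) → Uniform (suc r) A → Inter A → (∀ S → S ∈ᶠ A → 2 ≤ vcard e S) →
    ¬ ¬ (countSubsets A ≤ 1 + countSubsets (targetFaces e (suc r) D))
  hilton-milner-star {r} e r≤e D₀ A₀ star₀ sub₀ uni₀ meet₀ h2₀ =
    shift-until-stable toℕ Upward id outer-stable outer-step D₀ (star₀ , ℕ.≤-refl , A₀ , (sub₀ , uni₀ , meet₀ , h2₀ , ℕ.≤-refl))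
    where
    K = countSubsets (targetFaces e (suc r) D₀)
    G = countSubsets A₀ ≤ 1 + K
    Inside : Family (e + suc (suc r)) → Family (e + suc (suc r)) → Set
    Inside D A = (∀ S → S ∈ᶠ A → S ∈ᶠ D) × Uniform (suc r) A × Inter A × (∀ S → S ∈ᶠ A → 2 ≤ vcard e S) ×
      countSubsets A₀ ≤ countSubsets A
    Outer : Family (e + suc (suc r)) → Set
    Outer D = Star (suc r + suc r) D × countSubsets (targetFaces e (suc r) D) ≤ K × ∃ (Inside D)
    outer-step : ∀ D w i → Outer D → Upward w i → (Outer (shift w i D) → ¬ ¬ G) → ¬ ¬ G
    outer-step D w i (star , few , A , sub , uni , meet , h2 , many) w<i k = k
      ( shift-Star w i w<i D star , ℕ.≤-trans targetFaces≤ few , shift w i A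
      , shift-⊆ w i w<i A D sub , shift-uniform w i A uni , shift-intersecting w i A meet
      , shift-vcard e w i w<i A h2 , ℕ.≤-trans many (shift-count w i A))
      where
      targetFaces≤ : countSubsets (targetFaces e (suc r) (shift w i D)) ≤ countSubsets (targetFaces e (suc r) D)
      targetFaces≤ with toℕ i ℕ.<? e
      ... | yes i<e = shift-targetFaces-weak e w i w<i i<e D (suc r)
      ... | no i≮e = shift-targetFaces-strong e w i w<i (ℕ.≮⇒≥ i≮e) D star
    outer-stable : ∀ D → Outer D → Stable Upward D → ¬ ¬ G
    outer-stable D (star , few , A , inside) D-stable = shift-until-stable toℕ Upward id done step A inside
      where
      step : ∀ A w i → Inside D A → Upward w i → (Inside D (shift w i A) → ¬ ¬ G) → ¬ ¬ G
      step A w i (sub , uni , meet , h2 , many) w<i k = k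
        (sub′ , shift-uniform w i A uni , shift-intersecting w i A meet , shift-vcard e w i w<i A h2 , ℕ.≤-trans many (shift-count w i A))
        where
        sub′ : ∀ S → S ∈ᶠ shift w i A → S ∈ᶠ D
        sub′ S S∈ with shift-elim w i A {S} S∈
        ... | inj₁ (p , _) = sub S p
        ... | inj₂ (a , b , p) = subst (_∈ᶠ D) (move-move {S = S} a b)
          (D-stable w i w<i (move i w S) (sub _ p) (move-∋ {S = S} a b) (move-∌ {S = S} a b))
      done : ∀ A → Inside D A → Stable Upward A → ¬ ¬ G
      done A (sub , uni , meet , h2 , many) st = return (ℕ.≤-trans many (ℕ.≤-trans
        (bound-≡ e A D r≤e (record { star = star ; sub = sub ; uni = uni ; stable = Stable⇒StableR A st ; meet = meet ; h2 = h2 }))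
        (s≤s few)))

-- Ranks over a domain and iterated images and kernels

module Dimension where
  open import Defs
  open import Level using (Level; _⊔_) renaming (suc to lsuc)
  open import Algebra.Bundles using (CommutativeRing)
  import Algebra.Properties.Ring as RingProps
  open import Data.Bool using (Bool; true; false; if_then_else_)
  open import Data.Nat as ℕ using (ℕ; zero; suc; z≤n; s≤s; _≡ᵇ_)
  import Data.Nat.Properties as ℕ
  open import Algebra.Properties.CommutativeSemigroup ℕ.+-commutativeSemigroup using () renaming (interchange to +-interchange)
  open import Data.Fin using (Fin; zero; suc)
  import Data.Fin.Properties as Fin
  open import Data.Fin.Subset using (Subset; ∣_∣)
  open import Data.List as List using (List; []; _∷_)
  import Data.List.Membership.Propositional as Mem
  open import Data.List.Relation.Unary.Any using (here; there)
  import Data.List.Relation.Unary.All as All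
  open import Data.List.Relation.Unary.AllPairs using ([]; _∷_)
  open import Data.List.Relation.Unary.Unique.Propositional using (Unique)
  open import Data.Vec using (Vec; []; _∷_; lookup)
  open import Data.Vec.Properties using (≡-dec)
  import Data.Bool.Properties as Bool
  open import Data.Product using (∃; ∃₂; _×_; _,_; proj₁; proj₂)
  open import Data.Sum using (_⊎_; inj₁; inj₂)
  open import Data.Empty using (⊥; ⊥-elim)
  open import Function using (_∘_; id; const)
  open import Relation.Nullary using (¬_; Dec; yes; no; does)
  open import Relation.Nullary.Negation using (contradiction)
  open import Relation.Nullary.Decidable using (¬¬-excluded-middle)
  open import Relation.Binary.PropositionalEquality as ≡ using (_≡_; _≢_)
  import Relation.Binary.Reasoning.Setoid as SetoidReasoning
  open RingSolving
  open ExteriorAlgebra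
  open Subsets

  -- Cancellation replaces division, and stability of equality turns classical arguments into
  -- equations.
  record Domain (c ℓ : Level) : Set (lsuc (c ⊔ ℓ)) where
    no-eta-equality
    field
      commutativeRing : CommutativeRing c ℓ
    open CommutativeRing commutativeRing hiding (zero) public
    field
      stable : ∀ {x y} → ¬ ¬ (x ≈ y) → x ≈ y
      cancel : ∀ {a x} → ¬ (a ≈ 0#) → a * x ≈ 0# → x ≈ 0#
      1≉0    : ¬ (1# ≈ 0#)

  sumS : ∀ {n} → (Subset n → ℕ) → ℕ
  sumS {zero}  g = g []
  sumS {suc n} g = sumS (g ∘ (true ∷_)) ℕ.+ sumS (g ∘ (false ∷_))

  sumS-cong : ∀ {n} {g h : Subset n → ℕ} → (∀ S → g S ≡ h S) → sumS g ≡ sumS h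
  sumS-cong {zero}  p = p []
  sumS-cong {suc n} p = ≡.cong₂ ℕ._+_ (sumS-cong (p ∘ (true ∷_))) (sumS-cong (p ∘ (false ∷_)))

  sumS-+ : ∀ {n} (g h : Subset n → ℕ) → sumS (λ S → g S ℕ.+ h S) ≡ sumS g ℕ.+ sumS h
  sumS-+ {zero}  g h = ≡.refl
  sumS-+ {suc n} g h = ≡.trans (≡.cong₂ ℕ._+_ (sumS-+ (g ∘ (true ∷_)) (h ∘ (true ∷_))) (sumS-+ (g ∘ (false ∷_)) (h ∘ (false ∷_))))
    (+-interchange (sumS (g ∘ (true ∷_))) _ _ _)

  count≡sumS : ∀ {n} (g : Subset n → ℕ) → (∀ S → g S ℕ.≤ 1) → countSubsets (λ S → g S ≡ᵇ 1) ≡ sumS g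
  count≡sumS {zero} g p with g [] | p []
  ... | 0 | _ = ≡.refl
  ... | 1 | _ = ≡.refl
  ... | suc (suc _) | s≤s ()
  count≡sumS {suc n} g p = ≡.trans (count-suc (λ S → g S ≡ᵇ 1))
    (≡.cong₂ ℕ._+_ (count≡sumS (g ∘ (true ∷_)) (p ∘ (true ∷_))) (count≡sumS (g ∘ (false ∷_)) (p ∘ (false ∷_))))

  module LinearAlgebra {c ℓ : Level} (𝔻 : Domain c ℓ) where
    open Domain 𝔻
    open RingProps ring
    open IntegerSolver commutativeRing
    open Exterior commutativeRing public
    open SetoidReasoning setoid

    Nz : Carrier → Set ℓ
    Nz a = ¬ (a ≈ 0#)

    Nz-* : ∀ {a b} → Nz a → Nz b → Nz (a * b)
    Nz-* p q h = q (cancel p h)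

    Sub : ℕ → Set (lsuc (c ⊔ ℓ))
    Sub n = Ch n → Set (c ⊔ ℓ)

    infix 4 _⊆_
    _⊆_ : ∀ {n} → Sub n → Sub n → Set (c ⊔ ℓ)
    L ⊆ M = ∀ x → L x → M x

    -- Closure under `sat` makes these submodules correspond to subspaces over the fraction field;
    -- `stab` admits members obtained only up to double negation.
    record IsSub {n : ℕ} (L : Sub n) : Set (c ⊔ ℓ) where
      field
        resp : ∀ {x y} → x ≋ y → L x → L y
        zer  : L 𝟎
        add  : ∀ {x y} → L x → L y → L (x ⊕ y)
        scal : ∀ a {x} → L x → L (a ⊙ x)
        sat  : ∀ {s x} → Nz s → L (s ⊙ x) → L x
        stab : ∀ {x} → ¬ ¬ L x → L x

      sub : ∀ {x y} → L x → L y → L (x ⊖ y)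
      sub p q = resp (λ σ → +-congˡ (-1*x≈-x _)) (add p (scal (- 1#) q))

    Supp : ∀ {n} → (Subset n → Set) → Sub n
    Supp P x = Level.Lift c (∀ σ → ¬ P σ → x σ ≈ 0#)

    supp : ∀ {n} {P : Subset n → Set} {x} → (∀ σ → ¬ P σ → x σ ≈ 0#) → Supp P x
    supp = Level.lift

    vanish : ∀ {n} {P : Subset n → Set} {x} → Supp P x → ∀ σ → ¬ P σ → x σ ≈ 0#
    vanish = Level.lower

    Supp-isSub : ∀ {n} (P : Subset n → Set) → IsSub (Supp P)
    Supp-isSub P = record
      { resp = λ e p → supp λ σ h → trans (sym (e σ)) (vanish p σ h)
      ; zer = supp λ _ _ → refl
      ; add = λ p q → supp λ σ h → trans (+-cong (vanish p σ h) (vanish q σ h)) (+-identityˡ 0#)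
      ; scal = λ a p → supp λ σ h → trans (*-congˡ (vanish p σ h)) (zeroʳ a)
      ; sat = λ nz p → supp λ σ h → cancel nz (vanish p σ h)
      ; stab = λ p → supp λ σ h → stable (λ k → p λ q → k (vanish q σ h)) }

    -- The image is saturated because scalars of a domain cannot be divided by.
    Im Ker : ∀ {n} → (Ch n → Ch n) → Sub n → Sub n
    Im D L y = ¬ ¬ (∃₂ λ s x → Nz s × L x × s ⊙ y ≋ D x)
    Ker D L x = L x × Level.Lift c (D x ≋ 𝟎)

    module _ {n : ℕ} {D : Ch n → Ch n} (lin : Linear D) where
      private module D = Linear lin

      Im-isSub : ∀ {L} → IsSub L → IsSub (Im D L)
      Im-isSub {L} isL = record
        { resp = λ e p → p >>= λ { (s , x , nz , l , q) → return (s , x , nz , l , λ σ → trans (*-congˡ (sym (e σ))) (q σ)) }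
        ; zer = return (1# , 𝟎 , 1≉0 , I.zer , λ σ → trans (zeroʳ 1#) (sym (D.zero! (λ _ → refl) σ)))
        ; add = λ p q → p >>= λ { (s , x , nz , l , e) → q >>= λ { (t , y , nz′ , l′ , e′) →
            return (s * t , (t ⊙ x) ⊕ (s ⊙ y) , Nz-* nz nz′ , I.add (I.scal t l) (I.scal s l′) , λ σ →
              trans (solve 4 (λ s t x y → (s :* t) :* (x :+ y) := t :* (s :* x) :+ s :* (t :* y)) refl s t _ _)
              (trans (+-cong (*-congˡ (e σ)) (*-congˡ (e′ σ)))
              (sym (trans (D.add _ _ σ) (+-cong (D.scal t x σ) (D.scal s y σ)))))) } }
        ; scal = λ a p → p >>= λ { (s , x , nz , l , e) → return (s , a ⊙ x , nz , I.scal a l , λ σ →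
            trans (solve 3 (λ s a x → s :* (a :* x) := a :* (s :* x)) refl s a _) (trans (*-congˡ (e σ)) (sym (D.scal a x σ)))) }
        ; sat = λ {s} nz p → p >>= λ { (t , x , nz′ , l , e) → return (t * s , x , Nz-* nz′ nz , l , λ σ → trans (*-assoc t s _) (e σ)) }
        ; stab = λ p → p >>= id }
        where module I = IsSub isL

      Ker-isSub : ∀ {L} → IsSub L → IsSub (Ker D L)
      Ker-isSub {L} isL = record
        { resp = λ { e (l , k) → I.resp e l , Level.lift λ σ → trans (D.cong (λ τ → sym (e τ)) σ) (Level.lower k σ) }
        ; zer = I.zer , Level.lift (D.zero! λ _ → refl)
        ; add = λ { (l , k) (l′ , k′) → I.add l l′ , Level.lift λ σ →
            trans (D.add _ _ σ) (trans (+-cong (Level.lower k σ) (Level.lower k′ σ)) (+-identityˡ 0#)) }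
        ; scal = λ { a (l , k) → I.scal a l , Level.lift λ σ → trans (D.scal a _ σ) (trans (*-congˡ (Level.lower k σ)) (zeroʳ a)) }
        ; sat = λ { nz (l , k) → I.sat nz l , Level.lift λ σ → cancel nz (trans (sym (D.scal _ _ σ)) (Level.lower k σ)) }
        ; stab = λ p → I.stab (λ h → p (h ∘ proj₁)) , Level.lift λ σ → stable (λ h → p λ q → h (Level.lower (proj₂ q) σ)) }
        where module I = IsSub isL

    -- A flag of saturated submodules in which every step has rank one: up to a nonzero scalar, each
    -- element is a multiple of `b` modulo `L′`.
    data Dim {n : ℕ} (L : Sub n) : ℕ → Set (lsuc (c ⊔ ℓ)) where
      trivial : (∀ x → L x → x ≋ 𝟎) → Dim L 0
      extend  : ∀ {d} (L′ : Sub n) → IsSub L′ → Dim L′ d → L′ ⊆ L → ∀ b → L b → ¬ L′ b →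
        (∀ x → L x → ¬ ¬ (∃₂ λ s a → Nz s × L′ ((s ⊙ x) ⊖ (a ⊙ b)))) → Dim L (suc d)

    Dim-resp : ∀ {n d} {L M : Sub n} → L ⊆ M → M ⊆ L → Dim L d → Dim M d
    Dim-resp p q (trivial h) = trivial λ x → h x ∘ q x
    Dim-resp p q (extend L′ isL′ dim L′⊆L b b∈ b∉ gen) =
      extend L′ isL′ dim (λ x → p x ∘ L′⊆L x) b (p b b∈) b∉ (λ x → gen x ∘ q x)

    -- Along the flag, a new `b` enlarges either the kernel or the image. If `D b` already lies in
    -- `Im D L′`, say `s ⊙ D b ≋ D y`, the kernel gains `(s ⊙ b) ⊖ y`; otherwise the image gains
    -- `D b`.
    rank-nullity : ∀ {n d} {D : Ch n → Ch n} → Linear D → {L : Sub n} → IsSub L → Dim L d →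
      ¬ ¬ (∃₂ λ d₀ d₁ → Dim (Ker D L) d₀ × Dim (Im D L) d₁ × d₁ ℕ.+ d₀ ≡ d)
    rank-nullity {D = D} lin {L} isL (trivial h) = return (0 , 0 , trivial (λ x → h x ∘ proj₁) ,
      trivial (λ y p σ → stable (p >>= λ { (s , x , nz , l , e) → return (cancel nz (trans (e σ) (Linear.zero! lin (h x l) σ))) })) , ≡.refl)
    rank-nullity {n} {suc d} {D} lin {L} isL (extend L′ isL′ dim L′⊆L b b∈ b∉ gen) =
      rank-nullity lin isL′ dim >>= λ { (d₀ , d₁ , k , i , eq) →
      ¬¬-excluded-middle {A = Im D L′ (D b)} >>= λ where
        (yes p) → p >>= λ { (s , y , nz , l , e) → return (suc d₀ , d₁ , bigger-kernel k s y nz l e ,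
          Dim-resp (λ z → Im-mono L′⊆L z) (same-image p) i , ≡.trans (ℕ.+-suc d₁ d₀) (≡.cong suc eq)) }
        (no ¬p) → return (d₀ , suc d₁ ,
          Dim-resp (λ { x (l , z) → L′⊆L x l , z }) (same-kernel ¬p) k ,
          extend (Im D L′) (Im-isSub lin isL′) i (Im-mono L′⊆L) (D b)
            (return (1# , b , 1≉0 , b∈ , λ σ → *-identityˡ _)) ¬p bigger-image , ≡.cong suc eq) }
      where
      module D = Linear lin
      module I = IsSub isL
      module I′ = IsSub isL′
      module Im′ = IsSub (Im-isSub lin isL′)
      Im-mono : ∀ {M M′ : Sub n} → M ⊆ M′ → Im D M ⊆ Im D M′
      Im-mono h y p = p >>= λ { (s , x , nz , l , e) → return (s , x , nz , h x l , e) }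
      comb : ∀ {s a x} → L′ ((s ⊙ x) ⊖ (a ⊙ b)) → Im D L′ ((s ⊙ D x) ⊖ (a ⊙ D b))
      comb l = return (1# , _ , 1≉0 , l , λ σ → trans (*-identityˡ _) (sym (D.smul-sub _ _ _ _ σ)))
      same-image : Im D L′ (D b) → Im D L ⊆ Im D L′
      same-image p y q = q >>= λ { (t , x , nz , l , e) → gen x l >>= λ { (s , a , nz′ , l′) →
        Im′.sat nz (Im′.sat nz′ (Im′.resp
          (λ σ → trans (solve 2 (λ u v → (u :- v) :+ v := u) refl _ _) (*-congˡ (sym (e σ))))
          (Im′.add (comb {s} {a} l′) (Im′.scal a p)))) } }
      bigger-kernel : ∀ {d₀} → Dim (Ker D L′) d₀ → ∀ s y → Nz s → L′ y → s ⊙ D b ≋ D y → Dim (Ker D L) (suc d₀)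
      bigger-kernel k s y nz l e = extend (Ker D L′) (Ker-isSub lin isL′) k (λ { x (l , z) → L′⊆L x l , z }) z
        (I.sub (I.scal s b∈) (L′⊆L y l) , Level.lift Dz)
        (λ { (l′ , _) → b∉ (I′.sat nz (I′.resp (λ σ → solve 2 (λ u v → (u :- v) :+ v := u) refl _ _) (I′.add l′ l))) })
        λ { x (lx , kx) → gen x lx >>= λ { (s′ , a , nz′ , l′) → return (s * s′ , a , Nz-* nz nz′ ,
          I′.resp (λ σ → solve 6 (λ s s′ x a b y → s :* (s′ :* x :- a :* b) :+ a :* y := (s :* s′) :* x :- a :* (s :* b :- y)) refl _ _ _ _ _ _)
            (I′.add (I′.scal s l′) (I′.scal a l)) ,
          Level.lift λ σ → trans (D.smul-sub _ _ _ _ σ)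
            (trans (+-cong (trans (*-congˡ (Level.lower kx σ)) (zeroʳ _)) (-‿cong (trans (*-congˡ (Dz σ)) (zeroʳ _))))
              (-‿inverseʳ 0#))) } }
        where
        z = (s ⊙ b) ⊖ y
        Dz : D z ≋ 𝟎
        Dz σ = trans (D.sub _ _ σ) (trans (+-congʳ (trans (D.scal s b σ) (e σ))) (-‿inverseʳ _))
      same-kernel : ¬ Im D L′ (D b) → Ker D L ⊆ Ker D L′
      same-kernel ¬p x (l , k) = I′.stab (gen x l >>= λ { (s , a , nz , l′) → return (I′.sat nz (I′.resp (λ σ →
        trans (+-congˡ (-‿cong (trans (*-congʳ (a≈0 s a l′)) (zeroˡ _)))) (trans (+-congˡ -0#≈0#) (+-identityʳ _))) l′)) }) , k
        where
        a≈0 : ∀ s a → L′ ((s ⊙ x) ⊖ (a ⊙ b)) → a ≈ 0#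
        a≈0 s a l′ = stable λ nz → ¬p (Im′.sat nz (Im′.resp (λ σ → trans (*-congˡ
            (trans (+-congʳ (trans (*-congˡ (Level.lower k σ)) (zeroʳ s))) (+-identityˡ _)))
            (trans (-1*x≈-x _) (-‿involutive _)))
          (Im′.scal (- 1#) (comb {s} {a} l′))))
      bigger-image : ∀ y → Im D L y → ¬ ¬ (∃₂ λ s a → Nz s × Im D L′ ((s ⊙ y) ⊖ (a ⊙ D b)))
      bigger-image y q = q >>= λ { (t , x , nz , l , e) → gen x l >>= λ { (s , a , nz′ , l′) →
        return (s * t , a , Nz-* nz′ nz , Im′.resp (λ σ → +-congʳ (trans (*-congˡ (sym (e σ))) (sym (*-assoc s t _)))) (comb {s} {a} l′)) } }

    infix 4 _≟ˢ_
    _≟ˢ_ : ∀ {n} (σ τ : Subset n) → Dec (σ ≡ τ)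
    _≟ˢ_ = ≡-dec Bool._≟_

    point : ∀ {n} → Subset n → Ch n
    point σ τ = if does (σ ≟ˢ τ) then 1# else 0#

    point-same : ∀ {n} (σ : Subset n) → point σ σ ≈ 1#
    point-same σ with σ ≟ˢ σ
    ... | yes _ = refl
    ... | no h = ⊥-elim (h ≡.refl)

    point-other : ∀ {n} {σ τ : Subset n} → σ ≢ τ → point σ τ ≈ 0#
    point-other {σ = σ} {τ} ne with σ ≟ˢ τ
    ... | yes h = ⊥-elim (ne h)
    ... | no _ = refl

    Dim-list : ∀ {n} (xs : List (Subset n)) → Unique xs → Dim (Supp (Mem._∈ xs)) (List.length xs)
    Dim-list [] _ = trivial λ x p σ → vanish p σ λ ()
    Dim-list (σ ∷ xs) (σ∉ ∷ u) = extend (Supp (Mem._∈ xs)) (Supp-isSub _) (Dim-list xs u)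
      (λ x p → supp λ τ h → vanish p τ (h ∘ there))
      (point σ) (supp λ τ h → point-other {σ = σ} {τ} (λ { ≡.refl → h (here ≡.refl) }))
      (λ p → 1≉0 (trans (sym (point-same σ)) (vanish p σ (λ m → All.lookup σ∉ m ≡.refl))))
      λ x p → return (1# , x σ , 1≉0 , supp λ τ h → gone x p τ h)
      where
      gone : ∀ x → Supp (Mem._∈ (σ ∷ xs)) x → ∀ τ → ¬ (τ Mem.∈ xs) → 1# * x τ - x σ * point σ τ ≈ 0#
      gone x p τ h with σ ≟ˢ τ
      ... | yes ≡.refl = solve 2 (λ u v → u :* v :- v :* u := con (0 , 0)) refl 1# (x σ)
      ... | no ne = trans (+-cong (trans (*-congˡ (vanish p τ λ { (here e) → ne (≡.sym e) ; (there m) → h m })) (zeroʳ 1#))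
          (trans (-‿cong (zeroʳ _)) -0#≈0#)) (+-identityˡ 0#)

    Fam : ∀ {n} → Family n → Sub n
    Fam A = Supp (_∈ᶠ A)

    Dim-Fam : ∀ {n} (A : Family n) → Dim (Fam A) (countSubsets A)
    Dim-Fam A = Dim-resp (λ x p → supp λ σ h → vanish p σ (h ∘ ∈-members⁻ {P = A}))
      (λ x p → supp λ σ h → vanish p σ (h ∘ ∈-members⁺ {P = A})) (Dim-list (members A) (members-unique A))

    -- The two halves of rank-nullity for one functional: `true` records that it occurs in the
    -- leading set, `false` that it does not.
    step : ∀ {n} → (Fin n → Carrier) → Bool → Sub n → Sub n
    step φ true  = Im (∂ φ)
    step φ false = Ker (∂ φ)

    -- The functional at the end of the vector is used first, so that it is the
    -- strongest one in the resulting family of leading sets.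
    Proc : ∀ {n N} → Vec (Fin n → Carrier) N → Subset N → Sub n → Sub n
    Proc []      []      L = L
    Proc (φ ∷ ψ) (s ∷ S) L = step φ s (Proc ψ S L)

    step-isSub : ∀ {n} (φ : Fin n → Carrier) s {L} → IsSub L → IsSub (step φ s L)
    step-isSub φ true  = Im-isSub (∂-linear φ)
    step-isSub φ false = Ker-isSub (∂-linear φ)

    Proc-isSub : ∀ {n N} (ψ : Vec (Fin n → Carrier) N) S {L} → IsSub L → IsSub (Proc ψ S L)
    Proc-isSub []      []      isL = isL
    Proc-isSub (φ ∷ ψ) (s ∷ S) isL = step-isSub φ s (Proc-isSub ψ S isL)

    step-mono : ∀ {n} (φ : Fin n → Carrier) s {L M} → L ⊆ M → step φ s L ⊆ step φ s M
    step-mono φ true  h y p = p >>= λ { (s , x , nz , l , e) → return (s , x , nz , h x l , e) }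
    step-mono φ false h x (l , k) = h x l , k

    Proc-mono : ∀ {n N} (ψ : Vec (Fin n → Carrier) N) S {L M} → L ⊆ M → Proc ψ S L ⊆ Proc ψ S M
    Proc-mono []      []      h = h
    Proc-mono (φ ∷ ψ) (s ∷ S) h = step-mono φ s (Proc-mono ψ S h)

    step-∂ : ∀ {n} (φ χ : Fin n → Carrier) s {L M} → IsSub M → (∀ x → L x → M (∂ χ x)) →
      ∀ x → step φ s L x → step φ s M (∂ χ x)
    step-∂ φ χ true isM h y p = p >>= λ { (s , x , nz , l , e) → return (s , (- 1#) ⊙ ∂ χ x , nz , IsSub.scal isM (- 1#) (h x l) , λ σ → begin
      s * ∂ χ y σ              ≈⟨ sym (Linear.scal (∂-linear χ) s y σ) ⟩
      ∂ χ (s ⊙ y) σ            ≈⟨ Linear.cong (∂-linear χ) e σ ⟩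
      ∂ χ (∂ φ x) σ            ≈⟨ ∂-anticomm χ φ x σ ⟩
      - ∂ φ (∂ χ x) σ          ≈⟨ sym (-1*x≈-x _) ⟩
      - 1# * ∂ φ (∂ χ x) σ     ≈⟨ sym (Linear.scal (∂-linear φ) _ _ σ) ⟩
      ∂ φ ((- 1#) ⊙ ∂ χ x) σ   ∎) }
    step-∂ φ χ false isM h x (l , k) = h x l , Level.lift (∂-swap φ χ (Level.lower k))

    Proc-∂ : ∀ {n N} (ψ : Vec (Fin n → Carrier) N) χ S {L M} → IsSub M → (∀ x → L x → M (∂ χ x)) →
      ∀ x → Proc ψ S L x → Proc ψ S M (∂ χ x)
    Proc-∂ []      χ []      isM h = h
    Proc-∂ (φ ∷ ψ) χ (s ∷ S) isM h = step-∂ φ χ s (Proc-isSub ψ S isM) (Proc-∂ ψ χ S isM h)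

    step-killed : ∀ {n} (φ : Fin n → Carrier) s {L : Sub n} x → step φ s L x → ∂ φ x ≋ 𝟎
    step-killed φ true y p σ = stable (p >>= λ { (s , x , nz , l , e) → return (cancel nz
      (trans (sym (Linear.scal (∂-linear φ) s y σ)) (trans (Linear.cong (∂-linear φ) e σ) (∂∂ φ x σ)))) })
    step-killed φ false x (_ , k) = Level.lower k

    step-keeps-killed : ∀ {n} (φ χ : Fin n → Carrier) s {L : Sub n} → (∀ x → L x → ∂ χ x ≋ 𝟎) →
      ∀ x → step φ s L x → ∂ χ x ≋ 𝟎
    step-keeps-killed φ χ true h y p σ = stable (p >>= λ { (s , x , nz , l , e) → return (cancel nz
      (trans (sym (Linear.scal (∂-linear χ) s y σ)) (trans (Linear.cong (∂-linear χ) e σ) (∂-swap χ φ (h x l) σ)))) })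
    step-keeps-killed φ χ false h x (l , _) = h x l

    -- An image is killed because contraction squares to zero, a kernel by definition, and the later
    -- steps keep this by anticommutation. Once every coordinate form has been used, only scalars
    -- can survive.
    Proc-killed : ∀ {n N} (ψ : Vec (Fin n → Carrier) N) S {L : Sub n} i x → Proc ψ S L x → ∂ (lookup ψ i) x ≋ 𝟎
    Proc-killed (φ ∷ ψ) (s ∷ S) zero x p = step-killed φ s x p
    Proc-killed (φ ∷ ψ) (s ∷ S) {L} (suc i) x p = step-keeps-killed φ (lookup ψ i) s (Proc-killed ψ S {L} i) x p

    -- Each functional splits all current ranks by rank-nullity, so the total over all `S` remains
    -- `d`.
    Dim-Proc : ∀ {n N d} (ψ : Vec (Fin n → Carrier) N) {L : Sub n} → IsSub L → Dim L d →
      ¬ ¬ (∃ λ (g : Subset N → ℕ) → (∀ S → Dim (Proc ψ S L) (g S)) × sumS g ≡ d)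
    Dim-Proc {d = d} [] isL dim = return (const d , (λ { [] → dim }) , ≡.refl)
    Dim-Proc (φ ∷ ψ) {L} isL dim = Dim-Proc ψ isL dim >>= λ { (g , dims , eq) →
      ¬¬-∀Subset (λ S → rank-nullity (∂-linear φ) (Proc-isSub ψ S isL) (dims S)) >>= λ rn →
      return ( (λ { (true ∷ S) → proj₁ (proj₂ (rn S)) ; (false ∷ S) → proj₁ (rn S) })
             , (λ { (true ∷ S) → proj₁ (proj₂ (proj₂ (proj₂ (rn S)))) ; (false ∷ S) → proj₁ (proj₂ (proj₂ (rn S))) })
             , ≡.trans (≡.sym (sumS-+ (λ S → proj₁ (proj₂ (rn S))) (λ S → proj₁ (rn S))))
                 (≡.trans (sumS-cong (λ S → proj₂ (proj₂ (proj₂ (proj₂ (rn S)))))) eq)) }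

    Lead : ∀ {n} → Sub n → Set (c ⊔ ℓ)
    Lead L = ¬ (∀ x → L x → x ≋ 𝟎)

    Scalars : ∀ {n} → Sub n → Set (c ⊔ ℓ)
    Scalars L = ∀ x → L x → ∀ σ → 0 ℕ.< ∣ σ ∣ → x σ ≈ 0#

    Dim-scalars : ∀ {n d} {L : Sub n} → Scalars L → Dim L d → d ℕ.≤ 1
    Dim-scalars sc (trivial _) = z≤n
    Dim-scalars sc (extend _ _ (trivial _) _ _ _ _ _) = s≤s z≤n
    Dim-scalars {n} sc (extend L′ isL′ (extend L″ isL″ _ L″⊆ b′ b′∈ b′∉ _) L′⊆ b b∈ b∉ _) = contradiction b∈L′ b∉
      where
      ∅ : Subset n
      ∅ = Data.Vec.replicate n false
      only : ∀ σ → σ ≡ ∅ ⊎ 0 ℕ.< ∣ σ ∣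
      only σ with ∣ σ ∣ in eq
      ... | zero = inj₁ (subset-ext λ x → ≡.trans (0-card σ eq x) (≡.sym (Data.Vec.Properties.lookup-replicate x false)))
      ... | suc _ = inj₂ (s≤s z≤n)
      nz : Nz (b′ ∅)
      nz h = b′∉ (IsSub.resp isL″ (λ σ → sym (zero-at σ (only σ))) (IsSub.zer isL″))
        where
        zero-at : ∀ σ → σ ≡ ∅ ⊎ 0 ℕ.< ∣ σ ∣ → b′ σ ≈ 0#
        zero-at σ (inj₁ ≡.refl) = h
        zero-at σ (inj₂ p) = sc b′ (L′⊆ b′ b′∈) σ p
      -- Both chains live on the empty set only, so `b′ ∅` times `b` equals `b ∅` times `b′`, which
      -- lies in `L′`; saturation removes the nonzero scalar `b′ ∅`.
      b∈L′ : L′ b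
      b∈L′ = IsSub.sat isL′ nz (IsSub.resp isL′ (λ σ → prop σ (only σ)) (IsSub.scal isL′ (b ∅) b′∈))
        where
        prop : ∀ σ → σ ≡ ∅ ⊎ 0 ℕ.< ∣ σ ∣ → b ∅ * b′ σ ≈ b′ ∅ * b σ
        prop σ (inj₁ ≡.refl) = *-comm _ _
        prop σ (inj₂ p) = trans (trans (*-congˡ (sc b′ (L′⊆ b′ b′∈) σ p)) (zeroʳ _))
          (sym (trans (*-congˡ (sc b b∈ σ p)) (zeroʳ _)))

    -- Chains concentrated on the empty set have rank at most one. The ranks that sum to `d` are
    -- thus all 0 or 1, and the sets `S` of rank 1 are the leading ones.
    leading-family : ∀ {n N d} (ψ : Vec (Fin n → Carrier) N) {L : Sub n} → IsSub L → Dim L d →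
      (∀ S → Scalars (Proc ψ S L)) →
      ¬ ¬ (∃ λ (X : Family N) → countSubsets X ≡ d × (∀ S → S ∈ᶠ X → Lead (Proc ψ S L)) × (∀ S → Lead (Proc ψ S L) → S ∈ᶠ X))
    leading-family ψ {L} isL dim sc = Dim-Proc ψ isL dim >>= λ { (g , dims , eq) →
      let ≤1 = λ S → Dim-scalars (sc S) (dims S) in
      return ((λ S → g S ≡ᵇ 1) , ≡.trans (count≡sumS g ≤1) eq , (λ S p → lead (dims S) p) , (λ S p → member (≤1 S) (dims S) p)) }
      where
      lead : ∀ {n d} {M : Sub n} → Dim M d → (d ≡ᵇ 1) ≡ true → Lead M
      lead (extend L′ isL′ (trivial _) _ b b∈ b∉ _) _ h = b∉ (IsSub.resp isL′ (λ σ → sym (h b b∈ σ)) (IsSub.zer isL′))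
      member : ∀ {n d} {M : Sub n} → d ℕ.≤ 1 → Dim M d → Lead M → (d ≡ᵇ 1) ≡ true
      member _ (trivial h) p = ⊥-elim (p h)
      member _ (extend _ _ (trivial _) _ _ _ _ _) p = ≡.refl
      member (s≤s ()) (extend _ _ (extend _ _ _ _ _ _ _ _) _ _ _ _ _) p

    Orth : ∀ {n} → Sub n → Sub n → Set (c ⊔ ℓ)
    Orth L M = ∀ x y → L x → M y → (x ⋀ y ≋ 𝟎) × (bar x ⋀ y ≋ 𝟎)

    -- By the Leibniz rule, ∂ φ x ⋀ y = ∂ φ (x ⋀ y) when ∂ φ y = 0; keeping track of
    -- bar x as well makes orthogonality pass to images and kernels.
    private
      leibniz-zero : ∀ {n} (φ : Fin n → Carrier) {x y : Ch n} → x ⋀ y ≋ 𝟎 → ∀ σ → (∂ φ x ⋀ y) σ + (bar x ⋀ ∂ φ y) σ ≈ 0#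
      leibniz-zero φ h σ = trans (sym (∂-⋀ φ _ _ σ)) (Linear.zero! (∂-linear φ) h σ)

      first : ∀ {n} (φ : Fin n → Carrier) {x y : Ch n} → x ⋀ y ≋ 𝟎 → ∂ φ y ≋ 𝟎 → ∂ φ x ⋀ y ≋ 𝟎
      first φ {x} h k σ = trans (sym (trans (+-congˡ (Linear.zero! (⋀-linearʳ (bar x)) k σ)) (+-identityʳ _))) (leibniz-zero φ h σ)

      second : ∀ {n} (φ : Fin n → Carrier) {x y : Ch n} → x ⋀ y ≋ 𝟎 → ∂ φ x ≋ 𝟎 → bar x ⋀ ∂ φ y ≋ 𝟎
      second φ {x} {y} h k σ = trans (sym (trans (+-congʳ (Linear.zero! (⋀-linearˡ y) k σ)) (+-identityˡ _))) (leibniz-zero φ h σ)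

    -- Disjointness of `S` and `S′` ensures that no functional takes the image on both sides. Where
    -- one side does, the other is killed by it, as the Leibniz argument requires.
    Proc-orth : ∀ {n N} (ψ : Vec (Fin n → Carrier) N) S S′ {L M : Sub n} → Orth L M →
      (∀ x → lookup S x ≡ true → lookup S′ x ≡ true → ⊥) → Orth (Proc ψ S L) (Proc ψ S′ M)
    Proc-orth [] [] [] o d = o
    Proc-orth (φ ∷ ψ) (true ∷ S) (true ∷ S′) o d = ⊥-elim (d zero ≡.refl ≡.refl)
    Proc-orth (φ ∷ ψ) (false ∷ S) (false ∷ S′) o d x y (p , _) (q , _) = Proc-orth ψ S S′ o (d ∘ suc) x y p q
    Proc-orth (φ ∷ ψ) (true ∷ S) (false ∷ S′) {L} {M} o d z y p (q , k) = (λ σ → stable (p >>= λ w → return (go₁ w σ))) , (λ σ → stable (p >>= λ w → return (go₂ w σ)))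
      where
      rec = Proc-orth ψ S S′ {L} {M} o (d ∘ suc)
      go₁ : (∃₂ λ s x → Nz s × Proc ψ S L x × s ⊙ z ≋ ∂ φ x) → z ⋀ y ≋ 𝟎
      go₁ (s , x , nz , l , e) σ = cancel nz (trans (sym (Linear.scal (⋀-linearˡ y) s z σ))
        (trans (Linear.cong (⋀-linearˡ y) e σ) (first φ (proj₁ (rec x y l q)) (Level.lower k) σ)))
      go₂ : (∃₂ λ s x → Nz s × Proc ψ S L x × s ⊙ z ≋ ∂ φ x) → bar z ⋀ y ≋ 𝟎
      go₂ (s , x , nz , l , e) σ = cancel nz (begin
        s * (bar z ⋀ y) σ         ≈⟨ sym (Linear.scal (⋀-linearˡ y) s (bar z) σ) ⟩
        ((s ⊙ bar z) ⋀ y) σ       ≈⟨ Linear.cong (⋀-linearˡ y) (λ τ → trans (sym (Linear.scal bar-linear s z τ)) (Linear.cong bar-linear e τ)) σ ⟩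
        (bar (∂ φ x) ⋀ y) σ       ≈⟨ Linear.cong (⋀-linearˡ y) (λ τ → trans (sym (-‿involutive _)) (-‿cong (sym (bar-∂ φ x τ)))) σ ⟩
        ((λ τ → - ∂ φ (bar x) τ) ⋀ y) σ ≈⟨ Linear.neg (⋀-linearˡ y) _ σ ⟩
        - (∂ φ (bar x) ⋀ y) σ     ≈⟨ -‿cong (first φ (proj₂ (rec x y l q)) (Level.lower k) σ) ⟩
        - 0#                      ≈⟨ -0#≈0# ⟩
        0#                        ∎)
    Proc-orth (φ ∷ ψ) (false ∷ S) (true ∷ S′) {L} {M} o d x w (p , k) q = (λ σ → stable (q >>= λ v → return (go₁ v σ))) , (λ σ → stable (q >>= λ v → return (go₂ v σ)))
      where
      rec = Proc-orth ψ S S′ {L} {M} o (d ∘ suc)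
      ∂bar : ∂ φ (bar x) ≋ 𝟎
      ∂bar σ = trans (bar-∂ φ x σ) (trans (-‿cong (Linear.zero! bar-linear (Level.lower k) σ)) -0#≈0#)
      go₁ : (∃₂ λ s y → Nz s × Proc ψ S′ M y × s ⊙ w ≋ ∂ φ y) → x ⋀ w ≋ 𝟎
      go₁ (s , y , nz , l , e) σ = cancel nz (begin
        s * (x ⋀ w) σ              ≈⟨ sym (Linear.scal (⋀-linearʳ x) s w σ) ⟩
        (x ⋀ (s ⊙ w)) σ            ≈⟨ Linear.cong (⋀-linearʳ x) e σ ⟩
        (x ⋀ ∂ φ y) σ              ≈⟨ Linear.cong (⋀-linearˡ (∂ φ y)) (λ τ → sym (bar-bar x τ)) σ ⟩
        (bar (bar x) ⋀ ∂ φ y) σ    ≈⟨ second φ (proj₂ (rec x y p l)) ∂bar σ ⟩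
        0#                         ∎)
      go₂ : (∃₂ λ s y → Nz s × Proc ψ S′ M y × s ⊙ w ≋ ∂ φ y) → bar x ⋀ w ≋ 𝟎
      go₂ (s , y , nz , l , e) σ = cancel nz (trans (sym (Linear.scal (⋀-linearʳ (bar x)) s w σ))
        (trans (Linear.cong (⋀-linearʳ (bar x)) e σ) (second φ (proj₁ (rec x y p l)) (Level.lower k) σ)))

-- Leading sets of families and of simplicial complexes

module LeadingSets where
  open import Defs
  open import Level using (Level; _⊔_) renaming (suc to lsuc)
  import Algebra.Properties.Ring as RingProps
  open import Data.Bool using (Bool; true; false; if_then_else_)
  open import Data.Nat as ℕ using (ℕ; zero; suc; s≤s)
  import Data.Nat.Properties as ℕ
  open import Data.Fin using (Fin; zero; suc; toℕ)
  import Data.Fin.Properties as Fin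
  open import Data.Fin.Subset using (Subset; ∣_∣)
  open import Data.Vec as Vec using (Vec; []; _∷_; lookup; _[_]≔_; replicate; _++_)
  open import Data.Vec.Properties using (lookup-replicate)
  open import Data.Product using (_×_; _,_; proj₁; proj₂)
  open import Data.Sum using (_⊎_; inj₁; inj₂)
  open import Data.Empty using (⊥; ⊥-elim)
  open import Data.Unit using (⊤)
  open import Function using (_∘_)
  open import Relation.Nullary using (¬_; yes; no; does)
  open import Relation.Nullary.Negation using (contradiction)
  open import Relation.Binary.PropositionalEquality as ≡ using (_≡_; _≢_)
  import Relation.Binary.Reasoning.Setoid as SetoidReasoning
  open RingSolving
  open ExteriorAlgebra
  open Subsets
  open ShiftedFamilies using (Inter)
  open Dimension

  module Leading {c ℓ : Level} (𝔻 : Domain c ℓ) where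
    open Domain 𝔻
    open RingProps ring
    open LinearAlgebra 𝔻 public
    open IntegerSolver commutativeRing
    open SetoidReasoning setoid

    Fam-orth : ∀ {n} (A : Family n) → Inter A → Orth (Fam A) (Fam A)
    Fam-orth A meet x y p q =
      ⋀-zero-local (λ σ τ d → stable λ nz → both σ τ d (λ h → nz (trans (*-congʳ h) (zeroˡ _))) (λ h → nz (trans (*-congˡ h) (zeroʳ _)))) ,
      ⋀-zero-local (λ σ τ d → stable λ nz → both σ τ d (λ h → nz (trans (*-congʳ (bar-local σ h)) (zeroˡ _))) (λ h → nz (trans (*-congˡ h) (zeroʳ _))))
      where
      both : ∀ σ τ → (∀ v → σ ∋ v → τ ∋ v → ⊥) → ¬ (x σ ≈ 0#) → ¬ (y τ ≈ 0#) → ⊥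
      both σ τ d nx ny = nx (vanish p σ λ σ∈ → ny (vanish q τ λ τ∈ → let (v , a , b) = meet σ τ σ∈ τ∈ in d v a b))

    δ : ∀ {n} → Fin n → Fin n → Carrier
    δ u v = if does (u Fin.≟ v) then 1# else 0#

    δ-same : ∀ {n} (u : Fin n) → δ u u ≈ 1#
    δ-same u with u Fin.≟ u
    ... | yes _ = refl
    ... | no h = ⊥-elim (h ≡.refl)

    δ-other : ∀ {n} {u v : Fin n} → u ≢ v → δ u v ≈ 0#
    δ-other {u = u} {v} h with u Fin.≟ v
    ... | yes e = ⊥-elim (h e)
    ... | no _ = refl

    ∂δ-vanish : ∀ {n} (u : Fin n) (x : Ch n) σ → σ ∋ u → ∂ (δ u) x σ ≈ 0#
    ∂δ-vanish u x σ σ∋u = ∂-zero-local σ λ v σ∌v → trans (*-congʳ (δ-other (∋∌⇒≢ σ σ∋u σ∌v))) (zeroˡ _)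

    ∂δ-local : ∀ {n} (u : Fin n) {x : Ch n} σ → (σ ∌ u → x (σ [ u ]≔ true) ≈ 0#) → ∂ (δ u) x σ ≈ 0#
    ∂δ-local u {x} σ h = ∂-zero-local σ term
      where
      term : ∀ v → σ ∌ v → δ u v * x (σ [ v ]≔ true) ≈ 0#
      term v σ∌v with u Fin.≟ v
      ... | yes ≡.refl = trans (*-congˡ (h σ∌v)) (zeroʳ _)
      ... | no _ = zeroˡ _

    -- If `δ u` kills `x`, the homotopy formula expresses `x` as a contraction by `δ u`, and no such
    -- contraction has a coefficient at a set containing `u`.
    killed-vanish : ∀ {n} (u : Fin n) {x : Ch n} → ∂ (δ u) x ≋ 𝟎 → ∀ σ → σ ∋ u → x σ ≈ 0#
    killed-vanish u {x} h σ σ∋u = begin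
      x σ                                        ≈⟨ solve 1 (λ a → a := a :- con (0 , 0)) refl _ ⟩
      x σ - 0#                                   ≈⟨ +-cong (sym (trans (*-congʳ (δ-same u)) (*-identityˡ _))) (-‿cong (sym (Linear.zero! (e-linear u) h σ))) ⟩
      δ u u * x σ - e u (∂ (δ u) x) σ            ≈⟨ sym (∂-e (δ u) u x σ) ⟩
      ∂ (δ u) (e u x) σ                          ≈⟨ ∂δ-vanish u (e u x) σ σ∋u ⟩
      0#                                         ∎

    -- For `s = true` the link of `v`, for `s = false` the deletion of `v`: the combinatorial form
    -- of an image or kernel under a coordinate form.
    stepP : ∀ {n} → Fin n → Bool → (Subset n → Set) → (Subset n → Set)
    stepP v s P ρ = ρ ∌ v × P (ρ [ v ]≔ s)

    step-coord⁻ : ∀ {n} (v : Fin n) s (P : Subset n → Set) → step (δ v) s (Supp P) ⊆ Supp (stepP v s P)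
    step-coord⁻ v true P y p = supp λ ρ h → stable (p >>= λ { (s , x , nz , l , e) → return (cancel nz (trans (e ρ)
      (∂δ-local v ρ λ ρ∌v → vanish l (ρ [ v ]≔ true) (λ q → h (ρ∌v , q))))) })
    step-coord⁻ v false P x (l , k) = supp λ ρ h → go ρ h (∋? ρ v)
      where
      go : ∀ ρ → ¬ stepP v false P ρ → ρ ∋ v ⊎ ρ ∌ v → x ρ ≈ 0#
      go ρ h (inj₁ ρ∋v) = killed-vanish v (Level.lower k) ρ ρ∋v
      go ρ h (inj₂ ρ∌v) = vanish l ρ (λ q → h (ρ∌v , ≡.subst P (≡.sym (update-id ρ v ρ∌v)) q))

    step-coord⁺ : ∀ {n} (v : Fin n) s (P : Subset n → Set) → Supp (stepP v s P) ⊆ step (δ v) s (Supp P)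
    step-coord⁺ v true P y p = return (1# , e v y , 1≉0 , supp l , λ σ → begin
        1# * y σ                           ≈⟨ *-identityˡ _ ⟩
        y σ                                ≈⟨ solve 1 (λ a → a := a :- con (0 , 0)) refl _ ⟩
        y σ - 0#                           ≈⟨ +-cong (sym (trans (*-congʳ (δ-same v)) (*-identityˡ _))) (-‿cong (sym (Linear.zero! (e-linear v) kill σ))) ⟩
        δ v v * y σ - e v (∂ (δ v) y) σ    ≈⟨ sym (∂-e (δ v) v y σ) ⟩
        ∂ (δ v) (e v y) σ                  ∎)
      where
      kill : ∂ (δ v) y ≋ 𝟎
      kill σ = ∂δ-local v σ λ _ → vanish p (σ [ v ]≔ true) λ { (h , _) → ∋∌ (update-same σ v true) h }
      l : ∀ τ → ¬ P τ → e v y τ ≈ 0#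
      l τ h = e-zero-local v τ λ τ∋v → vanish p (τ [ v ]≔ false) λ { (_ , q) → h (≡.subst P (≡.trans (update-update τ v) (update-id τ v τ∋v)) q) }
    step-coord⁺ v false P x p = supp l , Level.lift kill
      where
      l : ∀ τ → ¬ P τ → x τ ≈ 0#
      l τ h = vanish p τ λ { (τ∌v , q) → h (≡.subst P (update-id τ v τ∌v) q) }
      kill : ∂ (δ v) x ≋ 𝟎
      kill σ = ∂δ-local v σ λ _ → vanish p (σ [ v ]≔ true) λ { (h , _) → ∋∌ (update-same σ v true) h }

    coords : ∀ {n t} → Vec (Fin n) t → Vec (Fin n → Carrier) t
    coords = Vec.map δ

    procP : ∀ {n t} → Vec (Fin n) t → Subset t → (Subset n → Set) → (Subset n → Set)
    procP []       []      P = P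
    procP (v ∷ us) (s ∷ T) P = stepP v s (procP us T P)

    Proc-coords⁻ : ∀ {n t} (us : Vec (Fin n) t) T (P : Subset n → Set) → Proc (coords us) T (Supp P) ⊆ Supp (procP us T P)
    Proc-coords⁻ []       []      P x p = p
    Proc-coords⁻ (v ∷ us) (s ∷ T) P x p = step-coord⁻ v s (procP us T P) x (step-mono (δ v) s (Proc-coords⁻ us T P) x p)

    Proc-coords⁺ : ∀ {n t} (us : Vec (Fin n) t) T (P : Subset n → Set) → Supp (procP us T P) ⊆ Proc (coords us) T (Supp P)
    Proc-coords⁺ []       []      P x p = p
    Proc-coords⁺ (v ∷ us) (s ∷ T) P x p = step-mono (δ v) s (Proc-coords⁺ us T P) x (step-coord⁺ v s (procP us T P) x p)

    Proc-++ : ∀ {n N N′} (ψ : Vec (Fin n → Carrier) N) (χ : Vec (Fin n → Carrier) N′) S S′ {L : Sub n} →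
      Proc (ψ ++ χ) (S ++ S′) L ≡ Proc ψ S (Proc χ S′ L)
    Proc-++ [] χ [] S′ = ≡.refl
    Proc-++ (φ ∷ ψ) χ (s ∷ S) S′ = ≡.cong (step φ s) (Proc-++ ψ χ S S′)

    Proc-degree : ∀ {n N} (ψ : Vec (Fin n → Carrier) N) S k →
      Proc ψ S (Supp (λ ρ → ∣ ρ ∣ ≡ k)) ⊆ Supp (λ ρ → ∣ ρ ∣ ℕ.+ ∣ S ∣ ≡ k)
    Proc-degree [] [] k x p = supp λ ρ h → vanish p ρ (h ∘ ≡.trans (ℕ.+-identityʳ _))
    Proc-degree (φ ∷ ψ) (false ∷ S) k x (p , _) = Proc-degree ψ S k x p
    Proc-degree (φ ∷ ψ) (true ∷ S) k y p = supp λ ρ h → stable (p >>= λ { (s , x , nz , l , e) → return (cancel nz (trans (e ρ)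
      (∂-zero-local ρ λ v ρ∌v → trans (*-congˡ (vanish (Proc-degree ψ S k x l) (ρ [ v ]≔ true)
        (λ q → h (≡.trans (ℕ.+-suc _ _) (≡.trans (≡.cong (ℕ._+ ∣ S ∣) (≡.sym (card-insert ρ v ρ∌v))) q))))) (zeroʳ _)))) })

    module Complex {n : ℕ} (Δ : Family n) (closed : ∀ σ τ → τ ⊑ σ → σ ∈ᶠ Δ → τ ∈ᶠ Δ) where

      Face : ℕ → Subset n → Set
      Face k ρ = ∣ ρ ∣ ≡ k × ρ ∈ᶠ Δ

      C : ℕ → Sub n
      C k = Supp (Face k)

      ∂-C : ∀ φ k x → C (suc k) x → C k (∂ φ x)
      ∂-C φ k x p = supp λ ρ h → ∂-zero-local ρ λ v ρ∌v → trans (*-congˡ (vanish p (ρ [ v ]≔ true)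
        λ { (c , q) → h (ℕ.suc-injective (≡.trans (≡.sym (card-insert ρ v ρ∌v)) c) , closed _ _ (λ x → update-∋ ρ v) q) })) (zeroʳ _)

      C-isSub : ∀ k → IsSub (C k)
      C-isSub k = Supp-isSub _

      -- Leading sets of a complex are closed under subsets: an image under `∂ φ` also lies in its
      -- kernel, and contraction sends chains of faces to chains of faces, anticommuting with the
      -- remaining steps. The equation between degrees makes up for the omitted contractions.
      Proc-delete : ∀ {N} (ψ : Vec (Fin n → Carrier) N) S S₁ k k₁ → S₁ ⊑ S → k ℕ.+ ∣ S₁ ∣ ≡ k₁ ℕ.+ ∣ S ∣ →
        Proc ψ S (C k) ⊆ Proc ψ S₁ (C k₁)
      Proc-delete [] [] [] k k₁ _ eq = ≡.subst (λ m → C k ⊆ C m) (≡.trans (≡.sym (ℕ.+-identityʳ k)) (≡.trans eq (ℕ.+-identityʳ k₁))) (λ x p → p)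
      Proc-delete (φ ∷ ψ) (false ∷ S) (true ∷ S₁) k k₁ h eq = contradiction (h zero ≡.refl) λ ()
      Proc-delete (φ ∷ ψ) (false ∷ S) (false ∷ S₁) k k₁ h eq = step-mono φ false (Proc-delete ψ S S₁ k k₁ (h ∘ suc) eq)
      Proc-delete (φ ∷ ψ) (true ∷ S) (true ∷ S₁) k k₁ h eq = step-mono φ true (Proc-delete ψ S S₁ k k₁ (h ∘ suc)
        (ℕ.suc-injective (≡.trans (≡.sym (ℕ.+-suc k _)) (≡.trans eq (ℕ.+-suc k₁ _)))))
      Proc-delete (φ ∷ ψ) (true ∷ S) (false ∷ S₁) k k₁ h eq y p = IsSub.stab (Proc-isSub (φ ∷ ψ) (false ∷ S₁) (C-isSub k₁))
        (p >>= λ { (s , x , nz , l , e) → return (IsSub.sat (Proc-isSub (φ ∷ ψ) (false ∷ S₁) (C-isSub k₁)) nz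
          (IsSub.resp (Proc-isSub (φ ∷ ψ) (false ∷ S₁) (C-isSub k₁)) (λ σ → sym (e σ))
            (Proc-∂ ψ φ S₁ (C-isSub k₁) (∂-C φ k₁) x (Proc-delete ψ S S₁ k (suc k₁) (h ∘ suc) (≡.trans eq (ℕ.+-suc k₁ _)) x l) ,
             Level.lift (∂∂ φ x)))) })

      -- The algebraic counterpart of Star.
      Extendable : ℕ → ∀ {N} → Vec (Fin n → Carrier) N → Set (c ⊔ ℓ)
      Extendable M [] = Level.Lift (c ⊔ ℓ) ⊤
      Extendable M {suc N} (φ ∷ ψ) = Extendable M ψ × (∀ q → q ℕ.+ suc N ℕ.≤ M →
        Proc (φ ∷ ψ) (replicate (suc N) false) (C q) ⊆ Proc (φ ∷ ψ) (replicate (suc N) true) (C (q ℕ.+ suc N)))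

      -- The last `j` functionals act innermost, and there `Extendable` exchanges all kernels for
      -- images. The functionals in front of them act afterwards in the same way on both sides, so
      -- monotonicity carries the inclusion outwards.
      Proc-extend : ∀ {M N} (ψ : Vec (Fin n → Carrier) N) → Extendable M ψ → ∀ j S S′ q → j ℕ.≤ N →
        (∀ x → N ℕ.≤ toℕ x ℕ.+ j → S ∌ x × S′ ∋ x) → (∀ x → ¬ (N ℕ.≤ toℕ x ℕ.+ j) → lookup S x ≡ lookup S′ x) →
        q ℕ.+ j ℕ.≤ M → Proc ψ S (C q) ⊆ Proc ψ S′ (C (q ℕ.+ j))
      Proc-extend [] ext zero [] [] q h t nt c x p = ≡.subst (λ m → C m x) (≡.sym (ℕ.+-identityʳ q)) p
      Proc-extend {N = suc N} (φ ∷ ψ) (ext , main) j (s ∷ S) (s′ ∷ S′) q h t nt c with ℕ.m≤n⇒m<n∨m≡n h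
      ... | inj₂ ≡.refl = ≡.subst₂ (λ U U′ → Proc (φ ∷ ψ) U (C q) ⊆ Proc (φ ∷ ψ) U′ (C (q ℕ.+ suc N)))
        none all (main q c)
        where
        none : replicate (suc N) false ≡ s ∷ S
        none = subset-ext λ x → ≡.trans (lookup-replicate x false) (≡.sym (proj₁ (t x (ℕ.m≤n+m (suc N) (toℕ x)))))
        all : replicate (suc N) true ≡ s′ ∷ S′
        all = subset-ext λ x → ≡.trans (lookup-replicate x true) (≡.sym (proj₂ (t x (ℕ.m≤n+m (suc N) (toℕ x)))))
      ... | inj₁ (s≤s j≤N) = ≡.subst (λ b → step φ s (Proc ψ S (C q)) ⊆ step φ b (Proc ψ S′ (C (q ℕ.+ j))))
        (nt zero (ℕ.<⇒≱ (s≤s j≤N)))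
        (step-mono φ s (Proc-extend ψ ext j S S′ q j≤N (λ x p → t (suc x) (s≤s p)) (λ x p → nt (suc x) (p ∘ ℕ.≤-pred)) c))

-- Exactness of the Vandermonde forms on links

module GenericForms where
  open import Defs
  open import Level using (Level; _⊔_) renaming (suc to lsuc)
  import Algebra.Properties.Ring as RingProps
  open import Data.Bool using (true; false; if_then_else_)
  open import Data.Nat as ℕ using (ℕ; zero; suc; z≤n; s≤s)
  import Data.Nat.Properties as ℕ
  open import Data.Fin using (Fin; zero; suc)
  import Data.Fin.Properties as Fin
  open import Data.Fin.Subset using (Subset; ∣_∣)
  open import Data.Vec as Vec using ([]; _∷_; lookup; _[_]≔_; replicate)
  open import Data.Vec.Properties using (lookup-replicate)
  open import Data.Product using (∃; ∃₂; _×_; _,_; proj₁; proj₂)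
  open import Data.Sum using (_⊎_; inj₁; inj₂)
  open import Data.Empty using (⊥-elim)
  open import Function using (_∘_)
  open import Relation.Nullary using (¬_; Dec; yes; no; does)
  open import Relation.Nullary.Negation using (contradiction)
  open import Relation.Nullary.Decidable using (¬¬-excluded-middle)
  open import Relation.Binary.PropositionalEquality as ≡ using (_≡_; _≢_)
  import Relation.Binary.Reasoning.Setoid as SetoidReasoning
  open RingSolving
  open ExteriorAlgebra
  open Subsets
  open Dimension
  open LeadingSets

  Disj : ∀ {n} → Subset n → Subset n → Set
  Disj ρ B = ∀ x → ρ ∋ x → B ∌ x

  module Link {n : ℕ} (Δ : Family n) where
    -- The faces of size `k` in the star of σ inside the link of `B`, expressed by a common face τ
    -- in place of a union.
    SP : Subset n → Subset n → ℕ → Subset n → Set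
    SP B σ k ρ = ∣ ρ ∣ ≡ k × Disj ρ B × ∃ λ τ → τ ∈ᶠ Δ × ρ ⊑ τ × σ ⊑ τ × B ⊑ τ

    LinkP : Subset n → ℕ → Subset n → Set
    LinkP B k ρ = ∣ ρ ∣ ≡ k × Disj ρ B × ∃ λ τ → τ ∈ᶠ Δ × ρ ⊑ τ × B ⊑ τ

  module Generic {κ ℓ : Level} (𝔻 : Domain κ ℓ) {n : ℕ} (Δ : Family n) (d : ℕ)
    (θ : Fin n → Domain.Carrier 𝔻)
    (θ-distinct : ∀ {u v} → u ≢ v → ¬ (Domain._≈_ 𝔻 (Domain._-_ 𝔻 (θ v) (θ u)) (Domain.0# 𝔻)))
    where
    open Domain 𝔻
    open RingProps ring
    open Leading 𝔻
    open IntegerSolver commutativeRing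
    open SetoidReasoning setoid
    open Link Δ

    -- The Vandermonde forms with weights: the i-th one takes the value c(v) times the i-th power of
    -- θ(v). Weights are carried along because eliminating a vertex changes them.
    W : (Fin n → Carrier) → ℕ → Fin n → Carrier
    W c zero    v = c v
    W c (suc i) v = θ v * W c i v

    Killed : (Fin n → Carrier) → ℕ → Ch n → Set ℓ
    Killed c j x = ∀ i → i ℕ.< j → ∂ (W c i) x ≋ 𝟎

    GoodW : Subset n → (Fin n → Carrier) → Set ℓ
    GoodW B c = ∀ v → B ∌ v → Nz (c v)

    -- On the common kernel of the forms before the j-th one, contraction by the j-th form is exact
    -- up to nonzero scalars; for `j = 0` this is weighted acyclicity.
    Exact : Subset n → Subset n → ℕ → ℕ → (Fin n → Carrier) → Set (κ ⊔ ℓ)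
    Exact B σ j k c = ∀ x → Supp (SP B σ k) x → Killed c (suc j) x →
      ¬ ¬ (∃₂ λ s y → Nz s × Supp (SP B σ (suc k)) y × Killed c j y × s ⊙ x ≋ ∂ (W c j) y)

    e-SP : ∀ {B σ u k} → σ ∋ u → B ∌ u → ∀ {x : Ch n} → Supp (λ ρ → ∃ λ v → SP B σ (suc k) (ρ [ v ]≔ true) × ρ ∌ v) x →
      Supp (SP B σ (suc k)) (e u x)
    e-SP {B} {σ} {u} {k} σ∋u B∌u p = supp λ ρ h → e-zero-local u ρ λ ρ∋u → vanish p (ρ [ u ]≔ false) λ {
      (v , (c , disj , τ , τ∈ , ρ⊑ , σ⊑ , B⊑) , ∌v) → h
        ( ≡.trans (card-erase ρ u ρ∋u) (≡.trans (≡.sym (card-insert (ρ [ u ]≔ false) v ∌v)) c)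
        , (λ x ρ∋x → Disj-case ρ v disj x ρ∋x)
        , τ , τ∈ , (λ x ρ∋x → ⊑-case ρ v τ ρ⊑ (σ⊑ u σ∋u) x ρ∋x) , σ⊑ , B⊑) }
      where
      Disj-case : ∀ ρ v → Disj ((ρ [ u ]≔ false) [ v ]≔ true) B → Disj ρ B
      Disj-case ρ v disj x ρ∋x with x Fin.≟ u
      ... | yes ≡.refl = B∌u
      ... | no x≢u = disj x (update-∋ (ρ [ u ]≔ false) v (≡.trans (update-other ρ false x≢u) ρ∋x))
      ⊑-case : ∀ ρ v τ → ((ρ [ u ]≔ false) [ v ]≔ true) ⊑ τ → τ ∋ u → ρ ⊑ τ
      ⊑-case ρ v τ h τ∋u x ρ∋x with x Fin.≟ u
      ... | yes ≡.refl = τ∋u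
      ... | no x≢u = h x (update-∋ (ρ [ u ]≔ false) v (≡.trans (update-other ρ false x≢u) ρ∋x))

    -- On the star of u, eliminating u from the forms W c i leaves forms of the same
    -- Vandermonde shape on the link of u, with weights c v * (θ v - θ u).
    module StarStep (B σ : Subset n) (u : Fin n) (σ∋u : σ ∋ u) (B∌u : B ∌ u)
                    (c : Fin n → Carrier) (good : GoodW B c) where
      cu = c u
      Nz-cu : Nz cu
      Nz-cu = good u B∌u

      -- The star of `u` is a cone with apex `u`, and `e u` contracts it because the weight at `u`
      -- is nonzero.
      exact-0 : ∀ k → Exact B σ 0 k c
      exact-0 k x p kill = return (cu , e u x , Nz-cu , supp′ , (λ _ ()) , λ ρ → begin
        cu * x ρ                           ≈⟨ solve 1 (λ a → a := a :- con (0 , 0)) refl _ ⟩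
        cu * x ρ - 0#                      ≈⟨ +-congˡ (-‿cong (sym (Linear.zero! (e-linear u) (kill 0 (s≤s z≤n)) ρ))) ⟩
        cu * x ρ - e u (∂ c x) ρ           ≈⟨ sym (∂-e c u x ρ) ⟩
        ∂ c (e u x) ρ                      ∎)
        where
        supp′ : Supp (SP B σ (suc k)) (e u x)
        supp′ = supp λ ρ h → e-zero-local u ρ λ ρ∋u → vanish p (ρ [ u ]≔ false) λ {
          (cd , disj , τ , τ∈ , ρ⊑ , σ⊑ , B⊑) → h (≡.trans (card-erase ρ u ρ∋u) (≡.cong suc cd)
            , (λ x ρ∋x → D′ ρ disj x ρ∋x) , τ , τ∈ , (λ x ρ∋x → L′ ρ τ ρ⊑ (σ⊑ u σ∋u) x ρ∋x) , σ⊑ , B⊑) }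
          where
          D′ : ∀ ρ → Disj (ρ [ u ]≔ false) B → Disj ρ B
          D′ ρ disj x ρ∋x with x Fin.≟ u
          ... | yes ≡.refl = B∌u
          ... | no x≢u = disj x (≡.trans (update-other ρ false x≢u) ρ∋x)
          L′ : ∀ ρ τ → (ρ [ u ]≔ false) ⊑ τ → τ ∋ u → ρ ⊑ τ
          L′ ρ τ h τ∋u x ρ∋x with x Fin.≟ u
          ... | yes ≡.refl = τ∋u
          ... | no x≢u = h x (≡.trans (update-other ρ false x≢u) ρ∋x)

      B′ = B [ u ]≔ true
      c′ : Fin n → Carrier
      c′ v = c v * (θ v - θ u)

      -- Distinctness of the θ enters here: eliminating `u` multiplies the weight of `v` by
      -- `θ v - θ u`.
      good′ : GoodW B′ c′
      good′ v B′∌v = Nz-* (good v (B∌v (v Fin.≟ u))) (θ-distinct v≢u)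
        where
        v≢u : u ≢ v
        v≢u ≡.refl = ∋∌ (update-same B u true) B′∌v
        B∌v : Dec (v ≡ u) → B ∌ v
        B∌v (yes ≡.refl) = B∌u
        B∌v (no v≢u) = ≡.trans (≡.sym (update-other B true v≢u)) B′∌v

      W′ : ∀ i v → W c′ i v ≈ 1# * W c (suc i) v - θ u * W c i v
      W′ zero v = trans (solve 3 (λ c t s → c :* (t :- s) := t :* c :- s :* c) refl (c v) (θ v) (θ u))
        (+-congʳ (sym (*-identityˡ _)))
      W′ (suc i) v = begin
        θ v * W c′ i v                                    ≈⟨ *-congˡ (W′ i v) ⟩
        θ v * (1# * W c (suc i) v - θ u * W c i v)        ≈⟨ *-congˡ (+-congʳ (*-identityˡ _)) ⟩
        θ v * (W c (suc i) v - θ u * W c i v)             ≈⟨ solve 4 (λ t w s z → t :* (w :- s :* z) := t :* w :- s :* (t :* z)) refl _ _ _ _ ⟩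
        W c (suc (suc i)) v - θ u * W c (suc i) v         ≈⟨ +-congʳ (sym (*-identityˡ _)) ⟩
        1# * W c (suc (suc i)) v - θ u * W c (suc i) v    ∎

      D : ℕ → Ch n → Ch n
      D i = ∂ (W c i)
      D′ : ℕ → Ch n → Ch n
      D′ i = ∂ (W c′ i)
      module Dl i = Linear (∂-linear (W c i))

      D′≋ : ∀ i x ρ → D′ i x ρ ≈ D (suc i) x ρ - θ u * D i x ρ
      D′≋ i x ρ = trans (∂-cong (W′ i) (λ _ → refl) ρ) (trans (∂-functional 1# (θ u) (W c (suc i)) (W c i) x ρ) (+-congʳ (*-identityˡ _)))

      W′u : ∀ i → W c′ i u ≈ 0#
      W′u i = trans (W′ i u) (trans (+-congʳ (*-identityˡ _)) (-‿inverseʳ _))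

      module Step (j k : ℕ) (ih : Exact B′ σ j k c′) (x : Ch n) (p : Supp (SP B σ k) x) (kill : Killed c (suc (suc j)) x) where
        ι = ∂ (δ u)
        -- The part of `x` on the sets avoiding `u`; the rest of `x` is `e u (ι x)`.
        x₀ = ι (e u x)

        x₀+ : ∀ ρ → x₀ ρ + e u (ι x) ρ ≈ x ρ
        x₀+ ρ = trans (+-congʳ (∂-e (δ u) u x ρ)) (trans (solve 2 (λ a b → (a :- b) :+ b := a) refl _ _)
          (trans (*-congʳ (δ-same u)) (*-identityˡ _)))

        D′x : ∀ i → i ℕ.< suc j → D′ i x ≋ 𝟎
        D′x i i<j ρ = trans (D′≋ i x ρ) (trans (+-cong (kill (suc i) (s≤s i<j) ρ) (-‿cong (trans (*-congˡ (kill i (ℕ.<-trans i<j (ℕ.n<1+n _)) ρ)) (zeroʳ _)))) (-‿inverseʳ 0#))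

        kill₀ : Killed c′ (suc j) x₀
        kill₀ i i<j = ∂-swap (W c′ i) (δ u) λ ρ → trans (∂-e (W c′ i) u x ρ)
          (trans (+-cong (trans (*-congʳ (W′u i)) (zeroˡ _)) (-‿cong (Linear.zero! (e-linear u) (D′x i i<j) ρ))) (-‿inverseʳ 0#))

        supp₀ : Supp (SP B′ σ k) x₀
        supp₀ = supp λ ρ h → go ρ h (∋? ρ u)
          where
          go : ∀ ρ → ¬ SP B′ σ k ρ → ρ ∋ u ⊎ ρ ∌ u → x₀ ρ ≈ 0#
          go ρ h (inj₁ ρ∋u) = ∂δ-vanish u (e u x) ρ ρ∋u
          go ρ h (inj₂ ρ∌u) = begin
            x₀ ρ                        ≈⟨ sym (+-identityʳ _) ⟩
            x₀ ρ + 0#                   ≈⟨ +-congˡ (sym (e-zero-local u ρ (λ ρ∋u → ∋∌ ρ∋u ρ∌u))) ⟩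
            x₀ ρ + e u (ι x) ρ          ≈⟨ x₀+ ρ ⟩
            x ρ                         ≈⟨ vanish p ρ (λ { (cd , disj , τ , τ∈ , ρ⊑ , σ⊑ , B⊑) → h (cd ,
                (λ v ρ∋v → ≡.trans (update-other B true (∋∌⇒≢ ρ ρ∋v ρ∌u)) (disj v ρ∋v)) ,
                τ , τ∈ , ρ⊑ , σ⊑ , λ v B′∋v → back τ B⊑ (σ⊑ u σ∋u) v (update-∋⁻ B u B′∋v)) }) ⟩
            0#                          ∎
            where
            back : ∀ τ → B ⊑ τ → τ ∋ u → ∀ v → v ≡ u ⊎ B ∋ v → τ ∋ v
            back τ B⊑ τ∋u v (inj₁ ≡.refl) = τ∋u
            back τ B⊑ τ∋u v (inj₂ B∋v) = B⊑ v B∋v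

        module _ (s : Carrier) (y′ : Ch n) (sp′ : Supp (SP B′ σ (suc k)) y′) (kill′ : Killed c′ j y′)
                 (eq′ : s ⊙ x₀ ≋ D′ j y′) where
          -- The term `e u z` is chosen so that `D 0` kills `y`. Since `D′ i` kills `y′` for
          -- `i < j`, each `cu ⊙ D i y′` with `i ≤ j` is the multiple `a i ⊙ z`, so the same
          -- correction makes all these `D i` kill `y`.
          z = D 0 y′
          y = (cu ⊙ y′) ⊖ e u z
          a : ℕ → Carrier
          a i = W c i u

          up : ∀ i → i ℕ.< j → ∀ ρ → D (suc i) y′ ρ ≈ θ u * D i y′ ρ
          up i i<j ρ = begin
            D (suc i) y′ ρ                                           ≈⟨ solve 2 (λ a b → a := (a :- b) :+ b) refl _ _ ⟩
            (D (suc i) y′ ρ - θ u * D i y′ ρ) + θ u * D i y′ ρ       ≈⟨ +-congʳ (trans (sym (D′≋ i y′ ρ)) (kill′ i i<j ρ)) ⟩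
            0# + θ u * D i y′ ρ                                      ≈⟨ +-identityˡ _ ⟩
            θ u * D i y′ ρ                                           ∎

          prop : ∀ i → i ℕ.≤ j → ∀ ρ → cu * D i y′ ρ ≈ a i * z ρ
          prop zero h ρ = refl
          prop (suc i) h ρ = begin
            cu * D (suc i) y′ ρ      ≈⟨ *-congˡ (up i h ρ) ⟩
            cu * (θ u * D i y′ ρ)    ≈⟨ solve 3 (λ c t d → c :* (t :* d) := t :* (c :* d)) refl _ _ _ ⟩
            θ u * (cu * D i y′ ρ)    ≈⟨ *-congˡ (prop i (ℕ.<⇒≤ h) ρ) ⟩
            θ u * (a i * z ρ)        ≈⟨ sym (*-assoc _ _ _) ⟩
            a (suc i) * z ρ          ∎

          Dz : ∀ i → i ℕ.≤ j → D i z ≋ 𝟎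
          Dz i h ρ = cancel Nz-cu (begin
            cu * D i (D 0 y′) ρ        ≈⟨ *-congˡ (∂-anticomm (W c i) (W c 0) y′ ρ) ⟩
            cu * - D 0 (D i y′) ρ      ≈⟨ sym (-‿distribʳ-* _ _) ⟩
            - (cu * D 0 (D i y′) ρ)    ≈⟨ -‿cong (sym (Dl.scal 0 cu (D i y′) ρ)) ⟩
            - D 0 (cu ⊙ D i y′) ρ      ≈⟨ -‿cong (Dl.cong 0 (prop i h) ρ) ⟩
            - D 0 (a i ⊙ z) ρ          ≈⟨ -‿cong (trans (Dl.scal 0 (a i) z ρ) (trans (*-congˡ (∂∂ (W c 0) y′ ρ)) (zeroʳ _))) ⟩
            - 0#                       ≈⟨ -0#≈0# ⟩
            0#                         ∎)

          Dy : ∀ i ρ → D i y ρ ≈ cu * D i y′ ρ - (a i * z ρ - e u (D i z) ρ)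
          Dy i ρ = trans (Dl.sub i _ _ ρ) (+-cong (Dl.scal i cu y′ ρ) (-‿cong (∂-e (W c i) u z ρ)))

          kill-y : Killed c (suc j) y
          kill-y i (s≤s h) ρ = trans (Dy i ρ) (trans (+-cong (prop i h ρ) (-‿cong (+-congˡ (-‿cong (Linear.zero! (e-linear u) (Dz i h) ρ)))))
            (solve 1 (λ a → a :- (a :- con (0 , 0)) := con (0 , 0)) refl _))

          D0x₀ : ∀ ρ → D 0 x₀ ρ ≈ - (cu * ι x ρ)
          D0x₀ ρ = begin
            D 0 (ι (e u x)) ρ          ≈⟨ ∂-anticomm (W c 0) (δ u) (e u x) ρ ⟩
            - ι (D 0 (e u x)) ρ        ≈⟨ -‿cong (Linear.cong (∂-linear (δ u)) (λ τ → trans (∂-e (W c 0) u x τ)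
                                            (trans (+-congˡ (-‿cong (Linear.zero! (e-linear u) (kill 0 (s≤s z≤n)) τ)))
                                              (solve 1 (λ a → a :- con (0 , 0) := a) refl _))) ρ) ⟩
            - ι (cu ⊙ x) ρ             ≈⟨ -‿cong (Linear.scal (∂-linear (δ u)) cu x ρ) ⟩
            - (cu * ι x ρ)             ∎

          Dtop : ∀ ρ → D (suc j) y′ ρ ≈ s * x₀ ρ + θ u * D j y′ ρ
          Dtop ρ = trans (solve 2 (λ a b → a := (a :- b) :+ b) refl _ (θ u * D j y′ ρ)) (+-congʳ (trans (sym (D′≋ j y′ ρ)) (sym (eq′ ρ))))

          Dtop-z : ∀ ρ → D (suc j) z ρ ≈ s * (cu * ι x ρ)
          Dtop-z ρ = begin
            D (suc j) (D 0 y′) ρ                             ≈⟨ ∂-anticomm (W c (suc j)) (W c 0) y′ ρ ⟩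
            - D 0 (D (suc j) y′) ρ                           ≈⟨ -‿cong (trans (Dl.cong 0 Dtop ρ) (trans (Dl.add 0 _ _ ρ) (+-cong (Dl.scal 0 s x₀ ρ) (Dl.scal 0 (θ u) _ ρ)))) ⟩
            - (s * D 0 x₀ ρ + θ u * D 0 (D j y′) ρ)          ≈⟨ -‿cong (+-cong (*-congˡ (D0x₀ ρ)) (trans (*-congˡ (trans (∂-anticomm (W c 0) (W c j) y′ ρ) (trans (-‿cong (Dz j ℕ.≤-refl ρ)) -0#≈0#))) (zeroʳ _))) ⟩
            - (s * - (cu * ι x ρ) + 0#)                      ≈⟨ solve 2 (λ s b → :- (s :* (:- b) :+ con (0 , 0)) := s :* b) refl _ _ ⟩
            s * (cu * ι x ρ)                                 ∎

          result : (cu * s) ⊙ x ≋ D (suc j) y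
          result ρ = sym (begin
            D (suc j) y ρ                                                              ≈⟨ Dy (suc j) ρ ⟩
            cu * D (suc j) y′ ρ - (a (suc j) * z ρ - e u (D (suc j) z) ρ)              ≈⟨ +-cong (*-congˡ (Dtop ρ)) (-‿cong (+-congˡ (-‿cong (trans (e-cong u Dtop-z ρ)
                                                                                          (trans (Linear.scal (e-linear u) s _ ρ) (*-congˡ (Linear.scal (e-linear u) cu _ ρ))))))) ⟩
            cu * (s * x₀ ρ + θ u * D j y′ ρ) - (a (suc j) * z ρ - s * (cu * e u (ι x) ρ)) ≈⟨ +-congˡ (-‿cong (+-congʳ (trans (*-assoc _ _ _) (*-congˡ (sym (prop j ℕ.≤-refl ρ)))))) ⟩
            cu * (s * x₀ ρ + θ u * D j y′ ρ) - (θ u * (cu * D j y′ ρ) - s * (cu * e u (ι x) ρ))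
              ≈⟨ solve 6 (λ c s x t d e → c :* (s :* x :+ t :* d) :- (t :* (c :* d) :- s :* (c :* e)) := (c :* s) :* (x :+ e)) refl cu s (x₀ ρ) (θ u) (D j y′ ρ) (e u (ι x) ρ) ⟩
            (cu * s) * (x₀ ρ + e u (ι x) ρ)                                            ≈⟨ *-congˡ (x₀+ ρ) ⟩
            (cu * s) * x ρ                                                             ∎)

          B′⇒B : ∀ {k} ρ → SP B′ σ k ρ → SP B σ k ρ
          B′⇒B ρ (cd , disj , τ , τ∈ , ρ⊑ , σ⊑ , B⊑) = cd , (λ v ρ∋v → shrink v (disj v ρ∋v)) , τ , τ∈ , ρ⊑ , σ⊑ , λ v B∋v → B⊑ v (update-∋ B u B∋v)
            where
            shrink : ∀ v → B′ ∌ v → B ∌ v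
            shrink v h with ∋? B v
            ... | inj₁ B∋v = ∋∌ (update-∋ B u B∋v) h
            ... | inj₂ q = q

          supp-y : Supp (SP B σ (suc k)) y
          supp-y = IsSub.sub (Supp-isSub _) (IsSub.scal (Supp-isSub _) cu (supp λ ρ h → vanish sp′ ρ (h ∘ B′⇒B ρ)))
            (e-SP {B} {σ} {u} {k} σ∋u B∌u {z} (supp λ ρ h → ∂-zero-local {φ = W c 0} {y′} ρ λ v ρ∌v →
              trans (*-congˡ (vanish sp′ (ρ [ v ]≔ true) (λ q → h (v , B′⇒B (ρ [ v ]≔ true) q , ρ∌v)))) (zeroʳ _)))

      exact-suc : ∀ j k → Exact B′ σ j k c′ → Exact B σ (suc j) k c
      exact-suc j k ih x p kill = ih x₀ supp₀ kill₀ >>= λ { (s , y′ , nz , sp′ , kill′ , eq′) →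
        return (cu * s , y s y′ sp′ kill′ eq′ , Nz-* Nz-cu nz , supp-y s y′ sp′ kill′ eq′ , kill-y s y′ sp′ kill′ eq′ , result s y′ sp′ kill′ eq′) }
        where open Step j k ih x p kill

    U : ℕ → Set κ
    U m = Subset m → Ch n

    one : ∀ {m} → Fin m → Carrier
    one _ = 1#

    ∂′ : ∀ {m} → U m → U m
    ∂′ u σ ρ = ∂ one (λ τ → u τ ρ) σ

    -- The operators act on different variables and no sign is inserted, so they commute strictly.
    ∂′-commute : ∀ {m} {D : Ch n → Ch n} → Linear D → (u : U m) → ∀ σ → D (∂′ u σ) ≋ ∂′ (λ τ → D (u τ)) σ
    ∂′-commute {D = D} lin u [] = Linear.zero! lin (λ _ → refl)
    ∂′-commute {D = D} lin u (false ∷ σ) ρ = trans (Linear.add lin _ _ ρ)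
      (+-cong (Linear.scal lin 1# _ ρ) (∂′-commute lin (u ∘ (false ∷_)) σ ρ))
    ∂′-commute {D = D} lin u (true ∷ σ) ρ = trans (Linear.neg lin _ ρ) (-‿cong (∂′-commute lin (u ∘ (true ∷_)) σ ρ))

    -- Clears denominators: the scalars belonging to the finitely many σ are replaced by a product
    -- of them.
    common : ∀ {m q} {Q : Subset m → Carrier → Set q} → (∀ σ s t → Nz t → Q σ s → Q σ (t * s)) →
      (∀ σ s t → s ≈ t → Q σ s → Q σ t) → (∀ σ → ∃ λ s → Nz s × Q σ s) → ∃ λ s → Nz s × (∀ σ → Q σ s)
    common {zero} mul resp h with h []
    ... | s , nz , q = s , nz , λ { [] → q }
    common {suc m} {Q = Q} mul resp h
      with common {Q = Q ∘ (false ∷_)} (mul ∘ (false ∷_)) (resp ∘ (false ∷_)) (h ∘ (false ∷_))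
         | common {Q = Q ∘ (true ∷_)} (mul ∘ (true ∷_)) (resp ∘ (true ∷_)) (h ∘ (true ∷_))
    ... | s , nz , q | t , nz′ , q′ = s * t , Nz-* nz nz′ , λ where
      (false ∷ σ) → resp (false ∷ σ) (t * s) (s * t) (*-comm t s) (mul (false ∷ σ) s t nz′ (q σ))
      (true ∷ σ)  → mul (true ∷ σ) t s nz (q′ σ)

    -- The double complex of pairs (σ , ρ) spanning a face of the link of B.  Its
    -- columns σ ≠ ∅ are handled by StarStep, its rows by homology (ρ = ∅) or by a
    -- cone construction (ρ ≠ ∅), and the column σ = ∅ follows by a diagram chase.
    module Double (B : Subset n) (c : Fin n → Carrier)
      (col₁ : ∀ σ u → σ ∋ u → B ∌ u → ∀ j q → ∣ B ∣ ℕ.+ (q ℕ.+ suc j) ℕ.≤ d → Exact B σ j q c)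
      (hom : ∀ p → ∣ B ∣ ℕ.+ p ℕ.< d → ∀ x → Supp (LinkP B p) x → ∂ one x ≋ 𝟎 →
        ¬ ¬ (∃ λ b → Supp (LinkP B (suc p)) b × x ≋ ∂ one b)) where

      -- Bidegree (p , q) of the double complex. σ and ρ may share vertices, since only a common
      -- face containing both is demanded; this is what makes rows and columns stars.
      TT : ℕ → ℕ → Subset n → Subset n → Set
      TT p q σ ρ = ∣ σ ∣ ≡ p × ∣ ρ ∣ ≡ q × Disj σ B × Disj ρ B × ∃ λ τ → τ ∈ᶠ Δ × σ ⊑ τ × ρ ⊑ τ × B ⊑ τ

      T : ℕ → ℕ → U n → Set ℓ
      T p q u = ∀ σ ρ → ¬ TT p q σ ρ → u σ ρ ≈ 0#

      KilledU : ℕ → U n → Set ℓ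
      KilledU j u = ∀ σ → Killed c j (u σ)

      infixr 7 _⊙ᵤ_
      _⊙ᵤ_ : Carrier → U n → U n
      (s ⊙ᵤ u) σ = s ⊙ u σ

      D : ℕ → Ch n → Ch n
      D i = ∂ (W c i)
      module Dl i = Linear (∂-linear (W c i))
      module ∂₁ = Linear (∂-linear {n} one)

      T-scal : ∀ {p q} s u → T p q u → T p q (s ⊙ᵤ u)
      T-scal s u t σ ρ h = trans (*-congˡ (t σ ρ h)) (zeroʳ s)

      T-sub : ∀ {p q} u v → T p q u → T p q v → T p q (λ σ → u σ ⊖ v σ)
      T-sub u v t t′ σ ρ h = trans (+-cong (t σ ρ h) (-‿cong (t′ σ ρ h))) (-‿inverseʳ 0#)

      T-D : ∀ {p q} φ u → T p (suc q) u → T p q (λ σ → ∂ φ (u σ))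
      T-D φ u t σ ρ h = ∂-zero-local ρ λ v ρ∌v → trans (*-congˡ (t σ (ρ [ v ]≔ true) λ where
        (cσ , cρ , dσ , dρ , τ , τ∈ , σ⊑ , ρ⊑ , B⊑) → h (cσ , ℕ.suc-injective (≡.trans (≡.sym (card-insert ρ v ρ∌v)) cρ) , dσ ,
          (λ x ρ∋x → dρ x (update-∋ ρ v ρ∋x)) , τ , τ∈ , σ⊑ , (λ x ρ∋x → ρ⊑ x (update-∋ ρ v ρ∋x)) , B⊑))) (zeroʳ _)

      T-D0 : ∀ {p} φ u → T p 0 u → ∀ σ → ∂ φ (u σ) ≋ 𝟎
      T-D0 φ u t σ ρ = ∂-zero-local ρ λ v ρ∌v → trans (*-congˡ (t σ (ρ [ v ]≔ true) λ { (_ , cρ , _) →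
        contradiction (≡.trans (≡.sym (card-insert ρ v ρ∌v)) cρ) λ () })) (zeroʳ _)

      T-∂′ : ∀ {p q} u → T (suc p) q u → T p q (∂′ u)
      T-∂′ u t σ ρ h = ∂-zero-local σ λ v σ∌v → trans (*-congˡ (t (σ [ v ]≔ true) ρ λ where
        (cσ , cρ , dσ , dρ , τ , τ∈ , σ⊑ , ρ⊑ , B⊑) → h (ℕ.suc-injective (≡.trans (≡.sym (card-insert σ v σ∌v)) cσ) , cρ ,
          (λ x σ∋x → dσ x (update-∋ σ v σ∋x)) , dρ , τ , τ∈ , (λ x σ∋x → σ⊑ x (update-∋ σ v σ∋x)) , ρ⊑ , B⊑))) (zeroʳ _)

      KilledU-∂′ : ∀ {j} u → KilledU j u → KilledU j (∂′ u)
      KilledU-∂′ u k σ i i<j ρ = trans (∂′-commute (∂-linear (W c i)) u σ ρ) (∂₁.zero! (λ τ → k τ i i<j ρ) σ)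

      KilledU-scal : ∀ {j} s u → KilledU j u → KilledU j (s ⊙ᵤ u)
      KilledU-scal s u k σ i i<j ρ = trans (Dl.scal i s _ ρ) (trans (*-congˡ (k σ i i<j ρ)) (zeroʳ s))

      KilledU-sub : ∀ {j} u v → KilledU j u → KilledU j v → KilledU j (λ σ → u σ ⊖ v σ)
      KilledU-sub u v k k′ σ i i<j ρ = trans (Dl.sub i _ _ ρ) (trans (+-cong (k σ i i<j ρ) (-‿cong (k′ σ i i<j ρ))) (-‿inverseʳ 0#))

      KilledU-D : ∀ {j} u → KilledU j u → KilledU (suc j) (λ σ → D j (u σ))
      KilledU-D {j} u k σ i i<j ρ with ℕ.m≤n⇒m<n∨m≡n (ℕ.≤-pred i<j)
      ... | inj₁ lt = ∂-swap (W c i) (W c j) (k σ i lt) ρ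
      ... | inj₂ ≡.refl = ∂∂ (W c i) (u σ) ρ

      KilledU-suc : ∀ {j} u → KilledU j u → (∀ σ → D j (u σ) ≋ 𝟎) → KilledU (suc j) u
      KilledU-suc u k h σ i i<j ρ with ℕ.m≤n⇒m<n∨m≡n (ℕ.≤-pred i<j)
      ... | inj₁ lt = k σ i lt ρ
      ... | inj₂ ≡.refl = h σ ρ

      KilledU-pred : ∀ {j} u → KilledU (suc j) u → KilledU j u
      KilledU-pred u k σ i i<j = k σ i (ℕ.m≤n⇒m≤1+n i<j)

      col : ∀ j q → ∣ B ∣ ℕ.+ (q ℕ.+ suc j) ℕ.≤ d → ∀ p u → T (suc p) q u → KilledU (suc j) u →
        ¬ ¬ (∃₂ λ s y → Nz s × T (suc p) (suc q) y × KilledU j y × (∀ σ → s ⊙ u σ ≋ D j (y σ)))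
      col j q h p u t k = ¬¬-∀Subset {P = λ σ → ∃ λ s → Nz s × Q σ s} each >>= λ all →
        let (s , nz , w) = common {Q = Q} mul resp all in
        return (s , (λ σ → proj₁ (w σ)) , nz , (λ σ → proj₁ (proj₂ (w σ))) , (λ σ → proj₁ (proj₂ (proj₂ (w σ)))) , (λ σ → proj₂ (proj₂ (proj₂ (w σ)))))
        where
        Q : Subset n → Carrier → Set (κ ⊔ ℓ)
        Q σ s = ∃ λ y → (∀ ρ → ¬ TT (suc p) (suc q) σ ρ → y ρ ≈ 0#) × Killed c j y × s ⊙ u σ ≋ D j y
        mul : ∀ σ s t → Nz t → Q σ s → Q σ (t * s)
        mul σ s a nz (y , sy , ky , eq) = a ⊙ y , (λ ρ h → trans (*-congˡ (sy ρ h)) (zeroʳ a)) ,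
          (λ i i<j ρ → trans (Dl.scal i a y ρ) (trans (*-congˡ (ky i i<j ρ)) (zeroʳ a))) ,
          λ ρ → trans (*-assoc a s _) (trans (*-congˡ (eq ρ)) (sym (Dl.scal j a y ρ)))
        resp : ∀ σ s t → s ≈ t → Q σ s → Q σ t
        resp σ s t s≈t (y , sy , ky , eq) = y , sy , ky , λ ρ → trans (*-congʳ (sym s≈t)) (eq ρ)
        each : ∀ σ → ¬ ¬ (∃ λ s → Nz s × Q σ s)
        each σ = ¬¬-excluded-middle {A = ∣ σ ∣ ≡ suc p × Disj σ B} >>= λ {
          (no bad) → return (outside bad)
          ; (yes (cσ , dσ)) → let (v , σ∋v) = ∃∋ σ (≡.subst (0 ℕ.<_) (≡.sym cσ) (s≤s z≤n)) in
            col₁ σ v σ∋v (dσ v σ∋v) j q h (u σ)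
              (supp λ ρ out → t σ ρ λ { (_ , cρ , _ , dρ , τ , τ∈ , σ⊑ , ρ⊑ , B⊑) → out (cρ , dρ , τ , τ∈ , ρ⊑ , σ⊑ , B⊑) })
              (k σ) >>= λ { (s , y , nz , sy , ky , eq) → return (s , nz , y ,
                (λ ρ out → vanish sy ρ λ { (cρ , dρ , τ , τ∈ , ρ⊑ , σ⊑ , B⊑) → out (cσ , cρ , dσ , dρ , τ , τ∈ , σ⊑ , ρ⊑ , B⊑) }) , ky , eq) } }
          where
          outside : ¬ (∣ σ ∣ ≡ suc p × Disj σ B) → ∃ λ s → Nz s × Q σ s
          outside bad = 1# , 1≉0 , 𝟎 , (λ _ _ → refl) , (λ i _ → Dl.zero! i (λ _ → refl)) , λ ρ →
            trans (*-congˡ (t σ ρ λ { (cσ , _ , dσ , _) → bad (cσ , dσ) })) (trans (zeroʳ 1#) (sym (Dl.zero! j (λ _ → refl) ρ)))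

      Row : ℕ → ℕ → ℕ → Set (κ ⊔ ℓ)
      Row j p q = ∀ u → T p q u → KilledU j u → (∀ σ ρ → ∂′ u σ ρ ≈ 0#) →
        ¬ ¬ (∃₂ λ s v → Nz s × T (suc p) q v × KilledU j v × (∀ σ ρ → s * u σ ρ ≈ ∂′ v σ ρ))

      ∅ : Subset n
      ∅ = replicate n false

      ∅-unique : ∀ (ρ : Subset n) → ∣ ρ ∣ ≡ 0 → ρ ≡ ∅
      ∅-unique ρ h = subset-ext λ x → ≡.trans (0-card ρ h x) (≡.sym (lookup-replicate x false))

      -- With ρ empty these are ordinary chains on the link of `B`. The forms impose no condition,
      -- as contraction vanishes in degree 0.
      row-0 : ∀ j p → ∣ B ∣ ℕ.+ p ℕ.< d → Row j p 0
      row-0 j p h u t k closed = hom p h (λ σ → u σ ∅) (supp λ σ out → t σ ∅ λ {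
          (cσ , _ , dσ , _ , τ , τ∈ , σ⊑ , _ , B⊑) → out (cσ , dσ , τ , τ∈ , σ⊑ , B⊑) }) (λ σ → closed σ ∅) >>= λ { (b , sb , eq) →
        let v : U n
            v = λ σ ρ → if does (ρ ≟ˢ ∅) then b σ else 0#
            Tv : T (suc p) 0 v
            Tv = tv b sb
        in return (1# , v , 1≉0 , Tv , (λ σ i _ → T-D0 (W c i) v Tv σ) , λ σ ρ → at b eq σ ρ) }
        where
        tv : ∀ b → Supp (LinkP B (suc p)) b → ∀ σ ρ → ¬ TT (suc p) 0 σ ρ → (if does (ρ ≟ˢ ∅) then b σ else 0#) ≈ 0#
        tv b sb σ ρ out with ρ ≟ˢ ∅
        ... | no _ = refl
        ... | yes ≡.refl = vanish sb σ λ where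
          (cσ , dσ , τ , τ∈ , σ⊑ , B⊑) → out (cσ , card-0 ∅ (λ x → lookup-replicate x false) , dσ ,
            (λ x h → ∋∌ h (lookup-replicate x false)) , τ , τ∈ , σ⊑ , (λ x h → ∋∌ h (lookup-replicate x false)) , B⊑)
        at : ∀ b → (∀ σ → u σ ∅ ≈ ∂ one b σ) → ∀ σ ρ → 1# * u σ ρ ≈ ∂ one (λ τ → if does (ρ ≟ˢ ∅) then b τ else 0#) σ
        at b eq σ ρ with ρ ≟ˢ ∅
        ... | yes ≡.refl = trans (*-identityˡ _) (eq σ)
        ... | no ρ≢∅ = trans (*-identityˡ _) (trans (t σ ρ λ { (_ , cρ , _) → ρ≢∅ (∅-unique ρ cρ) }) (sym (∂₁.zero! (λ _ → refl) σ)))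

      -- For ρ nonempty the faces spanning a face with ρ form a cone.
      row-cone : ∀ p q → Row 0 p (suc q)
      row-cone p q u t k closed = return (1# , v , 1≉0 , Tv , (λ σ i ()) , λ σ ρ → eqv σ ρ)
        where
        pickV : Subset n → Ch n → Ch n
        pickV ρ x with ∣ ρ ∣ ℕ.≟ suc q
        ... | yes h = e (proj₁ (∃∋ ρ (≡.subst (0 ℕ.<_) (≡.sym h) (s≤s z≤n)))) x
        ... | no _ = 𝟎
        v : U n
        v σ ρ = pickV ρ (λ τ → u τ ρ) σ
        eqv : ∀ σ ρ → 1# * u σ ρ ≈ ∂ one (pickV ρ (λ τ → u τ ρ)) σ
        eqv σ ρ with ∣ ρ ∣ ℕ.≟ suc q
        ... | no h = trans (*-identityˡ _) (trans (t σ ρ λ { (_ , cρ , _) → h cρ }) (sym (∂₁.zero! (λ _ → refl) σ)))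
        ... | yes h = sym (begin
          ∂ one (e y x) σ             ≈⟨ ∂-e one y x σ ⟩
          1# * x σ - e y (∂ one x) σ  ≈⟨ +-congˡ (-‿cong (Linear.zero! (e-linear y) (λ τ → closed τ ρ) σ)) ⟩
          1# * x σ - 0#               ≈⟨ solve 1 (λ a → a :- con (0 , 0) := a) refl _ ⟩
          1# * x σ                    ∎)
          where
          y = proj₁ (∃∋ ρ (≡.subst (0 ℕ.<_) (≡.sym h) (s≤s z≤n)))
          x : Ch n
          x τ = u τ ρ
        Tv : T (suc p) (suc q) v
        Tv σ ρ out with ∣ ρ ∣ ℕ.≟ suc q
        ... | no _ = refl
        ... | yes h = e-zero-local y σ λ σ∋y → t (σ [ y ]≔ false) ρ λ {
            (cσ , cρ , dσ , dρ , τ , τ∈ , σ⊑ , ρ⊑ , B⊑) → out (≡.trans (card-erase σ y σ∋y) (≡.cong suc cσ) , cρ ,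
              (λ x σ∋x → restore (λ x → B ∌ x) (dρ y ρ∋y) dσ x (x Fin.≟ y) σ∋x) , dρ , τ , τ∈ ,
              (λ x σ∋x → restore (τ ∋_) (ρ⊑ y ρ∋y) σ⊑ x (x Fin.≟ y) σ∋x) , ρ⊑ , B⊑) }
          where
          y = proj₁ (∃∋ ρ (≡.subst (0 ℕ.<_) (≡.sym h) (s≤s z≤n)))
          ρ∋y = proj₂ (∃∋ ρ (≡.subst (0 ℕ.<_) (≡.sym h) (s≤s z≤n)))
          restore : (P : Fin n → Set) → P y → (∀ x → (σ [ y ]≔ false) ∋ x → P x) → ∀ x → Dec (x ≡ y) → σ ∋ x → P x
          restore P py ps x (yes ≡.refl) σ∋x = py
          restore P py ps x (no x≢y) σ∋x = ps x (≡.trans (update-other σ false x≢y) σ∋x)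

      -- The last form is added as a further condition. A preimage `v` that respects the earlier
      -- forms has `D j v` closed along the row, one degree lower in ρ, hence equal to a row
      -- boundary of some `w`; the column lifts `w` through `D j` to `y`, and `v - ∂′ y`, up to
      -- scalars, is killed by `D j` as well with the same boundary as `v`.
      row : ∀ j p q → ∣ B ∣ ℕ.+ (p ℕ.+ q) ℕ.< d → ∣ B ∣ ℕ.+ (q ℕ.+ j) ℕ.≤ d → Row j p q
      row j p zero h₁ h₂ = row-0 j p (≡.subst (λ m → ∣ B ∣ ℕ.+ m ℕ.< d) (ℕ.+-identityʳ p) h₁)
      row zero p (suc q) h₁ h₂ = row-cone p q
      row (suc j) p (suc q) h₁ h₂ u t k closed =
        row j p (suc q) h₁ (ℕ.≤-trans (ℕ.+-monoʳ-≤ ∣ B ∣ (ℕ.+-monoʳ-≤ (suc q) (ℕ.n≤1+n j))) h₂) u t (KilledU-pred u k) closed >>= λ { (s₁ , v , nz₁ , tv , kv , e₁) →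
        row (suc j) (suc p) q (≡.subst (λ m → ∣ B ∣ ℕ.+ m ℕ.< d) (ℕ.+-suc p q) h₁) (ℕ.≤-trans (ℕ.+-monoʳ-≤ ∣ B ∣ (ℕ.n≤1+n _)) h₂)
          (λ σ → D j (v σ)) (T-D (W c j) v tv) (KilledU-D v kv)
          (λ σ ρ → trans (sym (∂′-commute (∂-linear (W c j)) v σ ρ)) (trans (Dl.cong j (λ τ → sym (e₁ σ τ)) ρ)
            (trans (Dl.scal j s₁ (u σ) ρ) (trans (*-congˡ (k σ j ℕ.≤-refl ρ)) (zeroʳ s₁))))) >>= λ { (s₂ , w , nz₂ , tw , kw , e₂) →
        col j q (ℕ.≤-trans (ℕ.+-monoʳ-≤ ∣ B ∣ (ℕ.n≤1+n _)) h₂) (suc p) w tw kw >>= λ { (s₃ , y , nz₃ , ty , ky , e₃) →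
        let a = s₃ * s₂
            v′ : U n
            v′ = λ σ → (a ⊙ᵤ v) σ ⊖ ∂′ y σ
            kill-j : ∀ σ → D j (v′ σ) ≋ 𝟎
            kill-j σ ρ = begin
              D j (v′ σ) ρ                                    ≈⟨ Dl.sub j _ _ ρ ⟩
              D j (a ⊙ v σ) ρ - D j (∂′ y σ) ρ                ≈⟨ +-cong (Dl.scal j a (v σ) ρ) (-‿cong (∂′-commute (∂-linear (W c j)) y σ ρ)) ⟩
              a * D j (v σ) ρ - ∂ one (λ τ → D j (y τ) ρ) σ   ≈⟨ +-cong (trans (*-assoc s₃ s₂ _) (*-congˡ (e₂ σ ρ))) (-‿cong (∂₁.cong (λ τ → sym (e₃ τ ρ)) σ)) ⟩
              s₃ * ∂′ w σ ρ - ∂ one (λ τ → s₃ * w τ ρ) σ      ≈⟨ +-congˡ (-‿cong (∂₁.scal s₃ _ σ)) ⟩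
              s₃ * ∂′ w σ ρ - s₃ * ∂′ w σ ρ                   ≈⟨ -‿inverseʳ _ ⟩
              0#                                              ∎
        in return (a * s₁ , v′ , Nz-* (Nz-* nz₃ nz₂) nz₁ , T-sub _ _ (T-scal a v tv) (T-∂′ y ty) ,
          KilledU-suc v′ (KilledU-sub _ _ (KilledU-scal a v kv) (KilledU-∂′ y ky)) kill-j ,
          λ σ ρ → begin
            (a * s₁) * u σ ρ                                         ≈⟨ trans (*-assoc a s₁ _) (*-congˡ (e₁ σ ρ)) ⟩
            a * ∂′ v σ ρ                                             ≈⟨ solve 1 (λ a → a := a :- con (0 , 0)) refl _ ⟩
            a * ∂′ v σ ρ - 0#                                        ≈⟨ +-cong (sym (∂₁.scal a _ σ)) (-‿cong (sym (∂∂ one (λ τ → y τ ρ) σ))) ⟩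
            ∂ one (λ τ → a * v τ ρ) σ - ∂ one (λ τ → ∂′ y τ ρ) σ     ≈⟨ sym (∂₁.sub _ _ σ) ⟩
            ∂′ v′ σ ρ                                                ∎) } } }

      -- The zigzag: `D j u` is a row boundary of some `u′` in lower degree, to which the claim
      -- applies. Subtracting from `u` the row boundary of the `y′` found there leaves a chain
      -- killed by `D j`, and the column lifts this chain.
      chase : ∀ j p q → ∣ B ∣ ℕ.+ (p ℕ.+ q) ℕ.< d → ∣ B ∣ ℕ.+ (q ℕ.+ suc j) ℕ.≤ d → ∀ u → T (suc p) q u → KilledU j u →
        (∀ σ ρ → ∂ one (λ τ → D j (u τ) ρ) σ ≈ 0#) →
        ¬ ¬ (∃ λ s → ∃₂ λ y v → Nz s × T (suc p) (suc q) y × KilledU j y × T (suc (suc p)) q v × KilledU j v ×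
          (∀ σ ρ → s * u σ ρ ≈ D j (y σ) ρ + ∂′ v σ ρ))
      chase j p zero h₁ h₂ u t k closed = col j 0 h₂ p u t (KilledU-suc u k (T-D0 (W c j) u t)) >>= λ { (s , y , nz , ty , ky , eq) →
        return (s , y , (λ _ → 𝟎) , nz , ty , ky , (λ _ _ _ → refl) , (λ σ i _ → Dl.zero! i (λ _ → refl)) ,
          λ σ ρ → trans (eq σ ρ) (sym (trans (+-congˡ (∂₁.zero! (λ _ → refl) σ)) (+-identityʳ _)))) }
      chase j p (suc q) h₁ h₂ u t k closed =
        row j (suc p) q (≡.subst (λ m → ∣ B ∣ ℕ.+ m ℕ.< d) (ℕ.+-suc p q) h₁)
          (ℕ.≤-trans (ℕ.+-monoʳ-≤ ∣ B ∣ (ℕ.+-mono-≤ (ℕ.n≤1+n q) (ℕ.n≤1+n j))) h₂)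
          (λ σ → D j (u σ)) (T-D (W c j) u t) (KilledU-pred _ (KilledU-D u k)) closed >>= λ { (s₁ , u′ , nz₁ , tu′ , ku′ , e₁) →
        chase j (suc p) q (≡.subst (λ m → ∣ B ∣ ℕ.+ m ℕ.< d) (ℕ.+-suc p q) h₁) (ℕ.≤-trans (ℕ.+-monoʳ-≤ ∣ B ∣ (ℕ.n≤1+n _)) h₂) u′ tu′ ku′
          (λ σ ρ → trans (sym (∂′-commute (∂-linear (W c j)) u′ σ ρ)) (trans (Dl.cong j (λ τ → sym (e₁ σ τ)) ρ)
            (trans (Dl.scal j s₁ _ ρ) (trans (*-congˡ (∂∂ (W c j) (u σ) ρ)) (zeroʳ s₁))))) >>= λ { (s₂ , y′ , v′ , nz₂ , ty′ , ky′ , tv′ , kv′ , e₂) →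
        let a = s₂ * s₁
            u″ : U n
            u″ = λ σ → (a ⊙ᵤ u) σ ⊖ ∂′ y′ σ
            kill-j : ∀ σ → D j (u″ σ) ≋ 𝟎
            kill-j σ ρ = begin
              D j (u″ σ) ρ                                       ≈⟨ Dl.sub j _ _ ρ ⟩
              D j (a ⊙ u σ) ρ - D j (∂′ y′ σ) ρ                  ≈⟨ +-cong (trans (Dl.scal j a (u σ) ρ) (trans (*-assoc s₂ s₁ _) (*-congˡ (e₁ σ ρ)))) (-‿cong (∂′-commute (∂-linear (W c j)) y′ σ ρ)) ⟩
              s₂ * ∂′ u′ σ ρ - ∂ one (λ τ → D j (y′ τ) ρ) σ      ≈⟨ +-congʳ (trans (sym (∂₁.scal s₂ _ σ)) (trans (∂₁.cong (λ τ → e₂ τ ρ) σ) (∂₁.add _ _ σ))) ⟩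
              (∂ one (λ τ → D j (y′ τ) ρ) σ + ∂ one (λ τ → ∂′ v′ τ ρ) σ) - ∂ one (λ τ → D j (y′ τ) ρ) σ
                ≈⟨ +-congʳ (+-congˡ (∂∂ one (λ τ → v′ τ ρ) σ)) ⟩
              (∂ one (λ τ → D j (y′ τ) ρ) σ + 0#) - ∂ one (λ τ → D j (y′ τ) ρ) σ
                ≈⟨ solve 1 (λ a → (a :+ con (0 , 0)) :- a := con (0 , 0)) refl _ ⟩
              0#                                                 ∎
        in col j (suc q) h₂ p u″ (T-sub _ _ (T-scal a u t) (T-∂′ y′ ty′)) (KilledU-suc u″ (KilledU-sub _ _ (KilledU-scal a u k) (KilledU-∂′ y′ ky′)) kill-j) >>= λ { (s₃ , y , nz₃ , ty , ky , e₃) →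
        return (s₃ * a , y , s₃ ⊙ᵤ y′ , Nz-* nz₃ (Nz-* nz₂ nz₁) , ty , ky , T-scal s₃ y′ ty′ , KilledU-scal s₃ y′ ky′ , λ σ ρ → begin
          (s₃ * a) * u σ ρ                                       ≈⟨ solve 4 (λ s a u w → (s :* a) :* u := s :* (a :* u :- w) :+ s :* w) refl s₃ a (u σ ρ) (∂′ y′ σ ρ) ⟩
          s₃ * u″ σ ρ + s₃ * ∂′ y′ σ ρ                           ≈⟨ +-cong (e₃ σ ρ) (sym (∂₁.scal s₃ _ σ)) ⟩
          D j (y σ) ρ + ∂′ (s₃ ⊙ᵤ y′) σ ρ                        ∎) } } }

      -- Placed in the column of the empty set, `x` is closed along rows for lack of smaller sets,
      -- hence a row boundary of some `u₁`. By `chase`, `u₁` is `D j y` up to a row boundary, so `x`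
      -- equals `D j` of the row boundary of `y`; all equations hold up to scalars.
      exact-∅ : ∀ j k → ∣ B ∣ ℕ.+ (k ℕ.+ suc j) ℕ.≤ d → Exact B ∅ j k c
      exact-∅ j k h x p kill =
        row j 0 k (ℕ.<-≤-trans (ℕ.+-monoʳ-< ∣ B ∣ (ℕ.m<m+n k (s≤s z≤n))) h)
            (ℕ.≤-trans (ℕ.+-monoʳ-≤ ∣ B ∣ (ℕ.+-monoʳ-≤ k (ℕ.n≤1+n j))) h)
            u Tu (KilledU-pred u Ku) (λ σ ρ → ∂u σ ρ) >>= λ { (s₁ , u₁ , nz₁ , t₁ , k₁ , e₁) →
        chase j 0 k (ℕ.<-≤-trans (ℕ.+-monoʳ-< ∣ B ∣ (ℕ.m<m+n k (s≤s z≤n))) h) h u₁ t₁ k₁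
            (λ σ ρ → trans (sym (∂′-commute (∂-linear (W c j)) u₁ σ ρ)) (trans (Dl.cong j (λ τ → sym (e₁ σ τ)) ρ)
              (trans (Dl.scal j s₁ (u σ) ρ) (trans (*-congˡ (Ku σ j ℕ.≤-refl ρ)) (zeroʳ s₁))))) >>= λ { (s₂ , y , v , nz₂ , ty , ky , _ , _ , e₂) →
        return (s₂ * s₁ , ∂′ y ∅ , Nz-* nz₂ nz₁ ,
          supp (λ ρ out → T-∂′ y ty ∅ ρ λ { (_ , cρ , _ , dρ , τ , τ∈ , _ , ρ⊑ , B⊑) →
            out (cρ , dρ , τ , τ∈ , ρ⊑ , (λ x q → ∋∌ q (lookup-replicate x false)) , B⊑) }) ,
          KilledU-∂′ y ky ∅ , λ ρ → begin
            (s₂ * s₁) * x ρ                                              ≈⟨ trans (*-assoc s₂ s₁ _) (*-congˡ (*-congˡ (sym (u∅ ρ)))) ⟩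
            s₂ * (s₁ * u ∅ ρ)                                            ≈⟨ *-congˡ (e₁ ∅ ρ) ⟩
            s₂ * ∂′ u₁ ∅ ρ                                               ≈⟨ sym (∂₁.scal s₂ _ ∅) ⟩
            ∂ one (λ τ → s₂ * u₁ τ ρ) ∅                                  ≈⟨ trans (∂₁.cong (λ τ → e₂ τ ρ) ∅) (∂₁.add _ _ ∅) ⟩
            ∂ one (λ τ → D j (y τ) ρ) ∅ + ∂ one (λ τ → ∂′ v τ ρ) ∅       ≈⟨ trans (+-congˡ (∂∂ one (λ τ → v τ ρ) ∅)) (+-identityʳ _) ⟩
            ∂ one (λ τ → D j (y τ) ρ) ∅                                  ≈⟨ sym (∂′-commute (∂-linear (W c j)) y ∅ ρ) ⟩
            D j (∂′ y ∅) ρ                                               ∎) } }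
        where
        u : U n
        u σ ρ = if does (σ ≟ˢ ∅) then x ρ else 0#
        u∅ : ∀ ρ → u ∅ ρ ≈ x ρ
        u∅ ρ with ∅ ≟ˢ ∅
        ... | yes _ = refl
        ... | no h = ⊥-elim (h ≡.refl)
        Tu : T 0 k u
        Tu σ ρ out with σ ≟ˢ ∅
        ... | no _ = refl
        ... | yes ≡.refl = vanish p ρ λ where
          (cρ , dρ , τ , τ∈ , ρ⊑ , ∅⊑ , B⊑) → out (card-0 ∅ (λ x → lookup-replicate x false) , cρ ,
            (λ x q → ∋∌ q (lookup-replicate x false)) , dρ , τ , τ∈ , ∅⊑ , ρ⊑ , B⊑)
        Ku : KilledU (suc j) u
        Ku σ i i<j ρ with σ ≟ˢ ∅
        ... | yes _ = kill i i<j ρ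
        ... | no _ = Dl.zero! i (λ _ → refl) ρ
        ∂u : ∀ σ ρ → ∂′ u σ ρ ≈ 0#
        ∂u σ ρ = ∂-zero-local σ λ v σ∌v → trans (*-congˡ (off v)) (zeroʳ _)
          where
          off : ∀ v → u (σ [ v ]≔ true) ρ ≈ 0#
          off v with (σ [ v ]≔ true) ≟ˢ ∅
          ... | no _ = refl
          ... | yes eq = contradiction (≡.trans (≡.sym (update-same σ v true)) (≡.trans (≡.cong (λ S → lookup S v) eq) (lookup-replicate v false))) λ ()

    module _ (hom : ∀ B p → ∣ B ∣ ℕ.+ p ℕ.< d → ∀ x → Supp (LinkP B p) x → ∂ one x ≋ 𝟎 →
        ¬ ¬ (∃ λ b → Supp (LinkP B (suc p)) b × x ≋ ∂ one b)) where

      -- Induction on `g`, the difference of `d` and the size of `B`. A vertex of σ outside `B` can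
      -- be absorbed into `B` at the cost of one form. If there is none, the star of σ is the whole
      -- link and the double complex applies; its columns with nonempty σ fall under the case of a
      -- vertex outside the same `B`.
      exact : ∀ g B → ∣ B ∣ ℕ.+ g ≡ d → ∀ c → GoodW B c → ∀ σ j k → k ℕ.+ suc j ℕ.≤ g → Exact B σ j k c
      exact zero B eq c good σ j k h = contradiction (ℕ.≤-trans (ℕ.m≤n+m (suc j) k) h) λ ()
      exact (suc g) B eq c good σ j k h x p kill = ¬¬-excluded-middle {A = ∃ λ u → σ ∋ u × B ∌ u} >>= λ {
          (yes (u , σ∋u , B∌u)) → star σ u σ∋u B∌u j k h x p kill
          ; (no none) → Double.exact-∅ B c (λ σ u a b j q → star σ u a b j q ∘ fits) (hom B) j k
              (≡.subst (∣ B ∣ ℕ.+ (k ℕ.+ suc j) ℕ.≤_) eq (ℕ.+-monoʳ-≤ ∣ B ∣ h)) x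
              (supp λ ρ out → vanish p ρ λ { (cρ , dρ , τ , τ∈ , ρ⊑ , σ⊑ , B⊑) → out (cρ , dρ , τ , τ∈ , ρ⊑ , (λ v q → ∋∌ q (lookup-replicate v false)) , B⊑) }) kill
            >>= λ { (s , y , nz , sy , ky , e) → return (s , y , nz ,
              supp (λ ρ out → vanish sy ρ λ { (cρ , dρ , τ , τ∈ , ρ⊑ , _ , B⊑) → out (cρ , dρ , τ , τ∈ , ρ⊑ , (λ v σ∋v → B⊑ v (inB none v σ∋v)) , B⊑) }) , ky , e) } }
        where
        inB : ¬ (∃ λ u → σ ∋ u × B ∌ u) → ∀ v → σ ∋ v → B ∋ v
        inB none v σ∋v with ∋? B v
        ... | inj₁ q = q
        ... | inj₂ q = contradiction (v , σ∋v , q) none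
        fits : ∀ {m} → ∣ B ∣ ℕ.+ m ℕ.≤ d → m ℕ.≤ suc g
        fits q = ℕ.+-cancelˡ-≤ ∣ B ∣ _ _ (≡.subst (_ ℕ.≤_) (≡.sym eq) q)
        star : ∀ σ u → σ ∋ u → B ∌ u → ∀ j k → k ℕ.+ suc j ℕ.≤ suc g → Exact B σ j k c
        star σ u σ∋u B∌u zero k h = StarStep.exact-0 B σ u σ∋u B∌u c good k
        star σ u σ∋u B∌u (suc j) k h = StarStep.exact-suc B σ u σ∋u B∌u c good j k
          (exact g (B [ u ]≔ true) (≡.trans (≡.cong (ℕ._+ g) (card-insert B u B∌u)) (≡.trans (≡.sym (ℕ.+-suc ∣ B ∣ g)) eq))
            (StarStep.c′ B σ u σ∋u B∌u c good) (StarStep.good′ B σ u σ∋u B∌u c good) σ j k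
            (ℕ.≤-pred (≡.subst (ℕ._≤ suc g) (ℕ.+-suc k (suc j)) h)))

-- Polynomials over the field, and exactness with polynomial coefficients

module PolynomialCoefficients where
  open import Defs
  open import Level using (Level; _⊔_) renaming (suc to lsuc)
  open import Algebra.Bundles using (CommutativeRing)
  import Algebra.Properties.Ring as RingProps
  open import Data.Bool using (true; false)
  open import Data.Nat as ℕ using (ℕ; zero; suc; z≤n; s≤s; _⊔_)
  import Data.Nat.Properties as ℕ
  open import Data.Fin using (Fin; zero; suc; toℕ)
  import Data.Fin.Properties as Fin
  open import Data.Fin.Subset using (Subset)
  open import Data.List as List using (List; []; _∷_; length)
  open import Data.Vec as Vec using ([]; _∷_)
  open import Data.Product using (∃; _×_; _,_)
  open import Data.Empty using (⊥-elim)
  open import Function using (_∘_)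
  open import Relation.Nullary using (¬_; yes; no)
  open import Relation.Nullary.Negation using (contradiction)
  open import Relation.Nullary.Decidable using (¬¬-excluded-middle)
  open import Relation.Binary.PropositionalEquality as ≡ using (_≡_; _≢_)
  import Relation.Binary.Reasoning.Setoid as SetoidReasoning
  open RingSolving
  open ExteriorAlgebra
  open Subsets
  open Dimension

  -- Equality of a field need not be decidable, but its double negation is stable.
  stabilise : ∀ {c ℓ} → CommutativeRing c ℓ → CommutativeRing c ℓ
  stabilise R = record
    { Carrier = Carrier ; _≈_ = λ x y → ¬ ¬ (x ≈ y) ; _+_ = _+_ ; _*_ = _*_ ; -_ = -_ ; 0# = 0# ; 1# = 1#
    ; isCommutativeRing = record
      { isRing = record
        { +-isAbelianGroup = record
          { isGroup = record
            { isMonoid = record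
              { isSemigroup = record
                { isMagma = record
                  { isEquivalence = record
                    { refl = return refl
                    ; sym = λ p → p >>= λ a → return (sym a)
                    ; trans = λ p q → p >>= λ a → q >>= λ b → return (trans a b) }
                  ; ∙-cong = λ p q → p >>= λ a → q >>= λ b → return (+-cong a b) }
                ; assoc = λ x y z → return (+-assoc x y z) }
              ; identity = (λ x → return (+-identityˡ x)) , (λ x → return (+-identityʳ x)) }
            ; inverse = (λ x → return (-‿inverseˡ x)) , (λ x → return (-‿inverseʳ x))
            ; ⁻¹-cong = λ p → p >>= λ a → return (-‿cong a) }
          ; comm = λ x y → return (+-comm x y) }
        ; *-cong = λ p q → p >>= λ a → q >>= λ b → return (*-cong a b)
        ; *-assoc = λ x y z → return (*-assoc x y z)
        ; *-identity = (λ x → return (*-identityˡ x)) , (λ x → return (*-identityʳ x))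
        ; distrib = (λ x y z → return (distribˡ x y z)) , (λ x y z → return (distribʳ x y z)) }
      ; *-comm = λ x y → return (*-comm x y) } }
    where open CommutativeRing R hiding (zero)

  module Polynomials {c ℓ : Level} (R : CommutativeRing c ℓ) where
    open CommutativeRing R hiding (zero)
    open RingProps ring
    open IntegerSolver R
    open SetoidReasoning setoid

    -- Coefficient lists from degree 0 upwards. Trailing zeros are permitted because they could not
    -- be recognised, so equality compares coefficients.
    P : Set c
    P = List Carrier

    coef : P → ℕ → Carrier
    coef []      _       = 0#
    coef (a ∷ p) zero    = a
    coef (a ∷ p) (suc k) = coef p k

    infix 4 _≈ₚ_
    _≈ₚ_ : P → P → Set ℓ
    p ≈ₚ q = ∀ k → coef p k ≈ coef q k

    _+ₚ_ _*ₚ_ : P → P → P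
    []      +ₚ q       = q
    (a ∷ p) +ₚ []      = a ∷ p
    (a ∷ p) +ₚ (b ∷ q) = (a + b) ∷ (p +ₚ q)

    scale : Carrier → P → P
    scale a = List.map (a *_)

    negₚ : P → P
    negₚ = List.map (-_)

    []      *ₚ q = []
    (a ∷ p) *ₚ q = scale a q +ₚ (0# ∷ (p *ₚ q))

    coef-+ : ∀ p q k → coef (p +ₚ q) k ≈ coef p k + coef q k
    coef-+ []      q       k       = sym (+-identityˡ _)
    coef-+ (a ∷ p) []      k       = sym (+-identityʳ _)
    coef-+ (a ∷ p) (b ∷ q) zero    = refl
    coef-+ (a ∷ p) (b ∷ q) (suc k) = coef-+ p q k

    coef-scale : ∀ a p k → coef (scale a p) k ≈ a * coef p k
    coef-scale a []      k       = sym (zeroʳ a)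
    coef-scale a (b ∷ p) zero    = refl
    coef-scale a (b ∷ p) (suc k) = coef-scale a p k

    coef-neg : ∀ p k → coef (negₚ p) k ≈ - coef p k
    coef-neg []      k       = sym -0#≈0#
    coef-neg (b ∷ p) zero    = refl
    coef-neg (b ∷ p) (suc k) = coef-neg p k

    coef-* : ∀ a p q k → coef ((a ∷ p) *ₚ q) k ≈ a * coef q k + coef (0# ∷ (p *ₚ q)) k
    coef-* a p q k = trans (coef-+ (scale a q) _ k) (+-congʳ (coef-scale a q k))

    shift-cong : ∀ {p q} → p ≈ₚ q → (0# ∷ p) ≈ₚ (0# ∷ q)
    shift-cong h zero    = refl
    shift-cong h (suc k) = h k

    *ₚ-congʳ : ∀ p {q q′} → q ≈ₚ q′ → (p *ₚ q) ≈ₚ (p *ₚ q′)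
    *ₚ-congʳ []      h k = refl
    *ₚ-congʳ (a ∷ p) {q} {q′} h k = trans (coef-* a p q k) (trans (+-cong (*-congˡ (h k)) (shift-cong (*ₚ-congʳ p h) k)) (sym (coef-* a p q′ k)))

    shift-+ : ∀ p q k → coef (0# ∷ (p +ₚ q)) k ≈ coef (0# ∷ p) k + coef (0# ∷ q) k
    shift-+ p q zero    = sym (+-identityˡ 0#)
    shift-+ p q (suc k) = coef-+ p q k

    *ₚ-distribˡ : ∀ p q r → (p *ₚ (q +ₚ r)) ≈ₚ ((p *ₚ q) +ₚ (p *ₚ r))
    *ₚ-distribˡ []      q r k = refl
    *ₚ-distribˡ (a ∷ p) q r k = begin
      coef ((a ∷ p) *ₚ (q +ₚ r)) k                                  ≈⟨ coef-* a p (q +ₚ r) k ⟩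
      a * coef (q +ₚ r) k + coef (0# ∷ (p *ₚ (q +ₚ r))) k           ≈⟨ +-cong (*-congˡ (coef-+ q r k)) (trans (shift-cong (*ₚ-distribˡ p q r) k) (shift-+ (p *ₚ q) (p *ₚ r) k)) ⟩
      a * (coef q k + coef r k) + (coef (0# ∷ (p *ₚ q)) k + coef (0# ∷ (p *ₚ r)) k)
        ≈⟨ solve 5 (λ a x y z w → a :* (x :+ y) :+ (z :+ w) := (a :* x :+ z) :+ (a :* y :+ w)) refl _ _ _ _ _ ⟩
      (a * coef q k + coef (0# ∷ (p *ₚ q)) k) + (a * coef r k + coef (0# ∷ (p *ₚ r)) k)
        ≈⟨ sym (trans (coef-+ ((a ∷ p) *ₚ q) _ k) (+-cong (coef-* a p q k) (coef-* a p r k))) ⟩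
      coef (((a ∷ p) *ₚ q) +ₚ ((a ∷ p) *ₚ r)) k                     ∎

    *ₚ-cons : ∀ p b q k → coef (p *ₚ (b ∷ q)) k ≈ b * coef p k + coef (0# ∷ (p *ₚ q)) k
    *ₚ-cons []      b q zero    = solve 1 (λ b → con (0 , 0) := b :* con (0 , 0) :+ con (0 , 0)) refl b
    *ₚ-cons []      b q (suc k) = solve 1 (λ b → con (0 , 0) := b :* con (0 , 0) :+ con (0 , 0)) refl b
    *ₚ-cons (a ∷ p) b q zero    = trans (coef-* a p (b ∷ q) zero) (+-congʳ (*-comm a b))
    *ₚ-cons (a ∷ p) b q (suc k) = begin
      coef ((a ∷ p) *ₚ (b ∷ q)) (suc k)                               ≈⟨ coef-* a p (b ∷ q) (suc k) ⟩
      a * coef q k + coef (p *ₚ (b ∷ q)) k                            ≈⟨ +-congˡ (*ₚ-cons p b q k) ⟩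
      a * coef q k + (b * coef p k + coef (0# ∷ (p *ₚ q)) k)          ≈⟨ solve 3 (λ x y z → x :+ (y :+ z) := y :+ (x :+ z)) refl _ _ _ ⟩
      b * coef p k + (a * coef q k + coef (0# ∷ (p *ₚ q)) k)          ≈⟨ +-congˡ (sym (coef-* a p q k)) ⟩
      b * coef p k + coef ((a ∷ p) *ₚ q) k                            ∎

    *ₚ-zeroʳ : ∀ p → (p *ₚ []) ≈ₚ []
    *ₚ-zeroʳ []      k       = refl
    *ₚ-zeroʳ (a ∷ p) zero    = refl
    *ₚ-zeroʳ (a ∷ p) (suc k) = *ₚ-zeroʳ p k

    *ₚ-comm : ∀ p q → (p *ₚ q) ≈ₚ (q *ₚ p)
    *ₚ-comm []      q k = sym (*ₚ-zeroʳ q k)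
    *ₚ-comm (a ∷ p) q k = trans (coef-* a p q k) (trans (+-congˡ (shift-cong (*ₚ-comm p q) k)) (sym (*ₚ-cons q a p k)))

    *ₚ-distribʳ : ∀ r p q → ((p +ₚ q) *ₚ r) ≈ₚ ((p *ₚ r) +ₚ (q *ₚ r))
    *ₚ-distribʳ r p q k = trans (*ₚ-comm (p +ₚ q) r k) (trans (*ₚ-distribˡ r p q k) (trans (coef-+ (r *ₚ p) _ k)
      (trans (+-cong (*ₚ-comm r p k) (*ₚ-comm r q k)) (sym (coef-+ (p *ₚ r) _ k)))))

    scale-* : ∀ a p q k → coef (scale a p *ₚ q) k ≈ a * coef (p *ₚ q) k
    scale-* a []      q k = sym (zeroʳ a)
    scale-* a (b ∷ p) q k = trans (coef-* (a * b) (scale a p) q k) (trans (+-congˡ (shifted k))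
      (trans (solve 4 (λ a b x y → (a :* b) :* x :+ a :* y := a :* (b :* x :+ y)) refl _ _ _ _) (*-congˡ (sym (coef-* b p q k)))))
      where
      shifted : ∀ k → coef (0# ∷ (scale a p *ₚ q)) k ≈ a * coef (0# ∷ (p *ₚ q)) k
      shifted zero    = sym (zeroʳ a)
      shifted (suc k) = scale-* a p q k

    shift-* : ∀ p q k → coef ((0# ∷ p) *ₚ q) k ≈ coef (0# ∷ (p *ₚ q)) k
    shift-* p q k = trans (coef-* 0# p q k) (trans (+-congʳ (zeroˡ _)) (+-identityˡ _))

    *ₚ-assoc : ∀ p q r → ((p *ₚ q) *ₚ r) ≈ₚ (p *ₚ (q *ₚ r))
    *ₚ-assoc []      q r k = refl
    *ₚ-assoc (a ∷ p) q r k = begin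
      coef ((scale a q +ₚ (0# ∷ (p *ₚ q))) *ₚ r) k                  ≈⟨ *ₚ-distribʳ r (scale a q) _ k ⟩
      coef ((scale a q *ₚ r) +ₚ ((0# ∷ (p *ₚ q)) *ₚ r)) k           ≈⟨ coef-+ (scale a q *ₚ r) _ k ⟩
      coef (scale a q *ₚ r) k + coef ((0# ∷ (p *ₚ q)) *ₚ r) k       ≈⟨ +-cong (scale-* a q r k) (trans (shift-* (p *ₚ q) r k) (shift-cong (*ₚ-assoc p q r) k)) ⟩
      a * coef (q *ₚ r) k + coef (0# ∷ (p *ₚ (q *ₚ r))) k           ≈⟨ sym (coef-* a p (q *ₚ r) k) ⟩
      coef ((a ∷ p) *ₚ (q *ₚ r)) k                                  ∎

    1ₚ : P
    1ₚ = 1# ∷ []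

    *ₚ-identityˡ : ∀ p → (1ₚ *ₚ p) ≈ₚ p
    *ₚ-identityˡ p k = trans (coef-* 1# [] p k) (trans (+-cong (*-identityˡ _) (nothing k)) (+-identityʳ _))
      where
      nothing : ∀ k → coef (0# ∷ []) k ≈ 0#
      nothing zero    = refl
      nothing (suc k) = refl

    +ₚ-cong : ∀ {p p′ q q′} → p ≈ₚ p′ → q ≈ₚ q′ → (p +ₚ q) ≈ₚ (p′ +ₚ q′)
    +ₚ-cong {p} {p′} {q} {q′} h h′ k = trans (coef-+ p q k) (trans (+-cong (h k) (h′ k)) (sym (coef-+ p′ q′ k)))

    polynomialRing : CommutativeRing c ℓ
    polynomialRing = record
      { Carrier = P ; _≈_ = _≈ₚ_ ; _+_ = _+ₚ_ ; _*_ = _*ₚ_ ; -_ = negₚ ; 0# = [] ; 1# = 1ₚ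
      ; isCommutativeRing = record
        { isRing = record
          { +-isAbelianGroup = record
            { isGroup = record
              { isMonoid = record
                { isSemigroup = record
                  { isMagma = record
                    { isEquivalence = record { refl = λ _ → refl ; sym = λ h k → sym (h k) ; trans = λ h h′ k → trans (h k) (h′ k) }
                    ; ∙-cong = λ {p} {p′} {q} {q′} → +ₚ-cong {p} {p′} {q} {q′} }
                  ; assoc = λ p q r k → trans (coef-+ (p +ₚ q) r k) (trans (+-congʳ (coef-+ p q k)) (trans (+-assoc _ _ _)
                      (sym (trans (coef-+ p (q +ₚ r) k) (+-congˡ (coef-+ q r k)))))) }
                ; identity = (λ p k → refl) , (λ p k → trans (coef-+ p [] k) (+-identityʳ _)) }
              ; inverse = (λ p k → trans (coef-+ (negₚ p) p k) (trans (+-congʳ (coef-neg p k)) (-‿inverseˡ _)))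
                        , (λ p k → trans (coef-+ p (negₚ p) k) (trans (+-congˡ (coef-neg p k)) (-‿inverseʳ _)))
              ; ⁻¹-cong = λ {p} {q} h k → trans (coef-neg p k) (trans (-‿cong (h k)) (sym (coef-neg q k))) }
            ; comm = λ p q k → trans (coef-+ p q k) (trans (+-comm _ _) (sym (coef-+ q p k))) }
          ; *-cong = λ {p} {p′} {q} {q′} h h′ k → trans (*ₚ-congʳ p h′ k) (trans (*ₚ-comm p q′ k) (trans (*ₚ-congʳ q′ h k) (*ₚ-comm q′ p′ k)))
          ; *-assoc = *ₚ-assoc
          ; *-identity = *ₚ-identityˡ , (λ p k → trans (*ₚ-comm p 1ₚ k) (*ₚ-identityˡ p k))
          ; distrib = *ₚ-distribˡ , *ₚ-distribʳ }
        ; *-comm = *ₚ-comm } }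

    X^_ : ℕ → P
    X^ zero  = 1ₚ
    X^ suc k = 0# ∷ X^ k

    coef-X-same : ∀ k → coef (X^ k) k ≈ 1#
    coef-X-same zero    = refl
    coef-X-same (suc k) = coef-X-same k

    coef-X-other : ∀ i k → i ≢ k → coef (X^ i) k ≈ 0#
    coef-X-other zero    zero    h = ⊥-elim (h ≡.refl)
    coef-X-other zero    (suc k) h = refl
    coef-X-other (suc i) zero    h = refl
    coef-X-other (suc i) (suc k) h = coef-X-other i k (h ∘ ≡.cong suc)

  module FieldPolynomials {c ℓ : Level} (F : Field c ℓ) where
    private
      module F = Field F
      R̃ = stabilise F.commutativeRing
    open Polynomials R̃ public
    open CommutativeRing R̃ hiding (zero)
    open RingProps ring
    open SetoidReasoning setoid

    invertible-cancel : ∀ {a b} → ¬ (a F.≈ F.0#) → b * a ≈ 0# → b ≈ 0#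
    invertible-cancel {a} {b} nz h with F.inverse a nz
    ... | a⁻¹ , aa⁻¹ = begin
      b                ≈⟨ sym (*-identityʳ b) ⟩
      b * 1#           ≈⟨ *-congˡ (sym (return aa⁻¹)) ⟩
      b * (a * a⁻¹)    ≈⟨ sym (*-assoc b a a⁻¹) ⟩
      (b * a) * a⁻¹    ≈⟨ *-congʳ h ⟩
      0# * a⁻¹         ≈⟨ zeroˡ a⁻¹ ⟩
      0#               ∎

    -- An invertible constant term forces the coefficients of `q` to vanish one after the other,
    -- from the lowest.
    unit-cancel : ∀ a p q → ¬ (a F.≈ F.0#) → ((a ∷ p) *ₚ q) ≈ₚ [] → q ≈ₚ []
    unit-cancel a p []      nz h k = refl
    unit-cancel a p (b ∷ q) nz h = λ { zero → b≈0 ; (suc k) → unit-cancel a p q nz tail k }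
      where
      b≈0 : b ≈ 0#
      b≈0 = invertible-cancel nz (trans (sym (+-identityʳ _)) (trans (sym (*ₚ-cons (a ∷ p) b q 0)) (h 0)))
      tail : ((a ∷ p) *ₚ q) ≈ₚ []
      tail k = trans (sym (trans (*ₚ-cons (a ∷ p) b q (suc k)) (trans (+-congʳ (trans (*-congʳ b≈0) (zeroˡ _))) (+-identityˡ _)))) (h (suc k))

    ≈ₚ-stable : ∀ {p q} → ¬ ¬ (p ≈ₚ q) → p ≈ₚ q
    ≈ₚ-stable h k = h >>= λ e → e k

    -- Vanishing constant terms of `p` are stripped until a unit appears. Whether one vanishes is
    -- decided only up to double negation, which the equality in use absorbs.
    polynomial-cancel : ∀ p q → ¬ (p ≈ₚ []) → (p *ₚ q) ≈ₚ [] → q ≈ₚ []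
    polynomial-cancel []      q nz h = ⊥-elim (nz λ _ → refl)
    polynomial-cancel (a ∷ p) q nz h = ≈ₚ-stable {q} {[]} (¬¬-excluded-middle {A = a F.≈ F.0#} >>= λ where
      (no a≉0) → return (unit-cancel a p q a≉0 h)
      (yes a≈0) → return (polynomial-cancel p q (λ z → nz λ { zero → return a≈0 ; (suc k) → z k })
        λ k → trans (sym (trans (coef-* a p q (suc k)) (trans (+-congʳ (trans (*-congʳ (return a≈0)) (zeroˡ _))) (+-identityˡ _)))) (h (suc k))))

    domain : Domain c ℓ
    domain = record
      { commutativeRing = polynomialRing
      ; stable = λ {p} {q} → ≈ₚ-stable {p} {q}
      ; cancel = λ {p} {q} → polynomial-cancel p q
      ; 1≉0 = λ h → h 0 λ e → F.0≉1 (F.sym e) }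

    -- Powers of the variable differ for different vertices regardless of the size of the field.
    θ : ∀ {n} → Fin n → P
    θ v = X^ toℕ v

    θ-distinct : ∀ {n} {u v : Fin n} → u ≢ v → ¬ ((θ v +ₚ negₚ (θ u)) ≈ₚ [])
    θ-distinct {u = u} {v} u≢v h = one-zero λ e → F.0≉1 (F.sym e)
      where
      one-zero : 1# ≈ 0#
      one-zero = begin
        1#                                                 ≈⟨ sym (+-identityʳ 1#) ⟩
        1# + 0#                                            ≈⟨ +-congˡ (sym -0#≈0#) ⟩
        1# - 0#                                            ≈⟨ +-cong (sym (coef-X-same (toℕ v))) (-‿cong (sym (coef-X-other (toℕ u) (toℕ v) (u≢v ∘ Fin.toℕ-injective)))) ⟩
        coef (θ v) (toℕ v) - coef (θ u) (toℕ v)            ≈⟨ +-congˡ (sym (coef-neg (θ u) (toℕ v))) ⟩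
        coef (θ v) (toℕ v) + coef (negₚ (θ u)) (toℕ v)     ≈⟨ sym (coef-+ (θ v) (negₚ (θ u)) (toℕ v)) ⟩
        coef (θ v +ₚ negₚ (θ u)) (toℕ v)                   ≈⟨ h (toℕ v) ⟩
        0#                                                 ∎

    module EF = Exterior F.commutativeRing
    module EP = Exterior polynomialRing

    coef-∂ : ∀ {n} (x : EP.Ch n) σ k → coef (EP.∂ (λ _ → 1ₚ) x σ) k ≈ EF.∂ (λ _ → F.1#) (λ τ → coef (x τ) k) σ
    coef-∂ x [] k = refl
    coef-∂ x (false ∷ σ) k = trans (coef-+ (1ₚ *ₚ x (true ∷ σ)) _ k)
      (+-cong (trans (*ₚ-identityˡ (x (true ∷ σ)) k) (sym (*-identityˡ _))) (coef-∂ (x ∘ (false ∷_)) σ k))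
    coef-∂ x (true ∷ σ) k = trans (coef-neg (EP.∂ (λ _ → 1ₚ) (x ∘ (true ∷_)) σ) k) (-‿cong (coef-∂ (x ∘ (true ∷_)) σ k))

    tailₚ : P → P
    tailₚ []      = []
    tailₚ (a ∷ p) = p

    coef-tail : ∀ p k → coef (tailₚ p) k ≡ coef p (suc k)
    coef-tail []      k = ≡.refl
    coef-tail (a ∷ p) k = ≡.refl

    EF-∂-cong : ∀ {n} {x y : EF.Ch n} → (∀ σ → x σ ≡ y σ) → ∀ σ → EF.∂ (λ _ → F.1#) x σ ≈ EF.∂ (λ _ → F.1#) y σ
    EF-∂-cong h σ = return (EF.∂-cong (λ _ → F.refl) (λ τ → F.reflexive (h τ)) σ)

    -- Exactness with coefficients in F passes to polynomial coefficients, one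
    -- coefficient at a time.
    exact-polynomial : ∀ {n} (Q Q⁺ : Subset n → Set) →
      (∀ x → (∀ σ → ¬ Q σ → x σ F.≈ F.0#) → (∀ σ → EF.∂ (λ _ → F.1#) x σ F.≈ F.0#) →
        ∃ λ b → (∀ σ → ¬ Q⁺ σ → b σ F.≈ F.0#) × (∀ σ → x σ F.≈ EF.∂ (λ _ → F.1#) b σ)) →
      ∀ m (x : EP.Ch n) → (∀ σ → length (x σ) ℕ.≤ m) → (∀ σ → ¬ Q σ → x σ ≈ₚ []) →
      (∀ σ → EP.∂ (λ _ → 1ₚ) x σ ≈ₚ []) →
      ¬ ¬ (∃ λ b → (∀ σ → ¬ Q⁺ σ → b σ ≈ₚ []) × (∀ σ → x σ ≈ₚ EP.∂ (λ _ → 1ₚ) b σ))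
    exact-polynomial Q Q⁺ hom zero x short sx cx = return ((λ _ → []) , (λ _ _ _ → refl) ,
      λ σ k → trans (empty (x σ) (short σ) k) (sym (EP.Linear.zero! (EP.∂-linear (λ _ → 1ₚ)) {λ _ → []} (λ _ _ → refl) σ k)))
      where
      empty : ∀ p → length p ℕ.≤ 0 → p ≈ₚ []
      empty [] _ k = refl
    exact-polynomial {n} Q Q⁺ hom (suc m) x short sx cx =
      ¬¬-∀Subset {P = λ σ → ¬ Q σ → x₀ σ F.≈ F.0#} support >>= λ sx₀ →
      ¬¬-∀Subset {P = λ σ → EF.∂ (λ _ → F.1#) x₀ σ F.≈ F.0#} (λ σ → trans (sym (coef-∂ x σ 0)) (cx σ 0)) >>= λ cx₀ →
      exact-polynomial Q Q⁺ hom m x′ (λ σ → shorter (x σ) (short σ)) (λ σ q k → trans (reflexive (coef-tail (x σ) k)) (sx σ q (suc k)))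
        (λ σ k → trans (coef-∂ x′ σ k) (trans (EF-∂-cong (λ τ → coef-tail (x τ) k) σ) (trans (sym (coef-∂ x σ (suc k))) (cx σ (suc k))))) >>= λ { (b′ , sb′ , e′) →
      let (b₀ , sb₀ , e₀) = hom x₀ sx₀ cx₀ in
      return ((λ σ → b₀ σ ∷ b′ σ) , (λ { σ q zero → return (sb₀ σ q) ; σ q (suc k) → sb′ σ q k }) ,
        λ { σ zero → trans (return (e₀ σ)) (sym (coef-∂ (λ σ → b₀ σ ∷ b′ σ) σ 0))
          ; σ (suc k) → trans (sym (reflexive (coef-tail (x σ) k))) (trans (e′ σ k) (trans (coef-∂ b′ σ k) (sym (coef-∂ (λ σ → b₀ σ ∷ b′ σ) σ (suc k))))) }) }
      where
      x₀ : EF.Ch n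
      x₀ σ = coef (x σ) 0
      x′ : EP.Ch n
      x′ σ = tailₚ (x σ)
      shorter : ∀ p → length p ℕ.≤ suc m → length (tailₚ p) ℕ.≤ m
      shorter [] h = z≤n
      shorter (a ∷ p) (s≤s h) = h
      support : ∀ σ → ¬ ¬ (¬ Q σ → x₀ σ F.≈ F.0#)
      support σ = ¬¬-excluded-middle {A = Q σ} >>= λ where
        (yes q) → return λ ¬q → contradiction q ¬q
        (no ¬q) → sx σ ¬q 0 >>= λ h → return λ _ → h

    bounded : ∀ {n} (x : EP.Ch n) → ∃ λ m → ∀ σ → length (x σ) ℕ.≤ m
    bounded {zero} x = length (x []) , λ { [] → ℕ.≤-refl }
    bounded {suc n} x with bounded (x ∘ (false ∷_)) | bounded (x ∘ (true ∷_))
    ... | m , h | m′ , h′ = m ℕ.⊔ m′ , λ { (false ∷ σ) → ℕ.≤-trans (h σ) (ℕ.m≤m⊔n m m′) ; (true ∷ σ) → ℕ.≤-trans (h′ σ) (ℕ.m≤n⊔m m m′) }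

-- Consequences of depth: exactness in links, purity, enlarging faces by V

module DepthConsequences where
  open import Defs
  open import Level using (Level) renaming (suc to lsuc)
  import Algebra.Properties.Ring as RingProps
  open import Data.Bool using (Bool; true; false; if_then_else_; _∧_; _∨_)
  import Data.Bool.Properties as Bool
  open import Data.Nat as ℕ using (ℕ; zero; suc; z≤n; s≤s; _≡ᵇ_)
  import Data.Nat.Properties as ℕ
  open import Data.Fin using (Fin; zero; suc; toℕ; fromℕ<)
  import Data.Fin.Properties as Fin
  open import Data.Fin.Subset as Subset using (Subset; ∣_∣; _∪_; _∩_; ⁅_⁆)
  open import Data.Fin.Subset.Properties using (∪-identityʳ)
  open import Data.Vec as Vec using ([]; _∷_; lookup; _[_]≔_; replicate; tabulate)
  open import Data.Vec.Properties using (lookup-replicate; lookup-zipWith; lookup⇒[]=; []=⇒lookup)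
  open import Data.Product using (∃; _×_; _,_; proj₁; proj₂)
  open import Data.Sum using (_⊎_; inj₁; inj₂)
  open import Data.Empty using (⊥; ⊥-elim)
  open import Function using (_∘_)
  open import Relation.Nullary using (¬_; Dec; yes; no; does)
  open import Relation.Nullary.Negation using (contradiction)
  open import Relation.Nullary.Decidable using (¬¬-excluded-middle; _×-dec_; dec-true; dec-false)
  open import Relation.Binary.PropositionalEquality as ≡ using (_≡_; _≢_)
  import Relation.Binary.Reasoning.Setoid as SetoidReasoning
  open ExteriorAlgebra
  open Subsets
  open ShiftedFamilies using (≡ᵇ-intro; ≡ᵇ-elim; ≤ᵇ-intro; ≤ᵇ-elim; ∧-intro; ∧-elim)
  open GenericForms

  lookup-∪ : ∀ {n} (p q : Subset n) x → lookup (p ∪ q) x ≡ lookup p x ∨ lookup q x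
  lookup-∪ p q x = lookup-zipWith _∨_ x p q

  ∪-∋ˡ : ∀ {n} (p q : Subset n) → p ⊑ (p ∪ q)
  ∪-∋ˡ p q x h = ≡.trans (lookup-∪ p q x) (≡.cong (_∨ lookup q x) h)

  ∪-∋ʳ : ∀ {n} (p q : Subset n) → q ⊑ (p ∪ q)
  ∪-∋ʳ p q x h = ≡.trans (lookup-∪ p q x) (≡.trans (≡.cong (lookup p x ∨_) h) (Bool.∨-zeroʳ _))

  ∪-∋⁻ : ∀ {n} (p q : Subset n) {x} → (p ∪ q) ∋ x → p ∋ x ⊎ q ∋ x
  ∪-∋⁻ p q {x} h with lookup p x | lookup q x | ≡.trans (≡.sym (lookup-∪ p q x)) h
  ... | true  | _ | _  = inj₁ ≡.refl
  ... | false | _ | h′ = inj₂ h′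

  ∪-card : ∀ {n} (p q : Subset n) → ∣ p ∪ q ∣ ℕ.≤ ∣ p ∣ ℕ.+ ∣ q ∣
  ∪-card [] [] = z≤n
  ∪-card (true ∷ p) (true ∷ q) = s≤s (ℕ.≤-trans (∪-card p q) (ℕ.+-monoʳ-≤ ∣ p ∣ (ℕ.n≤1+n _)))
  ∪-card (true ∷ p) (false ∷ q) = s≤s (∪-card p q)
  ∪-card (false ∷ p) (true ∷ q) = ℕ.≤-trans (s≤s (∪-card p q)) (ℕ.≤-reflexive (≡.sym (ℕ.+-suc ∣ p ∣ _)))
  ∪-card (false ∷ p) (false ∷ q) = ∪-card p q

  ∩-empty : ∀ {n} (p q : Subset n) → Disj q p → ∣ p ∩ q ∣ ≡ 0
  ∩-empty p q d = card-0 (p ∩ q) λ x → ≡.trans (lookup-zipWith _∧_ x p q) (go x (∋? q x))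
    where
    go : ∀ x → q ∋ x ⊎ q ∌ x → (lookup p x ∧ lookup q x) ≡ false
    go x (inj₁ h) = ≡.cong (_∧ lookup q x) (d x h)
    go x (inj₂ h) = ≡.trans (≡.cong (lookup p x ∧_) h) (Bool.∧-zeroʳ _)

  ∩-empty⁻ : ∀ {n} (p q : Subset n) → ∣ p ∩ q ∣ ≡ 0 → Disj q p
  ∩-empty⁻ p q h x q∋x with ∋? p x
  ... | inj₂ r = r
  ... | inj₁ r = ∋∌ (≡.trans (lookup-zipWith _∧_ x p q) (≡.cong₂ _∧_ r q∋x)) (0-card (p ∩ q) h x)

  choose : ∀ {n} (A τ : Subset n) m → A ⊑ τ → ∣ A ∣ ℕ.+ m ℕ.≤ ∣ τ ∣ → ∃ λ ρ → ρ ⊑ τ × Disj ρ A × ∣ ρ ∣ ≡ m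
  choose [] [] zero sub h = [] , (λ ()) , (λ ()) , ≡.refl
  choose (true ∷ A) (false ∷ τ) m sub h = contradiction (sub zero ≡.refl) λ ()
  choose (true ∷ A) (true ∷ τ) m sub (s≤s h) with choose A τ m (sub ∘ suc) h
  ... | ρ , a , b , c = false ∷ ρ , (λ { (suc x) → a x }) , (λ { (suc x) → b x }) , c
  choose (false ∷ A) (false ∷ τ) m sub h with choose A τ m (sub ∘ suc) h
  ... | ρ , a , b , c = false ∷ ρ , (λ { (suc x) → a x }) , (λ { (suc x) → b x }) , c
  choose {suc n} (false ∷ A) (true ∷ τ) zero sub h = replicate (suc n) false , (λ x q → ∋∌ q (lookup-replicate x false)) ,
    (λ x q → ∋∌ q (lookup-replicate x false)) , card-0 (replicate (suc n) false) (λ x → lookup-replicate x false)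
  choose (false ∷ A) (true ∷ τ) (suc m) sub h with choose A τ m (sub ∘ suc) (ℕ.≤-pred (≡.subst (ℕ._≤ suc ∣ τ ∣) (ℕ.+-suc ∣ A ∣ m) h))
  ... | ρ , a , b , c = true ∷ ρ , (λ { zero _ → ≡.refl ; (suc x) → a x }) , (λ { zero _ → ≡.refl ; (suc x) → b x }) , ≡.cong suc c

  module _ {c ℓ : Level} (F : Field c ℓ) where
    open Field F hiding (zero)
    open RingProps ring
    open SetoidReasoning setoid
    private module H = Homology F
    open Exterior commutativeRing

    sumFin-cong : ∀ {m} {f g : Fin m → Carrier} → (∀ v → f v ≈ g v) → H.sumFin f ≈ H.sumFin g
    sumFin-cong {zero} h = refl
    sumFin-cong {suc m} h = +-cong (h zero) (sumFin-cong (h ∘ suc))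

    sumFin-neg : ∀ {m} (f : Fin m → Carrier) → H.sumFin (λ v → - f v) ≈ - H.sumFin f
    sumFin-neg {zero} f = sym -0#≈0#
    sumFin-neg {suc m} f = trans (+-congˡ (sumFin-neg (f ∘ suc))) (-‿+-comm _ _)

    below-0 : ∀ {n} (τ : Subset n) → ∣ τ ∩ tabulate (λ u → false) ∣ ≡ 0
    below-0 [] = ≡.refl
    below-0 (true ∷ τ) = below-0 τ
    below-0 (false ∷ τ) = below-0 τ

    -- The signs agree because a first vertex in τ raises `below` by one for every later vertex,
    -- which is the minus sign in the recursive `∂`.
    boundary : ∀ {n} (x : Ch n) τ → H.∂ x τ ≈ ∂ (λ _ → 1#) x τ
    boundary x [] = refl
    boundary x (false ∷ τ) = +-cong
      (*-cong (reflexive (≡.cong H.signPow (below-0 τ))) (reflexive (≡.cong (λ S → x (true ∷ S)) (∪-identityʳ τ))))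
      (boundary (x ∘ (false ∷_)) τ)
    boundary x (true ∷ τ) = trans (+-identityˡ _) (trans (sumFin-cong term)
      (trans (sumFin-neg (λ v → if lookup τ v then 0# else H.signPow (H.below τ v) * x (true ∷ (τ ∪ ⁅ v ⁆)))) (-‿cong (boundary (x ∘ (true ∷_)) τ))))
      where
      term : ∀ v → (if lookup τ v then 0# else H.signPow (H.below (true ∷ τ) (suc v)) * x (true ∷ (τ ∪ ⁅ v ⁆)))
        ≈ - (if lookup τ v then 0# else H.signPow (H.below τ v) * x (true ∷ (τ ∪ ⁅ v ⁆)))
      term v with lookup τ v
      ... | true = sym -0#≈0#
      ... | false = sym (-‿distribˡ-* _ _)

    module _ {n : ℕ} (Δ : Family n) (d : ℕ) (complex : IsSimplicialComplex Δ) (CM : H.CohenMacaulay (skeleton d Δ))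
             (big : ∃ λ σ → σ ∈ᶠ Δ × d ℕ.≤ ∣ σ ∣) where
      open Link Δ

      closed : ∀ σ τ → τ ⊑ σ → σ ∈ᶠ Δ → τ ∈ᶠ Δ
      closed σ τ sub = proj₂ complex σ τ λ {x} h → lookup⇒[]= x σ (sub x ([]=⇒lookup h))

      link-intro : ∀ B ρ τ → τ ∈ᶠ Δ → ρ ⊑ τ → B ⊑ τ → Disj ρ B → ∣ B ∣ ℕ.+ ∣ ρ ∣ ℕ.≤ d → ρ ∈ᶠ link (skeleton d Δ) B
      link-intro B ρ τ τ∈ ρ⊑ B⊑ disj h = ∧-intro (skeleton d Δ ρ) (∧-intro (Δ ρ) (closed τ ρ ρ⊑ τ∈) (≤ᵇ-intro {∣ ρ ∣} (ℕ.≤-trans (ℕ.m≤n+m ∣ ρ ∣ ∣ B ∣) h)))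
        (∧-intro (∣ B ∩ ρ ∣ ≡ᵇ 0) (≡ᵇ-intro {∣ B ∩ ρ ∣} (∩-empty B ρ disj))
          (∧-intro (Δ (B ∪ ρ)) (closed τ (B ∪ ρ) union τ∈) (≤ᵇ-intro {∣ B ∪ ρ ∣} (ℕ.≤-trans (∪-card B ρ) h))))
        where
        union : (B ∪ ρ) ⊑ τ
        union x q with ∪-∋⁻ B ρ q
        ... | inj₁ p = B⊑ x p
        ... | inj₂ p = ρ⊑ x p

      link-elim : ∀ B ρ → ρ ∈ᶠ link (skeleton d Δ) B → Disj ρ B × (B ∪ ρ) ∈ᶠ Δ
      link-elim B ρ p = let (_ , q) = ∧-elim (skeleton d Δ ρ) p ; (a , b) = ∧-elim (∣ B ∩ ρ ∣ ≡ᵇ 0) q in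
        ∩-empty⁻ B ρ (≡ᵇ-elim {∣ B ∩ ρ ∣} a) , proj₁ (∧-elim (Δ (B ∪ ρ)) b)

      -- The face τ provides a link face with `suc p` vertices, so p lies in the range of the
      -- Cohen-Macaulay condition. Since `∣ B ∣ + p < d`, the skeleton contains every face of the
      -- link that is involved.
      link-exact : ∀ B τ → τ ∈ᶠ Δ → B ⊑ τ → ∀ p → ∣ B ∣ ℕ.+ p ℕ.< d → d ℕ.≤ ∣ τ ∣ → ∀ x →
        (∀ σ → ¬ LinkP B p σ → x σ ≈ 0#) → (∀ σ → ∂ (λ _ → 1#) x σ ≈ 0#) →
        ∃ λ b → (∀ σ → ¬ LinkP B (suc p) σ → b σ ≈ 0#) × (∀ σ → x σ ≈ ∂ (λ _ → 1#) b σ)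
      link-exact B τ τ∈ B⊑ p lt d≤ x sx cx
        with choose B τ (suc p) B⊑ (ℕ.≤-trans (≡.subst (ℕ._≤ d) (≡.sym (ℕ.+-suc ∣ B ∣ p)) lt) d≤)
      ... | ρ , ρ⊑ , disj , size with CM B B∈ p (ρ , link-intro B ρ τ τ∈ ρ⊑ B⊑ disj small , ≡.subst (p ℕ.<_) (≡.sym size) (ℕ.n<1+n p))
          x chain (λ σ → trans (boundary x σ) (cx σ))
        where
        small : ∣ B ∣ ℕ.+ ∣ ρ ∣ ℕ.≤ d
        small = ≡.subst (λ m → ∣ B ∣ ℕ.+ m ℕ.≤ d) (≡.sym size) (≡.subst (ℕ._≤ d) (≡.sym (ℕ.+-suc ∣ B ∣ p)) lt)
        B∈ : B ∈ᶠ skeleton d Δ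
        B∈ = ∧-intro (Δ B) (closed τ B B⊑ τ∈) (≤ᵇ-intro {∣ B ∣} (ℕ.≤-trans (ℕ.m≤m+n ∣ B ∣ p) (ℕ.<⇒≤ lt)))
        chain : H.IsChain (link (skeleton d Δ) B) p x
        chain σ out = sx σ λ { (cσ , dσ , τ′ , τ′∈ , σ⊑ , B⊑′) → out
          (link-intro B σ τ′ τ′∈ σ⊑ B⊑′ dσ (≡.subst (λ m → ∣ B ∣ ℕ.+ m ℕ.≤ d) (≡.sym cσ) (ℕ.<⇒≤ lt)) , cσ) }
      ... | b , sb , eq = b , (λ σ out → sb σ λ { (σ∈ , cσ) → let (dσ , u∈) = link-elim B σ σ∈ in
          out (cσ , dσ , B ∪ σ , u∈ , ∪-∋ʳ B σ , ∪-∋ˡ B σ) }) , λ σ → trans (eq σ) (boundary b σ)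

      Full : Subset n → Set
      Full A = ∃ λ τ → τ ∈ᶠ Δ × A ⊑ τ × d ℕ.≤ ∣ τ ∣

      Full-⊑ : ∀ A A′ → A ⊑ A′ → Full A′ → Full A
      Full-⊑ A A′ sub (τ , τ∈ , A⊑ , h) = τ , τ∈ , (λ x → A⊑ x ∘ sub x) , h

      -- If the link of A were disconnected, the difference of two vertices in
      -- different components would be a cycle that is not a boundary.
      module Connected (A τ₀ : Subset n) (τ₀∈ : τ₀ ∈ᶠ Δ) (A⊑ : A ⊑ τ₀) (lt₁ : ∣ A ∣ ℕ.+ 1 ℕ.< d) (d≤ : d ℕ.≤ ∣ τ₀ ∣)
        (W : Fin n → Bool)
        (W-closed : ∀ x y τ → A ∌ x → A ∌ y → x ≢ y → τ ∈ᶠ Δ → A ⊑ τ → τ ∋ x → τ ∋ y → W x ≡ true → W y ≡ true)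
        (u v₀ : Fin n) (A∌u : A ∌ u) (A∌v₀ : A ∌ v₀) (u∈ : (A [ u ]≔ true) ∈ᶠ Δ) (v₀∈ : (A [ v₀ ]≔ true) ∈ᶠ Δ)
        (Wu : W u ≡ false) (Wv₀ : W v₀ ≡ true) where

        o : Ch n
        o σ = if ∣ σ ∣ ≡ᵇ 0 then 1# else 0#

        o-nonempty : ∀ σ {m} → ∣ σ ∣ ≡ suc m → o σ ≈ 0#
        o-nonempty σ h = reflexive (≡.cong (λ m → if m ≡ᵇ 0 then 1# else 0#) h)

        ∂o : ∀ φ → ∂ φ o ≋ 𝟎
        ∂o φ σ = ∂-zero-local σ λ v σ∌v → trans (*-congˡ (o-nonempty (σ [ v ]≔ true) (card-insert σ v σ∌v))) (zeroʳ _)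

        ch : Ch n
        ch = e u o ⊖ e v₀ o

        ∂ch : ∀ φ σ → ∂ φ ch σ ≈ φ u * o σ - φ v₀ * o σ
        ∂ch φ σ = trans (Linear.sub (∂-linear φ) _ _ σ) (+-cong (one-term u) (-‿cong (one-term v₀)))
          where
          one-term : ∀ v → ∂ φ (e v o) σ ≈ φ v * o σ
          one-term v = trans (∂-e φ v o σ) (trans (+-congˡ (trans (-‿cong (Linear.zero! (e-linear v) (∂o φ) σ)) -0#≈0#)) (+-identityʳ _))

        vertex-supp : ∀ v → A ∌ v → (A [ v ]≔ true) ∈ᶠ Δ → ∀ σ → ¬ LinkP A 1 σ → e v o σ ≈ 0#
        vertex-supp v A∌v v∈ σ out = e-zero-local v σ λ σ∋v → go σ∋v (∣ σ [ v ]≔ false ∣) ≡.refl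
          where
          go : σ ∋ v → ∀ m → ∣ σ [ v ]≔ false ∣ ≡ m → o (σ [ v ]≔ false) ≈ 0#
          go σ∋v (suc m) eq = o-nonempty (σ [ v ]≔ false) eq
          go σ∋v zero eq = contradiction (≡.trans (card-erase σ v σ∋v) (≡.cong suc eq) ,
              (λ x h → ≡.subst (A ∌_) (≡.sym (only x h)) A∌v) , A [ v ]≔ true , v∈ ,
              (λ x h → ≡.subst ((A [ v ]≔ true) ∋_) (≡.sym (only x h)) (update-same A v true)) , (λ x → update-∋ A v)) out
            where
            only : ∀ x → σ ∋ x → x ≡ v
            only x h with x Fin.≟ v
            ... | yes q = q
            ... | no q = ∋∌ (≡.trans (update-other σ false q) h) (0-card (σ [ v ]≔ false) eq x)

        absurd : ⊥
        absurd with link-exact A τ₀ τ₀∈ A⊑ 1 lt₁ d≤ ch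
            (λ σ out → trans (+-cong (vertex-supp u A∌u u∈ σ out) (-‿cong (vertex-supp v₀ A∌v₀ v₀∈ σ out))) (-‿inverseʳ 0#))
            (λ σ → trans (∂ch _ σ) (-‿inverseʳ _))
        ... | b , sb , eqb = 0≉1 (begin
          0#                                      ≈⟨ sym -0#≈0# ⟩
          - 0#                                    ≈⟨ -‿cong (sym zero-side) ⟩
          - ∂ φ ch ∅                              ≈⟨ -‿cong (∂ch φ ∅) ⟩
          - (φ u * o ∅ - φ v₀ * o ∅)              ≈⟨ -‿cong (+-cong (trans (*-congʳ (reflexive (≡.cong (λ t → if t then 1# else 0#) Wu))) (zeroˡ _))
                                                      (-‿cong (trans (*-cong (reflexive (≡.cong (λ t → if t then 1# else 0#) Wv₀)) o∅) (*-identityˡ _)))) ⟩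
          - (0# - 1#)                             ≈⟨ -‿cong (+-identityˡ _) ⟩
          - - 1#                                  ≈⟨ -‿involutive 1# ⟩
          1#                                      ∎)
          where
          ∅ : Subset n
          ∅ = replicate n false
          o∅ : o ∅ ≈ 1#
          o∅ = reflexive (≡.cong (λ m → if m ≡ᵇ 0 then 1# else 0#) (card-0 ∅ (λ x → lookup-replicate x false)))
          -- φ indicates the component W. An edge of the link lies inside W or misses it, so `∂ φ b`
          -- is the ordinary boundary of the part `bW` of `b` on edges meeting W. Hence `∂ φ ch`
          -- vanishes at the empty set, although computed from `u` and `v₀` it is -1.
          φ one′ : Fin n → Carrier
          φ v = if W v then 1# else 0#
          one′ _ = 1#
          meets? : ∀ σ → Dec (∃ λ x → σ ∋ x × W x ≡ true)
          meets? σ = Fin.any? λ x → (lookup σ x Bool.≟ true) ×-dec (W x Bool.≟ true)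
          bW : Ch n
          bW σ = if does (meets? σ) then b σ else 0#
          agree : ∀ τ v → τ ∌ v → φ v * b (τ [ v ]≔ true) ≈ 1# * bW (τ [ v ]≔ true)
          agree τ v τ∌v = go (W v) ≡.refl (meets? (τ [ v ]≔ true)) ≡.refl
            where
            σ = τ [ v ]≔ true
            σ∋v : σ ∋ v
            σ∋v = update-same τ v true
            at : ∀ {t} → does (meets? σ) ≡ t → bW σ ≈ (if t then b σ else 0#)
            at h = reflexive (≡.cong (λ t → if t then b σ else 0#) h)
            go : ∀ t → W v ≡ t → (m : Dec (∃ λ x → σ ∋ x × W x ≡ true)) → meets? σ ≡ m → φ v * b σ ≈ 1# * bW σ
            go true w (yes _) m = *-cong (reflexive (≡.cong (λ t → if t then 1# else 0#) w)) (sym (at (≡.cong does m)))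
            go true w (no h) m = contradiction (v , σ∋v , w) h
            go false w (no h) m = trans (*-congʳ (reflexive (≡.cong (λ t → if t then 1# else 0#) w)))
              (trans (zeroˡ _) (sym (trans (*-congˡ (at (≡.cong does m))) (zeroʳ 1#))))
            go false w (yes (x , σ∋x , Wx)) m = trans (*-congˡ b≈0) (trans (zeroʳ _) (sym (trans (*-congˡ (trans (at (≡.cong does m)) b≈0)) (zeroʳ 1#))))
              where
              b≈0 : b σ ≈ 0#
              b≈0 = sb σ λ { (_ , disj , τ′ , τ′∈ , σ⊑ , A⊑′) → ∋∌
                (W-closed x v τ′ (disj x σ∋x) (disj v σ∋v) (λ { ≡.refl → ∋∌ Wx w }) τ′∈ A⊑′ (σ⊑ x σ∋x) (σ⊑ v σ∋v) Wx) w }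
          zero-side : ∂ φ ch ∅ ≈ 0#
          zero-side = begin
            ∂ φ ch ∅                  ≈⟨ Linear.cong (∂-linear φ) eqb ∅ ⟩
            ∂ φ (∂ one′ b) ∅          ≈⟨ ∂-anticomm φ one′ b ∅ ⟩
            - ∂ one′ (∂ φ b) ∅        ≈⟨ -‿cong (Linear.cong (∂-linear one′) (λ τ → ∂-local τ (agree τ)) ∅) ⟩
            - ∂ one′ (∂ one′ bW) ∅    ≈⟨ -‿cong (∂∂ one′ bW ∅) ⟩
            - 0#                      ≈⟨ -0#≈0# ⟩
            0#                        ∎

      -- Let W consist of the vertices whose addition to `A` gives a subset of a face with at least
      -- `d` elements. By induction, applied to `A` with one more vertex, W is closed under
      -- adjacency in the link; it is nonempty since `A` is full, and the link is connected, so `u`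
      -- belongs to W.
      full-neighbour : ∀ e A → ∣ A ∣ ℕ.+ suc e ≡ d → Full A → ∀ u → A ∌ u → (A [ u ]≔ true) ∈ᶠ Δ → ¬ ¬ Full (A [ u ]≔ true)
      full-neighbour zero A eq full u A∌u ∈Δ = return (A [ u ]≔ true , ∈Δ , (λ _ q → q) ,
        ℕ.≤-reflexive (≡.trans (≡.sym eq) (≡.trans (ℕ.+-comm ∣ A ∣ 1) (≡.sym (card-insert A u A∌u)))))
      full-neighbour (suc e) A eq (τ₀ , τ₀∈ , A⊑ , d≤) u A∌u ∈Δ ¬full =
        ¬¬-∀Fin {P = λ v → Dec (Full (A [ v ]≔ true))} (λ v → ¬¬-excluded-middle) contra
        where
        lt₁ : ∣ A ∣ ℕ.+ 1 ℕ.< d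
        lt₁ = ≡.subst (∣ A ∣ ℕ.+ 1 ℕ.<_) eq (ℕ.+-monoʳ-< ∣ A ∣ (s≤s (s≤s z≤n)))
        extend-⊑ : ∀ v τ → A ⊑ τ → τ ∋ v → (A [ v ]≔ true) ⊑ τ
        extend-⊑ v τ sub τ∋v x h with update-∋⁻ A v h
        ... | inj₁ ≡.refl = τ∋v
        ... | inj₂ q = sub x q
        contra : ¬ (∀ v → Dec (Full (A [ v ]≔ true)))
        contra dec with choose A τ₀ 1 A⊑ (ℕ.≤-trans (ℕ.<⇒≤ lt₁) d≤)
        ... | ρ₀ , ρ₀⊑ , ρ₀-disj , ρ₀-size with ∃∋ ρ₀ (≡.subst (0 ℕ.<_) (≡.sym ρ₀-size) (s≤s z≤n))
        ... | v₀ , ρ₀∋v₀ = Connected.absurd A τ₀ τ₀∈ A⊑ lt₁ d≤ (λ v → does (dec v)) closedW u v₀ A∌u (ρ₀-disj v₀ ρ₀∋v₀) ∈Δ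
            (closed τ₀ _ (extend-⊑ v₀ τ₀ A⊑ (ρ₀⊑ v₀ ρ₀∋v₀)) τ₀∈) (dec-false (dec u) ¬full)
            (dec-true (dec v₀) (τ₀ , τ₀∈ , extend-⊑ v₀ τ₀ A⊑ (ρ₀⊑ v₀ ρ₀∋v₀) , d≤))
          where
          fromTrue : ∀ {P : Set} (d : Dec P) → does d ≡ true → P
          fromTrue (yes p) _ = p
          closedW : ∀ x y τ → A ∌ x → A ∌ y → x ≢ y → τ ∈ᶠ Δ → A ⊑ τ → τ ∋ x → τ ∋ y → does (dec x) ≡ true → does (dec y) ≡ true
          closedW x y τ A∌x A∌y x≢y τ∈ A⊑τ τ∋x τ∋y Wx with dec y
          ... | yes _ = ≡.refl
          ... | no ¬fy = ⊥-elim (full-neighbour e (A [ x ]≔ true)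
              (≡.trans (≡.cong (ℕ._+ suc e) (card-insert A x A∌x)) (≡.trans (≡.sym (ℕ.+-suc ∣ A ∣ (suc e))) eq))
              (fromTrue (dec x) Wx) y (≡.trans (update-other A true (x≢y ∘ ≡.sym)) A∌y)
              (closed τ _ two τ∈) λ full → ¬fy (Full-⊑ (A [ y ]≔ true) ((A [ x ]≔ true) [ y ]≔ true) sub full))
            where
            two : ((A [ x ]≔ true) [ y ]≔ true) ⊑ τ
            two z h with update-∋⁻ (A [ x ]≔ true) y h
            ... | inj₁ ≡.refl = τ∋y
            ... | inj₂ q = extend-⊑ x τ A⊑τ τ∋x z q
            sub : (A [ y ]≔ true) ⊑ ((A [ x ]≔ true) [ y ]≔ true)
            sub z h with update-∋⁻ A y h
            ... | inj₁ ≡.refl = update-same (A [ x ]≔ true) y true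
            ... | inj₂ q = update-∋ (A [ x ]≔ true) y (update-∋ A x q)

      -- Purity of the skeleton. The empty set is full by the hypothesis `big`, and adding the
      -- vertices of `A` one at a time preserves fullness.
      pure : ∀ m A → ∣ A ∣ ≡ m → m ℕ.≤ d → A ∈ᶠ Δ → ¬ ¬ Full A
      pure zero A size m≤ A∈ = let (σ , σ∈ , h) = big in return (σ , σ∈ , (λ x q → ∋∌ q (0-card A size x)) , h)
      pure (suc m) A size m≤ A∈ with ∃∋ A (≡.subst (0 ℕ.<_) (≡.sym size) (s≤s z≤n))
      ... | x , A∋x = pure m A⁻ size⁻ (ℕ.<⇒≤ m≤) (closed A A⁻ (erase-⊑ A x) A∈) >>= λ full →
        ≡.subst (λ S → ¬ ¬ Full S) back (full-neighbour (d ℕ.∸ suc m) A⁻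
          (≡.trans (≡.cong (ℕ._+ suc (d ℕ.∸ suc m)) size⁻) (≡.trans (ℕ.+-suc m _) (ℕ.m+[n∸m]≡n m≤))) full x (update-same A x false)
          (≡.subst (_∈ᶠ Δ) (≡.sym back) A∈))
        where
        A⁻ = A [ x ]≔ false
        back : A⁻ [ x ]≔ true ≡ A
        back = ≡.trans (update-update A x) (update-id A x A∋x)
        size⁻ : ∣ A⁻ ∣ ≡ m
        size⁻ = ℕ.suc-injective (≡.trans (≡.sym (card-erase A x A∋x)) size)

      extend-face : ∀ τ → τ ∈ᶠ Δ → ∣ τ ∣ ℕ.< d → ¬ ¬ (∃ λ y → τ ∌ y × (τ [ y ]≔ true) ∈ᶠ Δ)
      extend-face τ τ∈ lt = pure ∣ τ ∣ τ ≡.refl (ℕ.<⇒≤ lt) τ∈ >>= λ { (τ′ , τ′∈ , τ⊑ , h) → return (found τ′ τ′∈ τ⊑ h) }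
        where
        found : ∀ τ′ → τ′ ∈ᶠ Δ → τ ⊑ τ′ → d ℕ.≤ ∣ τ′ ∣ → ∃ λ y → τ ∌ y × (τ [ y ]≔ true) ∈ᶠ Δ
        found τ′ τ′∈ τ⊑ h with choose τ τ′ 1 τ⊑ (ℕ.≤-trans (≡.subst (ℕ._≤ d) (ℕ.+-comm 1 ∣ τ ∣) lt) h)
        ... | ρ , ρ⊑ , disj , size with ∃∋ ρ (≡.subst (0 ℕ.<_) (≡.sym size) (s≤s z≤n))
        ... | y , ρ∋y = y , disj y ρ∋y , closed τ′ _ sub τ′∈
          where
          sub : (τ [ y ]≔ true) ⊑ τ′
          sub z q with update-∋⁻ τ y q
          ... | inj₁ ≡.refl = ρ⊑ y ρ∋y
          ... | inj₂ p = τ⊑ z p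

      module _ {t₀ : ℕ} (vs : Fin t₀ → Fin n)
        (inv : ∀ i w → (∀ j → toℕ j ℕ.≤ toℕ i → w ≢ vs j) → ∀ S → S ∈ᶠ Δ → S ∋ w → S ∌ vs i → move w (vs i) S ∈ᶠ Δ) where

        -- Enlarge σ by any vertex and shift that vertex to the next vs i.
        add-first : ∀ t → t ℕ.≤ t₀ → ∀ σ → σ ∈ᶠ Δ → ∣ σ ∣ ℕ.+ t ℕ.≤ d →
          ¬ ¬ (∃ λ τ → τ ∈ᶠ Δ × σ ⊑ τ × (∀ i → toℕ i ℕ.< t → τ ∋ vs i) × ∣ τ ∣ ℕ.≤ ∣ σ ∣ ℕ.+ t)
        add-first zero h σ σ∈ c = return (σ , σ∈ , (λ _ q → q) , (λ i ()) , ℕ.m≤m+n _ _)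
        add-first (suc t) h σ σ∈ c = add-first t (ℕ.<⇒≤ h) σ σ∈ (ℕ.≤-trans (ℕ.+-monoʳ-≤ ∣ σ ∣ (ℕ.n≤1+n t)) c) >>= λ { (τ , τ∈ , σ⊑ , has , small) →
          next τ τ∈ σ⊑ has small (∋? τ (vs i)) }
          where
          i = fromℕ< h
          i≡t : toℕ i ≡ t
          i≡t = Fin.toℕ-fromℕ< h
          Result = ∃ λ τ → τ ∈ᶠ Δ × σ ⊑ τ × (∀ i → toℕ i ℕ.< suc t → τ ∋ vs i) × ∣ τ ∣ ℕ.≤ ∣ σ ∣ ℕ.+ suc t
          all : ∀ {τ} → (∀ j → toℕ j ℕ.< t → τ ∋ vs j) → τ ∋ vs i → ∀ j → toℕ j ℕ.< suc t → τ ∋ vs j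
          all {τ} has τ∋ j (s≤s j≤t) with ℕ.m≤n⇒m<n∨m≡n j≤t
          ... | inj₁ lt = has j lt
          ... | inj₂ eq = ≡.subst (λ k → τ ∋ vs k) (Fin.toℕ-injective (≡.trans i≡t (≡.sym eq))) τ∋
          next : ∀ τ → τ ∈ᶠ Δ → σ ⊑ τ → (∀ j → toℕ j ℕ.< t → τ ∋ vs j) → ∣ τ ∣ ℕ.≤ ∣ σ ∣ ℕ.+ t → τ ∋ vs i ⊎ τ ∌ vs i → ¬ ¬ Result
          next τ τ∈ σ⊑ has small (inj₁ τ∋) = return (τ , τ∈ , σ⊑ , all {τ} has τ∋ , ℕ.≤-trans small (ℕ.+-monoʳ-≤ ∣ σ ∣ (ℕ.n≤1+n t)))
          next τ τ∈ σ⊑ has small (inj₂ τ∌) = extend-face τ τ∈ (ℕ.≤-trans (s≤s small) (≡.subst (ℕ._≤ d) (ℕ.+-suc ∣ σ ∣ t) c)) >>= λ { (y , τ∌y , y∈) →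
            return (goal y τ∌y y∈ (y Fin.≟ vs i)) }
            where
            goal : ∀ y → τ ∌ y → (τ [ y ]≔ true) ∈ᶠ Δ → Dec (y ≡ vs i) → Result
            goal y τ∌y y∈ (yes ≡.refl) = τ [ y ]≔ true , y∈ , (λ x q → update-∋ τ y (σ⊑ x q)) ,
              all {τ [ y ]≔ true} (λ j lt → update-∋ τ y (has j lt)) (update-same τ y true) ,
              ℕ.≤-trans (ℕ.≤-reflexive (card-insert τ y τ∌y)) (ℕ.≤-trans (s≤s small) (ℕ.≤-reflexive (≡.sym (ℕ.+-suc ∣ σ ∣ t))))
            goal y τ∌y y∈ (no y≢) = M , inv i y fresh S y∈ S∋y S∌ , (λ x q → keep x (σ⊑ x q)) ,
              all {M} (λ j lt → keep (vs j) (has j lt)) (move-∋ {S = S} S∋y S∌) ,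
              ℕ.≤-trans (ℕ.≤-reflexive (≡.trans (move-card {S = S} S∋y S∌) (card-insert τ y τ∌y))) (ℕ.≤-trans (s≤s small) (ℕ.≤-reflexive (≡.sym (ℕ.+-suc ∣ σ ∣ t))))
              where
              S = τ [ y ]≔ true
              M = move y (vs i) S
              S∋y : S ∋ y
              S∋y = update-same τ y true
              S∌ : S ∌ vs i
              S∌ = ≡.trans (update-other τ true (y≢ ∘ ≡.sym)) τ∌
              keep : ∀ x → τ ∋ x → M ∋ x
              keep x q = move-∋⁺ {S = S} S∋y S∌ (∋∌⇒≢ τ q τ∌y) (update-∋ τ y q)
              -- The earlier `vs j` already belong to τ and `y` does not, so the shift from `y` to
              -- `vs i` is admissible.
              fresh : ∀ j → toℕ j ℕ.≤ toℕ i → y ≢ vs j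
              fresh j j≤i with ℕ.m≤n⇒m<n∨m≡n j≤i
              ... | inj₁ lt = λ { ≡.refl → ∋∌ (has j (ℕ.<-≤-trans lt (ℕ.≤-reflexive i≡t))) τ∌y }
              ... | inj₂ eq = λ q → y≢ (≡.trans q (≡.cong vs (Fin.toℕ-injective eq)))

-- The bound for families all of whose members meet V twice

module TraceBound where
  open import Defs
  open import Level using (Level) renaming (suc to lsuc)
  open import Data.Bool using (Bool; true; false; if_then_else_; _∧_; _∨_)
  import Data.Bool.Properties as Bool
  open import Data.Nat as ℕ using (ℕ; zero; suc; z≤n; s≤s; _≡ᵇ_; _≤ᵇ_)
  import Data.Nat.Properties as ℕ
  open import Data.Fin using (Fin; zero; suc; toℕ; fromℕ<; _↑ˡ_)
  import Data.Fin.Properties as Fin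
  open import Data.Fin.Subset as Subset using (Subset; ∣_∣)
  open import Data.Fin.Subset.Properties using (∣⊤∣≡n)
  open import Data.Vec as Vec using (Vec; []; _∷_; lookup; _[_]≔_; replicate; tabulate; _++_)
  open import Data.Vec.Properties using (lookup-replicate; lookup-map; lookup-++ˡ; lookup∘tabulate)
  open import Data.Product using (∃; ∃₂; _×_; _,_; proj₁; proj₂)
  open import Data.Sum using (_⊎_; inj₁; inj₂)
  open import Data.Empty using (⊥)
  open import Data.Unit using (⊤; tt)
  open import Function using (_∘_)
  import Data.List as List
  open import Algebra.Bundles using (CommutativeRing)
  open import Relation.Nullary using (¬_; Dec; yes; no; does)
  open import Relation.Nullary.Negation using (contradiction)
  open import Relation.Nullary.Decidable using (¬¬-excluded-middle; decidable-stable; _×-dec_; dec-true)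
  open import Relation.Binary.PropositionalEquality as ≡ using (_≡_; _≢_)
  open ExteriorAlgebra
  open Subsets
  open ShiftedFamilies
  open Dimension
  open LeadingSets
  open GenericForms
  open PolynomialCoefficients
  open DepthConsequences

  private variable
    n t : ℕ

  -- Prescribes the trace on `us`: inverse to the passage from a face with trace T to its part
  -- outside `us`.
  upd : Vec (Fin n) t → Subset t → Subset n → Subset n
  upd []       []      ρ = ρ
  upd (v ∷ us) (s ∷ T) ρ = upd us T (ρ [ v ]≔ s)

  Dist : Vec (Fin n) t → Set
  Dist []       = ⊤
  Dist (v ∷ us) = (∀ i → v ≢ lookup us i) × Dist us

  Dist-injective : ∀ (us : Vec (Fin n) t) → Dist us → ∀ i j → lookup us i ≡ lookup us j → i ≡ j
  Dist-injective (v ∷ us) (d , _) zero    zero    _  = ≡.refl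
  Dist-injective (v ∷ us) (d , _) zero    (suc j) eq = contradiction eq (d j)
  Dist-injective (v ∷ us) (d , _) (suc i) zero    eq = contradiction (≡.sym eq) (d i)
  Dist-injective (v ∷ us) (_ , d) (suc i) (suc j) eq = ≡.cong suc (Dist-injective us d i j eq)

  Off : Vec (Fin n) t → Subset n → Set
  Off us ρ = ∀ i → ρ ∌ lookup us i

  trace : Vec (Fin n) t → Subset n → Subset t
  trace us σ = Vec.map (lookup σ) us

  upd-off : ∀ (us : Vec (Fin n) t) T ρ x → (∀ i → x ≢ lookup us i) → lookup (upd us T ρ) x ≡ lookup ρ x
  upd-off []       []      ρ x h = ≡.refl
  upd-off (v ∷ us) (s ∷ T) ρ x h = ≡.trans (upd-off us T _ x (h ∘ suc)) (update-other ρ s (h zero))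

  upd-on : ∀ (us : Vec (Fin n) t) T ρ → Dist us → ∀ i → lookup (upd us T ρ) (lookup us i) ≡ lookup T i
  upd-on (v ∷ us) (s ∷ T) ρ (d , _) zero    = ≡.trans (upd-off us T _ v d) (update-same ρ v s)
  upd-on (v ∷ us) (s ∷ T) ρ (_ , d) (suc i) = upd-on us T _ d i

  trace-upd : ∀ (us : Vec (Fin n) t) T ρ → Dist us → trace us (upd us T ρ) ≡ T
  trace-upd us T ρ d = subset-ext λ i → ≡.trans (lookup-map i (lookup (upd us T ρ)) us) (upd-on us T ρ d i)

  upd-false : ∀ (us : Vec (Fin n) t) ρ → Off us ρ → upd us (replicate t false) ρ ≡ ρ
  upd-false []       ρ off = ≡.refl
  upd-false (v ∷ us) ρ off rewrite update-id ρ v (off zero) = upd-false us ρ (off ∘ suc)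

  Off-update : ∀ (us : Vec (Fin n) t) v s ρ → (∀ i → v ≢ lookup us i) → Off us ρ → Off us (ρ [ v ]≔ s)
  Off-update us v s ρ d off i = ≡.trans (update-other ρ s (d i ∘ ≡.sym)) (off i)

  Off-update⁻ : ∀ (us : Vec (Fin n) t) v s ρ → (∀ i → v ≢ lookup us i) → Off us (ρ [ v ]≔ s) → Off us ρ
  Off-update⁻ us v s ρ d off i = ≡.trans (≡.sym (update-other ρ s (d i ∘ ≡.sym))) (off i)

  upd-card : ∀ (us : Vec (Fin n) t) T ρ → Dist us → Off us ρ → ∣ upd us T ρ ∣ ≡ ∣ ρ ∣ ℕ.+ ∣ T ∣
  upd-card []       []          ρ d off = ≡.sym (ℕ.+-identityʳ _)
  upd-card (v ∷ us) (true ∷ T)  ρ (d , ds) off = ≡.trans (upd-card us T _ ds (Off-update us v true ρ d (off ∘ suc)))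
    (≡.trans (≡.cong (ℕ._+ ∣ T ∣) (card-insert ρ v (off zero))) (≡.sym (ℕ.+-suc _ _)))
  upd-card (v ∷ us) (false ∷ T) ρ (d , ds) off = ≡.trans (upd-card us T _ ds (Off-update us v false ρ d (off ∘ suc)))
    (≡.cong (λ S → ∣ S ∣ ℕ.+ ∣ T ∣) (update-id ρ v (off zero)))

  upd-⊑ : ∀ (us : Vec (Fin n) t) T ρ τ → ρ ⊑ τ → (∀ i → τ ∋ lookup us i) → upd us T ρ ⊑ τ
  upd-⊑ []       []      ρ τ sub has = sub
  upd-⊑ (v ∷ us) (s ∷ T) ρ τ sub has = upd-⊑ us T (ρ [ v ]≔ s) τ step′ (has ∘ suc)
    where
    step′ : (ρ [ v ]≔ s) ⊑ τ
    step′ x h with x Fin.≟ v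
    ... | yes ≡.refl = has zero
    ... | no x≢v = sub x (≡.trans (≡.sym (update-other ρ s x≢v)) h)

  fill-exact : ∀ {n} j (S : Subset n) → j ℕ.≤ n → (∀ x → n ℕ.≤ toℕ x ℕ.+ j → S ∌ x) → ∣ fill j S ∣ ≡ ∣ S ∣ ℕ.+ j
  fill-exact zero [] h off = ≡.refl
  fill-exact {suc n} j (s ∷ S) h off with ℕ.m≤n⇒m<n∨m≡n h
  ... | inj₂ ≡.refl = ≡.trans (≡.cong ∣_∣ (subset-ext {S = fill j (s ∷ S)} {replicate (suc n) true}
        λ x → ≡.trans (fill-top j (s ∷ S) x (ℕ.m≤n+m j (toℕ x))) (≡.sym (lookup-replicate x true))))
      (≡.trans (∣⊤∣≡n (suc n)) (≡.cong (ℕ._+ suc n) (≡.sym (card-0 (s ∷ S) λ x → off x (ℕ.m≤n+m j (toℕ x))))))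
  ... | inj₁ (s≤s j≤n) = go s (suc n ≤ᵇ j) ≡.refl
    where
    rec : ∣ fill j S ∣ ≡ ∣ S ∣ ℕ.+ j
    rec = fill-exact j S j≤n λ x q → off (suc x) (s≤s q)
    go : ∀ s b → (suc n ≤ᵇ j) ≡ b → ∣ (s ∨ b) ∷ fill j S ∣ ≡ ∣ s ∷ S ∣ ℕ.+ j
    go true b _ = ≡.cong suc rec
    go false false _ = rec
    go false true eq = contradiction (≤ᵇ-elim {suc n} eq) (ℕ.<⇒≱ (s≤s j≤n))

  vcard-++ : ∀ {r} e (S : Subset e) (T : Subset (suc r)) → vcard e (S ++ T) ≡ ∣ T ∣
  vcard-++ zero    []      T = ≡.refl
  vcard-++ (suc e) (s ∷ S) T = vcard-++ e S T

  lastᵇ-++ : ∀ {r} e (S : Subset e) (T : Subset (suc r)) → lastᵇ (S ++ T) ≡ lastᵇ T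
  lastᵇ-++ zero    []      T = ≡.refl
  lastᵇ-++ (suc e) (s ∷ S) T = ≡.trans (lastᵇ-∷ s (S ++ T) (0<e+ e)) (lastᵇ-++ e S T)

  module Trace {n : ℕ} (Δ : Family n) (r′ : ℕ) (vs : Fin (suc (suc r′)) → Fin n)
    (vs-injective : ∀ {i j} → vs i ≡ vs j → i ≡ j) where

    private
      r = suc r′

    -- us t lists vs (t - 1), …, vs 0, so that vs 0 becomes the strongest functional.
    us : ∀ t → t ℕ.≤ suc r → Vec (Fin n) t
    us zero    h = []
    us (suc t) h = vs (fromℕ< h) ∷ us t (ℕ.<⇒≤ h)

    us-index : ∀ t h i → ∃ λ k → toℕ k ℕ.< t × lookup (us t h) i ≡ vs k
    us-index (suc t) h zero = fromℕ< h , ≡.subst (ℕ._< suc t) (≡.sym (Fin.toℕ-fromℕ< h)) (ℕ.n<1+n t) , ≡.refl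
    us-index (suc t) h (suc i) with us-index t (ℕ.<⇒≤ h) i
    ... | k , lt , eq = k , ℕ.m≤n⇒m≤1+n lt , eq

    us-dist : ∀ t h → Dist (us t h)
    us-dist zero    h = tt
    us-dist (suc t) h = (λ i eq → let (k , lt , eq′) = us-index t (ℕ.<⇒≤ h) i in
      ℕ.<-irrefl (≡.trans (≡.cong toℕ (vs-injective (≡.trans (≡.sym eq′) (≡.sym eq)))) (Fin.toℕ-fromℕ< h)) lt) , us-dist t (ℕ.<⇒≤ h)

    V : Vec (Fin n) (suc r)
    V = us (suc r) ℕ.≤-refl

    tr : Subset n → Subset (suc r)
    tr = trace V

    trace-last : ∀ t h σ → lastᵇ (trace (us (suc t) h) σ) ≡ lookup σ (vs zero)
    trace-last zero    h σ = ≡.refl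
    trace-last (suc t) h σ = trace-last t (ℕ.<⇒≤ h) σ

    has-us : ∀ t h τ → (∀ i → toℕ i ℕ.< t → τ ∋ vs i) → ∀ i → τ ∋ lookup (us t h) i
    has-us t h τ has i with us-index t h i
    ... | k , lt , eq = ≡.trans (≡.cong (lookup τ) eq) (has k lt)

    Vset : Subset n
    Vset = upd V (replicate (suc r) true) (replicate n false)

    Vset-card : ∣ Vset ∣ ≡ suc r
    Vset-card = ≡.trans (upd-card V (replicate (suc r) true) _ (us-dist (suc r) ℕ.≤-refl) (λ i → lookup-replicate (lookup V i) false))
      (≡.cong₂ ℕ._+_ (card-0 (replicate n false) (λ x → lookup-replicate x false)) (∣⊤∣≡n (suc r)))

    Vset-∋ : ∀ i → Vset ∋ lookup V i
    Vset-∋ i = ≡.trans (upd-on V (replicate (suc r) true) _ (us-dist (suc r) ℕ.≤-refl) i) (lookup-replicate i true)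

    us-has : ∀ t h k → toℕ k ℕ.< t → ∃ λ i → lookup (us t h) i ≡ vs k
    us-has (suc t) h k (s≤s k≤t) with ℕ.m≤n⇒m<n∨m≡n k≤t
    ... | inj₁ lt = let (i , eq) = us-has t (ℕ.<⇒≤ h) k lt in suc i , eq
    ... | inj₂ eq = zero , ≡.cong vs (Fin.toℕ-injective (≡.trans (Fin.toℕ-fromℕ< h) (≡.sym eq)))

    V-has : ∀ k → ∃ λ i → lookup V i ≡ vs k
    V-has k = us-has (suc r) ℕ.≤-refl k (Fin.toℕ<n k)

    Vset-vs : ∀ k → Vset ∋ vs k
    Vset-vs k = let (i , eq) = V-has k in ≡.subst (Vset ∋_) eq (Vset-∋ i)

    Vset-∋⁻ : ∀ {x} → Vset ∋ x → ∃ λ k → x ≡ vs k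
    Vset-∋⁻ {x} h with Fin.any? (λ i → x Fin.≟ lookup V i)
    ... | yes (i , eq) = let (k , _ , eq′) = us-index (suc r) ℕ.≤-refl i in k , ≡.trans eq eq′
    ... | no none = ∋∌ h (≡.trans (upd-off V (replicate (suc r) true) _ x (λ i eq → none (i , eq))) (lookup-replicate x false))

    two-in-trace : ∀ σ {k l} → k ≢ l → σ ∋ vs k → σ ∋ vs l → 2 ℕ.≤ ∣ tr σ ∣
    two-in-trace σ {k} {l} k≢l σ∋k σ∋l with V-has k | V-has l
    ... | i , eqi | j , eqj = ≡.subst (2 ℕ.≤_) (≡.sym (≡.trans (card-erase (tr σ) i (at i eqi σ∋k))
        (≡.cong suc (card-erase (tr σ [ i ]≔ false) j (≡.trans (update-other (tr σ) false j≢i) (at j eqj σ∋l)))))) (s≤s (s≤s z≤n))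
      where
      at : ∀ i {k} → lookup V i ≡ vs k → σ ∋ vs k → tr σ ∋ i
      at i eq h = ≡.trans (lookup-map i (lookup σ) V) (≡.trans (≡.cong (lookup σ) eq) h)
      j≢i : j ≢ i
      j≢i ≡.refl = k≢l (vs-injective (≡.trans (≡.sym eqi) eqj))

    trace-two : ∀ σ → 2 ℕ.≤ ∣ tr σ ∣ → ∃ λ k → k ≢ zero × σ ∋ vs k
    trace-two σ h with ∃∋ (tr σ) (ℕ.≤-trans (s≤s z≤n) h)
    ... | i , tr∋i with ∃∋ (tr σ [ i ]≔ false) (ℕ.≤-pred (≡.subst (2 ℕ.≤_) (card-erase (tr σ) i tr∋i) h))
    ... | j , tr∋j with us-index (suc r) ℕ.≤-refl i | us-index (suc r) ℕ.≤-refl j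
    ... | k , _ , eqk | l , _ , eql = pick (k Fin.≟ zero)
      where
      back : ∀ i {k} → lookup V i ≡ vs k → tr σ ∋ i → σ ∋ vs k
      back i eq h = ≡.trans (≡.cong (lookup σ) (≡.sym eq)) (≡.trans (≡.sym (lookup-map i (lookup σ) V)) h)
      pick : Dec (k ≡ zero) → ∃ λ k → k ≢ zero × σ ∋ vs k
      pick (no k≢0) = k , k≢0 , back i eqk tr∋i
      pick (yes ≡.refl) = l , (λ { ≡.refl → i≢j (Dist-injective V (us-dist (suc r) ℕ.≤-refl) i j (≡.trans eqk (≡.sym eql))) }) ,
        back j eql (erase-⊑ (tr σ) i j tr∋j)
        where
        i≢j : i ≢ j
        i≢j ≡.refl = ∋∌ tr∋j (update-same (tr σ) i false)

    -- The analogue in `Δ` of `target`: `lastᵇ` of the trace says that v₁ is present.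
    starFaces : Family n
    starFaces σ = Δ σ ∧ ((∣ σ ∣ ≡ᵇ r) ∧ (lastᵇ (tr σ) ∧ (2 ≤ᵇ ∣ tr σ ∣)))

  module LeadingBound {κ ℓ : Level} (𝔻 : Domain κ ℓ) {n : ℕ} (Δ : Family n)
    (Δ-closed : ∀ σ τ → τ ⊑ σ → σ ∈ᶠ Δ → τ ∈ᶠ Δ) (d r′ : ℕ) (2r≤d : suc r′ ℕ.+ suc r′ ℕ.≤ d)
    (vs : Fin (suc (suc r′)) → Fin n) (vs-injective : ∀ {i j} → vs i ≡ vs j → i ≡ j)
    (add : ∀ t → t ℕ.≤ suc (suc r′) → ∀ σ → σ ∈ᶠ Δ → ∣ σ ∣ ℕ.+ t ℕ.≤ d →
      ¬ ¬ (∃ λ τ → τ ∈ᶠ Δ × σ ⊑ τ × (∀ i → toℕ i ℕ.< t → τ ∋ vs i) × ∣ τ ∣ ℕ.≤ ∣ σ ∣ ℕ.+ t))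
    (θ : Fin n → Domain.Carrier 𝔻)
    (θ-distinct : ∀ {u v} → u ≢ v → ¬ (Domain._≈_ 𝔻 (Domain._-_ 𝔻 (θ v) (θ u)) (Domain.0# 𝔻)))
    (hom : ∀ B p → ∣ B ∣ ℕ.+ p ℕ.< d → ∀ x → Leading.Supp 𝔻 (Link.LinkP Δ B p) x → Leading._≋_ 𝔻 (Leading.∂ 𝔻 (λ _ → Domain.1# 𝔻) x) (Leading.𝟎 𝔻) →
      ¬ ¬ (∃ λ b → Leading.Supp 𝔻 (Link.LinkP Δ B (suc p)) b × Leading._≋_ 𝔻 x (Leading.∂ 𝔻 (λ _ → Domain.1# 𝔻) b))) where

    open Trace Δ r′ vs vs-injective

    private
      r = suc r′
      open Domain 𝔻 using (Carrier; _≈_; 0#; 1#; trans; sym; *-congˡ; *-congʳ; zeroʳ; zeroˡ; cancel; stable; 1≉0)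
      open Leading 𝔻
      open Complex Δ Δ-closed
      open Generic 𝔻 Δ d θ θ-distinct
      open Link Δ

      procP-elim : ∀ {t} (us : Vec (Fin n) t) T {P} ρ → Dist us → procP us T P ρ → Off us ρ × P (upd us T ρ)
      procP-elim []       []      ρ d p = (λ ()) , p
      procP-elim (v ∷ us) (s ∷ T) ρ (d , ds) (ρ∌v , q) with procP-elim us T (ρ [ v ]≔ s) ds q
      ... | off , p = (λ { zero → ρ∌v ; (suc i) → Off-update⁻ us v s ρ d off i }) , p

      procP-intro : ∀ {t} (us : Vec (Fin n) t) T {P} ρ → Dist us → Off us ρ → P (upd us T ρ) → procP us T P ρ
      procP-intro []       []      ρ d off p = p
      procP-intro (v ∷ us) (s ∷ T) ρ (d , ds) off p = off zero , procP-intro us T (ρ [ v ]≔ s) ds (Off-update us v s ρ d (off ∘ suc)) p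

      ones : Fin n → Carrier
      ones _ = 1#

      face-with : ∀ t (h : t ℕ.≤ suc r) ρ → ρ ∈ᶠ Δ → ∣ ρ ∣ ℕ.+ t ℕ.≤ r ℕ.+ r → ¬ ¬ (∃ λ τ → τ ∈ᶠ Δ × ρ ⊑ τ × (∀ i → τ ∋ lookup (us t h) i))
      face-with t h ρ ρ∈ c = add t h ρ ρ∈ (ℕ.≤-trans c 2r≤d) >>= λ { (τ , τ∈ , ρ⊑ , has , _) →
        return (τ , τ∈ , ρ⊑ , has-us t h τ has) }

      -- For coordinate forms the condition is combinatorial: the kernels give the faces avoiding
      -- these vertices, the images give their link, and `add` shows that small faces of the former
      -- kind lie in the link.
      extendable-us : ∀ t h → Extendable (r ℕ.+ r) (coords (us t h))
      extendable-us zero    h = _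
      extendable-us (suc t) h = extendable-us t (ℕ.<⇒≤ h) , λ q q≤ x p →
        Proc-coords⁺ Uₜ (replicate (suc t) true) (Face (q ℕ.+ suc t)) x (supp λ ρ out →
          vanish (Proc-coords⁻ Uₜ (replicate (suc t) false) (Face q) x p) ρ λ pp → impossible q q≤ ρ out pp)
        where
        Uₜ = us (suc t) h
        impossible : ∀ q → q ℕ.+ suc t ℕ.≤ r ℕ.+ r → ∀ ρ → ¬ procP Uₜ (replicate (suc t) true) (Face (q ℕ.+ suc t)) ρ →
          ¬ procP Uₜ (replicate (suc t) false) (Face q) ρ
        impossible q q≤ ρ out pp with procP-elim Uₜ (replicate (suc t) false) {Face q} ρ (us-dist (suc t) h) pp
        ... | off , face with ≡.subst (Face q) (upd-false Uₜ ρ off) face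
        ... | size , ρ∈ = face-with (suc t) h ρ ρ∈ (≡.subst (λ m → m ℕ.+ suc t ℕ.≤ r ℕ.+ r) (≡.sym size) q≤) λ { (τ , τ∈ , ρ⊑ , has) →
          out (procP-intro Uₜ (replicate (suc t) true) ρ (us-dist (suc t) h) off
            (≡.trans (upd-card Uₜ (replicate (suc t) true) ρ (us-dist (suc t) h) off) (≡.cong₂ ℕ._+_ size (∣⊤∣≡n (suc t))) ,
             Δ-closed τ _ (upd-⊑ Uₜ (replicate (suc t) true) ρ τ ρ⊑ has) τ∈)) }

      fs : ∀ m → Vec (Fin n → Carrier) m
      fs zero    = []
      fs (suc m) = W ones m ∷ fs m

      killed-false : ∀ j q x → Proc (fs j ++ coords V) (replicate (j ℕ.+ suc r) false) (C q) x →
        Killed ones j x × Proc (coords V) (replicate (suc r) false) (C q) x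
      killed-false zero q x p = (λ i ()) , p
      killed-false (suc j) q x (p , k) with killed-false j q x p
      ... | kill , base = (λ i i<j → both i (ℕ.m≤n⇒m<n∨m≡n (ℕ.≤-pred i<j))) , base
        where
        both : ∀ i → i ℕ.< j ⊎ i ≡ j → ∂ (W ones i) x ≋ 𝟎
        both i (inj₁ lt) = kill i lt
        both i (inj₂ ≡.refl) = Level.lower k

      ∅ : Subset n
      ∅ = replicate n false

      -- The limit on `q` leaves room for all of V, so a face avoiding V can be enlarged by V and
      -- thus lies in its link.
      off-link : ∀ q → q ℕ.+ suc r ℕ.≤ r ℕ.+ r → ∀ x → Proc (coords V) (replicate (suc r) false) (C q) x → Supp (SP Vset ∅ q) x
      off-link q q≤ x p = supp λ ρ out → vanish (Proc-coords⁻ V (replicate (suc r) false) (Face q) x p) ρ λ pp → impossible ρ out pp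
        where
        impossible : ∀ ρ → ¬ SP Vset ∅ q ρ → ¬ procP V (replicate (suc r) false) (Face q) ρ
        impossible ρ out pp with procP-elim V (replicate (suc r) false) {Face q} ρ (us-dist (suc r) ℕ.≤-refl) pp
        ... | off , face with ≡.subst (Face q) (upd-false V ρ off) face
        ... | size , ρ∈ = face-with (suc r) ℕ.≤-refl ρ ρ∈ (≡.subst (λ m → m ℕ.+ suc r ℕ.≤ r ℕ.+ r) (≡.sym size) q≤) λ { (τ , τ∈ , ρ⊑ , has) →
          out (size , disj , τ , τ∈ , ρ⊑ , (λ x h → ∋∌ h (lookup-replicate x false)) ,
            upd-⊑ V (replicate (suc r) true) ∅ τ (λ x h → ∋∌ h (lookup-replicate x false)) has) }
          where
          disj : Disj ρ Vset
          disj x ρ∋x = ≡.trans (upd-off V (replicate (suc r) true) ∅ x (λ { i ≡.refl → ∋∌ ρ∋x (off i) })) (lookup-replicate x false)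

      -- Exactness on the link of V writes the chain as a contraction by the last form. The preimage
      -- has one more degree and one form fewer to respect, and the recursion ends with the
      -- coordinate forms of V, whose images are the link.
      lift-true : ∀ j k x → suc r ℕ.+ (k ℕ.+ j) ℕ.≤ d → Supp (SP Vset ∅ k) x → Killed ones j x →
        Proc (fs j ++ coords V) (replicate (j ℕ.+ suc r) true) (C (k ℕ.+ (j ℕ.+ suc r))) x
      lift-true zero k x h sx kill = Proc-coords⁺ V (replicate (suc r) true) (Face (k ℕ.+ suc r)) x
        (supp λ ρ out → vanish sx ρ λ { (size , disj , τ , τ∈ , ρ⊑ , _ , V⊑) →
          let off = λ i → off-at ρ disj i in
          out (procP-intro V (replicate (suc r) true) ρ (us-dist (suc r) ℕ.≤-refl) off
            (≡.trans (upd-card V (replicate (suc r) true) ρ (us-dist (suc r) ℕ.≤-refl) off) (≡.cong₂ ℕ._+_ size (∣⊤∣≡n (suc r))) ,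
             Δ-closed τ _ (upd-⊑ V (replicate (suc r) true) ρ τ ρ⊑ (λ i → V⊑ _ (Vset-∋ i))) τ∈)) })
        where
        off-at : ∀ ρ → Disj ρ Vset → Off V ρ
        off-at ρ disj i with ∋? ρ (lookup V i)
        ... | inj₂ q = q
        ... | inj₁ q = ∋∌ (Vset-∋ i) (disj _ q)
      lift-true (suc j) k x h sx kill =
        exact hom (d ℕ.∸ suc r) Vset (≡.trans (≡.cong (ℕ._+ (d ℕ.∸ suc r)) Vset-card) (ℕ.m+[n∸m]≡n (ℕ.≤-trans (ℕ.m≤m+n (suc r) _) h)))
          ones (λ _ _ → 1≉0) ∅ j k
          (ℕ.+-cancelˡ-≤ (suc r) _ _ (≡.subst (suc r ℕ.+ (k ℕ.+ suc j) ℕ.≤_) (≡.sym (ℕ.m+[n∸m]≡n (ℕ.≤-trans (ℕ.m≤m+n (suc r) _) h))) h))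
          x sx kill >>= λ { (s , y , nz , sy , ky , e) →
        return (s , y , nz , ≡.subst (λ m → Proc (fs j ++ coords V) (replicate (j ℕ.+ suc r) true) (C m) y) (≡.sym (ℕ.+-suc k (j ℕ.+ suc r)))
          (lift-true j (suc k) y (≡.subst (λ m → suc r ℕ.+ m ℕ.≤ d) (ℕ.+-suc k j) h) sy ky) , e) }

      extendable-fs : ∀ j → Extendable (r ℕ.+ r) (fs j ++ coords V)
      extendable-fs zero = extendable-us (suc r) ℕ.≤-refl
      extendable-fs (suc j) = extendable-fs j , λ q q≤ x p →
        let (kill , base) = killed-false (suc j) q x p in
        lift-true (suc j) q x (ℕ.≤-trans (ℕ.≤-trans (ℕ.≤-reflexive (≡.trans (ℕ.+-comm (suc r) _) (ℕ.+-assoc q (suc j) (suc r)))) q≤) 2r≤d)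
          (off-link q (ℕ.≤-trans (ℕ.+-monoʳ-≤ q (ℕ.m≤n+m (suc r) (suc j))) q≤) x base) kill

      -- `r′ + suc r` equals 2r, so the Vandermonde forms and V fill the whole size limit. For the
      -- `n` coordinate forms in front `Extendable` is vacuous; they reduce every remaining chain to
      -- a scalar.
      ψ : Vec (Fin n → Carrier) ((n ℕ.+ r′) ℕ.+ suc r)
      ψ = (tabulate δ ++ fs r′) ++ coords V

      extendable-ψ : Extendable (r ℕ.+ r) ψ
      extendable-ψ = go (tabulate δ)
        where
        go : ∀ {m} (es : Vec (Fin n → Carrier) m) → Extendable (r ℕ.+ r) ((es ++ fs r′) ++ coords V)
        go [] = extendable-fs r′
        go {suc m} (φ ∷ es) = go es , λ q q≤ → contradiction (ℕ.≤-trans (s≤s (ℕ.≤-trans long (ℕ.≤-reflexive (≡.sym (ℕ.+-assoc m r′ (suc r))))))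
            (ℕ.≤-trans (ℕ.m≤n+m _ q) q≤)) (ℕ.<-irrefl ≡.refl)
          where
          long : r ℕ.+ r ℕ.≤ m ℕ.+ (r′ ℕ.+ suc r)
          long = ℕ.≤-trans (ℕ.≤-reflexive (≡.sym (ℕ.+-suc r′ r))) (ℕ.m≤n+m _ m)

      scalars : ∀ S {L : Sub n} → Scalars (Proc ψ S L)
      scalars S {L} x p σ 0<σ with ∃∋ σ 0<σ
      ... | u , σ∋u = killed-vanish u (≡.subst (λ φ → ∂ φ x ≋ 𝟎) is-δ (Proc-killed ψ S {L} ((u ↑ˡ r′) ↑ˡ suc r) x p)) σ σ∋u
        where
        is-δ : lookup ψ ((u ↑ˡ r′) ↑ˡ suc r) ≡ δ u
        is-δ = ≡.trans (lookup-++ˡ (tabulate δ ++ fs r′) (coords V) (u ↑ˡ r′)) (≡.trans (lookup-++ˡ (tabulate δ) (fs r′) u) (lookup∘tabulate δ u))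

      only-∅ : ∀ S {L : Sub n} x → Proc ψ S L x → x ∅ ≈ 0# → x ≋ 𝟎
      only-∅ S {L} x p h σ with ∣ σ ∣ in eq
      ... | suc _ = scalars S {L} x p σ (≡.subst (0 ℕ.<_) (≡.sym eq) (s≤s z≤n))
      ... | zero = ≡.subst (λ τ → x τ ≈ 0#) (subset-ext λ v → ≡.trans (lookup-replicate v false) (≡.sym (0-card σ eq v))) h

      -- Only the coefficient at the empty set can survive, and each image step lowers the degree by
      -- exactly one.
      lead-size : ∀ S k → Lead (Proc ψ S (C k)) → ∣ S ∣ ≡ k
      lead-size S k lead = decidable-stable (∣ S ∣ ℕ.≟ k) λ ne → lead λ x p → only-∅ S {C k} x p
        (vanish (Proc-degree ψ S k x (Proc-mono ψ S (λ y q → supp λ ρ h → vanish q ρ (h ∘ proj₁)) x p)) ∅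
          λ eq → ne (≡.trans (≡.cong (ℕ._+ ∣ S ∣) (≡.sym (card-0 ∅ (λ v → lookup-replicate v false)))) eq))

      Lead-mono : ∀ {L M : Sub n} → L ⊆ M → Lead L → Lead M
      Lead-mono h lead z = lead λ x p → z x (h x p)

      LeadΔ : Subset ((n ℕ.+ r′) ℕ.+ suc r) → Set _
      LeadΔ S = Lead (Proc ψ S (C ∣ S ∣))

      -- `S` is reduced by `Proc-delete` to `S₁`, the part of `S′` before the last `j` positions,
      -- and all of these positions are restored by `Proc-extend`.
      LeadΔ-star : ∀ j S S′ → j ℕ.≤ (n ℕ.+ r′) ℕ.+ suc r → LeadΔ S →
        (∀ x → S′ ∋ x → S ∋ x ⊎ (n ℕ.+ r′) ℕ.+ suc r ℕ.≤ toℕ x ℕ.+ j) →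
        (∀ x → (n ℕ.+ r′) ℕ.+ suc r ℕ.≤ toℕ x ℕ.+ j → S′ ∋ x) → ∣ S′ ∣ ℕ.≤ r ℕ.+ r → LeadΔ S′
      LeadΔ-star j S S′ j≤ lead sub top small = Lead-mono
        (λ x p → ≡.subst (λ m → Proc ψ S′ (C m) x) (≡.sym size)
          (Proc-extend ψ extendable-ψ j S₁ S′ ∣ S₁ ∣ j≤ (λ y t → S₁-top y t , top y t) same (≡.subst (ℕ._≤ r ℕ.+ r) size small) x
            (Proc-delete ψ S S₁ ∣ S ∣ ∣ S₁ ∣ S₁⊑ (ℕ.+-comm ∣ S ∣ ∣ S₁ ∣) x p))) lead
        where
        N = (n ℕ.+ r′) ℕ.+ suc r
        Top? : ∀ (x : Fin N) → Dec (N ℕ.≤ toℕ x ℕ.+ j)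
        Top? x = N ℕ.≤? toℕ x ℕ.+ j
        S₁ : Subset N
        S₁ = tabulate λ x → if does (Top? x) then false else lookup S′ x
        S₁-top : ∀ x → N ℕ.≤ toℕ x ℕ.+ j → S₁ ∌ x
        S₁-top x t = ≡.trans (lookup∘tabulate (λ x → if does (Top? x) then false else lookup S′ x) x) (go (Top? x))
          where
          go : (dt : Dec (N ℕ.≤ toℕ x ℕ.+ j)) → (if does dt then false else lookup S′ x) ≡ false
          go (yes _) = ≡.refl
          go (no h) = contradiction t h
        same : ∀ x → ¬ (N ℕ.≤ toℕ x ℕ.+ j) → lookup S₁ x ≡ lookup S′ x
        same x t = ≡.trans (lookup∘tabulate (λ x → if does (Top? x) then false else lookup S′ x) x) (go (Top? x))
          where
          go : (dt : Dec (N ℕ.≤ toℕ x ℕ.+ j)) → (if does dt then false else lookup S′ x) ≡ lookup S′ x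
          go (yes h) = contradiction h t
          go (no _) = ≡.refl
        S₁⊑ : S₁ ⊑ S
        S₁⊑ x h with Top? x
        ... | yes t = ∋∌ h (S₁-top x t)
        ... | no t with sub x (≡.trans (≡.sym (same x t)) h)
        ... | inj₁ q = q
        ... | inj₂ q = contradiction q t
        fills : fill j S₁ ≡ S′
        fills = subset-ext λ x → go x (Top? x)
          where
          go : ∀ x → Dec (N ℕ.≤ toℕ x ℕ.+ j) → lookup (fill j S₁) x ≡ lookup S′ x
          go x (yes t) = ≡.trans (fill-top j S₁ x t) (≡.sym (top x t))
          go x (no t) with ∋? (fill j S₁) x
          ... | inj₁ h with fill-∋ j S₁ x h
          ... | inj₁ q = ≡.trans h (≡.sym (≡.trans (≡.sym (same x t)) q))
          ... | inj₂ q = contradiction q t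
          go x (no t) | inj₂ h with ∋? S₁ x
          ... | inj₁ q = ∋∌ (fill-⊒ j S₁ x q) h
          ... | inj₂ q = ≡.trans h (≡.trans (≡.sym q) (same x t))
        size : ∣ S′ ∣ ≡ ∣ S₁ ∣ ℕ.+ j
        size = ≡.trans (≡.cong ∣_∣ (≡.sym fills)) (fill-exact j S₁ j≤ S₁-top)

      Proc-zero : ∀ {N} (χ : Vec (Fin n → Carrier) N) S {L : Sub n} → (∀ x → L x → x ≋ 𝟎) → ∀ x → Proc χ S L x → x ≋ 𝟎
      Proc-zero [] [] h = h
      Proc-zero (φ ∷ χ) (false ∷ S) h x (p , _) = Proc-zero χ S h x p
      Proc-zero (φ ∷ χ) (true ∷ S) h y p σ = stable (p >>= λ { (s , x , nz , l , e) →
        return (cancel nz (trans (e σ) (Linear.zero! (∂-linear φ) (Proc-zero χ S h x l) σ))) })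

      wedge-∅ : ∀ {m} (x y : Ch m) → (x ⋀ y) (replicate m false) ≡ Domain._*_ 𝔻 (x (replicate m false)) (y (replicate m false))
      wedge-∅ {zero}  x y = ≡.refl
      wedge-∅ {suc m} x y = wedge-∅ (x ∘ (false ∷_)) (y ∘ (false ∷_))

      -- For disjoint `S` and `S′` the surviving chains are orthogonal. Their product at the empty
      -- set is the product of two scalars, of which one must vanish.
      lead-meet : ∀ (A : Family n) → Inter A → ∀ S S′ → Lead (Proc ψ S (Fam A)) → Lead (Proc ψ S′ (Fam A)) → ¬ ¬ Meet S S′
      lead-meet A meet S S′ lead lead′ ¬meet = lead λ x p → only-∅ S {Fam A} x p (stable λ x≉0 →
        lead′ λ y q → only-∅ S′ {Fam A} y q (cancel x≉0 (≡.subst (_≈ 0#) (wedge-∅ x y)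
          (proj₁ (Proc-orth ψ S S′ {Fam A} {Fam A} (Fam-orth A meet) (λ v a b → ¬meet (v , a , b)) x y p q) ∅))))

      -- The coordinate forms of V act first and replace a family by the part with trace T, so
      -- membership matters only on sets with that trace.
      split-trace : ∀ (S₀ : Subset (n ℕ.+ r′)) (T : Subset (suc r)) {P Q : Subset n → Set} → (∀ ρ → Off V ρ → P (upd V T ρ) → Q (upd V T ρ)) →
        Proc ψ (S₀ ++ T) (Supp P) ⊆ Proc ψ (S₀ ++ T) (Supp Q)
      split-trace S₀ T {P} {Q} h x p = ≡.subst (λ L → L x) (≡.sym (Proc-++ (tabulate δ ++ fs r′) (coords V) S₀ T {Supp Q}))
        (Proc-mono (tabulate δ ++ fs r′) S₀ inner x (≡.subst (λ L → L x) (Proc-++ (tabulate δ ++ fs r′) (coords V) S₀ T {Supp P}) p))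
        where
        inner : Proc (coords V) T (Supp P) ⊆ Proc (coords V) T (Supp Q)
        inner y q = Proc-coords⁺ V T Q y (supp λ ρ out → vanish (Proc-coords⁻ V T P y q) ρ λ pp →
          let (off , pu) = procP-elim V T {P} ρ (us-dist (suc r) ℕ.≤-refl) pp in
          out (procP-intro V T ρ (us-dist (suc r) ℕ.≤-refl) off (h ρ off pu)))

      meet? : ∀ {m} (S S′ : Subset m) → Dec (Meet S S′)
      meet? S S′ = Fin.any? λ x → (lookup S x Bool.≟ true) ×-dec (lookup S′ x Bool.≟ true)

      splitS : ∀ (S : Subset ((n ℕ.+ r′) ℕ.+ suc r)) → ∃₂ λ (S₀ : Subset (n ℕ.+ r′)) (T : Subset (suc r)) → S ≡ S₀ ++ T
      splitS S = Vec.splitAt (n ℕ.+ r′) S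

    -- `D′` collects the leading sets of `Δ` in all degrees, as `Star` requires. An r-set of `D′` in
    -- the target has a trace containing v₁ and another vertex of V; all r-faces with this trace are
    -- `starFaces`, so it is a leading set of `starFaces`, and there are as many of those as of
    -- `starFaces`.
    intersecting-bound : (A : Family n) → (∀ σ → σ ∈ᶠ A → σ ∈ᶠ Δ) → Uniform r A → Inter A → (∀ σ → σ ∈ᶠ A → 2 ℕ.≤ ∣ tr σ ∣) →
      ¬ ¬ (countSubsets A ℕ.≤ 1 ℕ.+ countSubsets starFaces)
    intersecting-bound A A⊆Δ uni meet h2 =
      leading-family ψ (Supp-isSub _) (Dim-Fam A) (λ S → scalars S {Fam A}) >>= λ { (A′ , cA , A′⇒ , _) →
      leading-family ψ (Supp-isSub _) (Dim-Fam starFaces) (λ S → scalars S {Fam starFaces}) >>= λ { (B′ , cB , _ , ⇒B′) →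
      ¬¬-∀Subset {P = λ S → Dec (LeadΔ S)} (λ S → ¬¬-excluded-middle) >>= λ dec →
      let D′ : Family ((n ℕ.+ r′) ℕ.+ suc r)
          D′ S = does (dec S)
          isTrue : ∀ {S} → LeadΔ S → S ∈ᶠ D′
          isTrue {S} l = dec-true (dec S) l
          fromTrue : ∀ {S} → S ∈ᶠ D′ → LeadΔ S
          fromTrue {S} q = elim (dec S) q
      in hilton-milner-star {r′} (n ℕ.+ r′) (s≤s (ℕ.m≤n+m r′ n)) D′ A′
        (λ j S S′ j≤ p sub top small → isTrue {S′} (LeadΔ-star j S S′ j≤ (fromTrue {S} p) sub top small))
        (λ S p → isTrue {S} (leadA⇒Δ S (A′⇒ S p)))
        (λ S p → sizeA S (A′⇒ S p))
        (λ S S′ p q → decidable-stable (meet? S S′) (lead-meet A meet S S′ (A′⇒ S p) (A′⇒ S′ q)))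
        (λ S p → twoA S (A′⇒ S p)) >>= λ bound →
      return (ℕ.≤-trans (ℕ.≤-reflexive (≡.sym cA)) (ℕ.≤-trans bound (s≤s (ℕ.≤-trans
        (count-mono λ S p → ⇒B′ S (leadB S (fromTrue {S} (proj₁ (∧-elim (D′ S) p))) (proj₂ (∧-elim (D′ S) p)))) (ℕ.≤-reflexive cB))))) } }
      where
      elim : ∀ {ℓ} {P : Set ℓ} (d : Dec P) → does d ≡ true → P
      elim (yes p) _ = p
      A⊆C : Fam A ⊆ C r
      A⊆C x p = supp λ ρ out → vanish p ρ λ ρ∈ → out (uni ρ ρ∈ , A⊆Δ ρ ρ∈)
      sizeA : ∀ S → Lead (Proc ψ S (Fam A)) → ∣ S ∣ ≡ r
      sizeA S l = lead-size S r (Lead-mono (Proc-mono ψ S A⊆C) l)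
      leadA⇒Δ : ∀ S → Lead (Proc ψ S (Fam A)) → LeadΔ S
      leadA⇒Δ S l = ≡.subst (λ k → Lead (Proc ψ S (C k))) (≡.sym (sizeA S l)) (Lead-mono (Proc-mono ψ S A⊆C) l)
      twoA : ∀ S → Lead (Proc ψ S (Fam A)) → 2 ℕ.≤ vcard (n ℕ.+ r′) S
      twoA S l with splitS S
      ... | S₀ , T , ≡.refl = decidable-stable (2 ℕ.≤? _) λ ¬2 → l λ x p →
        Proc-zero ψ (S₀ ++ T) (λ y q σ → vanish q σ λ ()) x
          (split-trace S₀ T {_∈ᶠ A} {λ _ → ⊥} (λ ρ off u∈ → ¬2 (≡.subst (2 ℕ.≤_)
            (≡.trans (≡.cong ∣_∣ (trace-upd V T ρ (us-dist (suc r) ℕ.≤-refl))) (≡.sym (vcard-++ (n ℕ.+ r′) S₀ T))) (h2 _ u∈))) x p)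
      leadB : ∀ S → LeadΔ S → ((∣ S ∣ ≡ᵇ r) ∧ target (n ℕ.+ r′) S) ≡ true → Lead (Proc ψ S (Fam starFaces))
      leadB S l h with splitS S
      ... | S₀ , T , ≡.refl = Lead-mono (λ x p → split-trace S₀ T {Face r} {_∈ᶠ starFaces}
          (λ ρ off u → ∧-intro (Δ (upd V T ρ)) (proj₂ u) (∧-intro (∣ upd V T ρ ∣ ≡ᵇ r) (≡ᵇ-intro (proj₁ u)) (≡.trans (same ρ) tgt))) x
          (≡.subst (λ k → Proc ψ (S₀ ++ T) (C k) x) (≡ᵇ-elim {∣ S₀ ++ T ∣} size) p)) l
        where
        size = proj₁ (∧-elim (∣ S₀ ++ T ∣ ≡ᵇ r) h)
        tgt = proj₂ (∧-elim (∣ S₀ ++ T ∣ ≡ᵇ r) h)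
        same : ∀ ρ → (lastᵇ (tr (upd V T ρ)) ∧ (2 ≤ᵇ ∣ tr (upd V T ρ) ∣)) ≡ target (n ℕ.+ r′) (S₀ ++ T)
        same ρ = ≡.trans (≡.cong (λ T → lastᵇ T ∧ (2 ≤ᵇ ∣ T ∣)) (trace-upd V T ρ (us-dist (suc r) ℕ.≤-refl)))
          (≡.cong₂ (λ l m → l ∧ (2 ≤ᵇ m)) (≡.sym (lastᵇ-++ (n ℕ.+ r′) S₀ T)) (≡.sym (vcard-++ (n ℕ.+ r′) S₀ T)))

  module _ {c ℓ : Level} (F : Field c ℓ) {n : ℕ} (Δ : Family n) (d r′ : ℕ) (complex : IsSimplicialComplex Δ)
    (CM : Homology.CohenMacaulay F (skeleton d Δ)) (big : ∃ λ σ → σ ∈ᶠ Δ × d ℕ.≤ ∣ σ ∣)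
    (vs : Fin (suc (suc r′)) → Fin n) (vs-injective : ∀ {i j} → vs i ≡ vs j → i ≡ j)
    (inv : ∀ i w → (∀ j → toℕ j ℕ.≤ toℕ i → w ≢ vs j) → ∀ S → S ∈ᶠ Δ → S ∋ w → S ∌ vs i → move w (vs i) S ∈ᶠ Δ)
    (2r≤d : suc r′ ℕ.+ suc r′ ℕ.≤ d) where

    private
      Δ-closed = closed F Δ d complex CM big
      module FP = FieldPolynomials F
      open Link Δ

      -- If `B` is no face, the chain is zero. Otherwise purity puts `B` into a face of size at
      -- least `d`, as `link-exact` needs.
      hom : ∀ B p → ∣ B ∣ ℕ.+ p ℕ.< d → ∀ x → Leading.Supp FP.domain (LinkP B p) x →
        (∀ σ → FP.EP.∂ (λ _ → FP.1ₚ) x σ FP.≈ₚ List.[]) →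
        ¬ ¬ (∃ λ b → Leading.Supp FP.domain (LinkP B (suc p)) b × (∀ σ → x σ FP.≈ₚ FP.EP.∂ (λ _ → FP.1ₚ) b σ))
      hom B p lt x sx cx with Δ B in eq
      ... | false = return ((λ _ → List.[]) , Level.lift (λ _ _ _ → return (Field.refl F)) , λ σ k →
        trans (Level.lower sx σ (λ { (_ , _ , τ , τ∈ , _ , B⊑) → ∋∌ (Δ-closed τ B B⊑ τ∈) eq }) k)
          (sym (FP.EP.Linear.zero! (FP.EP.∂-linear (λ _ → FP.1ₚ)) {λ _ → List.[]} (λ _ _ → return (Field.refl F)) σ k)))
        where
        open CommutativeRing (stabilise (Field.commutativeRing F)) using (trans; sym)
      ... | true = pure F Δ d complex CM big ∣ B ∣ B ≡.refl (ℕ.≤-trans (ℕ.m≤m+n ∣ B ∣ p) (ℕ.<⇒≤ lt)) eq >>= λ { (τ , τ∈ , B⊑ , d≤) →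
        let (m , short) = FP.bounded x in
        FP.exact-polynomial (LinkP B p) (LinkP B (suc p)) (link-exact F Δ d complex CM big B τ τ∈ B⊑ p lt d≤) m x short (Level.lower sx) cx >>= λ { (b , sb , e) →
        return (b , Level.lift sb , e) } }

    open Trace Δ r′ vs vs-injective

    depth-bound : (A : Family n) → (∀ σ → σ ∈ᶠ A → σ ∈ᶠ Δ) → Uniform (suc r′) A → Inter A → (∀ σ → σ ∈ᶠ A → 2 ℕ.≤ ∣ tr σ ∣) →
      ¬ ¬ (countSubsets A ℕ.≤ 1 ℕ.+ countSubsets starFaces)
    depth-bound = LeadingBound.intersecting-bound FP.domain Δ Δ-closed d r′ 2r≤d vs vs-injective
      (add-first F Δ d complex CM big vs inv) FP.θ FP.θ-distinct hom

-- Compressing the family without making it a star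

module Compression where
  open import Defs
  open import Data.Bool using (Bool; true; false; if_then_else_; _∧_; _∨_)
  import Data.Bool.Properties as Bool
  open import Data.Nat as ℕ using (ℕ; zero; suc; z≤n; s≤s; _≡ᵇ_)
  import Data.Nat.Properties as ℕ
  open import Data.Fin using (Fin; zero; suc; toℕ; fromℕ<; fromℕ)
  import Data.Fin.Properties as Fin
  open import Data.Fin.Subset using (Subset; ∣_∣)
  open import Data.Vec as Vec using ([]; _∷_; lookup; _[_]≔_; replicate)
  open import Data.Vec.Properties using (lookup-replicate)
  open import Data.Product using (∃; _×_; _,_; proj₁; proj₂)
  open import Data.Sum using (_⊎_; inj₁; inj₂)
  open import Data.Empty using (⊥)
  open import Function using (_∘_)
  open import Relation.Nullary using (¬_; Dec; yes; no; does)
  open import Relation.Nullary.Negation using (contradiction)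
  open import Relation.Nullary.Decidable using (¬¬-excluded-middle)
  open import Relation.Binary.PropositionalEquality as ≡ using (_≡_; _≢_)
  open Subsets
  open Shifting
  open ShiftedFamilies
  open TraceBound

  private variable
    n : ℕ

  ⊑-or : ∀ (Y S : Subset n) → Y ⊑ S ⊎ ∃ λ y → Y ∋ y × S ∌ y
  ⊑-or [] [] = inj₁ λ ()
  ⊑-or (true ∷ Y) (false ∷ S) = inj₂ (zero , ≡.refl , ≡.refl)
  ⊑-or (false ∷ Y) (s ∷ S) with ⊑-or Y S
  ... | inj₁ h = inj₁ λ { (suc x) → h x }
  ... | inj₂ (y , a , b) = inj₂ (suc y , a , b)
  ⊑-or (true ∷ Y) (true ∷ S) with ⊑-or Y S
  ... | inj₁ h = inj₁ λ { zero _ → ≡.refl ; (suc x) → h x }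
  ... | inj₂ (y , a , b) = inj₂ (suc y , a , b)

  -- The elements of `S` outside `Y` are exchanged one at a time for missing elements of `Y`. Both
  -- differences only shrink, so the hypothesis on `Rel` persists.
  reach : ∀ {Rel : Fin n → Fin n → Set} (A : Family n) → Stable Rel A → ∀ S Y → ∣ S ∣ ≡ ∣ Y ∣ → S ∈ᶠ A →
    (∀ x y → S ∋ x → Y ∌ x → Y ∋ y → S ∌ y → Rel x y) → Y ∈ᶠ A
  reach {n} {Rel} A st S₀ Y = go _ S₀ ≡.refl
    where
    outside : Fin n → ℕ
    outside x = if lookup Y x then 0 else 1
    go : ∀ m S → wt outside S ≡ m → ∣ S ∣ ≡ ∣ Y ∣ → S ∈ᶠ A → (∀ x y → S ∋ x → Y ∌ x → Y ∋ y → S ∌ y → Rel x y) → Y ∈ᶠ A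
    go m S eq size S∈ rel with ⊑-or S Y | ⊑-or Y S
    ... | inj₁ S⊑Y | _ = ≡.subst (_∈ᶠ A) (card-⊑-≡ S Y S⊑Y (ℕ.≤-reflexive (≡.sym size))) S∈
    ... | inj₂ (x , S∋x , Y∌x) | inj₁ Y⊑S = ∋∌ (≡.subst (_∋ x) (≡.sym (card-⊑-≡ Y S Y⊑S (ℕ.≤-reflexive size))) S∋x) Y∌x
    go zero S eq size S∈ rel | inj₂ (x , S∋x , Y∌x) | inj₂ _ = contradiction
      (≡.trans (≡.sym (wt-erase outside S x S∋x)) eq) (λ q → contradiction (≡.trans (≡.sym (≡.cong (λ b → (if b then 0 else 1) ℕ.+ wt outside (S [ x ]≔ false)) Y∌x)) q) λ ())
    go (suc m) S eq size S∈ rel | inj₂ (x , S∋x , Y∌x) | inj₂ (y , Y∋y , S∌y) = go m S′ eq′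
      (≡.trans (move-card {S = S} S∋x S∌y) size) (st x y (rel x y S∋x Y∌x Y∋y S∌y) S S∈ S∋x S∌y) rel′
      where
      S′ = move x y S
      out : ∀ {z b} → lookup Y z ≡ b → outside z ≡ (if b then 0 else 1)
      out h = ≡.cong (λ b → if b then 0 else 1) h
      eq′ : wt outside S′ ≡ m
      eq′ = ℕ.suc-injective (≡.trans (ℕ.+-comm 1 _) (≡.trans (≡.cong (wt outside S′ ℕ.+_) (≡.sym (out Y∌x)))
        (≡.trans (move-wt {S = S} S∋x S∌y outside) (≡.trans (≡.cong (wt outside S ℕ.+_) (out Y∋y)) (≡.trans (ℕ.+-identityʳ _) eq)))))
      rel′ : ∀ x′ y′ → S′ ∋ x′ → Y ∌ x′ → Y ∋ y′ → S′ ∌ y′ → Rel x′ y′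
      rel′ x′ y′ S′∋x′ Y∌x′ Y∋y′ S′∌y′ = rel x′ y′ S∋x′ Y∌x′ Y∋y′ S∌y′
        where
        S∋x′ : S ∋ x′
        S∋x′ with move-∋⁻ {S = S} S∋x S∌y S′∋x′
        ... | inj₁ ≡.refl = ∋∌ Y∋y Y∌x′
        ... | inj₂ (_ , q) = q
        S∌y′ : S ∌ y′
        S∌y′ with ∋? S y′
        ... | inj₂ q = q
        ... | inj₁ q = ∋∌ (move-∋⁺ {S = S} S∋x S∌y (λ { ≡.refl → ∋∌ Y∋y′ Y∌x }) q) S′∌y′

  -- A potential for the admissible shifts: the first entry of `vs` has the largest rank and
  -- vertices outside `vs` have rank 0.
  rank : ∀ {t} → (Fin t → Fin n) → Fin n → ℕ
  rank {t = zero}  vs x = 0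
  rank {t = suc t} vs x = if does (x Fin.≟ vs zero) then suc t else rank (vs ∘ suc) x

  rank-≤ : ∀ {t} (vs : Fin t → Fin n) x → rank vs x ℕ.≤ t
  rank-≤ {t = zero}  vs x = z≤n
  rank-≤ {t = suc t} vs x with x Fin.≟ vs zero
  ... | yes _ = ℕ.≤-refl
  ... | no _ = ℕ.m≤n⇒m≤1+n (rank-≤ (vs ∘ suc) x)

  rank-< : ∀ {t} (vs : Fin t → Fin n) → (∀ {i j} → vs i ≡ vs j → i ≡ j) → ∀ i w → (∀ j → toℕ j ℕ.≤ toℕ i → w ≢ vs j) →
    rank vs w ℕ.< rank vs (vs i)
  rank-< {t = suc t} vs inj i w h with w Fin.≟ vs zero | vs i Fin.≟ vs zero
  ... | yes eq | _ = contradiction eq (h zero z≤n)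
  ... | no _ | yes _ = s≤s (rank-≤ (vs ∘ suc) w)
  rank-< {t = suc t} vs inj zero w h | no _ | no ne = contradiction ≡.refl ne
  rank-< {t = suc t} vs inj (suc i) w h | no _ | no _ =
    rank-< (vs ∘ suc) (λ eq → Fin.suc-injective (inj eq)) i w (λ j j≤i → h (suc j) (s≤s j≤i))

  module Compress {n : ℕ} (Δ : Family n) (Δ-closed : ∀ σ τ → τ ⊑ σ → σ ∈ᶠ Δ → τ ∈ᶠ Δ) (d r′ : ℕ)
    (1≤r′ : 1 ℕ.≤ r′) (2r≤d : suc r′ ℕ.+ suc r′ ℕ.≤ d)
    (vs : Fin (suc (suc r′)) → Fin n) (vs-injective : ∀ {i j} → vs i ≡ vs j → i ≡ j)
    (inv : ∀ i w → (∀ j → toℕ j ℕ.≤ toℕ i → w ≢ vs j) → ∀ S → S ∈ᶠ Δ → S ∋ w → S ∌ vs i → move w (vs i) S ∈ᶠ Δ)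
    (add : ∀ t → t ℕ.≤ suc (suc r′) → ∀ σ → σ ∈ᶠ Δ → ∣ σ ∣ ℕ.+ t ℕ.≤ d →
      ¬ ¬ (∃ λ τ → τ ∈ᶠ Δ × σ ⊑ τ × (∀ i → toℕ i ℕ.< t → τ ∋ vs i) × ∣ τ ∣ ℕ.≤ ∣ σ ∣ ℕ.+ t)) where

    open Trace Δ r′ vs vs-injective

    private
      r = suc r′

      Rel : Fin n → Fin n → Set
      Rel w y = ∃ λ i → y ≡ vs i × (∀ j → toℕ j ℕ.≤ toℕ i → w ≢ vs j)

      Rel⇒< : ∀ {w y} → Rel w y → rank vs w ℕ.< rank vs y
      Rel⇒< (i , ≡.refl , h) = rank-< vs vs-injective i _ h

      inv′ : ∀ w y → Rel w y → ∀ S → S ∈ᶠ Δ → S ∋ w → S ∌ y → move w y S ∈ᶠ Δ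
      inv′ w y (i , ≡.refl , h) = inv i w h

      outside-Rel : ∀ {x y} → ¬ (Vset ∋ x) → Vset ∋ y → Rel x y
      outside-Rel x∉ y∈ = let (i , eq) = Vset-∋⁻ y∈ in i , eq , λ j _ → λ { ≡.refl → x∉ (Vset-vs j) }

      without : Fin n → Subset n
      without z = Vset [ z ]≔ false

      without-card : ∀ {z} → Vset ∋ z → ∣ without z ∣ ≡ r
      without-card {z} h = ℕ.suc-injective (≡.trans (≡.sym (card-erase Vset z h)) Vset-card)

      without-∋ : ∀ z {x} → x ≢ z → Vset ∋ x → without z ∋ x
      without-∋ z x≢z h = ≡.trans (update-other Vset false x≢z) h

      without-∋⁻ : ∀ z {x} → without z ∋ x → x ≢ z × Vset ∋ x
      without-∋⁻ z {x} h = (λ { ≡.refl → ∋∌ h (update-same Vset z false) }) , erase-⊑ Vset z x h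

      ∌⇒¬ : ∀ {b : Bool} → b ≡ false → ¬ (b ≡ true)
      ∌⇒¬ p q = ∋∌ q p

      not-without : ∀ z {x} → without z ∌ x → x ≢ z → ¬ (Vset ∋ x)
      not-without z h x≢z q = ∋∌ (without-∋ z x≢z q) h

      module _ (A₀ : Family n) where

        record Good (A : Family n) : Set where
          field
            sub  : ∀ S → S ∈ᶠ A → S ∈ᶠ Δ
            uni  : Uniform r A
            meet : Inter A
            many : countSubsets A₀ ℕ.≤ countSubsets A

        shift-good : ∀ w y A → Rel w y → Good A → Good (shift w y A)
        shift-good w y A rel G = record
          { sub = sub′ ; uni = shift-uniform w y A uni ; meet = shift-intersecting w y A meet
          ; many = ℕ.≤-trans many (shift-count w y A) }
          where
          open Good G
          sub′ : ∀ S → S ∈ᶠ shift w y A → S ∈ᶠ Δ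
          sub′ S S∈ with shift-elim w y A {S} S∈
          ... | inj₁ (p , _) = sub S p
          ... | inj₂ (a , b , p) = ≡.subst (_∈ᶠ Δ) (move-move {S = S} a b)
            (inv′ w y rel (move y w S) (sub _ p) (move-∋ {S = S} a b) (move-∌ {S = S} a b))

        -- Meeting V without v₁ gives one vertex of V in σ; meeting V without that vertex gives
        -- another.
        all⇒two : ∀ A → Inter A → (∀ k → without (vs k) ∈ᶠ A) → ∀ σ → σ ∈ᶠ A → 2 ℕ.≤ ∣ tr σ ∣
        all⇒two A meet all σ σ∈ with meet σ (without (vs zero)) σ∈ (all zero)
        ... | y , σ∋y , h with Vset-∋⁻ (proj₂ (without-∋⁻ (vs zero) h))
        ... | k , ≡.refl with meet σ (without (vs k)) σ∈ (all k)
        ... | y′ , σ∋y′ , h′ with Vset-∋⁻ (proj₂ (without-∋⁻ (vs k) h′))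
        ... | l , ≡.refl = two-in-trace σ {k} {l} (λ { ≡.refl → proj₁ (without-∋⁻ (vs k) h′) ≡.refl }) σ∋y σ∋y′

        -- For a member missing v₁, all the exchanges needed to reach V without v₁ replace vertices
        -- outside V, and so are admissible. From there each further r-subset of V is one exchange
        -- towards v₁ away.
        stable-all : ∀ A → Good A → Stable Rel A → (∃ λ S → S ∈ᶠ A × S ∌ vs zero) → ∀ k → without (vs k) ∈ᶠ A
        stable-all A G st (S , S∈ , S∌) k = reach A st (without (vs zero)) (without (vs k))
            (≡.trans (without-card (Vset-vs zero)) (≡.sym (without-card (Vset-vs k)))) first rel
          where
          open Good G
          first : without (vs zero) ∈ᶠ A
          first = reach A st S (without (vs zero)) (≡.trans (uni S S∈) (≡.sym (without-card (Vset-vs zero)))) S∈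
            λ x y S∋x Y∌x Y∋y _ → outside-Rel (not-without (vs zero) Y∌x (∋∌⇒≢ S S∋x S∌)) (proj₂ (without-∋⁻ (vs zero) Y∋y))
          rel : ∀ x y → without (vs zero) ∋ x → without (vs k) ∌ x → without (vs k) ∋ y → without (vs zero) ∌ y → Rel x y
          rel x y a b c e with x Fin.≟ vs k | y Fin.≟ vs zero
          ... | no x≢ | _ = contradiction (proj₂ (without-∋⁻ (vs zero) a)) (not-without (vs k) b x≢)
          ... | yes _ | no y≢ = contradiction (proj₂ (without-∋⁻ (vs k) c)) (not-without (vs zero) e y≢)
          ... | yes _ | yes eq = zero , eq , λ { zero _ → proj₁ (without-∋⁻ (vs zero) a) ; (suc j) () }

        -- The remaining case: shifting from w to v would produce a star, so that
        -- every member meets {v, w}.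
        module Critical (v w : Fin n) (i₀ : Fin (suc r)) (v≡ : v ≡ vs i₀) (Rel-wv : Rel w v)
          {G : Set} (goal : ∀ A → Good A → (∀ k → without (vs k) ∈ᶠ A) → ¬ ¬ G) where

          v≢w : v ≢ w
          v≢w eq = let (i , eq′ , h) = Rel-wv in h i ℕ.≤-refl (≡.trans (≡.sym eq) eq′)

          v∈V : Vset ∋ v
          v∈V = ≡.subst (Vset ∋_) (≡.sym v≡) (Vset-vs i₀)

          -- The fields `miss-v` and `miss-w` prevent a star at either vertex; `full` lets any
          -- r-face through both be used freely later. All survive shifts that involve neither `v`
          -- nor `w`.
          record Crit (A : Family n) : Set where
            field
              good  : Good A
              hits  : ∀ S → S ∈ᶠ A → S ∋ v ⊎ S ∋ w
              full  : ∀ S → S ∈ᶠ Δ → ∣ S ∣ ≡ r → S ∋ v → S ∋ w → S ∈ᶠ A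
              miss-v : ∃ λ S → S ∈ᶠ A × S ∌ v
              miss-w : ∃ λ S → S ∈ᶠ A × S ∌ w

          Rel₂ : Fin n → Fin n → Set
          Rel₂ x y = Rel x y × x ≢ v × x ≢ w × y ≢ v × y ≢ w

          step₂ : ∀ A x y → Crit A → Rel₂ x y → Crit (shift x y A)
          step₂ A x y Cr (rel , x≢v , x≢w , y≢v , y≢w) = record
            { good = shift-good x y A rel good
            ; hits = hits′
            ; full = λ S S∈Δ size S∋v S∋w → shift-stay x y A {S} (full S S∈Δ size S∋v S∋w) λ S∋x S∌y →
                full (move x y S) (inv′ x y rel S S∈Δ S∋x S∌y) (≡.trans (move-card {S = S} S∋x S∌y) size)
                  (move-∋⁺ {S = S} S∋x S∌y (x≢v ∘ ≡.sym) S∋v) (move-∋⁺ {S = S} S∋x S∌y (x≢w ∘ ≡.sym) S∋w)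
            ; miss-v = let (S , S∈ , S∌v) = miss-v ; (S′ , S′∈ , same) = follow S S∈ in
                S′ , S′∈ , ≡.trans (same v (x≢v ∘ ≡.sym) (y≢v ∘ ≡.sym)) S∌v
            ; miss-w = let (S , S∈ , S∌w) = miss-w ; (S′ , S′∈ , same) = follow S S∈ in
                S′ , S′∈ , ≡.trans (same w (x≢w ∘ ≡.sym) (y≢w ∘ ≡.sym)) S∌w }
            where
            open Crit Cr
            hits′ : ∀ S → S ∈ᶠ shift x y A → S ∋ v ⊎ S ∋ w
            hits′ S S∈ with shift-elim x y A {S} S∈
            ... | inj₁ (p , _) = hits S p
            ... | inj₂ (S∋y , S∌x , p) with hits _ p
            ... | inj₁ M∋v = inj₁ (≡.trans (≡.sym (move-other {S = S} S∋y S∌x (y≢v ∘ ≡.sym) (x≢v ∘ ≡.sym))) M∋v)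
            ... | inj₂ M∋w = inj₂ (≡.trans (≡.sym (move-other {S = S} S∋y S∌x (y≢w ∘ ≡.sym) (x≢w ∘ ≡.sym))) M∋w)
            follow : ∀ S → S ∈ᶠ A → ∃ λ S′ → S′ ∈ᶠ shift x y A × (∀ z → z ≢ x → z ≢ y → lookup S′ z ≡ lookup S z)
            follow S S∈ with ∋? S x | ∋? S y
            ... | inj₁ S∋x | inj₂ S∌y = move x y S , shift-move x y A {S} S∈ S∋x S∌y , λ z → move-other {S = S} S∋x S∌y
            ... | inj₂ S∌x | _ = S , shift-stay x y A {S} S∈ (λ h → ∋∌ h S∌x) , λ _ _ _ → ≡.refl
            ... | inj₁ _ | inj₁ S∋y = S , shift-stay x y A {S} S∈ (λ _ h → ∋∌ S∋y h) , λ _ _ _ → ≡.refl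

          -- The vertex of V replaced by w: w itself if it lies in V, and otherwise the
          -- last vertex of V different from v.
          pivot : ∃ λ z → Vset ∋ z × z ≢ v × (z ≡ w ⊎ (Vset ∌ w × (∀ y → Vset ∋ y → y ≢ v → y ≢ z → Rel z y)))
          pivot with ∋? Vset w
          ... | inj₁ w∈ = w , w∈ , (v≢w ∘ ≡.sym) , inj₁ ≡.refl
          ... | inj₂ w∉ with i₀ Fin.≟ fromℕ r
          ... | no i₀≢ = vs (fromℕ r) , Vset-vs _ , (λ eq → i₀≢ (vs-injective (≡.trans (≡.sym v≡) (≡.sym eq)))) , inj₂ (w∉ , rel)
            where
            rel : ∀ y → Vset ∋ y → y ≢ v → y ≢ vs (fromℕ r) → Rel (vs (fromℕ r)) y
            rel y y∈ y≢v y≢z with Vset-∋⁻ y∈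
            ... | l , ≡.refl = l , ≡.refl , λ j j≤l eq → l≢ (Fin.toℕ-injective (ℕ.≤-antisym (ℕ.≤-trans (Fin.toℕ≤pred[n] l) (ℕ.≤-reflexive (≡.sym (Fin.toℕ-fromℕ r))))
                (≡.subst (λ k → toℕ k ℕ.≤ toℕ l) (≡.sym (vs-injective eq)) j≤l)))
              where
              l≢ : l ≢ fromℕ r
              l≢ ≡.refl = y≢z ≡.refl
          ... | yes i₀≡ = vs k , Vset-vs k , (λ eq → ℕ.<-irrefl (≡.trans (≡.sym k≡) (≡.trans (≡.cong toℕ (vs-injective (≡.trans eq v≡))) (≡.trans (≡.cong toℕ i₀≡) (Fin.toℕ-fromℕ r)))) (ℕ.n<1+n r′)) , inj₂ (w∉ , rel)
            where
            k : Fin (suc r)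
            k = fromℕ< {r′} (s≤s (ℕ.n≤1+n r′))
            k≡ : toℕ k ≡ r′
            k≡ = Fin.toℕ-fromℕ< _
            rel : ∀ y → Vset ∋ y → y ≢ v → y ≢ vs k → Rel (vs k) y
            rel y y∈ y≢v y≢z with Vset-∋⁻ y∈
            ... | l , ≡.refl = l , ≡.refl , λ j j≤l eq → below j j≤l (vs-injective eq)
              where
              l<r : toℕ l ℕ.< r
              l<r = ℕ.≤∧≢⇒< (Fin.toℕ≤pred[n] l) (λ q → y≢v (≡.trans (≡.cong vs (≡.trans (Fin.toℕ-injective (≡.trans q (≡.sym (Fin.toℕ-fromℕ r)))) (≡.sym i₀≡))) (≡.sym v≡)))
              below : ∀ j → toℕ j ℕ.≤ toℕ l → k ≡ j → ⊥
              below j j≤l ≡.refl = y≢z (≡.cong vs (Fin.toℕ-injective (ℕ.≤-antisym (ℕ.≤-trans (ℕ.≤-pred l<r) (ℕ.≤-reflexive (≡.sym k≡))) j≤l)))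

          -- A member missing `w` leads to `C*`, the set V without the pivot z; one missing `v`
          -- leads to `B*`, which has `w` instead of `v`. If z is `w`, the other r-subsets of V
          -- contain `v` and `w` and are members by `full`. If `w` is outside V, a last shift from
          -- `w` to z produces them, since z replaced by `w` turns each into `B*` or into a face
          -- through both.
          done₂ : ∀ A → Crit A → Stable Rel₂ A → ¬ ¬ G
          done₂ A Cr st with pivot
          ... | z , z∈V , z≢v , which = add (suc r) ℕ.≤-refl single single∈ (ℕ.≤-trans (ℕ.+-monoˡ-≤ (suc r) (ℕ.≤-reflexive single-card)) enough) >>= λ { (τ , τ∈ , w⊑ , has , _) →
              finish τ τ∈ (w⊑ w (update-same (replicate n false) w true)) (λ x h → let (k , eq) = Vset-∋⁻ h in ≡.subst (τ ∋_) (≡.sym eq) (has k (Fin.toℕ<n k))) which }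
            where
            open Crit Cr
            open Good good
            B = proj₁ miss-v
            B∈ = proj₁ (proj₂ miss-v)
            B∌v = proj₂ (proj₂ miss-v)
            Cs = proj₁ miss-w
            Cs∈ = proj₁ (proj₂ miss-w)
            Cs∌w = proj₂ (proj₂ miss-w)
            B∋w : B ∋ w
            B∋w with hits B B∈
            ... | inj₁ h = ∋∌ h B∌v
            ... | inj₂ h = h
            Cs∋v : Cs ∋ v
            Cs∋v with hits Cs Cs∈
            ... | inj₁ h = h
            ... | inj₂ h = ∋∌ h Cs∌w
            single : Subset n
            single = replicate n false [ w ]≔ true
            single-card : ∣ single ∣ ≡ 1
            single-card = ≡.trans (card-insert (replicate n false) w (lookup-replicate w false)) (≡.cong suc (card-0 (replicate n false) (λ x → lookup-replicate x false)))
            single∈ : single ∈ᶠ Δ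
            single∈ = Δ-closed B single (λ x h → single-⊑ x (update-∋⁻ (replicate n false) w h)) (sub B B∈)
              where
              single-⊑ : ∀ x → x ≡ w ⊎ replicate n false ∋ x → B ∋ x
              single-⊑ x (inj₁ ≡.refl) = B∋w
              single-⊑ x (inj₂ h) = ∋∌ h (lookup-replicate x false)
            -- V and `w` together have at most r + 2 elements, which is at most 2r because r is at
            -- least 2.
            enough : 1 ℕ.+ suc r ℕ.≤ d
            enough = ℕ.≤-trans (ℕ.+-monoˡ-≤ r (s≤s 1≤r′)) 2r≤d
            C* = without z
            C*∋v : C* ∋ v
            C*∋v = without-∋ z (z≢v ∘ ≡.sym) v∈V
            C*∌w : C* ∌ w
            C*∌w = go which
              where
              go : z ≡ w ⊎ (Vset ∌ w × _) → C* ∌ w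
              go (inj₁ ≡.refl) = update-same Vset z false
              go (inj₂ (w∉ , _)) with ∋? C* w
              ... | inj₂ h = h
              ... | inj₁ h = ∋∌ (proj₂ (without-∋⁻ z h)) w∉
            rel-ok : ∀ x y → C* ∌ x → x ≢ v → x ≢ w → C* ∋ y → y ≢ v → Rel₂ x y
            rel-ok x y C*∌x x≢v x≢w C*∋y y≢v = go which (x Fin.≟ z) , x≢v , x≢w , y≢v , (∋∌⇒≢ C* C*∋y C*∌w)
              where
              y∈ = without-∋⁻ z C*∋y
              go : z ≡ w ⊎ (Vset ∌ w × (∀ y → Vset ∋ y → y ≢ v → y ≢ z → Rel z y)) → Dec (x ≡ z) → Rel x y
              go _ (no x≢z) = outside-Rel (not-without z C*∌x x≢z) (proj₂ y∈)
              go (inj₁ z≡w) (yes ≡.refl) = contradiction z≡w x≢w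
              go (inj₂ (_ , rel)) (yes ≡.refl) = rel y (proj₂ y∈) y≢v (proj₁ y∈)
            C*∈ : C* ∈ᶠ A
            C*∈ = reach A st Cs C* (≡.trans (uni Cs Cs∈) (≡.sym (without-card z∈V))) Cs∈ λ x y Cs∋x C*∌x C*∋y Cs∌y →
              rel-ok x y C*∌x (λ { ≡.refl → ∋∌ C*∋v C*∌x }) (∋∌⇒≢ Cs Cs∋x Cs∌w) C*∋y (λ { ≡.refl → ∋∌ Cs∋v Cs∌y })
            B* = move v w C*
            B*-card : ∣ B* ∣ ≡ r
            B*-card = ≡.trans (move-card {S = C*} C*∋v C*∌w) (without-card z∈V)
            B*∈ : B* ∈ᶠ A
            B*∈ = reach A st B B* (≡.trans (uni B B∈) (≡.sym B*-card)) B∈ rel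
              where
              rel : ∀ x y → B ∋ x → B* ∌ x → B* ∋ y → B ∌ y → Rel₂ x y
              rel x y B∋x B*∌x B*∋y B∌y with move-∋⁻ {S = C*} C*∋v C*∌w B*∋y
              ... | inj₁ ≡.refl = ∋∌ B∋w B∌y
              ... | inj₂ (y≢v , C*∋y) = rel-ok x y C*∌x x≢v x≢w C*∋y y≢v
                where
                x≢v : x ≢ v
                x≢v = ∋∌⇒≢ B B∋x B∌v
                x≢w : x ≢ w
                x≢w ≡.refl = ∋∌ (move-∋ {S = C*} C*∋v C*∌w) B*∌x
                C*∌x : C* ∌ x
                C*∌x with ∋? C* x
                ... | inj₂ h = h
                ... | inj₁ h = ∋∌ (move-∋⁺ {S = C*} C*∋v C*∌w x≢v h) B*∌x
            module _ (τ : Subset n) (τ∈ : τ ∈ᶠ Δ) (τ∋w : τ ∋ w) (V⊑ : Vset ⊑ τ) where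
              finish : z ≡ w ⊎ (Vset ∌ w × (∀ y → Vset ∋ y → y ≢ v → y ≢ z → Rel z y)) → ¬ ¬ G
              finish (inj₁ ≡.refl) = goal A good λ k → all k (vs k Fin.≟ w) (vs k Fin.≟ v)
                where
                all : ∀ k → Dec (vs k ≡ w) → Dec (vs k ≡ v) → without (vs k) ∈ᶠ A
                all k (yes eq) _ = ≡.subst (λ u → without u ∈ᶠ A) (≡.sym eq) C*∈
                all k (no _) (yes eq) = ≡.subst (λ u → without u ∈ᶠ A) (≡.sym eq) (≡.subst (_∈ᶠ A)
                  (card-⊑-≡ B* (without v) inside (ℕ.≤-reflexive (≡.trans (without-card v∈V) (≡.sym B*-card)))) B*∈)
                  where
                  inside : B* ⊑ without v
                  inside x h with move-∋⁻ {S = C*} C*∋v C*∌w h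
                  ... | inj₁ ≡.refl = without-∋ v (v≢w ∘ ≡.sym) z∈V
                  ... | inj₂ (x≢v , q) = without-∋ v x≢v (proj₂ (without-∋⁻ z q))
                all k (no k≢w) (no k≢v) = full (without (vs k)) (Δ-closed τ _ (λ x h → V⊑ x (proj₂ (without-∋⁻ (vs k) h))) τ∈)
                  (without-card (Vset-vs k)) (without-∋ (vs k) (k≢v ∘ ≡.sym) v∈V) (without-∋ (vs k) (k≢w ∘ ≡.sym) z∈V)
              finish (inj₂ (w∉ , rel-z)) = goal (shift w z A) (shift-good w z A (outside-Rel (∌⇒¬ w∉) z∈V) good) λ k → all k (vs k Fin.≟ z)
                where
                all : ∀ k → Dec (vs k ≡ z) → without (vs k) ∈ᶠ shift w z A
                all k (yes eq) = ≡.subst (λ u → without u ∈ᶠ shift w z A) (≡.sym eq) (shift-stay w z A {C*} C*∈ (λ h → ∋∌ h C*∌w))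
                all k (no k≢z) = shift-back w z A {S} S∋z S∌w (swapped (vs k Fin.≟ v))
                  where
                  S = without (vs k)
                  S∋z : S ∋ z
                  S∋z = without-∋ (vs k) (k≢z ∘ ≡.sym) z∈V
                  S∌w : S ∌ w
                  S∌w with ∋? S w
                  ... | inj₂ h = h
                  ... | inj₁ h = ∋∌ (proj₂ (without-∋⁻ (vs k) h)) w∉
                  M = move z w S
                  M-card : ∣ M ∣ ≡ r
                  M-card = ≡.trans (move-card {S = S} S∋z S∌w) (without-card (Vset-vs k))
                  swapped : Dec (vs k ≡ v) → M ∈ᶠ A
                  swapped (no k≢v) = full M (Δ-closed τ M inside τ∈) M-card
                      (move-∋⁺ {S = S} S∋z S∌w (z≢v ∘ ≡.sym) (without-∋ (vs k) (k≢v ∘ ≡.sym) v∈V)) (move-∋ {S = S} S∋z S∌w)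
                    where
                    inside : M ⊑ τ
                    inside x h with move-∋⁻ {S = S} S∋z S∌w h
                    ... | inj₁ ≡.refl = τ∋w
                    ... | inj₂ (_ , q) = V⊑ x (proj₂ (without-∋⁻ (vs k) q))
                  swapped (yes k≡v) = ≡.subst (_∈ᶠ A) (card-⊑-≡ B* M inside (ℕ.≤-reflexive (≡.trans M-card (≡.sym B*-card)))) B*∈
                    where
                    inside : B* ⊑ M
                    inside x h with move-∋⁻ {S = C*} C*∋v C*∌w h
                    ... | inj₁ ≡.refl = move-∋ {S = S} S∋z S∌w
                    ... | inj₂ (x≢v , q) = move-∋⁺ {S = S} S∋z S∌w (proj₁ (without-∋⁻ z q))
                      (without-∋ (vs k) (λ eq → x≢v (≡.trans eq k≡v)) (proj₂ (without-∋⁻ z q)))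

          critical : ∀ A → Good A → (∀ S → S ∈ᶠ A → S ∋ v ⊎ S ∋ w) → (∃ λ S → S ∈ᶠ A × S ∌ v) → (∃ λ S → S ∈ᶠ A × S ∌ w) → ¬ ¬ G
          critical A G₀ hit mv mw = shift-until-stable (rank vs) Rel₂ (Rel⇒< ∘ proj₁) {I = Crit} done₂
              (λ A x y Cr rel k → k (step₂ A x y Cr rel)) A₁ record
            { good = record { sub = sub₁ ; uni = uni₁ ; meet = meet₁ ; many = ℕ.≤-trans many (count-mono {P = A} {A₁} old) }
            ; hits = hits₁
            ; full = λ S S∈Δ size S∋v S∋w → added S (∧-intro (Δ S) S∈Δ (∧-intro (∣ S ∣ ≡ᵇ r) (≡ᵇ-intro {∣ S ∣} size) (∧-intro (lookup S v) S∋v S∋w)))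
            ; miss-v = let (S , S∈ , h) = mv in S , old S S∈ , h
            ; miss-w = let (S , S∈ , h) = mw in S , old S S∈ , h }
            where
            open Good G₀
            extra : Family n
            extra S = Δ S ∧ ((∣ S ∣ ≡ᵇ r) ∧ (lookup S v ∧ lookup S w))
            A₁ : Family n
            A₁ S = A S ∨ extra S
            old : ∀ S → S ∈ᶠ A → S ∈ᶠ A₁
            old S h = ≡.cong (_∨ extra S) h
            added : ∀ S → S ∈ᶠ extra → S ∈ᶠ A₁
            added S h = ≡.trans (≡.cong (A S ∨_) h) (Bool.∨-zeroʳ (A S))
            cases : ∀ S → S ∈ᶠ A₁ → S ∈ᶠ A ⊎ (S ∈ᶠ Δ × ∣ S ∣ ≡ r × S ∋ v × S ∋ w)
            cases S h = go (A S) ≡.refl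
              where
              go : ∀ b → A S ≡ b → S ∈ᶠ A ⊎ (S ∈ᶠ Δ × ∣ S ∣ ≡ r × S ∋ v × S ∋ w)
              go true eq = inj₁ eq
              go false eq = let (a , p) = ∧-elim (Δ S) (≡.trans (≡.cong (_∨ extra S) (≡.sym eq)) h) ; (b , q) = ∧-elim (∣ S ∣ ≡ᵇ r) p ; (c , e) = ∧-elim (lookup S v) q in
                inj₂ (a , ≡ᵇ-elim {∣ S ∣} b , c , e)
            sub₁ : ∀ S → S ∈ᶠ A₁ → S ∈ᶠ Δ
            sub₁ S h with cases S h
            ... | inj₁ p = sub S p
            ... | inj₂ (p , _) = p
            uni₁ : Uniform r A₁
            uni₁ S h with cases S h
            ... | inj₁ p = uni S p
            ... | inj₂ (_ , p , _) = p
            hits₁ : ∀ S → S ∈ᶠ A₁ → S ∋ v ⊎ S ∋ w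
            hits₁ S h with cases S h
            ... | inj₁ p = hit S p
            ... | inj₂ (_ , _ , p , _) = inj₁ p
            meet₁ : Inter A₁
            meet₁ S S′ h h′ with cases S h | cases S′ h′
            ... | inj₁ p | inj₁ q = meet S S′ p q
            ... | inj₂ (_ , _ , a , b) | _ = both (hits₁ S′ h′)
              where
              both : S′ ∋ v ⊎ S′ ∋ w → Meet S S′
              both (inj₁ c) = v , a , c
              both (inj₂ c) = w , b , c
            ... | inj₁ p | inj₂ (_ , _ , a , b) = both (hit S p)
              where
              both : S ∋ v ⊎ S ∋ w → Meet S S′
              both (inj₁ c) = v , c , a
              both (inj₂ c) = w , c , b

    compress : {G : Set} (A₀ : Family n) → (∀ S → S ∈ᶠ A₀ → S ∈ᶠ Δ) → Uniform r A₀ → Inter A₀ → (∀ x → ∃ λ S → S ∈ᶠ A₀ × S ∌ x) →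
      (∀ A → (∀ S → S ∈ᶠ A → S ∈ᶠ Δ) → Uniform r A → Inter A → (∀ σ → σ ∈ᶠ A → 2 ℕ.≤ ∣ tr σ ∣) →
        countSubsets A₀ ℕ.≤ countSubsets A → ¬ ¬ G) → ¬ ¬ G
    compress {G} A₀ sub₀ uni₀ meet₀ free₀ result =
      shift-until-stable (rank vs) Rel Rel⇒< {I = I} stable step A₀
        (record { sub = sub₀ ; uni = uni₀ ; meet = meet₀ ; many = ℕ.≤-refl } , free₀)
      where
      I : Family n → Set
      I A = Good A₀ A × (∀ x → ∃ λ S → S ∈ᶠ A × S ∌ x)
      goal : ∀ A → Good A₀ A → (∀ k → without (vs k) ∈ᶠ A) → ¬ ¬ G
      goal A g all = result A (Good.sub g) (Good.uni g) (Good.meet g) (all⇒two A₀ A (Good.meet g) all) (Good.many g)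
      stable : ∀ A → I A → Stable Rel A → ¬ ¬ G
      stable A (g , free) st = goal A g (stable-all A₀ A g st (free (vs zero)))
      step : ∀ A w y → I A → Rel w y → (I (shift w y A) → ¬ ¬ G) → ¬ ¬ G
      step A w y (g , free) rel@(i , y≡ , _) k = ¬¬-excluded-middle {A = ∃ λ x → ∀ S → S ∈ᶠ shift w y A → S ∋ x} >>= λ {
          (no none) → ¬¬-∀Fin {P = λ x → ∃ λ S → S ∈ᶠ shift w y A × S ∌ x} (λ x ¬ex → none (x , λ S S∈ → always x ¬ex S S∈)) >>= λ free′ →
            k (shift-good A₀ w y A rel g , free′)
          ; (yes (x , common)) → Critical.critical A₀ y w i y≡ rel goal A g (hits x common) (free y) (free w) }
        where
        always : ∀ x → ¬ (∃ λ S → S ∈ᶠ shift w y A × S ∌ x) → ∀ S → S ∈ᶠ shift w y A → S ∋ x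
        always x ¬ex S S∈ with ∋? S x
        ... | inj₁ h = h
        ... | inj₂ h = contradiction (S , S∈ , h) ¬ex
        module _ (x : Fin n) (common : ∀ S → S ∈ᶠ shift w y A → S ∋ x) where
          -- A member avoiding `x` cannot have stayed in the shifted family, so it was moved; the
          -- only vertex it gained is `y`.
          x≡y : x ≡ y
          x≡y with free x
          ... | B , B∈ , B∌x with ∋? B w | ∋? B y
          ... | inj₂ B∌w | _ = ∋∌ (common B (shift-stay w y A {B} B∈ (λ h → ∋∌ h B∌w))) B∌x
          ... | inj₁ _ | inj₁ B∋y = ∋∌ (common B (shift-stay w y A {B} B∈ (λ _ h → ∋∌ B∋y h))) B∌x
          ... | inj₁ B∋w | inj₂ B∌y with move-∋⁻ {S = B} B∋w B∌y (common (move w y B) (shift-move w y A {B} B∈ B∋w B∌y))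
          ... | inj₁ eq = eq
          ... | inj₂ (_ , h) = ∋∌ h B∌x
          -- A member without `w` is not moved, so it contains the vertex common to the shifted
          -- family.
          hits : ∀ S → S ∈ᶠ A → S ∋ y ⊎ S ∋ w
          hits S S∈ with ∋? S w
          ... | inj₁ h = inj₂ h
          ... | inj₂ S∌w = inj₁ (≡.subst (S ∋_) x≡y (common S (shift-stay w y A {S} S∈ (λ h → ∋∌ h S∌w))))

-- Counting in the link of v₁ and conclusion

open import Defs
open import Level using (Level)
open import Data.Bool using (Bool; true; false; not; _∧_)
open import Data.Nat as ℕ using (ℕ; suc; _+_; _∸_; _*_; _≤_; s≤s; _≡ᵇ_)
import Data.Nat.Properties as ℕ
open import Data.Fin using (Fin; toℕ) renaming (zero to fzero; suc to fsuc)
import Data.Fin.Properties as Fin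
open import Data.Fin.Subset using (Subset; ∣_∣; ⁅_⁆; _∪_; _∩_)
open import Data.Fin.Subset.Properties using (x∈p∧x≢y⇒x∈p-y; x∈p∪q⁺; x∈⁅x⁆; x∈⁅y⁆⇒x≡y)
open import Data.Vec using (_∷_; lookup; _[_]≔_)
open import Data.Vec.Properties using (lookup⇒[]=; []=⇒lookup; lookup-zipWith)
open import Data.Product using (∃; _×_; _,_; proj₁; proj₂)
open import Data.Sum using (_⊎_; inj₁; inj₂)
open import Data.Empty using (⊥)
open import Function using (_∘_)
open import Relation.Nullary.Decidable using (decidable-stable)
open import Relation.Nullary.Negation using (contradiction)
open import Relation.Binary.PropositionalEquality as ≡ using (_≡_; _≢_)
open Subsets
open ShiftedFamilies
open GenericForms using (Disj)
open DepthConsequences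
open TraceBound
open Compression

allFinᵇ-elim : ∀ {m} (g : Fin m → Bool) → allFinᵇ g ≡ true → ∀ i → g i ≡ true
allFinᵇ-elim g h fzero    = proj₁ (∧-elim (g fzero) h)
allFinᵇ-elim g h (fsuc i) = allFinᵇ-elim (g ∘ fsuc) (proj₂ (∧-elim (g fzero) h)) i

module _ {n : ℕ} (Δ : Family n) (Δ-closed : ∀ σ τ → τ ⊑ σ → σ ∈ᶠ Δ → τ ∈ᶠ Δ) where

  singleton-∋ : ∀ (v : Fin n) {x} → ⁅ v ⁆ ∋ x → x ≡ v
  singleton-∋ v {x} h = x∈⁅y⁆⇒x≡y v (lookup⇒[]= x ⁅ v ⁆ h)

  -- Deleting `v` embeds both families into the link, with disjoint images. They are packed into one
  -- family `Z` on an additional vertex that serves as a tag, so that a single injection suffices.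
  link-count : ∀ r′ v (X Y : Family n) → (∀ σ → σ ∈ᶠ X → σ ∈ᶠ Δ × ∣ σ ∣ ≡ suc r′ × σ ∋ v) →
    (∀ σ → σ ∈ᶠ Y → σ ∈ᶠ Δ × ∣ σ ∣ ≡ suc r′ × σ ∋ v) → (∀ σ → σ ∈ᶠ X → σ ∈ᶠ Y → ⊥) →
    countSubsets X + countSubsets Y ≤ f r′ (link Δ ⁅ v ⁆)
  link-count r′ v X Y hX hY apart = ≡.subst (_≤ f r′ (link Δ ⁅ v ⁆)) (count-suc Z) (count-inject φ into inj)
    where
    Z : Family (suc n)
    Z (true ∷ σ)  = X σ
    Z (false ∷ σ) = Y σ
    φ : Subset (suc n) → Subset n
    φ (_ ∷ σ) = σ [ v ]≔ false
    through : ∀ b σ → (b ∷ σ) ∈ᶠ Z → σ ∈ᶠ Δ × ∣ σ ∣ ≡ suc r′ × σ ∋ v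
    through true  = hX
    through false = hY
    into : ∀ S → S ∈ᶠ Z → (link Δ ⁅ v ⁆ (φ S) ∧ (∣ φ S ∣ ≡ᵇ r′)) ≡ true
    into (b ∷ σ) h = let (σ∈ , size , σ∋v) = through b σ h in
      ∧-intro (link Δ ⁅ v ⁆ ρ)
        (∧-intro (Δ ρ) (Δ-closed σ ρ (erase-⊑ σ v) σ∈)
          (∧-intro (∣ ⁅ v ⁆ ∩ ρ ∣ ≡ᵇ 0) (≡ᵇ-intro {∣ ⁅ v ⁆ ∩ ρ ∣} (∩-empty ⁅ v ⁆ ρ disj))
            (Δ-closed σ (⁅ v ⁆ ∪ ρ) (λ x q → below σ∋v x (∪-∋⁻ ⁅ v ⁆ ρ q)) σ∈)))
        (≡ᵇ-intro {∣ ρ ∣} (ℕ.suc-injective (≡.trans (≡.sym (card-erase σ v σ∋v)) size)))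
      where
      ρ = σ [ v ]≔ false
      disj : Disj ρ ⁅ v ⁆
      disj x ρ∋x with ∋? ⁅ v ⁆ x
      ... | inj₂ q = q
      ... | inj₁ q with singleton-∋ v q
      ... | ≡.refl = ∋∌ ρ∋x (update-same σ v false)
      below : σ ∋ v → ∀ x → ⁅ v ⁆ ∋ x ⊎ ρ ∋ x → σ ∋ x
      below σ∋v x (inj₁ q) with singleton-∋ v q
      ... | ≡.refl = σ∋v
      below σ∋v x (inj₂ q) = erase-⊑ σ v x q
    same : ∀ b b′ σ σ′ → (b ∷ σ) ∈ᶠ Z → (b′ ∷ σ′) ∈ᶠ Z → σ [ v ]≔ false ≡ σ′ [ v ]≔ false → σ ≡ σ′
    same b b′ σ σ′ h h′ eq = ≡.trans (≡.sym (restore σ (proj₂ (proj₂ (through b σ h)))))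
      (≡.trans (≡.cong (_[ v ]≔ true) eq) (restore σ′ (proj₂ (proj₂ (through b′ σ′ h′)))))
      where
      restore : ∀ σ → σ ∋ v → (σ [ v ]≔ false) [ v ]≔ true ≡ σ
      restore σ σ∋v = ≡.trans (update-update σ v) (update-id σ v σ∋v)
    inj : ∀ S S′ → S ∈ᶠ Z → S′ ∈ᶠ Z → φ S ≡ φ S′ → S ≡ S′
    inj (b ∷ σ) (b′ ∷ σ′) h h′ eq with same b b′ σ σ′ h h′ eq
    inj (true ∷ σ) (true ∷ σ) h h′ eq | ≡.refl = ≡.refl
    inj (false ∷ σ) (false ∷ σ) h h′ eq | ≡.refl = ≡.refl
    inj (true ∷ σ) (false ∷ σ) h h′ eq | ≡.refl = contradiction h′ (apart σ h)
    inj (false ∷ σ) (true ∷ σ) h h′ eq | ≡.refl = contradiction h (apart σ h′)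

theorem1p5 : ∀ {c ℓ : Level} (F : Field c ℓ) {n : ℕ} (Δ : Family n) (d r : ℕ)
    (vs : Fin (suc r) → Fin n) (𝒜 : Family n) →
    IsSimplicialComplex Δ →
    Homology.DepthIs F Δ d →
    2 ≤ r → 2 * r ≤ d →
    (∀ A → A ∈ᶠ 𝒜 → A ∈ᶠ Δ × ∣ A ∣ ≡ r) →
    Intersecting 𝒜 →
    Shifted Δ vs →
    NoCommonIntersection 𝒜 →
    countSubsets 𝒜
    + countSubsets (λ σ → Δ σ ∧ (∣ σ ∣ ≡ᵇ r) ∧ lookup σ (vs fzero)
    ∧ allFinᵇ (λ j → not (lookup σ (vs (fsuc j)))))
    ≤ f (r ∸ 1) (link Δ (Data.Fin.Subset.⁅_⁆ (vs fzero))) + 1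
theorem1p5 F {n} Δ d (suc r′) vs 𝒜 complex (CM , big , _) (s≤s 1≤r′) 2r≤d faces intersecting (vs-injective , shifted) free =
  decidable-stable (_ ℕ.≤? _)
    (Compress.compress Δ Δ-closed d r′ 1≤r′ 2r≤d′ vs vs-injective inv (add-first F Δ d complex CM big vs inv) 𝒜
      (λ S S∈ → proj₁ (faces S S∈)) (λ S S∈ → proj₂ (faces S S∈)) meet avoid λ A sub uni meet′ h2 many →
      depth-bound F Δ d r′ complex CM big vs vs-injective inv 2r≤d′ A sub uni meet′ h2 >>= λ bound →
      return (finish A many bound))
  where
  open Trace Δ r′ vs vs-injective
  Δ-closed = closed F Δ d complex CM big
  β : Family n
  β σ = Δ σ ∧ (∣ σ ∣ ≡ᵇ suc r′) ∧ lookup σ (vs fzero) ∧ allFinᵇ (λ j → not (lookup σ (vs (fsuc j))))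
  2r≤d′ : suc r′ + suc r′ ≤ d
  2r≤d′ = ≡.subst (_≤ d) (≡.cong (suc r′ +_) (ℕ.+-identityʳ (suc r′))) 2r≤d
  meet : Inter 𝒜
  meet S S′ S∈ S′∈ with intersecting S S′ S∈ S′∈
  ... | x , x∈ = let (a , b) = ∧-elim (lookup S x) (≡.trans (≡.sym (lookup-zipWith _∧_ x S S′)) ([]=⇒lookup x∈)) in x , a , b
  avoid : ∀ x → ∃ λ S → S ∈ᶠ 𝒜 × S ∌ x
  avoid x with free x
  ... | S , S∈ , x∉ with ∋? S x
  ... | inj₂ h = S , S∈ , h
  ... | inj₁ h = contradiction (lookup⇒[]= x S h) x∉
  inv : ∀ i w → (∀ j → toℕ j ≤ toℕ i → w ≢ vs j) → ∀ S → S ∈ᶠ Δ → S ∋ w → S ∌ vs i → move w (vs i) S ∈ᶠ Δ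
  -- Since `Δ` is closed under subsets, an inclusion suffices to pass from the shifted set of the
  -- definition to `move`.
  inv i w fresh S S∈ S∋w S∌v = Δ-closed _ _ inside
    (shifted i w fresh S S∈ (lookup⇒[]= w S S∋w) (λ v∈ → ∋∌ ([]=⇒lookup v∈) S∌v))
    where
    inside : move w (vs i) S ⊑ ((S Data.Fin.Subset.- w) ∪ ⁅ vs i ⁆)
    inside x h with move-∋⁻ {S = S} S∋w S∌v h
    ... | inj₁ ≡.refl = []=⇒lookup (x∈p∪q⁺ {p = S Data.Fin.Subset.- w} (inj₂ (x∈⁅x⁆ (vs i))))
    ... | inj₂ (x≢w , S∋x) = []=⇒lookup (x∈p∪q⁺ {p = S Data.Fin.Subset.- w} {⁅ vs i ⁆} (inj₁ (x∈p∧x≢y⇒x∈p-y (lookup⇒[]= x S S∋x) x≢w)))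
  star-faces : ∀ σ → σ ∈ᶠ starFaces → σ ∈ᶠ Δ × ∣ σ ∣ ≡ suc r′ × σ ∋ vs fzero
  star-faces σ h = let (a , p) = ∧-elim (Δ σ) h ; (b , q) = ∧-elim (∣ σ ∣ ≡ᵇ suc r′) p ; (l , _) = ∧-elim (lastᵇ (tr σ)) q in
    a , ≡ᵇ-elim {∣ σ ∣} b , ≡.trans (≡.sym (trace-last (suc r′) ℕ.≤-refl σ)) l
  β-faces : ∀ σ → σ ∈ᶠ β → σ ∈ᶠ Δ × ∣ σ ∣ ≡ suc r′ × σ ∋ vs fzero
  β-faces σ h = let (a , p) = ∧-elim (Δ σ) h ; (b , q) = ∧-elim (∣ σ ∣ ≡ᵇ suc r′) p in
    a , ≡ᵇ-elim {∣ σ ∣} b , proj₁ (∧-elim (lookup σ (vs fzero)) q)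
  apart : ∀ σ → σ ∈ᶠ starFaces → σ ∈ᶠ β → ⊥
  apart σ h h′ with trace-two σ two
    where
    two : 2 ≤ ∣ tr σ ∣
    two = ≤ᵇ-elim {2} (proj₂ (∧-elim (lastᵇ (tr σ)) (proj₂ (∧-elim (∣ σ ∣ ≡ᵇ suc r′) (proj₂ (∧-elim (Δ σ) h))))))
  ... | fzero , 0≢0 , _ = 0≢0 ≡.refl
  ... | fsuc k , _ , σ∋ = ∋∌ (allFinᵇ-elim (λ j → not (lookup σ (vs (fsuc j)))) only k) (≡.cong not σ∋)
    where
    only = proj₂ (∧-elim (lookup σ (vs fzero)) (proj₂ (∧-elim (∣ σ ∣ ≡ᵇ suc r′) (proj₂ (∧-elim (Δ σ) h′)))))
  finish : ∀ A → countSubsets 𝒜 ≤ countSubsets A → countSubsets A ≤ 1 + countSubsets starFaces →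
    countSubsets 𝒜 + countSubsets β ≤ f r′ (link Δ ⁅ vs fzero ⁆) + 1
  finish A many bound = begin
    countSubsets 𝒜 + countSubsets β                   ≤⟨ ℕ.+-monoˡ-≤ (countSubsets β) (ℕ.≤-trans many bound) ⟩
    (1 + countSubsets starFaces) + countSubsets β      ≤⟨ s≤s (link-count Δ Δ-closed r′ (vs fzero) starFaces β star-faces β-faces apart) ⟩
    1 + f r′ (link Δ ⁅ vs fzero ⁆)                     ≡⟨ ℕ.+-comm 1 _ ⟩
    f r′ (link Δ ⁅ vs fzero ⁆) + 1                     ∎
    where open ℕ.≤-Reasoning
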